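{- Let $0<|q|<1$. Then $$\vartheta_3(0,-q)^{16}=1-\tfrac{32}{3}\left(U_1+U_3+U_5\right)+\tfrac{256}{3}\left(U_1U_5-U_3^2\right),$$ where $$U_s\equiv U_s(q):=\sum_{r=1}^{\infty}(-1)^{r-1}\frac{r^sq^r}{1+q^r}=\sum_{n=1}^{\infty}\Bigl[\sum_{d\mid n,\,d>0}(-1)^{d+n/d}d^s\Bigr]q^n=\sum_{y_1,m_1\ge 1}(-1)^{y_1+m_1}m_1^sq^{m_1y_1},$$ and $$\vartheta_3(0,-q)^{24}=1+\tfrac{16}{9}\left(17G_3+8G_5+2G_7\right)+\tfrac{512}{9}\left(G_3G_7-G_5^2\right),$$ where $$G_s\equiv G_s(q):=\sum_{r=1}^{\infty}(-1)^{r}\frac{r^sq^r}{1-q^r}=\sum_{n=1}^{\infty}\Bigl[\sum_{d\mid n,\,d>0}(-1)^{d}d^s\Bigr]q^n=\sum_{y_1,m_1\ge 1}(-1)^{m_1}m_1^sq^{m_1y_1}.$$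
   Context: $\vartheta_3(0,q):=\sum_{j=-\infty}^{\infty}q^{j^2}$, so $\vartheta_3(0,-q)=\sum_{j=-\infty}^{\infty}(-1)^{j}q^{j^2}$. -}

module Defs where

open import Algebra.Bundles using (RawRing)
import Algebra.Definitions.RawSemiring as RawSemiringDefs
open import Data.Fin.Base using (toℕ)
open import Data.Integer.Base as ℤ using (ℤ; +_; -[1+_])
open import Data.List.Base using (List; filter; foldr; map; upTo)
open import Data.Nat.Base as ℕ using (ℕ; suc)
open import Data.Nat.Divisibility using (_∣?_)
import Data.Nat.DivMod as ℕ
import Data.Nat.Properties as ℕ
open import Data.Product.Base using (_×_; _,_; ∃-syntax)
open import Data.Rational.Base as ℚ using (ℚ; 0ℚ; 1ℚ; ½)
import Data.Rational.Properties as ℚ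
open import Data.Rational.Solver using (module +-*-Solver)
open import Level using (0ℓ)
open import Relation.Binary.PropositionalEquality
  using (_≡_; refl; sym; trans; cong; subst; module ≡-Reasoning)

------------------------------------------------------------------------
-- Real numbers: Cauchy sequences of rationals, compared with _≈ℝ_

CauchySeq : (ℕ → ℚ) → Set
CauchySeq x = ∀ ε → 0ℚ ℚ.< ε →
  ∃[ N ] (∀ m n → N ℕ.≤ m → N ℕ.≤ n → ℚ.∣ x m ℚ.- x n ∣ ℚ.< ε)

record ℝ : Set where
  constructor mkℝ
  field
    seq    : ℕ → ℚ
    cauchy : CauchySeq seq

open ℝ public

infix 4 _≈ℝ_ _<ℝ_

_≈ℝ_ : ℝ → ℝ → Set
x ≈ℝ y = ∀ ε → 0ℚ ℚ.< ε →
  ∃[ N ] (∀ n → N ℕ.≤ n → ℚ.∣ seq x n ℚ.- seq y n ∣ ℚ.< ε)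

-- The gap δ is uniform: a merely termwise eventual inequality would allow
-- equal limits.
_<ℝ_ : ℝ → ℝ → Set
x <ℝ y = ∃[ δ ] (0ℚ ℚ.< δ) ×
  (∃[ N ] (∀ n → N ℕ.≤ n → seq x n ℚ.+ δ ℚ.≤ seq y n))

private
  +-cauchy : ∀ x y → CauchySeq x → CauchySeq y →
             CauchySeq (λ n → x n ℚ.+ y n)
  +-cauchy x y cx cy ε 0<ε
    with cx (½ ℚ.* ε) 0<½ε | cy (½ ℚ.* ε) 0<½ε
    where
    0<½ε : 0ℚ ℚ.< ½ ℚ.* ε
    0<½ε = subst (ℚ._< ½ ℚ.* ε) (ℚ.*-zeroʳ ½) (ℚ.*-monoʳ-<-pos ½ 0<ε)
  ... | M , p | N , q = M ℕ.⊔ N , λ m n M⊔N≤m M⊔N≤n →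
    let open ℚ.≤-Reasoning in begin-strict
    ℚ.∣ (x m ℚ.+ y m) ℚ.- (x n ℚ.+ y n) ∣
      ≡⟨ cong ℚ.∣_∣ (regroup (x m) (y m) (x n) (y n)) ⟩
    ℚ.∣ (x m ℚ.- x n) ℚ.+ (y m ℚ.- y n) ∣
      ≤⟨ ℚ.∣p+q∣≤∣p∣+∣q∣ (x m ℚ.- x n) (y m ℚ.- y n) ⟩
    ℚ.∣ x m ℚ.- x n ∣ ℚ.+ ℚ.∣ y m ℚ.- y n ∣
      <⟨ ℚ.+-mono-<
           (p m n (ℕ.m⊔n≤o⇒m≤o M N M⊔N≤m) (ℕ.m⊔n≤o⇒m≤o M N M⊔N≤n))
           (q m n (ℕ.m⊔n≤o⇒n≤o M N M⊔N≤m) (ℕ.m⊔n≤o⇒n≤o M N M⊔N≤n)) ⟩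
    ½ ℚ.* ε ℚ.+ ½ ℚ.* ε
      ≡⟨ ℚ.*-distribʳ-+ ε ½ ½ ⟨
    1ℚ ℚ.* ε
      ≡⟨ ℚ.*-identityˡ ε ⟩
    ε ∎
    where
    open +-*-Solver
    regroup : ∀ a b c d →
      (a ℚ.+ b) ℚ.- (c ℚ.+ d) ≡ (a ℚ.- c) ℚ.+ (b ℚ.- d)
    regroup = solve 4 (λ a b c d →
      ((a :+ b) :- (c :+ d)) := ((a :- c) :+ (b :- d))) refl

  -‿cauchy : ∀ x → CauchySeq x → CauchySeq (λ n → ℚ.- x n)
  -‿cauchy x cx ε 0<ε with cx ε 0<ε
  ... | N , p = N , λ m n N≤m N≤n →
    subst (ℚ._< ε)
      (trans (sym (ℚ.∣-p∣≡∣p∣ (x m ℚ.- x n)))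
             (cong ℚ.∣_∣ (ℚ.neg-distrib-+ (x m) (ℚ.- x n))))
      (p m n N≤m N≤n)

  eventuallyBounded : ∀ x → CauchySeq x →
    ∃[ B ] (0ℚ ℚ.< B) × (∃[ N ] (∀ n → N ℕ.≤ n → ℚ.∣ x n ∣ ℚ.≤ B))
  eventuallyBounded x cx with cx 1ℚ (ℚ.positive⁻¹ 1ℚ)
  ... | N , p =
    1ℚ ℚ.+ ℚ.∣ x N ∣ ,
    ℚ.+-mono-<-≤ (ℚ.positive⁻¹ 1ℚ) (ℚ.0≤∣p∣ (x N)) ,
    N , λ n N≤n → let open ℚ.≤-Reasoning in begin
      ℚ.∣ x n ∣
        ≡⟨ cong ℚ.∣_∣ (split (x n) (x N)) ⟩
      ℚ.∣ (x n ℚ.- x N) ℚ.+ x N ∣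
        ≤⟨ ℚ.∣p+q∣≤∣p∣+∣q∣ (x n ℚ.- x N) (x N) ⟩
      ℚ.∣ x n ℚ.- x N ∣ ℚ.+ ℚ.∣ x N ∣
        ≤⟨ ℚ.+-monoˡ-≤ ℚ.∣ x N ∣ (ℚ.<⇒≤ (p n N N≤n ℕ.≤-refl)) ⟩
      1ℚ ℚ.+ ℚ.∣ x N ∣ ∎
    where
    open +-*-Solver
    split : ∀ a b → a ≡ (a ℚ.- b) ℚ.+ b
    split = solve 2 (λ a b → a := ((a :- b) :+ b)) refl

  splitTolerance : ∀ a b ε → 0ℚ ℚ.< a → 0ℚ ℚ.< b → 0ℚ ℚ.< ε →
    ∃[ δ ] (0ℚ ℚ.< δ) × (a ℚ.* δ ℚ.+ b ℚ.* δ ≡ ε)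
  splitTolerance a b ε 0<a 0<b 0<ε = go (a ℚ.+ b) (ℚ.+-mono-< 0<a 0<b) refl
    where
    go : ∀ c → 0ℚ ℚ.< c → a ℚ.+ b ≡ c →
         ∃[ δ ] (0ℚ ℚ.< δ) × (a ℚ.* δ ℚ.+ b ℚ.* δ ≡ ε)
    go c 0<c a+b≡c = c⁻¹ ℚ.* ε , 0<c⁻¹ε , (begin
      a ℚ.* (c⁻¹ ℚ.* ε) ℚ.+ b ℚ.* (c⁻¹ ℚ.* ε)
        ≡⟨ ℚ.*-distribʳ-+ (c⁻¹ ℚ.* ε) a b ⟨
      (a ℚ.+ b) ℚ.* (c⁻¹ ℚ.* ε)
        ≡⟨ cong (ℚ._* (c⁻¹ ℚ.* ε)) a+b≡c ⟩
      c ℚ.* (c⁻¹ ℚ.* ε)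
        ≡⟨ ℚ.*-assoc c c⁻¹ ε ⟨
      (c ℚ.* c⁻¹) ℚ.* ε
        ≡⟨ cong (ℚ._* ε) (ℚ.*-inverseʳ c) ⟩
      1ℚ ℚ.* ε
        ≡⟨ ℚ.*-identityˡ ε ⟩
      ε ∎)
      where
      open ≡-Reasoning
      instance
        c-pos : ℚ.Positive c
        c-pos = ℚ.positive 0<c
        c-nonZero : ℚ.NonZero c
        c-nonZero = ℚ.pos⇒nonZero c
      c⁻¹ : ℚ
      c⁻¹ = ℚ.1/ c
      0<c⁻¹ε : 0ℚ ℚ.< c⁻¹ ℚ.* ε
      0<c⁻¹ε = subst (ℚ._< c⁻¹ ℚ.* ε) (ℚ.*-zeroʳ c⁻¹)
        (ℚ.*-monoʳ-<-pos c⁻¹ {{ℚ.1/pos⇒pos c}} 0<ε)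

  product-bound : ∀ a b c d → 0ℚ ℚ.< c → ℚ.∣ a ∣ ℚ.≤ c → ℚ.∣ b ∣ ℚ.< d →
                  ℚ.∣ a ℚ.* b ∣ ℚ.< c ℚ.* d
  product-bound a b c d 0<c ∣a∣≤c ∣b∣<d = begin-strict
    ℚ.∣ a ℚ.* b ∣       ≡⟨ ℚ.∣p*q∣≡∣p∣*∣q∣ a b ⟩
    ℚ.∣ a ∣ ℚ.* ℚ.∣ b ∣ ≤⟨ ℚ.*-monoʳ-≤-nonNeg ℚ.∣ b ∣
                            {{ℚ.nonNegative (ℚ.0≤∣p∣ b)}} ∣a∣≤c ⟩
    c ℚ.* ℚ.∣ b ∣       <⟨ ℚ.*-monoʳ-<-pos c {{ℚ.positive 0<c}} ∣b∣<d ⟩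
    c ℚ.* d             ∎
    where open ℚ.≤-Reasoning

  product-difference : ∀ a b c d A B δ → 0ℚ ℚ.< A → 0ℚ ℚ.< B →
    ℚ.∣ a ∣ ℚ.≤ A → ℚ.∣ d ∣ ℚ.≤ B → ℚ.∣ a ℚ.- c ∣ ℚ.< δ → ℚ.∣ b ℚ.- d ∣ ℚ.< δ →
    ℚ.∣ a ℚ.* b ℚ.- c ℚ.* d ∣ ℚ.< A ℚ.* δ ℚ.+ B ℚ.* δ
  product-difference a b c d A B δ 0<A 0<B ∣a∣≤A ∣d∣≤B ∣a-c∣<δ ∣b-d∣<δ = begin-strict
    ℚ.∣ a ℚ.* b ℚ.- c ℚ.* d ∣
      ≡⟨ cong ℚ.∣_∣ (regroup a b c d) ⟩
    ℚ.∣ a ℚ.* (b ℚ.- d) ℚ.+ d ℚ.* (a ℚ.- c) ∣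
      ≤⟨ ℚ.∣p+q∣≤∣p∣+∣q∣ (a ℚ.* (b ℚ.- d)) (d ℚ.* (a ℚ.- c)) ⟩
    ℚ.∣ a ℚ.* (b ℚ.- d) ∣ ℚ.+ ℚ.∣ d ℚ.* (a ℚ.- c) ∣
      <⟨ ℚ.+-mono-< (product-bound a (b ℚ.- d) A δ 0<A ∣a∣≤A ∣b-d∣<δ)
                    (product-bound d (a ℚ.- c) B δ 0<B ∣d∣≤B ∣a-c∣<δ) ⟩
    A ℚ.* δ ℚ.+ B ℚ.* δ ∎
    where
    open ℚ.≤-Reasoning
    open +-*-Solver
    regroup : ∀ a b c d →
      a ℚ.* b ℚ.- c ℚ.* d ≡ a ℚ.* (b ℚ.- d) ℚ.+ d ℚ.* (a ℚ.- c)
    regroup = solve 4 (λ a b c d →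
      ((a :* b) :- (c :* d)) := ((a :* (b :- d)) :+ (d :* (a :- c)))) refl

  *-cauchy-from : ∀ (x y : ℕ → ℚ) A B δ ε (K L M N : ℕ) → 0ℚ ℚ.< A → 0ℚ ℚ.< B →
    (∀ n → K ℕ.≤ n → ℚ.∣ x n ∣ ℚ.≤ A) → (∀ n → L ℕ.≤ n → ℚ.∣ y n ∣ ℚ.≤ B) →
    A ℚ.* δ ℚ.+ B ℚ.* δ ≡ ε →
    (∀ m n → M ℕ.≤ m → M ℕ.≤ n → ℚ.∣ x m ℚ.- x n ∣ ℚ.< δ) →
    (∀ m n → N ℕ.≤ m → N ℕ.≤ n → ℚ.∣ y m ℚ.- y n ∣ ℚ.< δ) →
    ∃[ J ] (∀ m n → J ℕ.≤ m → J ℕ.≤ n →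
      ℚ.∣ x m ℚ.* y m ℚ.- x n ℚ.* y n ∣ ℚ.< ε)
  *-cauchy-from x y A B δ ε K L M N 0<A 0<B ∣x∣≤A ∣y∣≤B Aδ+Bδ≡ε p q =
    J , λ m n h k →
    subst (ℚ.∣ x m ℚ.* y m ℚ.- x n ℚ.* y n ∣ ℚ.<_) Aδ+Bδ≡ε
      (product-difference (x m) (y m) (x n) (y n) A B δ 0<A 0<B
        (∣x∣≤A m (K≤ m h)) (∣y∣≤B n (L≤ n k))
        (p m n (M≤ m h) (M≤ n k)) (q m n (N≤ m h) (N≤ n k)))
    where
    J : ℕ
    J = (K ℕ.⊔ L) ℕ.⊔ (M ℕ.⊔ N)
    K≤ : ∀ m → J ℕ.≤ m → K ℕ.≤ m
    K≤ m h = ℕ.m⊔n≤o⇒m≤o K L (ℕ.m⊔n≤o⇒m≤o (K ℕ.⊔ L) (M ℕ.⊔ N) h)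
    L≤ : ∀ m → J ℕ.≤ m → L ℕ.≤ m
    L≤ m h = ℕ.m⊔n≤o⇒n≤o K L (ℕ.m⊔n≤o⇒m≤o (K ℕ.⊔ L) (M ℕ.⊔ N) h)
    M≤ : ∀ m → J ℕ.≤ m → M ℕ.≤ m
    M≤ m h = ℕ.m⊔n≤o⇒m≤o M N (ℕ.m⊔n≤o⇒n≤o (K ℕ.⊔ L) (M ℕ.⊔ N) h)
    N≤ : ∀ m → J ℕ.≤ m → N ℕ.≤ m
    N≤ m h = ℕ.m⊔n≤o⇒n≤o M N (ℕ.m⊔n≤o⇒n≤o (K ℕ.⊔ L) (M ℕ.⊔ N) h)

  *-cauchy : ∀ x y → CauchySeq x → CauchySeq y →
             CauchySeq (λ n → x n ℚ.* y n)
  *-cauchy x y cx cy ε 0<ε =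
    let A , 0<A , K , ∣x∣≤A = eventuallyBounded x cx
        B , 0<B , L , ∣y∣≤B = eventuallyBounded y cy
        δ , 0<δ , Aδ+Bδ≡ε   = splitTolerance A B ε 0<A 0<B 0<ε
        M , p               = cx δ 0<δ
        N , q               = cy δ 0<δ
    in *-cauchy-from x y A B δ ε K L M N 0<A 0<B ∣x∣≤A ∣y∣≤B Aδ+Bδ≡ε p q

  const-cauchy : ∀ p → CauchySeq (λ _ → p)
  const-cauchy p ε 0<ε = 0 , λ _ _ _ _ →
    subst (λ r → ℚ.∣ r ∣ ℚ.< ε) (sym (ℚ.+-inverseʳ p)) 0<ε

infix  8 -ℝ_
infixl 6 _+ℝ_ _-ℝ_
infixl 7 _*ℝ_

ℚ→ℝ : ℚ → ℝ
ℚ→ℝ p = mkℝ (λ _ → p) (const-cauchy p)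

0ℝ 1ℝ : ℝ
0ℝ = ℚ→ℝ 0ℚ
1ℝ = ℚ→ℝ 1ℚ

-ℝ_ : ℝ → ℝ
-ℝ mkℝ x cx = mkℝ (λ n → ℚ.- x n) (-‿cauchy x cx)

_+ℝ_ _-ℝ_ _*ℝ_ : ℝ → ℝ → ℝ
mkℝ x cx +ℝ mkℝ y cy = mkℝ (λ n → x n ℚ.+ y n) (+-cauchy x y cx cy)
mkℝ x cx *ℝ mkℝ y cy = mkℝ (λ n → x n ℚ.* y n) (*-cauchy x y cx cy)
x -ℝ y = x +ℝ -ℝ y

------------------------------------------------------------------------
-- Complex numbers

record ℂ : Set where
  constructor _+i_
  field
    re im : ℝ

open ℂ public

infix  4 _≈_
infix  8 -_
infixl 6 _+_ _-_
infixl 7 _*_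

_≈_ : ℂ → ℂ → Set
z ≈ w = (re z ≈ℝ re w) × (im z ≈ℝ im w)

_+_ _-_ _*_ : ℂ → ℂ → ℂ
z + w = (re z +ℝ re w) +i (im z +ℝ im w)
z - w = (re z -ℝ re w) +i (im z -ℝ im w)
z * w = (re z *ℝ re w -ℝ im z *ℝ im w) +i (re z *ℝ im w +ℝ im z *ℝ re w)

-_ : ℂ → ℂ
- z = (-ℝ re z) +i (-ℝ im z)

ℚ→ℂ : ℚ → ℂ
ℚ→ℂ p = ℚ→ℝ p +i 0ℝ

ℤ→ℂ : ℤ → ℂ
ℤ→ℂ k = ℚ→ℂ (k ℚ./ 1)

0ℂ 1ℂ : ℂ
0ℂ = ℚ→ℂ 0ℚ
1ℂ = ℚ→ℂ 1ℚ

ℂ-rawRing : RawRing 0ℓ 0ℓ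
ℂ-rawRing = record
  { Carrier = ℂ ; _≈_ = _≈_ ; _+_ = _+_ ; _*_ = _*_ ; -_ = -_
  ; 0# = 0ℂ ; 1# = 1ℂ }

open RawSemiringDefs (RawRing.rawSemiring ℂ-rawRing) public using (_^_; sum)

-- The squared modulus; bounds |z| < r with r ≥ 0 are written |z|² < r².
∣_∣² : ℂ → ℝ
∣ z ∣² = re z *ℝ re z +ℝ im z *ℝ im z

-- w = z / d, including the condition that d is apart from zero.
IsQuotient : ℂ → ℂ → ℂ → Set
IsQuotient w z d = (0ℝ <ℝ ∣ d ∣²) × (w * d ≈ z)

------------------------------------------------------------------------
-- Infinite series

Within : ℚ → ℂ → ℂ → Set
Within ε z w = ∣ z - w ∣² <ℝ ℚ→ℝ (ε ℚ.* ε)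

-- Σ_{r ≥ 1} a r = L
HasSum : (ℕ → ℂ) → ℂ → Set
HasSum a L = ∀ ε → 0ℚ ℚ.< ε →
  ∃[ N ] (∀ n → N ℕ.≤ n → Within ε (sum {n} (λ i → a (suc (toℕ i)))) L)

-- Σ_{j ∈ ℤ} a j = L, as the limit of Σ_{j = -m}^{n} a j when m and n tend
-- to infinity independently.
HasSumℤ : (ℤ → ℂ) → ℂ → Set
HasSumℤ a L = ∀ ε → 0ℚ ℚ.< ε →
  ∃[ N ] (∀ m n → N ℕ.≤ m → N ℕ.≤ n →
    Within ε (sum {suc n} (λ i → a (+ toℕ i)) + sum {m} (λ i → a -[1+ toℕ i ])) L)

-- Σ_{y, m ≥ 1} a y m = L, as the limit of the rectangular partial sums
-- over y ≤ Y and m ≤ M when Y and M tend to infinity independently.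
HasSum₂ : (ℕ → ℕ → ℂ) → ℂ → Set
HasSum₂ a L = ∀ ε → 0ℚ ℚ.< ε →
  ∃[ N ] (∀ Y M → N ℕ.≤ Y → N ℕ.≤ M →
    Within ε (sum {Y} (λ i → sum {M} (λ j → a (suc (toℕ i)) (suc (toℕ j))))) L)

-- Σ_{r ≥ 1} num r / den r = L
HasQuotientSum : (num den : ℕ → ℂ) → ℂ → Set
HasQuotientSum num den L =
  ∃[ t ] (∀ r → 1 ℕ.≤ r → IsQuotient (t r) (num r) (den r)) × HasSum t L

------------------------------------------------------------------------
-- Isϑ₃ q θ, IsU s q u, IsG s q g say that the defining series of
-- θ = ϑ₃(0,q), u = U_s(q), g = G_s(q) converge to θ, u, g; for U_s and G_s
-- these are the Lambert series, the divisor sum and the double series, in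
-- that order.

-- j² is a nonnegative integer, so its absolute value is j² as an exponent.
Isϑ₃ : ℂ → ℂ → Set
Isϑ₃ q θ = HasSumℤ (λ j → q ^ ℤ.∣ j ℤ.* j ∣) θ

sign : ℕ → ℤ
sign n = ℤ.-1ℤ ℤ.^ n

-- Σ_{d ∣ n, d > 0} f d (n/d) for n ≥ 1, with d = k + 1 and 0 ≤ k < n.
divisorSum : (ℕ → ℕ → ℤ) → ℕ → ℤ
divisorSum f n =
  foldr ℤ._+_ ℤ.0ℤ
    (map (λ k → f (suc k) (n ℕ./ suc k))
         (filter (λ k → suc k ∣? n) (upTo n)))

IsU : ℕ → ℂ → ℂ → Set
IsU s q u =
  HasQuotientSum
    (λ r → ℤ→ℂ (sign (r ℕ.∸ 1) ℤ.* (+ r) ℤ.^ s) * q ^ r)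
    (λ r → 1ℂ + q ^ r) u ×
  HasSum
    (λ n → ℤ→ℂ (divisorSum (λ d e → sign (d ℕ.+ e) ℤ.* (+ d) ℤ.^ s) n) * q ^ n) u ×
  HasSum₂
    (λ y m → ℤ→ℂ (sign (y ℕ.+ m) ℤ.* (+ m) ℤ.^ s) * q ^ (m ℕ.* y)) u

IsG : ℕ → ℂ → ℂ → Set
IsG s q g =
  HasQuotientSum
    (λ r → ℤ→ℂ (sign r ℤ.* (+ r) ℤ.^ s) * q ^ r)
    (λ r → 1ℂ - q ^ r) g ×
  HasSum
    (λ n → ℤ→ℂ (divisorSum (λ d _ → sign d ℤ.* (+ d) ℤ.^ s) n) * q ^ n) g ×
  HasSum₂
    (λ y m → ℤ→ℂ (sign m ℤ.* (+ m) ℤ.^ s) * q ^ (m ℕ.* y)) g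

{-# OPTIONS --safe #-}
module Submission where

-- Partial fractions for products of two terms q^m / (1 ± q^m) express products
-- of the Lambert series u_p = Σ (-1)^m m^p q^m / (1 + q^m) = -U_p and
-- g_p = Σ (-1)^m m^p q^m / (1 - q^m) = G_p as linear combinations of such
-- series; the first such relation is 4 u₁² = g₃ - u₁. Together they write the
-- square and the cube of D₃ = 1 + 16 g₃ = (1 + 8 u₁)² as in the theorem, so
-- that it remains to show θ⁸ = D₃. With D = q d/dq, the relations for g₁ g₃ and
-- u₁ g₁ yield D D₃ = -8 W D₃ for a Lambert series W. Shanks' finite telescoping
-- sums prove Gauss' product θ = Π (1 - q^k) / (1 + q^k), whose logarithmic
-- derivative is D θ = -W θ. Both θ⁸ and D₃ have constant term 1, so they agree.
--
-- The identities hold in ℤ[[q]] modulo q^M for every M. A series with polynomially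
-- bounded coefficients takes at a complex number q the value given by the Cauchy
-- sequence whose n-th term is the n-th partial sum at the n-th approximation of
-- q, and products of series go to products of values.

open import Algebra.Bundles using (CommutativeRing)
import Algebra.Properties.Ring as RingProperties
import Algebra.Properties.Semiring.Exp as Exponentiation
import Algebra.Properties.Semiring.Sum as SemiringSum
import Algebra.Solver.Ring as RingSolver
open import Algebra.Solver.Ring.AlmostCommutativeRing
  using (_-Raw-AlmostCommutative⟶_; fromCommutativeRing)
open import Data.Bool.Base using (true; false; if_then_else_)
open import Data.Fin.Base using (toℕ)
open import Data.Integer.Base as ℤ using (ℤ; +_; -[1+_])
import Data.Integer.Properties as ℤ
import Data.Integer.Solver as ℤSolver
open import Data.List.Base using (List; []; _∷_; filter; foldr; map; applyUpTo)
open import Data.Maybe.Base using (Maybe; just; nothing)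
open import Data.Nat.Base as ℕ using (ℕ; zero; suc; z≤n; s≤s)
open import Data.Nat.Divisibility using (_∣_; _∣?_; divides)
import Data.Nat.DivMod as ℕ
open import Data.Nat.Induction using (<-rec)
import Data.Nat.Properties as ℕ
import Data.Nat.Solver as ℕSolver
open import Data.Product.Base using (_×_; _,_; proj₁; proj₂; ∃-syntax)
open import Data.Rational.Base as ℚ using (ℚ; 0ℚ; 1ℚ; ½; mkℚ)
import Data.Rational.Properties as ℚ
import Data.Rational.Solver as ℚSolver
open import Data.Rational.Unnormalised.Base as ℚᵘ using (mkℚᵘ)
import Data.Rational.Unnormalised.Properties as ℚᵘ
open import Data.Sign.Base as Sign using (Sign)
open import Data.Sum.Base using (_⊎_; inj₁; inj₂)
open import Data.Unit.Base using (⊤; tt)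
open import Data.Vec.Base as Vec using (Vec; []; _∷_)
open import Data.Vec.N-ary using (N-ary; _$ⁿ_)
import Defs
open Defs using (sign)
open import Function.Base using (_∘_; id)
open import Level as Level using (Lift; lift; 0ℓ)
import Relation.Binary.PropositionalEquality as ≡
open ≡ using (_≡_)
import Relation.Binary.Reasoning.Setoid as SetoidReasoning
open import Relation.Nullary.Decidable.Core using (Dec; yes; no; does)
open import Relation.Nullary.Negation.Core using (contradiction)

-- Put A = 1 + 8 u₁, B₃ = 1 - 16 u₃, B₅ = 1 + 8 u₅, D₅ = 1 - 8 g₅, D₇ = 17 + 32 g₇ and E = 1 + 8 (W
-- - g₁). The relations found by partial fractions then read A² = D₃, A B₃ = D₅, A E = B₃, 4 B₅ = B₃
-- E + 3 A D₃ and 12 A B₅ + 5 B₃² = D₇. Eliminating E gives 3 D₃² = 4 A B₅ - B₃² and 9 D₃³ = D₃ D₇ -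
-- 8 D₅², and expanding these two produces every constant of the theorem. In the same way D₅ = D₃ E
-- converts the relation for g₁ g₃ into the differential equation of D₃. Truncation makes q
-- nilpotent and every sum finite, so a double sum may be reordered as soon as the terms outside the
-- range vanish. Since the coefficients are integers, relations are multiplied by 2, 4 or 8 where
-- halves would arise, and the division by 3 or 9 is made on values. There the approximation of q
-- varies together with the length of the partial sum; all tail estimates are therefore uniform in
-- the point and in the coefficients.

-- Finite sums, convolutions and reorderings of double sums

module RangeSums {c ℓ} (R : CommutativeRing c ℓ) where
  open CommutativeRing R
  open SetoidReasoning setoid
  private module S = SemiringSum semiring

  ∑ : ℕ → (ℕ → Carrier) → Carrier
  ∑ zero    f = 0#
  ∑ (suc n) f = f 0 + ∑ n (f ∘ suc)

  infixl 10 ∑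
  syntax ∑ n (λ i → e) = ∑[ i < n ] e

  ∑≡sum : ∀ n (f : ℕ → Carrier) → ∑ n f ≡ S.sum {n} (f ∘ toℕ)
  ∑≡sum zero    f = ≡.refl
  ∑≡sum (suc n) f = ≡.cong (λ x → f 0 + x) (∑≡sum n (f ∘ suc))

  private
    swapʳ : ∀ a b c → (a + b) + c ≈ (a + c) + b
    swapʳ a b c = trans (+-assoc a b c) (trans (+-congˡ (+-comm b c)) (sym (+-assoc a c b)))

  ∑-cong< : ∀ n {f g : ℕ → Carrier} → (∀ i → i ℕ.< n → f i ≈ g i) → ∑ n f ≈ ∑ n g
  ∑-cong< zero    f≈g = refl
  ∑-cong< (suc n) f≈g =
    +-cong (f≈g 0 (s≤s z≤n)) (∑-cong< n λ i i<n → f≈g (suc i) (s≤s i<n))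

  ∑-cong : ∀ n {f g : ℕ → Carrier} → (∀ i → f i ≈ g i) → ∑ n f ≈ ∑ n g
  ∑-cong n f≈g = ∑-cong< n λ i _ → f≈g i

  ∑-zero : ∀ n {f : ℕ → Carrier} → (∀ i → i ℕ.< n → f i ≈ 0#) → ∑ n f ≈ 0#
  ∑-zero zero    f≈0 = refl
  ∑-zero (suc n) f≈0 = trans
    (+-cong (f≈0 0 (s≤s z≤n)) (∑-zero n λ i i<n → f≈0 (suc i) (s≤s i<n)))
    (+-identityˡ 0#)

  ∑-+ : ∀ n (f g : ℕ → Carrier) → ∑[ i < n ] (f i + g i) ≈ ∑ n f + ∑ n g
  ∑-+ n f g rewrite ∑≡sum n (λ i → f i + g i) | ∑≡sum n f | ∑≡sum n g =
    S.∑-distrib-+ {n} (f ∘ toℕ) (g ∘ toℕ)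

  ∑-*ˡ : ∀ n x (f : ℕ → Carrier) → ∑[ i < n ] (x * f i) ≈ x * ∑ n f
  ∑-*ˡ n x f rewrite ∑≡sum n (λ i → x * f i) | ∑≡sum n f =
    sym (S.*-distribˡ-sum {n} x (f ∘ toℕ))

  ∑-*ʳ : ∀ n (f : ℕ → Carrier) x → ∑[ i < n ] (f i * x) ≈ ∑ n f * x
  ∑-*ʳ n f x rewrite ∑≡sum n (λ i → f i * x) | ∑≡sum n f =
    sym (S.*-distribʳ-sum {n} x (f ∘ toℕ))

  ∑-neg : ∀ n (f : ℕ → Carrier) → ∑[ i < n ] (- f i) ≈ - ∑ n f
  ∑-neg n f = begin
    ∑[ i < n ] (- f i)      ≈⟨ ∑-cong n (λ i → sym (P.-1*x≈-x (f i))) ⟩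
    ∑[ i < n ] (- 1# * f i) ≈⟨ ∑-*ˡ n (- 1#) f ⟩
    - 1# * ∑ n f            ≈⟨ P.-1*x≈-x _ ⟩
    - ∑ n f                 ∎
    where module P = RingProperties ring

  ∑-comm : ∀ m n (f : ℕ → ℕ → Carrier) →
           ∑[ i < m ] (∑[ j < n ] f i j) ≈ ∑[ j < n ] (∑[ i < m ] f i j)
  ∑-comm zero    n f = sym (∑-zero n λ _ _ → refl)
  ∑-comm (suc m) n f = trans (+-congˡ (∑-comm m n (f ∘ suc)))
    (sym (∑-+ n (f 0) (λ j → ∑[ i < m ] f (suc i) j)))

  ∑-snoc : ∀ n (f : ℕ → Carrier) → ∑ (suc n) f ≈ ∑ n f + f n
  ∑-snoc zero    f = +-comm (f 0) 0#
  ∑-snoc (suc n) f = trans (+-congˡ (∑-snoc n (f ∘ suc))) (sym (+-assoc _ _ _))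

  ∑-++ : ∀ m n (f : ℕ → Carrier) → ∑ (m ℕ.+ n) f ≈ ∑ m f + ∑[ j < n ] f (m ℕ.+ j)
  ∑-++ zero    n f = sym (+-identityˡ _)
  ∑-++ (suc m) n f = trans (+-congˡ (∑-++ m n (f ∘ suc))) (sym (+-assoc _ _ _))

  ∑-extend : ∀ {m n} (f : ℕ → Carrier) → m ℕ.≤ n → (∀ i → m ℕ.≤ i → f i ≈ 0#) →
             ∑ n f ≈ ∑ m f
  ∑-extend {zero}  {n}     f m≤n f≈0 = ∑-zero n λ i _ → f≈0 i z≤n
  ∑-extend {suc m} {suc n} f (s≤s m≤n) f≈0 =
    +-congˡ (∑-extend (f ∘ suc) m≤n λ i m≤i → f≈0 (suc i) (s≤s m≤i))

  -- The terms from `M` on vanish, so the range may be lengthened to `suc l + M` and cut at any `l`,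
  -- even one beyond `M`. The tail then has `M` entries whatever `l` is.
  ∑-split : ∀ M l (f : ℕ → Carrier) → (∀ i → M ℕ.≤ i → f i ≈ 0#) →
            ∑ M f ≈ (∑ l f + f l) + ∑[ j < M ] f (suc (l ℕ.+ j))
  ∑-split M l f f≈0 = begin
    ∑ M f                                          ≈⟨ ∑-extend f (ℕ.m≤n+m M (suc l)) f≈0 ⟨
    ∑ (suc l ℕ.+ M) f                              ≈⟨ ∑-++ (suc l) M f ⟩
    ∑ (suc l) f + ∑[ j < M ] f (suc (l ℕ.+ j))     ≈⟨ +-congʳ (∑-snoc l f) ⟩
    (∑ l f + f l) + ∑[ j < M ] f (suc (l ℕ.+ j))   ∎

  -- conv n X is the sum of X i j over all i, j with i + j + 1 = n.
  conv : ℕ → (ℕ → ℕ → Carrier) → Carrier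
  conv zero    X = 0#
  conv (suc n) X = X 0 n + conv n (X ∘ suc)

  conv-cong : ∀ n {X Y : ℕ → ℕ → Carrier} →
              (∀ i j → suc (i ℕ.+ j) ≡ n → X i j ≈ Y i j) → conv n X ≈ conv n Y
  conv-cong zero    X≈Y = refl
  conv-cong (suc n) X≈Y =
    +-cong (X≈Y 0 n ≡.refl) (conv-cong n λ i j eq → X≈Y (suc i) j (≡.cong suc eq))

  conv-fst : ∀ n (f : ℕ → Carrier) → conv n (λ i _ → f i) ≈ ∑ n f
  conv-fst zero    f = refl
  conv-fst (suc n) f = +-congˡ (conv-fst n (f ∘ suc))

  conv-snd : ∀ n (f : ℕ → Carrier) → conv n (λ _ j → f j) ≈ ∑ n f
  conv-snd zero    f = refl
  conv-snd (suc n) f = begin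
    f n + conv n (λ _ j → f j) ≈⟨ +-comm _ _ ⟩
    conv n (λ _ j → f j) + f n ≈⟨ +-congʳ (conv-snd n f) ⟩
    ∑ n f + f n                ≈⟨ ∑-snoc n f ⟨
    ∑ (suc n) f                ∎

  conv-+ : ∀ n (X Y : ℕ → ℕ → Carrier) →
           conv n (λ i j → X i j + Y i j) ≈ conv n X + conv n Y
  conv-+ zero    X Y = sym (+-identityˡ 0#)
  conv-+ (suc n) X Y = begin
    (X 0 n + Y 0 n) + conv n (λ i j → X (suc i) j + Y (suc i) j)
      ≈⟨ +-congˡ (conv-+ n (X ∘ suc) (Y ∘ suc)) ⟩
    (X 0 n + Y 0 n) + (conv n (X ∘ suc) + conv n (Y ∘ suc))
      ≈⟨ +-assoc _ _ _ ⟨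
    ((X 0 n + Y 0 n) + conv n (X ∘ suc)) + conv n (Y ∘ suc)
      ≈⟨ +-congʳ (swapʳ _ _ _) ⟩
    ((X 0 n + conv n (X ∘ suc)) + Y 0 n) + conv n (Y ∘ suc)
      ≈⟨ +-assoc _ _ _ ⟩
    (X 0 n + conv n (X ∘ suc)) + (Y 0 n + conv n (Y ∘ suc)) ∎

  conv-*ˡ : ∀ n x (X : ℕ → ℕ → Carrier) → conv n (λ i j → x * X i j) ≈ x * conv n X
  conv-*ˡ zero    x X = sym (zeroʳ x)
  conv-*ˡ (suc n) x X = trans (+-congˡ (conv-*ˡ n x (X ∘ suc))) (sym (distribˡ _ _ _))

  conv-snoc : ∀ n (X : ℕ → ℕ → Carrier) →
              conv (suc n) X ≈ conv n (λ i j → X i (suc j)) + X n 0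
  conv-snoc zero    X = +-comm _ _
  conv-snoc (suc n) X = begin
    X 0 (suc n) + conv (suc n) (X ∘ suc)
      ≈⟨ +-congˡ (conv-snoc n (X ∘ suc)) ⟩
    X 0 (suc n) + (conv n (λ i j → X (suc i) (suc j)) + X (suc n) 0)
      ≈⟨ +-assoc _ _ _ ⟨
    (X 0 (suc n) + conv n (λ i j → X (suc i) (suc j))) + X (suc n) 0 ∎

  conv-swap : ∀ n (X : ℕ → ℕ → Carrier) → conv n X ≈ conv n (λ i j → X j i)
  conv-swap zero    X = refl
  conv-swap (suc n) X = begin
    X 0 n + conv n (X ∘ suc)                 ≈⟨ +-comm _ _ ⟩
    conv n (X ∘ suc) + X 0 n                 ≈⟨ +-congʳ (conv-swap n (X ∘ suc)) ⟩
    conv n (λ i j → X (suc j) i) + X 0 n     ≈⟨ conv-snoc n (λ i j → X j i) ⟨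
    conv (suc n) (λ i j → X j i)             ∎

  -- Each row adds one entry to every antidiagonal, which is the recursion of `conv`. The bound `K`
  -- is separate from `M` because the induction removes a row and lowers only `M`.
  ∑-antidiagonal : ∀ M K (X : ℕ → ℕ → Carrier) → M ℕ.≤ K →
    (∀ i j → M ℕ.≤ suc (i ℕ.+ j) → X i j ≈ 0#) →
    ∑[ i < M ] (∑[ j < K ] X i j) ≈ ∑[ l < M ] conv l X
  ∑-antidiagonal zero    K X M≤K X≈0 = refl
  ∑-antidiagonal (suc M) K X M≤K X≈0 = begin
    ∑ K (X 0) + ∑[ i < M ] (∑[ j < K ] X (suc i) j)
      ≈⟨ +-cong (∑-extend (X 0) (ℕ.<⇒≤ M≤K) λ j M≤j → X≈0 0 j (s≤s M≤j))
                (∑-antidiagonal M K (X ∘ suc) (ℕ.<⇒≤ M≤K)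
                   λ i j h → X≈0 (suc i) j (s≤s h)) ⟩
    ∑ M (X 0) + ∑[ l < M ] conv l (X ∘ suc)
      ≈⟨ ∑-+ M (X 0) (λ l → conv l (X ∘ suc)) ⟨
    ∑[ l < M ] conv (suc l) X
      ≈⟨ +-identityˡ _ ⟨
    ∑[ l < suc M ] conv l X ∎

  -- The induction splits off the column with second index 0. On the right `l` is the smaller index
  -- and `suc j` the gap between the two indices.
  ∑-triangle : ∀ M K (X : ℕ → ℕ → Carrier) → M ℕ.≤ K →
    (∀ i j → M ℕ.≤ i → X i j ≈ 0#) →
    ∑[ i < M ] (∑[ j < i ] X i j) ≈ ∑[ l < M ] (∑[ j < K ] X (suc (l ℕ.+ j)) l)
  ∑-triangle zero    K X M≤K X≈0 = refl
  ∑-triangle (suc M) K X M≤K X≈0 = begin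
    0# + ∑[ i < M ] (X (suc i) 0 + ∑[ j < i ] X (suc i) (suc j))
      ≈⟨ +-identityˡ _ ⟩
    ∑[ i < M ] (X (suc i) 0 + ∑[ j < i ] X (suc i) (suc j))
      ≈⟨ ∑-+ M (λ i → X (suc i) 0) (λ i → ∑[ j < i ] X (suc i) (suc j)) ⟩
    ∑[ i < M ] X (suc i) 0 + ∑[ i < M ] (∑[ j < i ] X (suc i) (suc j))
      ≈⟨ +-cong (sym (∑-extend (λ i → X (suc i) 0) (ℕ.<⇒≤ M≤K)
                        λ i M≤i → X≈0 (suc i) 0 (s≤s M≤i)))
                (∑-triangle M K (λ i j → X (suc i) (suc j)) (ℕ.<⇒≤ M≤K)
                   λ i j M≤i → X≈0 (suc i) (suc j) (s≤s M≤i)) ⟩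
    ∑[ l < suc M ] (∑[ j < K ] X (suc (l ℕ.+ j)) l) ∎

  ∑-square : ∀ M (X : ℕ → ℕ → Carrier) →
    ∑[ i < M ] (∑[ j < M ] X i j) ≈
    ∑[ i < M ] X i i + ∑[ i < M ] (∑[ j < i ] (X i j + X j i))
  ∑-square zero    X = sym (+-identityˡ 0#)
  ∑-square (suc M) X = begin
    ∑[ i < suc M ] (∑[ j < suc M ] X i j)
      ≈⟨ ∑-snoc M (λ i → ∑[ j < suc M ] X i j) ⟩
    ∑[ i < M ] (∑[ j < suc M ] X i j) + ∑[ j < suc M ] X M j
      ≈⟨ +-cong (trans (∑-cong M λ i → ∑-snoc M (X i))
                       (∑-+ M (λ i → ∑ M (X i)) (λ i → X i M)))
                (∑-snoc M (X M)) ⟩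
    (∑[ i < M ] (∑[ j < M ] X i j) + ∑[ i < M ] X i M) + (∑ M (X M) + X M M)
      ≈⟨ +-congʳ (+-congʳ (∑-square M X)) ⟩
    ((d + t) + ∑[ i < M ] X i M) + (∑ M (X M) + X M M)
      ≈⟨ +-assoc _ _ _ ⟩
    (d + t) + (∑[ i < M ] X i M + (∑ M (X M) + X M M))
      ≈⟨ +-congˡ (trans (sym (+-assoc _ _ _))
                 (trans (+-congʳ (+-comm _ _)) (+-comm _ _))) ⟩
    (d + t) + (X M M + (∑ M (X M) + ∑[ i < M ] X i M))
      ≈⟨ +-assoc _ _ _ ⟨
    ((d + t) + X M M) + (∑ M (X M) + ∑[ i < M ] X i M)
      ≈⟨ +-congʳ (swapʳ _ _ _) ⟩
    ((d + X M M) + t) + (∑ M (X M) + ∑[ i < M ] X i M)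
      ≈⟨ +-assoc _ _ _ ⟩
    (d + X M M) + (t + (∑ M (X M) + ∑[ i < M ] X i M))
      ≈⟨ +-cong (sym (∑-snoc M (λ i → X i i)))
                (trans (+-congˡ (sym (∑-+ M (X M) (λ i → X i M))))
                       (sym (∑-snoc M (λ i → ∑[ j < i ] (X i j + X j i))))) ⟩
    ∑[ i < suc M ] X i i + ∑[ i < suc M ] (∑[ j < i ] (X i j + X j i)) ∎
    where
    d = ∑[ i < M ] X i i
    t = ∑[ i < M ] (∑[ j < i ] (X i j + X j i))

  -- Orders the square by the gap `suc l` between its indices, because the partial fractions for γ
  -- at n + k and n are summed over n at a fixed gap k.
  ∑-diagonal : ∀ M (X : ℕ → ℕ → Carrier) →
    (∀ i j → M ℕ.≤ i → X i j ≈ 0#) → (∀ i j → M ℕ.≤ j → X i j ≈ 0#) →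
    ∑[ i < M ] (∑[ j < M ] X i j) ≈
    ∑[ i < M ] X i i +
    ∑[ l < M ] (∑[ j < M ] (X (suc (j ℕ.+ l)) j + X j (suc (j ℕ.+ l))))
  ∑-diagonal M X Xi≈0 Xj≈0 = begin
    ∑[ i < M ] (∑[ j < M ] X i j)
      ≈⟨ ∑-square M X ⟩
    ∑[ i < M ] X i i + ∑[ i < M ] (∑[ j < i ] (X i j + X j i))
      ≈⟨ +-congˡ (∑-triangle M M (λ i j → X i j + X j i) ℕ.≤-refl
           λ i j M≤i → trans (+-cong (Xi≈0 i j M≤i) (Xj≈0 j i M≤i)) (+-identityˡ 0#)) ⟩
    ∑[ i < M ] X i i +
    ∑[ j < M ] (∑[ l < M ] (X (suc (j ℕ.+ l)) j + X j (suc (j ℕ.+ l))))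
      ≈⟨ +-congˡ (∑-comm M M (λ j l → X (suc (j ℕ.+ l)) j + X j (suc (j ℕ.+ l)))) ⟩
    ∑[ i < M ] X i i +
    ∑[ l < M ] (∑[ j < M ] (X (suc (j ℕ.+ l)) j + X j (suc (j ℕ.+ l)))) ∎

-- Linear consequences of ring equations with integer coefficients

ℤ-algebra : ∀ {c ℓ} → CommutativeRing c ℓ → Set _
ℤ-algebra R =
  CommutativeRing.rawRing ℤ.+-*-commutativeRing -Raw-AlmostCommutative⟶ fromCommutativeRing R

module ScalarSolver {c ℓ} (R : CommutativeRing c ℓ) (algebra : ℤ-algebra R) where
  open CommutativeRing R
  open SetoidReasoning setoid
  open _-Raw-AlmostCommutative⟶_ algebra public
    renaming (⟦_⟧ to ι; +-homo to ι-+; *-homo to ι-*; -‿homo to ι-neg; 0-homo to ι-0; 1-homo to ι-1)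

  private
    ι-≟ : ∀ a b → Maybe (ι a ≈ ι b)
    ι-≟ a b with a ℤ.≟ b
    ... | yes ≡.refl = just refl
    ... | no _       = nothing

  open RingSolver (CommutativeRing.rawRing ℤ.+-*-commutativeRing)
    (fromCommutativeRing R) algebra ι-≟ public

  ι-cong : ∀ {a b} → a ≡ b → ι a ≈ ι b
  ι-cong ≡.refl = refl

  Equation : ℕ → Set
  Equation n = Polynomial n × Polynomial n

  Hypotheses : ℕ → Set
  Hypotheses n = List (Polynomial n × Equation n)

  Hold : ∀ {n} → Vec Carrier n → Hypotheses n → Set ℓ
  Hold ρ []                  = Lift _ ⊤
  Hold ρ ((k , x , y) ∷ hyps) = (⟦ x ⟧ ρ ≈ ⟦ y ⟧ ρ) × Hold ρ hyps

  combination : ∀ {n} → Hypotheses n → Polynomial n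
  combination []                   = con ℤ.0ℤ
  combination ((k , x , y) ∷ hyps) = k :* (x :- y) :+ combination hyps

  private
    combination≈0 : ∀ {n} (ρ : Vec Carrier n) hyps → Hold ρ hyps → ⟦ combination hyps ⟧ ρ ≈ 0#
    combination≈0 ρ []                   _       = ι-0
    combination≈0 ρ ((k , x , y) ∷ hyps) (h , hs) = begin
      ⟦ k ⟧ ρ * (⟦ x ⟧ ρ + - ⟦ y ⟧ ρ) + ⟦ combination hyps ⟧ ρ
        ≈⟨ +-cong (*-congˡ (+-congʳ h)) (combination≈0 ρ hyps hs) ⟩
      ⟦ k ⟧ ρ * (⟦ y ⟧ ρ + - ⟦ y ⟧ ρ) + 0#
        ≈⟨ +-identityʳ _ ⟩
      ⟦ k ⟧ ρ * (⟦ y ⟧ ρ + - ⟦ y ⟧ ρ)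
        ≈⟨ *-congˡ (-‿inverseʳ _) ⟩
      ⟦ k ⟧ ρ * 0#
        ≈⟨ zeroʳ _ ⟩
      0# ∎

  -- A goal l ≈ r follows from hypotheses x ≈ y once l - r is exhibited as a
  -- combination of the differences x - y.
  linear : ∀ n (ρ : Vec Carrier n) (f : N-ary n (Polynomial n) (Equation n × Hypotheses n)) →
           let (l , r) , hyps = f $ⁿ Vec.map var (Vec.allFin n) in
           Hold ρ hyps → ⟦ l :- r ⟧↓ ρ ≈ ⟦ combination hyps ⟧↓ ρ → ⟦ l ⟧ ρ ≈ ⟦ r ⟧ ρ
  linear n ρ f hs eq with f $ⁿ Vec.map var (Vec.allFin n)
  ... | (l , r) , hyps = begin
    ⟦ l ⟧ ρ                        ≈⟨ +-identityʳ _ ⟨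
    ⟦ l ⟧ ρ + 0#                   ≈⟨ +-congˡ (-‿inverseˡ (⟦ r ⟧ ρ)) ⟨
    ⟦ l ⟧ ρ + (- ⟦ r ⟧ ρ + ⟦ r ⟧ ρ) ≈⟨ +-assoc _ _ _ ⟨
    ⟦ l :- r ⟧ ρ + ⟦ r ⟧ ρ         ≈⟨ +-congʳ l-r≈0 ⟩
    0# + ⟦ r ⟧ ρ                   ≈⟨ +-identityˡ _ ⟩
    ⟦ r ⟧ ρ                        ∎
    where
    l-r≈0 : ⟦ l :- r ⟧ ρ ≈ 0#
    l-r≈0 = trans (prove ρ (l :- r) (combination hyps) eq) (combination≈0 ρ hyps hs)

-- Partial fractions for products of two Lambert terms

σ : Sign → ℤ
σ Sign.+ = ℤ.1ℤ
σ Sign.- = ℤ.-1ℤ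

σ-* : ∀ s t → σ (s Sign.* t) ≡ σ s ℤ.* σ t
σ-* Sign.+ Sign.+ = ≡.refl
σ-* Sign.+ Sign.- = ≡.refl
σ-* Sign.- Sign.+ = ≡.refl
σ-* Sign.- Sign.- = ≡.refl

σ² : ∀ s → σ s ℤ.* σ s ≡ ℤ.1ℤ
σ² Sign.+ = ≡.refl
σ² Sign.- = ≡.refl

-- Q m is q^m for a nilpotent element q, and γ s i is q^m / (1 - s q^m) with
-- m = i + 1.
record LambertData {c ℓ} (R : CommutativeRing c ℓ) (algebra : ℤ-algebra R) : Set (c Level.⊔ ℓ) where
  open CommutativeRing R
  open _-Raw-AlmostCommutative⟶_ algebra using () renaming (⟦_⟧ to ι)
  field
    M        : ℕ
    Q        : ℕ → Carrier
    Q-0      : Q 0 ≈ ι ℤ.1ℤ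
    Q-+      : ∀ m n → Q (m ℕ.+ n) ≈ Q m * Q n
    Q-nil    : ∀ m → M ℕ.≤ m → Q m ≈ 0#
    γ        : Sign → ℕ → Carrier
    γ-unfold : ∀ s i → γ s i ≈ Q (suc i) * (ι ℤ.1ℤ + ι (σ s) * γ s i)

module Lambert {c ℓ} (R : CommutativeRing c ℓ) (algebra : ℤ-algebra R)
               (L : LambertData R algebra) where
  open CommutativeRing R
  open SetoidReasoning setoid
  open RangeSums R public
  open ScalarSolver R algebra public
  open LambertData L public

  α β : ℕ → Carrier
  α = γ Sign.-
  β = γ Sign.+

  γ-quotient : ∀ s i → γ s i * (ι ℤ.1ℤ - ι (σ s) * Q (suc i)) ≈ Q (suc i)
  γ-quotient s i = linear 3 (γ s i ∷ ι (σ s) ∷ Q (suc i) ∷ [])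
    (λ x S a → (x :* (con ℤ.1ℤ :- S :* a) := a) , (con ℤ.1ℤ , (x := a :* (con ℤ.1ℤ :+ S :* x))) ∷ [])
    (γ-unfold s i , lift tt) refl

  γ-vanish : ∀ s i → M ℕ.≤ suc i → γ s i ≈ 0#
  γ-vanish s i M≤i = trans (γ-unfold s i) (trans (*-congʳ (Q-nil (suc i) M≤i)) (zeroˡ _))

  σ-homo : ∀ s t → ι (σ (s Sign.* t)) ≈ ι (σ s) * ι (σ t)
  σ-homo s t = trans (ι-cong (σ-* s t)) (ι-* (σ s) (σ t))

  σσ : ∀ s → ι (σ s) * ι (σ s) ≈ ι ℤ.1ℤ
  σσ s = trans (sym (ι-* (σ s) (σ s))) (ι-cong (σ² s))

  -- Let x, y be the factors, a, b their powers of q, S, T their signs and z the term on the right.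
  -- Then 1/x = 1/a - S and 1/y = 1/b - T, so 1/z = 1/(ab) - ST = 1/(xy) + T/x + S/y; multiply by
  -- xyz. As a and b are nilpotent, the division is replaced by a combination of the unfolding
  -- equations.
  γγ-antidiagonal : ∀ s t i j →
    γ s i * γ t j ≈
    γ (s Sign.* t) (suc (i ℕ.+ j)) * (ι ℤ.1ℤ + ι (σ s) * γ s i + ι (σ t) * γ t j)
  γγ-antidiagonal s t i j =
    linear 7 (ι (σ s) ∷ ι (σ t) ∷ γ s i ∷ γ t j ∷ γ (s Sign.* t) (suc (i ℕ.+ j)) ∷
              Q (suc i) ∷ Q (suc j) ∷ [])
      (λ S T x y z a b →
        let 𝟙 = con ℤ.1ℤ ; u = 𝟙 :+ S :* x ; v = 𝟙 :+ T :* y ; w = 𝟙 :+ (S :* T) :* z in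
        (x :* y := z :* (𝟙 :+ S :* x :+ T :* y)) ,
        (w :* y , (x := a :* u)) ∷ (w :* (a :* u) , (y := b :* v)) ∷
        (:- (u :* v) , (z := (a :* b) :* w)) ∷ [])
      (γ-unfold s i , γ-unfold t j , z-unfold , lift tt) refl
    where
    z-unfold : γ (s Sign.* t) (suc (i ℕ.+ j)) ≈
               (Q (suc i) * Q (suc j)) *
               (ι ℤ.1ℤ + (ι (σ s) * ι (σ t)) * γ (s Sign.* t) (suc (i ℕ.+ j)))
    z-unfold = trans (γ-unfold (s Sign.* t) (suc (i ℕ.+ j)))
      (*-cong (trans (reflexive (≡.cong Q (≡.cong suc (≡.sym (ℕ.+-suc i j))))) (Q-+ (suc i) (suc j)))
              (+-congˡ (*-congʳ (σ-homo s t))))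

  -- With n = j + 1 and k = l + 1, the first factor has index n + k.
  γγ-diagonal : ∀ s t j l →
    γ s (suc (j ℕ.+ l)) * (ι ℤ.1ℤ + ι (σ t) * γ t j) ≈
    γ (s Sign.* t) l * (γ t j - (ι (σ s) * ι (σ t)) * γ s (suc (j ℕ.+ l)))
  γγ-diagonal s t j l =
    linear 7 (ι (σ s) ∷ ι (σ t) ∷ γ s (suc (j ℕ.+ l)) ∷ γ t j ∷ γ (s Sign.* t) l ∷
              Q (suc j) ∷ Q (suc l) ∷ [])
      (λ S T x y z b c →
        let 𝟙 = con ℤ.1ℤ ; p = S :* T
            u = 𝟙 :+ S :* x ; v = 𝟙 :+ T :* y ; w = 𝟙 :+ p :* z in
        (x :* v := z :* (y :- p :* x)) ,
        (u :* (v :+ p :* z) :- S :* (x :* v :- z :* (y :- p :* x)) , (x := (b :* c) :* u)) ∷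
        (:- (u :* c :* w) , (y := b :* v)) ∷
        (:- (u :* y) , (z := c :* w)) ∷
        (:- (u :* S :* b :* c :* z :* y) , (T :* T := 𝟙)) ∷ [])
      (x-unfold , γ-unfold t j , z-unfold , σσ t , lift tt) refl
    where
    x-unfold : γ s (suc (j ℕ.+ l)) ≈
               (Q (suc j) * Q (suc l)) * (ι ℤ.1ℤ + ι (σ s) * γ s (suc (j ℕ.+ l)))
    x-unfold = trans (γ-unfold s (suc (j ℕ.+ l)))
      (*-congʳ (trans (reflexive (≡.cong Q (≡.cong suc (≡.sym (ℕ.+-suc j l))))) (Q-+ (suc j) (suc l))))
    z-unfold : γ (s Sign.* t) l ≈
               Q (suc l) * (ι ℤ.1ℤ + (ι (σ s) * ι (σ t)) * γ (s Sign.* t) l)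
    z-unfold = trans (γ-unfold (s Sign.* t) l) (*-congˡ (+-congˡ (*-congʳ (σ-homo s t))))

-- Products of Lambert series of equal signs

record Antiderivative (f F : ℕ → ℤ) : Set where
  field
    at-0   : F 0 ≡ ℤ.0ℤ
    at-suc : ∀ i → F (suc i) ≡ F i ℤ.+ f i

module Convolution {c ℓ} (R : CommutativeRing c ℓ) (algebra : ℤ-algebra R)
                   (L : LambertData R algebra) where
  open CommutativeRing R
  open SetoidReasoning setoid
  open Lambert R algebra L public
  open Antiderivative

  moment : Sign → (ℕ → ℤ) → Carrier
  moment s x = ∑[ i < M ] (ι (x i) * γ s i)

  bilinear : Sign → Sign → (ℕ → ℕ → ℤ) → Carrier
  bilinear s t w = ∑[ i < M ] (∑[ j < M ] (ι (w i j) * (γ s i * γ t j)))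

  tail : Sign → ℕ → Carrier
  tail s l = ∑[ j < M ] γ s (suc (j ℕ.+ l))

  ∑-const : ∀ n → ∑[ i < n ] ι ℤ.1ℤ ≈ ι (+ n)
  ∑-const zero    = sym ι-0
  ∑-const (suc n) = trans (+-congˡ (∑-const n)) (sym (ι-+ ℤ.1ℤ (+ n)))

  ∑-ι : ∀ {f F} → Antiderivative f F → ∀ n → ∑[ i < n ] ι (f i) ≈ ι (F n)
  ∑-ι {f} {F} F′ zero    = sym (trans (ι-cong (at-0 F′)) ι-0)
  ∑-ι {f} {F} F′ (suc n) = begin
    ∑[ i < suc n ] ι (f i)     ≈⟨ ∑-snoc n (λ i → ι (f i)) ⟩
    ∑[ i < n ] ι (f i) + ι (f n) ≈⟨ +-congʳ (∑-ι F′ n) ⟩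
    ι (F n) + ι (f n)          ≈⟨ ι-+ (F n) (f n) ⟨
    ι (F n ℤ.+ f n)            ≈⟨ ι-cong (at-suc F′ n) ⟨
    ι (F (suc n))              ∎

  ∑-γ-split : ∀ s l → ∑ M (γ s) ≈ (∑ l (γ s) + γ s l) + tail s l
  ∑-γ-split s l = trans
    (∑-split M l (γ s) (λ i M≤i → γ-vanish s i (ℕ.m≤n⇒m≤1+n M≤i)))
    (+-congˡ (∑-cong M λ j → reflexive (≡.cong (λ k → γ s (suc k)) (ℕ.+-comm l j))))

  γγ-vanish : ∀ s t i j → M ℕ.≤ suc (i ℕ.+ j) → γ s i * γ t j ≈ 0#
  γγ-vanish s t i j M≤ = trans (γγ-antidiagonal s t i j)
    (trans (*-congʳ (γ-vanish _ _ (ℕ.m≤n⇒m≤1+n M≤))) (zeroˡ _))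

  private
    vanishˡ : ∀ s t (w : ℕ → ℕ → ℤ) i j → M ℕ.≤ i → ι (w i j) * (γ s i * γ t j) ≈ 0#
    vanishˡ s t w i j M≤i = trans
      (*-congˡ (γγ-vanish s t i j (ℕ.m≤n⇒m≤1+n (ℕ.m≤n⇒m≤n+o j M≤i)))) (zeroʳ _)

    vanishʳ : ∀ s t (w : ℕ → ℕ → ℤ) i j → M ℕ.≤ j → ι (w i j) * (γ s i * γ t j) ≈ 0#
    vanishʳ s t w i j M≤j = trans
      (*-congˡ (γγ-vanish s t i j (ℕ.m≤n⇒m≤1+n (ℕ.m≤n⇒m≤o+n i M≤j)))) (zeroʳ _)

  bilinear-diagonal : ∀ s t (w : ℕ → ℕ → ℤ) → (∀ i → w i i ≡ ℤ.0ℤ) →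
    bilinear s t w ≈
    ∑[ l < M ] (∑[ j < M ] (ι (w (suc (j ℕ.+ l)) j) * (γ s (suc (j ℕ.+ l)) * γ t j)
                          + ι (w j (suc (j ℕ.+ l))) * (γ s j * γ t (suc (j ℕ.+ l)))))
  bilinear-diagonal s t w w≡0 = begin
    bilinear s t w
      ≈⟨ ∑-diagonal M (λ i j → ι (w i j) * (γ s i * γ t j)) (vanishˡ s t w) (vanishʳ s t w) ⟩
    _ + _
      ≈⟨ +-congʳ (∑-zero M λ i _ →
           trans (*-congʳ (trans (ι-cong (w≡0 i)) ι-0)) (zeroˡ _)) ⟩
    0# + _
      ≈⟨ +-identityˡ _ ⟩
    _ ∎

  bilinear-antidiagonal : ∀ s t (w : ℕ → ℕ → ℤ) →
    bilinear s t w ≈ ∑[ l < M ] conv l (λ i j → ι (w i j) * (γ s i * γ t j))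
  bilinear-antidiagonal s t w =
    ∑-antidiagonal M M (λ i j → ι (w i j) * (γ s i * γ t j)) ℕ.≤-refl
      λ i j M≤ → trans (*-congˡ (γγ-vanish s t i j M≤)) (zeroʳ _)

  -- After exchanging the sums, γ at `i` is counted once for every `l < i` with weight `f l`, and
  -- these weights add up to `F i`.
  ∑-tail : ∀ s {f F} → Antiderivative f F →
           ∑[ l < M ] (ι (f l) * tail s l) ≈ moment s F
  ∑-tail s {f} {F} F′ = begin
    ∑[ l < M ] (ι (f l) * tail s l)
      ≈⟨ ∑-cong M (λ l → *-congˡ (∑-cong M λ j →
           reflexive (≡.cong (λ k → γ s (suc k)) (ℕ.+-comm j l)))) ⟩
    ∑[ l < M ] (ι (f l) * ∑[ j < M ] γ s (suc (l ℕ.+ j)))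
      ≈⟨ ∑-cong M (λ l → sym (∑-*ˡ M (ι (f l)) (λ j → γ s (suc (l ℕ.+ j))))) ⟩
    ∑[ l < M ] (∑[ j < M ] (ι (f l) * γ s (suc (l ℕ.+ j))))
      ≈⟨ ∑-triangle M M (λ i l → ι (f l) * γ s i) ℕ.≤-refl
           (λ i l M≤i → trans (*-congˡ (γ-vanish s i (ℕ.m≤n⇒m≤1+n M≤i))) (zeroʳ _)) ⟨
    ∑[ i < M ] (∑[ l < i ] (ι (f l) * γ s i))
      ≈⟨ ∑-cong M (λ i → ∑-*ʳ i (λ l → ι (f l)) (γ s i)) ⟩
    ∑[ i < M ] (∑[ l < i ] ι (f l) * γ s i)
      ≈⟨ ∑-cong M (λ i → *-congʳ (∑-ι F′ i)) ⟩
    moment s F ∎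

  private
    -- Up to a multiple of the tail, the partial fraction contains the differences of γ at n and at
    -- n + k. Their sum over n telescopes to the first k = l + 1 terms, which are
    -- `∑ l (γ s) + γ s l`.
    self-diagonal : ∀ s l →
      ι (σ s) * ∑[ j < M ] (γ s (suc (j ℕ.+ l)) * γ s j) ≈
      γ (s Sign.* s) l * (∑ l (γ s) + γ s l) - tail s l
    self-diagonal s l = begin
      S * ∑[ j < M ] (γ s (suc (j ℕ.+ l)) * γ s j)
        ≈⟨ ∑-*ˡ M S _ ⟨
      ∑[ j < M ] (S * (γ s (suc (j ℕ.+ l)) * γ s j))
        ≈⟨ ∑-cong M (λ j → linear 4 (S ∷ γ s (suc (j ℕ.+ l)) ∷ γ s j ∷ z ∷ [])
             (λ S x y z →
               (S :* (x :* y) := (z :* y) :+ (:- (z :+ con ℤ.1ℤ)) :* x) ,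
               (con ℤ.1ℤ , (x :* (con ℤ.1ℤ :+ S :* y) := z :* (y :- (S :* S) :* x))) ∷
               (:- (z :* x) , (S :* S := con ℤ.1ℤ)) ∷ [])
             (γγ-diagonal s s j l , σσ s , lift tt) refl) ⟩
      ∑[ j < M ] (z * γ s j + (- (z + ι ℤ.1ℤ)) * γ s (suc (j ℕ.+ l)))
        ≈⟨ ∑-+ M (λ j → z * γ s j) (λ j → (- (z + ι ℤ.1ℤ)) * γ s (suc (j ℕ.+ l))) ⟩
      ∑[ j < M ] (z * γ s j) + ∑[ j < M ] ((- (z + ι ℤ.1ℤ)) * γ s (suc (j ℕ.+ l)))
        ≈⟨ +-cong (∑-*ˡ M z (γ s)) (∑-*ˡ M (- (z + ι ℤ.1ℤ)) (λ j → γ s (suc (j ℕ.+ l)))) ⟩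
      z * ∑ M (γ s) + (- (z + ι ℤ.1ℤ)) * tail s l
        ≈⟨ +-congʳ (*-congˡ (∑-γ-split s l)) ⟩
      z * ((∑ l (γ s) + γ s l) + tail s l) + (- (z + ι ℤ.1ℤ)) * tail s l
        ≈⟨ solve 3 (λ z g t → z :* (g :+ t) :+ (:- (z :+ con ℤ.1ℤ)) :* t := z :* g :- t) refl
             z (∑ l (γ s) + γ s l) (tail s l) ⟩
      z * (∑ l (γ s) + γ s l) - tail s l ∎
      where
      S = ι (σ s)
      z = γ (s Sign.* s) l

    -- Both factors run through all indices below `l`, so the partial sum `∑ l (γ s)` occurs with
    -- the factor 2. Twice `self-diagonal` contains it equally often; in the difference only terms
    -- at the index `l` and tails survive.
    self-antidiagonal : ∀ s l →
      conv l (λ i j → γ s i * γ s j) ≈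
      γ (s Sign.* s) l * (ι (+ l) + ι (+ 2) * (ι (σ s) * ∑ l (γ s)))
    self-antidiagonal s l = begin
      conv l (λ i j → γ s i * γ s j)
        ≈⟨ conv-cong l (λ i j eq → trans (γγ-antidiagonal s s i j)
             (*-congʳ (reflexive (≡.cong (γ (s Sign.* s)) eq)))) ⟩
      conv l (λ i j → z * (ι ℤ.1ℤ + S * γ s i + S * γ s j))
        ≈⟨ conv-*ˡ l z (λ i j → ι ℤ.1ℤ + S * γ s i + S * γ s j) ⟩
      z * conv l (λ i j → ι ℤ.1ℤ + S * γ s i + S * γ s j)
        ≈⟨ *-congˡ (conv-+ l (λ i j → ι ℤ.1ℤ + S * γ s i) (λ i j → S * γ s j)) ⟩
      z * (conv l (λ i j → ι ℤ.1ℤ + S * γ s i) + conv l (λ i j → S * γ s j))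
        ≈⟨ *-congˡ (+-cong (conv-fst l (λ i → ι ℤ.1ℤ + S * γ s i))
                           (conv-snd l (λ j → S * γ s j))) ⟩
      z * (∑[ i < l ] (ι ℤ.1ℤ + S * γ s i) + ∑[ j < l ] (S * γ s j))
        ≈⟨ *-congˡ (+-cong (trans (∑-+ l (λ _ → ι ℤ.1ℤ) (λ i → S * γ s i))
                                  (+-cong (∑-const l) (∑-*ˡ l S (γ s))))
                           (∑-*ˡ l S (γ s))) ⟩
      z * ((ι (+ l) + S * ∑ l (γ s)) + S * ∑ l (γ s))
        ≈⟨ solve 3 (λ z n g → z :* ((n :+ g) :+ g) := z :* (n :+ con (+ 2) :* g)) refl
             z (ι (+ l)) (S * ∑ l (γ s)) ⟩
      z * (ι (+ l) + ι (+ 2) * (S * ∑ l (γ s))) ∎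
      where
      S = ι (σ s)
      z = γ (s Sign.* s) l

  -- The weights w⁻ and w⁺ are functions of the difference and of the sum of
  -- the two indices, as in 2 sin mu sin nu = cos (m - n)u - cos (m + n)u.
  self-convolution : ∀ s {w⁻ w⁺ : ℕ → ℕ → ℤ} {f F : ℕ → ℤ} →
    (∀ i → w⁻ i i ≡ ℤ.0ℤ) →
    (∀ j l → w⁻ (suc (j ℕ.+ l)) j ≡ f l) → (∀ j l → w⁻ j (suc (j ℕ.+ l)) ≡ f l) →
    (∀ i j → w⁺ i j ≡ f (suc (i ℕ.+ j))) → Antiderivative f F →
    ι (σ s) * (bilinear s s w⁻ - bilinear s s w⁺) ≈
    ∑[ l < M ] (ι (f l) * (ι (+ 2) * (γ (s Sign.* s) l * γ s l)
                           - ι (σ s) * (ι (+ l) * γ (s Sign.* s) l)))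
    - ι (+ 2) * moment s F
  self-convolution s {w⁻} {w⁺} {f} {F} w≡0 w↓ w↑ w⁺≡ F′ = begin
    S * (bilinear s s w⁻ - bilinear s s w⁺)
      ≈⟨ *-congˡ (+-cong diagonal (-‿cong antidiagonal)) ⟩
    S * (∑[ l < M ] (ι (f l) * (ι (+ 2) * B l)) - ∑[ l < M ] (ι (f l) * C l))
      ≈⟨ *-congˡ (+-congˡ (sym (∑-neg M (λ l → ι (f l) * C l)))) ⟩
    S * (∑[ l < M ] (ι (f l) * (ι (+ 2) * B l)) + ∑[ l < M ] (- (ι (f l) * C l)))
      ≈⟨ *-congˡ (sym (∑-+ M (λ l → ι (f l) * (ι (+ 2) * B l)) (λ l → - (ι (f l) * C l)))) ⟩
    S * ∑[ l < M ] (ι (f l) * (ι (+ 2) * B l) + - (ι (f l) * C l))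
      ≈⟨ ∑-*ˡ M S _ ⟨
    ∑[ l < M ] (S * (ι (f l) * (ι (+ 2) * B l) + - (ι (f l) * C l)))
      ≈⟨ ∑-cong M (λ l → linear 9
           (S ∷ ι (f l) ∷ B l ∷ C l ∷ z l ∷ ∑ l (γ s) ∷ γ s l ∷ tail s l ∷ ι (+ l) ∷ [])
           (λ S f B C z g γ t n →
             (S :* (f :* (con (+ 2) :* B) :+ :- (f :* C)) :=
              f :* (con (+ 2) :* (z :* γ) :- S :* (n :* z)) :+ (:- con (+ 2)) :* (f :* t)) ,
             (con (+ 2) :* f , (S :* B := z :* (g :+ γ) :- t)) ∷
             (:- (S :* f) , (C := z :* (n :+ con (+ 2) :* (S :* g)))) ∷
             (:- (con (+ 2) :* f :* z :* g) , (S :* S := con ℤ.1ℤ)) ∷ [])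
           (self-diagonal s l , self-antidiagonal s l , σσ s , lift tt) refl) ⟩
    ∑[ l < M ] (A l + (- ι (+ 2)) * (ι (f l) * tail s l))
      ≈⟨ ∑-+ M A (λ l → (- ι (+ 2)) * (ι (f l) * tail s l)) ⟩
    ∑ M A + ∑[ l < M ] ((- ι (+ 2)) * (ι (f l) * tail s l))
      ≈⟨ +-congˡ (trans (∑-*ˡ M (- ι (+ 2)) (λ l → ι (f l) * tail s l))
                        (*-congˡ (∑-tail s F′))) ⟩
    ∑ M A + (- ι (+ 2)) * moment s F
      ≈⟨ solve 2 (λ a m → a :+ (:- con (+ 2)) :* m := a :- con (+ 2) :* m) refl _ _ ⟩
    ∑ M A - ι (+ 2) * moment s F ∎
    where
    S = ι (σ s)
    z B C A : ℕ → Carrier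
    z = γ (s Sign.* s)
    B l = ∑[ j < M ] (γ s (suc (j ℕ.+ l)) * γ s j)
    C l = conv l (λ i j → γ s i * γ s j)
    A l = ι (f l) * (ι (+ 2) * (z l * γ s l) - S * (ι (+ l) * z l))
    diagonal : bilinear s s w⁻ ≈ ∑[ l < M ] (ι (f l) * (ι (+ 2) * B l))
    diagonal = begin
      bilinear s s w⁻
        ≈⟨ bilinear-diagonal s s w⁻ w≡0 ⟩
      _ ≈⟨ ∑-cong M (λ l → ∑-cong M λ j → trans
             (+-cong (*-congʳ (ι-cong (w↓ j l))) (*-congʳ (ι-cong (w↑ j l))))
             (solve 3 (λ f x y → f :* (x :* y) :+ f :* (y :* x) := (f :* con (+ 2)) :* (x :* y))
                refl (ι (f l)) (γ s (suc (j ℕ.+ l))) (γ s j))) ⟩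
      ∑[ l < M ] (∑[ j < M ] ((ι (f l) * ι (+ 2)) * (γ s (suc (j ℕ.+ l)) * γ s j)))
        ≈⟨ ∑-cong M (λ l → trans (∑-*ˡ M (ι (f l) * ι (+ 2)) _) (*-assoc _ _ _)) ⟩
      ∑[ l < M ] (ι (f l) * (ι (+ 2) * B l)) ∎
    antidiagonal : bilinear s s w⁺ ≈ ∑[ l < M ] (ι (f l) * C l)
    antidiagonal = begin
      bilinear s s w⁺
        ≈⟨ bilinear-antidiagonal s s w⁺ ⟩
      ∑[ l < M ] conv l (λ i j → ι (w⁺ i j) * (γ s i * γ s j))
        ≈⟨ ∑-cong M (λ l → trans
             (conv-cong l λ i j eq → *-congʳ (ι-cong (≡.trans (w⁺≡ i j) (≡.cong f eq))))
             (conv-*ˡ l (ι (f l)) (λ i j → γ s i * γ s j))) ⟩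
      ∑[ l < M ] (ι (f l) * C l) ∎

-- Products of Lambert series of opposite signs

index : ℕ → ℤ
index i = + suc i

module MixedConvolution {c ℓ} (R : CommutativeRing c ℓ) (algebra : ℤ-algebra R)
                        (L : LambertData R algebra) where
  open CommutativeRing R
  open SetoidReasoning setoid
  open Convolution R algebra L public
  open Antiderivative

  -- With a = q^m one has 1/α = 1/a + 1 and 1/β = 1/a - 1, hence 1/α - 1/β = 2.
  αβ-sameIndex : ∀ i → ι (+ 2) * (α i * β i) ≈ β i - α i
  αβ-sameIndex i = linear 3 (α i ∷ β i ∷ Q (suc i) ∷ [])
    (λ x y a →
      let 𝟙 = con ℤ.1ℤ in
      (con (+ 2) :* (x :* y) := y :- x) ,
      (𝟙 :+ y , (x := a :* (𝟙 :+ con ℤ.-1ℤ :* x))) ∷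
      (:- (𝟙 :- x) , (y := a :* (𝟙 :+ 𝟙 :* y))) ∷ [])
    (γ-unfold Sign.- i , γ-unfold Sign.+ i , lift tt) refl

  -- Its terms are 2 m q^m / (1 - q^(2m)), so that -W is the logarithmic derivative of Π (1 - q^k) /
  -- (1 + q^k). Its weights carry no sign, unlike those of u and g.
  W : Carrier
  W = moment Sign.- index + moment Sign.+ index

  private
    𝟙 : Carrier
    𝟙 = ι ℤ.1ℤ
    m : ℕ → Carrier
    m i = ι (index i)
    M₁ : Sign → Carrier
    M₁ s = moment s index
    below₀ below₁ above₁ above₂ : Sign → ℕ → Carrier
    below₀ s l = ∑ l (γ s)
    below₁ s l = ∑[ i < l ] (m i * γ s i)
    above₁ s l = ∑[ j < M ] (m j * γ s (suc (j ℕ.+ l)))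
    above₂ s l = ∑[ j < M ] (m (suc (j ℕ.+ l)) * γ s (suc (j ℕ.+ l)))

    m-suc : ∀ i → m i ≈ ι (+ i) + 𝟙
    m-suc i = trans (ι-cong (ℤ.+-comm ℤ.1ℤ (+ i))) (ι-+ (+ i) ℤ.1ℤ)

    m-+ : ∀ j l → m (suc (j ℕ.+ l)) ≈ m j + m l
    m-+ j l = trans (ι-cong (≡.cong +_ (≡.cong suc (≡.sym (ℕ.+-suc j l))))) (ι-+ (index j) (index l))

    ∑m : ∀ l → ι (+ 2) * ∑ l m ≈ ι (+ l) * (ι (+ l) + 𝟙)
    ∑m zero    = trans (zeroʳ _) (sym (trans (*-congʳ ι-0) (zeroˡ _)))
    ∑m (suc l) = begin
      ι (+ 2) * ∑ (suc l) m              ≈⟨ *-congˡ (∑-snoc l m) ⟩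
      ι (+ 2) * (∑ l m + m l)            ≈⟨ distribˡ _ _ _ ⟩
      ι (+ 2) * ∑ l m + ι (+ 2) * m l    ≈⟨ +-cong (∑m l) (*-congˡ (m-suc l)) ⟩
      ι (+ l) * (ι (+ l) + 𝟙) + ι (+ 2) * (ι (+ l) + 𝟙)
        ≈⟨ solve 1 (λ n → n :* (n :+ con ℤ.1ℤ) :+ con (+ 2) :* (n :+ con ℤ.1ℤ) :=
                          (n :+ con ℤ.1ℤ) :* ((n :+ con ℤ.1ℤ) :+ con ℤ.1ℤ)) refl (ι (+ l)) ⟩
      (ι (+ l) + 𝟙) * ((ι (+ l) + 𝟙) + 𝟙)
        ≈⟨ *-cong (m-suc l) (+-congʳ (m-suc l)) ⟨
      m l * (m l + 𝟙) ∎

    above₂-split : ∀ s l → above₂ s l ≈ above₁ s l + m l * tail s l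
    above₂-split s l = begin
      above₂ s l
        ≈⟨ ∑-cong M (λ j → trans (*-congʳ (m-+ j l)) (distribʳ _ _ _)) ⟩
      ∑[ j < M ] (m j * γ s (suc (j ℕ.+ l)) + m l * γ s (suc (j ℕ.+ l)))
        ≈⟨ ∑-+ M (λ j → m j * γ s (suc (j ℕ.+ l))) (λ j → m l * γ s (suc (j ℕ.+ l))) ⟩
      above₁ s l + ∑[ j < M ] (m l * γ s (suc (j ℕ.+ l)))
        ≈⟨ +-congˡ (∑-*ˡ M (m l) (λ j → γ s (suc (j ℕ.+ l)))) ⟩
      above₁ s l + m l * tail s l ∎

    M₁-split : ∀ s l → M₁ s ≈ (below₁ s l + m l * γ s l) + above₂ s l
    M₁-split s l = trans
      (∑-split M l (λ i → m i * γ s i)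
        (λ i M≤i → trans (*-congˡ (γ-vanish s i (ℕ.m≤n⇒m≤1+n M≤i))) (zeroʳ _)))
      (+-congˡ (∑-cong M λ j →
        reflexive (≡.cong (λ k → m (suc k) * γ s (suc k)) (ℕ.+-comm l j))))

    -- The weight belongs to the factor `β j`. On the term with `α i` it is rewritten as
    -- `m l - m i`, after which each of the sums depends on a single index.
    antidiagonal : ∀ l →
      conv l (λ i j → m j * (α i * β j)) ≈
      α l * ((∑ l m - (m l * below₀ Sign.- l - below₁ Sign.- l)) + below₁ Sign.+ l)
    antidiagonal l = begin
      conv l (λ i j → m j * (α i * β j))
        ≈⟨ conv-cong l (λ i j eq → linear 6
             (m j ∷ α i ∷ β j ∷ α l ∷ m i ∷ m l ∷ [])
             (λ n x y z k c →
               (n :* (x :* y) := z :* ((n :+ (k :* x :+ (:- c) :* x)) :+ n :* y)) ,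
               (n , (x :* y := z :* (con ℤ.1ℤ :+ con ℤ.-1ℤ :* x :+ con ℤ.1ℤ :* y))) ∷
               (:- (z :* x) , (n :+ k := c)) ∷ [])
             (trans (γγ-antidiagonal Sign.- Sign.+ i j)
                    (*-congʳ (reflexive (≡.cong α eq))) ,
              trans (+-comm _ _) (trans (sym (m-+ i j)) (reflexive (≡.cong m eq))) ,
              lift tt) refl) ⟩
      conv l (λ i j → α l * ((m j + (m i * α i + (- m l) * α i)) + m j * β j))
        ≈⟨ conv-*ˡ l (α l) (λ i j → (m j + (m i * α i + (- m l) * α i)) + m j * β j) ⟩
      α l * conv l (λ i j → (m j + (m i * α i + (- m l) * α i)) + m j * β j)
        ≈⟨ *-congˡ (trans (conv-+ l (λ i j → m j + (m i * α i + (- m l) * α i)) (λ i j → m j * β j))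
             (+-cong (conv-+ l (λ i j → m j) (λ i j → m i * α i + (- m l) * α i)) refl)) ⟩
      α l * ((conv l (λ i j → m j) + conv l (λ i j → m i * α i + (- m l) * α i))
             + conv l (λ i j → m j * β j))
        ≈⟨ *-congˡ (+-cong (+-cong (conv-snd l m) (conv-fst l (λ i → m i * α i + (- m l) * α i)))
                           (conv-snd l (λ j → m j * β j))) ⟩
      α l * ((∑ l m + ∑[ i < l ] (m i * α i + (- m l) * α i)) + below₁ Sign.+ l)
        ≈⟨ *-congˡ (+-congʳ (+-congˡ (trans (∑-+ l (λ i → m i * α i) (λ i → (- m l) * α i))
             (+-congˡ (∑-*ˡ l (- m l) α))))) ⟩
      α l * ((∑ l m + (below₁ Sign.- l + (- m l) * below₀ Sign.- l)) + below₁ Sign.+ l)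
        ≈⟨ solve 6 (λ z n a c b d → z :* ((n :+ (a :+ (:- c) :* b)) :+ d) :=
                                  z :* ((n :- (c :* b :- a)) :+ d)) refl
             (α l) (∑ l m) (below₁ Sign.- l) (m l) (below₀ Sign.- l) (below₁ Sign.+ l) ⟩
      α l * ((∑ l m - (m l * below₀ Sign.- l - below₁ Sign.- l)) + below₁ Sign.+ l) ∎

    diagonal↓ : ∀ l →
      ∑[ j < M ] (m j * (α (suc (j ℕ.+ l)) * β j)) ≈
      α l * (M₁ Sign.+ + above₁ Sign.- l) - above₁ Sign.- l
    diagonal↓ l = begin
      ∑[ j < M ] (m j * (α (suc (j ℕ.+ l)) * β j))
        ≈⟨ ∑-cong M (λ j → linear 4 (m j ∷ α (suc (j ℕ.+ l)) ∷ β j ∷ α l ∷ [])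
             (λ n x y z →
               (n :* (x :* y) := z :* (n :* y) :+ (z :- con ℤ.1ℤ) :* (n :* x)) ,
               (n , (x :* (con ℤ.1ℤ :+ con ℤ.1ℤ :* y) :=
                     z :* (y :- (con ℤ.-1ℤ :* con ℤ.1ℤ) :* x))) ∷ [])
             (γγ-diagonal Sign.- Sign.+ j l , lift tt) refl) ⟩
      ∑[ j < M ] (α l * (m j * β j) + (α l - 𝟙) * (m j * α (suc (j ℕ.+ l))))
        ≈⟨ ∑-+ M (λ j → α l * (m j * β j)) (λ j → (α l - 𝟙) * (m j * α (suc (j ℕ.+ l)))) ⟩
      ∑[ j < M ] (α l * (m j * β j)) + ∑[ j < M ] ((α l - 𝟙) * (m j * α (suc (j ℕ.+ l))))
        ≈⟨ +-cong (∑-*ˡ M (α l) (λ j → m j * β j))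
                  (∑-*ˡ M (α l - 𝟙) (λ j → m j * α (suc (j ℕ.+ l)))) ⟩
      α l * M₁ Sign.+ + (α l - 𝟙) * above₁ Sign.- l
        ≈⟨ solve 3 (λ z a b → z :* a :+ (z :- con ℤ.1ℤ) :* b := z :* (a :+ b) :- b) refl
             (α l) (M₁ Sign.+) (above₁ Sign.- l) ⟩
      α l * (M₁ Sign.+ + above₁ Sign.- l) - above₁ Sign.- l ∎

    -- The weight now sits on the larger index. On the term with `α j` it is split into `m j + m l`,
    -- which leaves the complete sums `M₁ Sign.-` and `∑ M α`.
    diagonal↑ : ∀ l →
      ∑[ j < M ] (m (suc (j ℕ.+ l)) * (α j * β (suc (j ℕ.+ l)))) ≈
      above₂ Sign.+ l - α l * ((M₁ Sign.- + m l * ∑ M α) + above₂ Sign.+ l)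
    diagonal↑ l = begin
      ∑[ j < M ] (m (suc (j ℕ.+ l)) * (α j * β (suc (j ℕ.+ l))))
        ≈⟨ ∑-cong M (λ j → linear 6
             (m (suc (j ℕ.+ l)) ∷ α j ∷ β (suc (j ℕ.+ l)) ∷ α l ∷ m j ∷ m l ∷ [])
             (λ n x y z k c →
               (n :* (x :* y) :=
                (con ℤ.1ℤ :- z) :* (n :* y) :+ ((:- z) :* (k :* x) :+ (:- (z :* c)) :* x)) ,
               (:- n , (y :* (con ℤ.1ℤ :+ con ℤ.-1ℤ :* x) :=
                        z :* (x :- (con ℤ.1ℤ :* con ℤ.-1ℤ) :* y))) ∷
               (:- (z :* x) , (n := k :+ c)) ∷ [])
             (γγ-diagonal Sign.+ Sign.- j l , m-+ j l , lift tt) refl) ⟩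
      ∑[ j < M ] ((𝟙 - α l) * (m (suc (j ℕ.+ l)) * β (suc (j ℕ.+ l)))
                  + ((- α l) * (m j * α j) + (- (α l * m l)) * α j))
        ≈⟨ trans (∑-+ M (λ j → (𝟙 - α l) * (m (suc (j ℕ.+ l)) * β (suc (j ℕ.+ l))))
                        (λ j → (- α l) * (m j * α j) + (- (α l * m l)) * α j))
                 (+-congˡ (∑-+ M (λ j → (- α l) * (m j * α j)) (λ j → (- (α l * m l)) * α j))) ⟩
      ∑[ j < M ] ((𝟙 - α l) * (m (suc (j ℕ.+ l)) * β (suc (j ℕ.+ l))))
      + (∑[ j < M ] ((- α l) * (m j * α j)) + ∑[ j < M ] ((- (α l * m l)) * α j))
        ≈⟨ +-cong (∑-*ˡ M (𝟙 - α l) (λ j → m (suc (j ℕ.+ l)) * β (suc (j ℕ.+ l))))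
             (+-cong (∑-*ˡ M (- α l) (λ j → m j * α j)) (∑-*ˡ M (- (α l * m l)) α)) ⟩
      (𝟙 - α l) * above₂ Sign.+ l + ((- α l) * M₁ Sign.- + (- (α l * m l)) * ∑ M α)
        ≈⟨ solve 5 (λ z b a c t → (con ℤ.1ℤ :- z) :* b :+ ((:- z) :* a :+ (:- (z :* c)) :* t) :=
                               b :- z :* ((a :+ c :* t) :+ b)) refl
             (α l) (above₂ Sign.+ l) (M₁ Sign.-) (m l) (∑ M α) ⟩
      above₂ Sign.+ l - α l * ((M₁ Sign.- + m l * ∑ M α) + above₂ Sign.+ l) ∎

    -- Cutting the complete sums at `l` makes everything below `l` cancel, and the products of `α l`
    -- with tails cancel too. Each half of `W` remains twice: once as a complete sum in the diagonal
    -- part and once assembled from the pieces below and above `l`. The other terms come from 2 (1 +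
    -- ... + l) = m (m - 1) with m = l + 1 and from 2 α β = β - α.
    coefficient : ∀ l →
      ι (+ 2) * (conv l (λ i j → m j * (α i * β j))
                 + (∑[ j < M ] (m j * (α (suc (j ℕ.+ l)) * β j))
                    - ∑[ j < M ] (m (suc (j ℕ.+ l)) * (α j * β (suc (j ℕ.+ l)))))) ≈
      (((ι (+ 4) * W) * α l + (m l * m l) * α l) - m l * β l)
      - ι (+ 2) * (above₁ Sign.- l + above₂ Sign.+ l)
    coefficient l = begin
      _ ≈⟨ *-congˡ (+-cong (antidiagonal l) (+-cong (diagonal↓ l) (-‿cong (diagonal↑ l)))) ⟩
      ι (+ 2) * (α l * ((∑ l m - (m l * below₀ Sign.- l - below₁ Sign.- l)) + below₁ Sign.+ l)
        + ((α l * (M₁ Sign.+ + above₁ Sign.- l) - above₁ Sign.- l)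
           - (above₂ Sign.+ l - α l * ((M₁ Sign.- + m l * ∑ M α) + above₂ Sign.+ l))))
        ≈⟨ linear 15
             (α l ∷ β l ∷ m l ∷ ι (+ l) ∷ ∑ l m ∷ ∑ M α ∷ M₁ Sign.- ∷ M₁ Sign.+ ∷
              below₀ Sign.- l ∷ below₁ Sign.- l ∷ below₁ Sign.+ l ∷ tail Sign.- l ∷
              above₁ Sign.- l ∷ above₂ Sign.- l ∷ above₂ Sign.+ l ∷ [])
             (λ a b c n N A₀ A₁ B₁ b₀ b₁ d₁ t₀ t₁ t₂ u₂ →
               (con (+ 2) :* (a :* ((N :- (c :* b₀ :- b₁)) :+ d₁)
                  :+ ((a :* (B₁ :+ t₁) :- t₁) :- (u₂ :- a :* ((A₁ :+ c :* A₀) :+ u₂)))) :=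
                (((con (+ 4) :* (A₁ :+ B₁)) :* a :+ (c :* c) :* a) :- c :* b)
                  :- con (+ 2) :* (t₁ :+ u₂)) ,
               (a , (con (+ 2) :* N := n :* (n :+ con ℤ.1ℤ))) ∷
               (:- (a :* (n :+ c)) , (c := n :+ con ℤ.1ℤ)) ∷
               (con (+ 2) :* a :* c , (A₀ := (b₀ :+ a) :+ t₀)) ∷
               (:- (con (+ 2) :* a) , (A₁ := (b₁ :+ c :* a) :+ t₂)) ∷
               (:- (con (+ 2) :* a) , (t₂ := t₁ :+ c :* t₀)) ∷
               (:- (con (+ 2) :* a) , (B₁ := (d₁ :+ c :* b) :+ u₂)) ∷
               (:- c , (con (+ 2) :* (a :* b) := b :- a)) ∷ [])
             (∑m l , m-suc l , ∑-γ-split Sign.- l , M₁-split Sign.- l , above₂-split Sign.- l ,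
              M₁-split Sign.+ l , αβ-sameIndex l , lift tt) refl ⟩
      _ ∎

    ∑-above : ∀ s (h : ℕ → ℕ → ℤ) →
      ∑[ l < M ] (∑[ j < M ] (ι (h (suc (j ℕ.+ l)) l) * γ s (suc (j ℕ.+ l)))) ≈
      ∑[ i < M ] (∑[ l < i ] ι (h i l) * γ s i)
    ∑-above s h = begin
      ∑[ l < M ] (∑[ j < M ] (ι (h (suc (j ℕ.+ l)) l) * γ s (suc (j ℕ.+ l))))
        ≈⟨ ∑-cong M (λ l → ∑-cong M λ j →
             reflexive (≡.cong (λ k → ι (h (suc k) l) * γ s (suc k)) (ℕ.+-comm j l))) ⟩
      ∑[ l < M ] (∑[ j < M ] (ι (h (suc (l ℕ.+ j)) l) * γ s (suc (l ℕ.+ j))))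
        ≈⟨ ∑-triangle M M (λ i l → ι (h i l) * γ s i) ℕ.≤-refl
             (λ i l M≤i → trans (*-congˡ (γ-vanish s i (ℕ.m≤n⇒m≤1+n M≤i))) (zeroʳ _)) ⟨
      ∑[ i < M ] (∑[ l < i ] (ι (h i l) * γ s i))
        ≈⟨ ∑-cong M (λ i → ∑-*ʳ i (λ l → ι (h i l)) (γ s i)) ⟩
      ∑[ i < M ] (∑[ l < i ] ι (h i l) * γ s i) ∎

    ∑-above₂ : ∀ s {f F} → Antiderivative f F →
      ∑[ l < M ] (ι (f l) * above₂ s l) ≈ moment s (λ i → index i ℤ.* F i)
    ∑-above₂ s {f} {F} F′ = begin
      ∑[ l < M ] (ι (f l) * above₂ s l)
        ≈⟨ ∑-cong M (λ l → trans (sym (∑-*ˡ M (ι (f l)) _)) (∑-cong M λ j →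
             trans (sym (*-assoc _ _ _)) (*-congʳ (trans (*-comm _ _) (sym (ι-* _ (f l))))))) ⟩
      _ ≈⟨ ∑-above s (λ i l → index i ℤ.* f l) ⟩
      ∑[ i < M ] (∑[ l < i ] ι (index i ℤ.* f l) * γ s i)
        ≈⟨ ∑-cong M (λ i → *-congʳ (trans
             (trans (∑-cong i λ l → ι-* (index i) (f l)) (∑-*ˡ i (m i) (λ l → ι (f l))))
             (trans (*-congˡ (∑-ι F′ i)) (sym (ι-* (index i) (F i)))))) ⟩
      moment s (λ i → index i ℤ.* F i) ∎

    -- Cauchy's formula for repeated summation: the double sum `G n` counts `f l` exactly n - l
    -- times.
    ∑-ι-second : ∀ {f F G} → Antiderivative f F → Antiderivative (λ i → F (suc i)) G →
      ∀ n → ∑[ l < n ] ι ((+ n ℤ.- + l) ℤ.* f l) ≈ ι (G n)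
    ∑-ι-second F′ G′ zero = sym (trans (ι-cong (at-0 G′)) ι-0)
    ∑-ι-second {f} {F} {G} F′ G′ (suc n) = begin
      ∑[ l < suc n ] ι ((+ suc n ℤ.- + l) ℤ.* f l)
        ≈⟨ ∑-cong (suc n) (λ l → trans (ι-cong (shift (+ n) (+ l) (f l)))
             (ι-+ ((+ n ℤ.- + l) ℤ.* f l) (f l))) ⟩
      ∑[ l < suc n ] (ι ((+ n ℤ.- + l) ℤ.* f l) + ι (f l))
        ≈⟨ ∑-+ (suc n) (λ l → ι ((+ n ℤ.- + l) ℤ.* f l)) (λ l → ι (f l)) ⟩
      ∑[ l < suc n ] ι ((+ n ℤ.- + l) ℤ.* f l) + ∑[ l < suc n ] ι (f l)
        ≈⟨ +-cong (trans (∑-snoc n (λ l → ι ((+ n ℤ.- + l) ℤ.* f l)))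
                         (+-cong (∑-ι-second F′ G′ n)
                                 (trans (ι-cong (cancel (+ n) (f n))) ι-0)))
                  (∑-ι F′ (suc n)) ⟩
      (ι (G n) + 0#) + ι (F (suc n))
        ≈⟨ +-congʳ (+-identityʳ _) ⟩
      ι (G n) + ι (F (suc n))
        ≈⟨ ι-+ (G n) (F (suc n)) ⟨
      ι (G n ℤ.+ F (suc n))
        ≈⟨ ι-cong (at-suc G′ n) ⟨
      ι (G (suc n)) ∎
      where
      open ℤSolver.+-*-Solver using () renaming
        (solve to ℤ-solve; _:+_ to _⊞_; _:-_ to _⊟_; _:*_ to _⊠_; con to ⟪_⟫; _:=_ to _≐_)
      shift : ∀ n l x → (ℤ.1ℤ ℤ.+ n ℤ.- l) ℤ.* x ≡ (n ℤ.- l) ℤ.* x ℤ.+ x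
      shift = ℤ-solve 3 (λ n l x → ((⟪ ℤ.1ℤ ⟫ ⊞ n) ⊟ l) ⊠ x ≐ (n ⊟ l) ⊠ x ⊞ x) ≡.refl
      cancel : ∀ n x → (n ℤ.- n) ℤ.* x ≡ ℤ.0ℤ
      cancel = ℤ-solve 2 (λ n x → (n ⊟ n) ⊠ x ≐ ⟪ ℤ.0ℤ ⟫) ≡.refl

    ∑-above₁ : ∀ s {f F G} → Antiderivative f F → Antiderivative (λ i → F (suc i)) G →
      ∑[ l < M ] (ι (f l) * above₁ s l) ≈ moment s G
    ∑-above₁ s {f} {F} {G} F′ G′ = begin
      ∑[ l < M ] (ι (f l) * above₁ s l)
        ≈⟨ ∑-cong M (λ l → trans (sym (∑-*ˡ M (ι (f l)) _)) (∑-cong M λ j →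
             trans (sym (*-assoc _ _ _)) (*-congʳ (trans (*-comm _ _)
               (trans (sym (ι-* (index j) (f l)))
                      (ι-cong (≡.cong (ℤ._* f l) (difference j l)))))))) ⟩
      _ ≈⟨ ∑-above s (λ i l → (+ i ℤ.- + l) ℤ.* f l) ⟩
      ∑[ i < M ] (∑[ l < i ] ι ((+ i ℤ.- + l) ℤ.* f l) * γ s i)
        ≈⟨ ∑-cong M (λ i → *-congʳ (∑-ι-second F′ G′ i)) ⟩
      moment s G ∎
      where
      difference : ∀ j l → index j ≡ + suc (j ℕ.+ l) ℤ.- + l
      difference j l = ≡.sym (≡.trans (ℤ.+-assoc (index j) (+ l) (ℤ.- + l))
        (≡.trans (≡.cong (λ z → index j ℤ.+ z) (ℤ.+-inverseʳ (+ l))) (ℤ.+-identityʳ (index j))))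

  -- As in 2 n sin mu cos nu: the weights are n times a function of the sum and
  -- n times an odd function of the difference of the indices.
  mixed-convolution : ∀ {w⁺ w⁻ : ℕ → ℕ → ℤ} {f F G : ℕ → ℤ} →
    (∀ i j → w⁺ i j ≡ index j ℤ.* f (suc (i ℕ.+ j))) → (∀ i → w⁻ i i ≡ ℤ.0ℤ) →
    (∀ j l → w⁻ (suc (j ℕ.+ l)) j ≡ index j ℤ.* f l) →
    (∀ j l → w⁻ j (suc (j ℕ.+ l)) ≡ ℤ.- (index (suc (j ℕ.+ l)) ℤ.* f l)) →
    Antiderivative f F → Antiderivative (λ i → F (suc i)) G →
    ι (+ 2) * (bilinear Sign.- Sign.+ w⁺ + bilinear Sign.- Sign.+ w⁻) ≈
    (((ι (+ 4) * W) * moment Sign.- f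
      + moment Sign.- (λ i → index i ℤ.* index i ℤ.* f i))
      - moment Sign.+ (λ i → index i ℤ.* f i))
    - ι (+ 2) * (moment Sign.- G + moment Sign.+ (λ i → index i ℤ.* F i))
  mixed-convolution {w⁺} {w⁻} {f} {F} {G} w⁺≡ w≡0 w↓ w↑ F′ G′ = begin
    ι (+ 2) * (bilinear Sign.- Sign.+ w⁺ + bilinear Sign.- Sign.+ w⁻)
      ≈⟨ *-congˡ (+-cong anti diag) ⟩
    ι (+ 2) * (∑[ l < M ] (ι (f l) * C l) + ∑[ l < M ] (ι (f l) * (B l - B′ l)))
      ≈⟨ *-congˡ (sym (∑-+ M (λ l → ι (f l) * C l) (λ l → ι (f l) * (B l - B′ l)))) ⟩
    ι (+ 2) * ∑[ l < M ] (ι (f l) * C l + ι (f l) * (B l - B′ l))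
      ≈⟨ ∑-*ˡ M (ι (+ 2)) _ ⟨
    ∑[ l < M ] (ι (+ 2) * (ι (f l) * C l + ι (f l) * (B l - B′ l)))
      ≈⟨ ∑-cong M (λ l → linear 9
           (ι (f l) ∷ C l ∷ B l ∷ B′ l ∷ W ∷ α l ∷ m l ∷ β l ∷ (above₁ Sign.- l + above₂ Sign.+ l) ∷ [])
           (λ f C B B′ W a m b t →
             (con (+ 2) :* (f :* C :+ f :* (B :- B′)) :=
              (((con (+ 4) :* W) :* (f :* a) :+ ((m :* m) :* f) :* a) :+ (:- con ℤ.1ℤ) :* ((m :* f) :* b))
                :+ (:- con (+ 2)) :* (f :* t)) ,
             (f , (con (+ 2) :* (C :+ (B :- B′)) :=
                   (((con (+ 4) :* W) :* a :+ (m :* m) :* a) :- m :* b) :- con (+ 2) :* t)) ∷ [])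
           (coefficient l , lift tt) refl) ⟩
    ∑[ l < M ] ((((ι (+ 4) * W) * (ι (f l) * α l) + ((m l * m l) * ι (f l)) * α l)
                  + (- 𝟙) * ((m l * ι (f l)) * β l))
                + (- ι (+ 2)) * (ι (f l) * (above₁ Sign.- l + above₂ Sign.+ l)))
      ≈⟨ trans (∑-+ M _ _) (+-cong (trans (∑-+ M _ _) (+-cong (trans (∑-+ M _ _)
           (+-cong (∑-*ˡ M (ι (+ 4) * W) (λ l → ι (f l) * α l))
                   (∑-cong M λ l → *-congʳ (trans (*-congʳ (sym (ι-* (index l) (index l))))
                                           (sym (ι-* (index l ℤ.* index l) (f l)))))))
           (trans (∑-*ˡ M (- 𝟙) (λ l → (m l * ι (f l)) * β l))
                  (*-congˡ (∑-cong M λ l → *-congʳ (sym (ι-* (index l) (f l))))))))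
           (trans (∑-*ˡ M (- ι (+ 2)) (λ l → ι (f l) * (above₁ Sign.- l + above₂ Sign.+ l)))
             (*-congˡ (trans (∑-cong M λ l → distribˡ _ _ _)
               (trans (∑-+ M (λ l → ι (f l) * above₁ Sign.- l) (λ l → ι (f l) * above₂ Sign.+ l))
                 (+-cong (∑-above₁ Sign.- F′ G′) (∑-above₂ Sign.+ F′))))))) ⟩
    _ ≈⟨ solve 4 (λ x a b t → ((x :+ a) :+ (:- con ℤ.1ℤ) :* b) :+ (:- con (+ 2)) :* t :=
                              ((x :+ a) :- b) :- con (+ 2) :* t) refl
           ((ι (+ 4) * W) * moment Sign.- f) (moment Sign.- (λ i → index i ℤ.* index i ℤ.* f i))
           (moment Sign.+ (λ i → index i ℤ.* f i))
           (moment Sign.- G + moment Sign.+ (λ i → index i ℤ.* F i)) ⟩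
    _ ∎
    where
    C B B′ : ℕ → Carrier
    C l = conv l (λ i j → m j * (α i * β j))
    B l = ∑[ j < M ] (m j * (α (suc (j ℕ.+ l)) * β j))
    B′ l = ∑[ j < M ] (m (suc (j ℕ.+ l)) * (α j * β (suc (j ℕ.+ l))))
    anti : bilinear Sign.- Sign.+ w⁺ ≈ ∑[ l < M ] (ι (f l) * C l)
    anti = trans (bilinear-antidiagonal Sign.- Sign.+ w⁺) (∑-cong M λ l → trans
      (conv-cong l λ i j eq → trans
        (*-congʳ (trans (ι-cong (≡.trans (w⁺≡ i j) (≡.cong (λ k → index j ℤ.* f k) eq)))
                        (trans (ι-* (index j) (f l)) (*-comm _ _))))
        (*-assoc _ _ _))
      (conv-*ˡ l (ι (f l)) (λ i j → m j * (α i * β j))))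
    diag : bilinear Sign.- Sign.+ w⁻ ≈ ∑[ l < M ] (ι (f l) * (B l - B′ l))
    diag = trans (bilinear-diagonal Sign.- Sign.+ w⁻ w≡0) (∑-cong M λ l → begin
      _ ≈⟨ ∑-cong M (λ j → trans
             (+-cong (*-congʳ (trans (ι-cong (w↓ j l)) (ι-* (index j) (f l))))
                     (*-congʳ (trans (ι-cong (w↑ j l)) (trans (ι-neg _)
                        (-‿cong (ι-* (index (suc (j ℕ.+ l))) (f l)))))))
             (solve 5 (λ n k f x y → (n :* f) :* x :+ (:- (k :* f)) :* y :=
                                     f :* (n :* x) :+ (:- f) :* (k :* y)) refl
                (m j) (m (suc (j ℕ.+ l))) (ι (f l))
                (α (suc (j ℕ.+ l)) * β j) (α j * β (suc (j ℕ.+ l))))) ⟩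
      _ ≈⟨ ∑-+ M (λ j → ι (f l) * (m j * (α (suc (j ℕ.+ l)) * β j)))
                 (λ j → (- ι (f l)) * (m (suc (j ℕ.+ l)) * (α j * β (suc (j ℕ.+ l))))) ⟩
      _ ≈⟨ +-cong (∑-*ˡ M (ι (f l)) _) (∑-*ˡ M (- ι (f l)) _) ⟩
      ι (f l) * B l + (- ι (f l)) * B′ l
        ≈⟨ solve 3 (λ f b b′ → f :* b :+ (:- f) :* b′ := f :* (b :- b′)) refl (ι (f l)) (B l) (B′ l) ⟩
      ι (f l) * (B l - B′ l) ∎)

-- Alternating power weights and their iterated sums

power : ℕ → ℕ → ℤ
power p i = sign (suc i) ℤ.* index i ℤ.^ p

partialSum : (ℕ → ℤ) → ℕ → ℤ
partialSum f zero    = ℤ.0ℤ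
partialSum f (suc n) = partialSum f n ℤ.+ f n

partialSum-antiderivative : ∀ f → Antiderivative f (partialSum f)
partialSum-antiderivative f = record { at-0 = ≡.refl ; at-suc = λ _ → ≡.refl }

module Weights where
  open ≡.≡-Reasoning
  open ℤSolver.+-*-Solver

  sign² : ∀ n → sign n ℤ.* sign n ≡ ℤ.1ℤ
  sign² zero    = ≡.refl
  sign² (suc n) = ≡.trans
    (solve 1 (λ s → (con ℤ.-1ℤ :* s) :* (con ℤ.-1ℤ :* s) := s :* s) ≡.refl (sign n)) (sign² n)

  sign-+ : ∀ m n → sign (m ℕ.+ n) ≡ sign m ℤ.* sign n
  sign-+ = ℤ.^-distribˡ-+-* ℤ.-1ℤ

  -- Since (-1)^(m+n) = (-1)^(m-n), this factor is a function of the sum and also of the difference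
  -- of the indices, as both kinds of weights require.
  signs : ℕ → ℕ → ℤ
  signs i j = sign (suc i) ℤ.* sign (suc j)

  w⁺ w⁻ : ℕ → ℕ → ℕ → ℤ
  w⁺ p i j = signs i j ℤ.* (index i ℤ.+ index j) ℤ.^ p
  w⁻ p i j = signs i j ℤ.* (index i ℤ.- index j) ℤ.^ p

  w⁺≡power : ∀ p i j → w⁺ p i j ≡ power p (suc (i ℕ.+ j))
  w⁺≡power p i j = ≡.trans (≡.cong (ℤ._* (index i ℤ.+ index j) ℤ.^ p) (≡.sym (sign-+ (suc i) (suc j))))
    (≡.cong (λ k → sign (suc k) ℤ.* (+ suc k) ℤ.^ p) (ℕ.+-suc i j))

  private
    index-+ : ∀ j l → index (suc (j ℕ.+ l)) ≡ index j ℤ.+ index l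
    index-+ j l = ≡.cong (λ k → + suc k) (≡.sym (ℕ.+-suc j l))

    signs-suc : ∀ j l → signs (suc (j ℕ.+ l)) j ≡ sign (suc l)
    signs-suc j l = begin
      sign (suc (suc j ℕ.+ l)) ℤ.* sign (suc j)
        ≡⟨ ≡.cong (λ k → sign k ℤ.* sign (suc j)) (≡.sym (ℕ.+-suc (suc j) l)) ⟩
      sign (suc j ℕ.+ suc l) ℤ.* sign (suc j)
        ≡⟨ ≡.cong (ℤ._* sign (suc j)) (sign-+ (suc j) (suc l)) ⟩
      sign (suc j) ℤ.* sign (suc l) ℤ.* sign (suc j)
        ≡⟨ solve 2 (λ a b → a :* b :* a := a :* a :* b) ≡.refl (sign (suc j)) (sign (suc l)) ⟩
      sign (suc j) ℤ.* sign (suc j) ℤ.* sign (suc l)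
        ≡⟨ ≡.cong (ℤ._* sign (suc l)) (sign² (suc j)) ⟩
      ℤ.1ℤ ℤ.* sign (suc l)
        ≡⟨ ℤ.*-identityˡ _ ⟩
      sign (suc l) ∎

  w⁻≡power : ∀ p j l → w⁻ p (suc (j ℕ.+ l)) j ≡ power p l
  w⁻≡power p j l = ≡.cong₂ (λ s x → s ℤ.* x ℤ.^ p) (signs-suc j l) (≡.trans
    (≡.cong (ℤ._- index j) (index-+ j l))
    (solve 2 (λ a b → (a :+ b) :- a := b) ≡.refl (index j) (index l)))

  w⁻-swap : ∀ p j l → w⁻ p j (suc (j ℕ.+ l)) ≡ sign (suc l) ℤ.* (ℤ.- index l) ℤ.^ p
  w⁻-swap p j l = ≡.cong₂ (λ s x → s ℤ.* x ℤ.^ p)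
    (≡.trans (ℤ.*-comm (sign (suc j)) _) (signs-suc j l))
    (≡.trans (≡.cong (λ k → index j ℤ.- k) (index-+ j l))
             (solve 2 (λ a b → a :- (a :+ b) := :- b) ≡.refl (index j) (index l)))

  w⁻-diagonal : ∀ p i → w⁻ (suc p) i i ≡ ℤ.0ℤ
  w⁻-diagonal p i = begin
    signs i i ℤ.* (index i ℤ.- index i) ℤ.^ suc p
      ≡⟨ ≡.cong (λ x → signs i i ℤ.* x ℤ.^ suc p) (ℤ.+-inverseʳ (index i)) ⟩
    signs i i ℤ.* (ℤ.0ℤ ℤ.* ℤ.0ℤ ℤ.^ p)
      ≡⟨ ℤ.*-zeroʳ (signs i i) ⟩
    ℤ.0ℤ ∎

  even₂ : ∀ x → (ℤ.- x) ℤ.^ 2 ≡ x ℤ.^ 2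
  even₂ = solve 1 (λ x → (:- x) :^ 2 := x :^ 2) ≡.refl
  even₄ : ∀ x → (ℤ.- x) ℤ.^ 4 ≡ x ℤ.^ 4
  even₄ = solve 1 (λ x → (:- x) :^ 4 := x :^ 4) ≡.refl
  even₆ : ∀ x → (ℤ.- x) ℤ.^ 6 ≡ x ℤ.^ 6
  even₆ = solve 1 (λ x → (:- x) :^ 6 := x :^ 6) ≡.refl

  -- The alternating sums f (i) + 2 Σ_{l < i} f (l) with f (l) = (-1)^m m^p,
  -- m = l + 1, and their iterates, in closed form.
  private
    S : ℕ → ℕ → ℤ
    S p = partialSum (power p)

    second : ℕ → ℕ → ℤ
    second p = partialSum (λ i → S p (suc i))

    -- The left side is the sum of two neighbouring partial sums, so it changes by
    -- `power p i + power p (suc i)`. A closed form in s = (-1)^m and m is therefore checked by its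
    -- first value and one polynomial identity.
    step : ∀ p (closed : ℤ → ℤ → ℤ) →
      power p 0 ℤ.+ ℤ.0ℤ ≡ closed ℤ.-1ℤ ℤ.1ℤ →
      (∀ s m → (s ℤ.* m ℤ.^ p ℤ.+ closed s m) ℤ.+ (ℤ.-1ℤ ℤ.* s) ℤ.* (ℤ.1ℤ ℤ.+ m) ℤ.^ p ≡
               closed (ℤ.-1ℤ ℤ.* s) (ℤ.1ℤ ℤ.+ m)) →
      ∀ i → power p i ℤ.+ + 2 ℤ.* S p i ≡ closed (sign (suc i)) (index i)
    step p closed base st zero    = base
    step p closed base st (suc i) = begin
      power p (suc i) ℤ.+ + 2 ℤ.* (S p i ℤ.+ power p i)
        ≡⟨ solve 3 (λ f S g → g :+ con (+ 2) :* (S :+ f) := (f :+ (f :+ con (+ 2) :* S)) :+ g)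
             ≡.refl (power p i) (S p i) (power p (suc i)) ⟩
      (power p i ℤ.+ (power p i ℤ.+ + 2 ℤ.* S p i)) ℤ.+ power p (suc i)
        ≡⟨ ≡.cong (λ x → (power p i ℤ.+ x) ℤ.+ power p (suc i)) (step p closed base st i) ⟩
      (power p i ℤ.+ closed (sign (suc i)) (index i)) ℤ.+ power p (suc i)
        ≡⟨ st (sign (suc i)) (index i) ⟩
      closed (sign (suc (suc i))) (index (suc i)) ∎

  alternating₂ : ∀ i → power 2 i ℤ.+ + 2 ℤ.* S 2 i ≡ power 1 i
  alternating₂ = step 2 (λ s m → s ℤ.* m ℤ.^ 1) ≡.refl
    (solve 2 (λ s m → (s :* m :^ 2 :+ s :* m :^ 1) :+ (con ℤ.-1ℤ :* s) :* (con ℤ.1ℤ :+ m) :^ 2 :=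
                      (con ℤ.-1ℤ :* s) :* (con ℤ.1ℤ :+ m) :^ 1) ≡.refl)

  alternating₄ : ∀ i → power 4 i ℤ.+ + 2 ℤ.* S 4 i ≡ + 2 ℤ.* power 3 i ℤ.- power 1 i
  alternating₄ = step 4 (λ s m → + 2 ℤ.* (s ℤ.* m ℤ.^ 3) ℤ.- s ℤ.* m ℤ.^ 1) ≡.refl
    (solve 2 (λ s m →
      let c = λ s m → con (+ 2) :* (s :* m :^ 3) :- s :* m :^ 1 in
      (s :* m :^ 4 :+ c s m) :+ (con ℤ.-1ℤ :* s) :* (con ℤ.1ℤ :+ m) :^ 4 :=
      c (con ℤ.-1ℤ :* s) (con ℤ.1ℤ :+ m)) ≡.refl)

  alternating₆ : ∀ i → power 6 i ℤ.+ + 2 ℤ.* S 6 i ≡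
                       (+ 3 ℤ.* power 5 i ℤ.- + 5 ℤ.* power 3 i) ℤ.+ + 3 ℤ.* power 1 i
  alternating₆ = step 6
    (λ s m → (+ 3 ℤ.* (s ℤ.* m ℤ.^ 5) ℤ.- + 5 ℤ.* (s ℤ.* m ℤ.^ 3)) ℤ.+ + 3 ℤ.* (s ℤ.* m ℤ.^ 1)) ≡.refl
    (solve 2 (λ s m →
      let c = λ s m → (con (+ 3) :* (s :* m :^ 5) :- con (+ 5) :* (s :* m :^ 3))
                      :+ con (+ 3) :* (s :* m :^ 1) in
      (s :* m :^ 6 :+ c s m) :+ (con ℤ.-1ℤ :* s) :* (con ℤ.1ℤ :+ m) :^ 6 :=
      c (con ℤ.-1ℤ :* s) (con ℤ.1ℤ :+ m)) ≡.refl)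

  -- For odd exponents the closed form contains a constant next to the alternating part. Multiplied
  -- by the index, this constant later yields the half of `W` that belongs to β. The factor 2 keeps
  -- the coefficients integral.
  alternating₁ : ∀ i → + 2 ℤ.* (power 1 i ℤ.+ + 2 ℤ.* S 1 i) ≡ sign (suc i) ℤ.- ℤ.1ℤ
  alternating₁ zero    = ≡.refl
  alternating₁ (suc i) = begin
    + 2 ℤ.* (power 1 (suc i) ℤ.+ + 2 ℤ.* (S 1 i ℤ.+ power 1 i))
      ≡⟨ solve 3 (λ S s m →
           let f = s :* m :^ 1 ; f′ = (con ℤ.-1ℤ :* s) :* (con ℤ.1ℤ :+ m) :^ 1 in
           con (+ 2) :* (f′ :+ con (+ 2) :* (S :+ f)) :=
           con (+ 2) :* (f :+ con (+ 2) :* S) :- con (+ 2) :* s) ≡.refl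
           (S 1 i) (sign (suc i)) (index i) ⟩
    + 2 ℤ.* (power 1 i ℤ.+ + 2 ℤ.* S 1 i) ℤ.- + 2 ℤ.* sign (suc i)
      ≡⟨ ≡.cong (λ x → x ℤ.- + 2 ℤ.* sign (suc i)) (alternating₁ i) ⟩
    (sign (suc i) ℤ.- ℤ.1ℤ) ℤ.- + 2 ℤ.* sign (suc i)
      ≡⟨ solve 1 (λ s → (s :- con ℤ.1ℤ) :- con (+ 2) :* s := con ℤ.-1ℤ :* s :- con ℤ.1ℤ)
           ≡.refl (sign (suc i)) ⟩
    sign (suc (suc i)) ℤ.- ℤ.1ℤ ∎

  alternating₃ : ∀ i → + 4 ℤ.* (power 3 i ℤ.+ + 2 ℤ.* S 3 i) ≡
                       (+ 6 ℤ.* power 2 i ℤ.+ ℤ.1ℤ) ℤ.- sign (suc i)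
  alternating₃ zero    = ≡.refl
  alternating₃ (suc i) = begin
    + 4 ℤ.* (power 3 (suc i) ℤ.+ + 2 ℤ.* (S 3 i ℤ.+ power 3 i))
      ≡⟨ solve 3 (λ S f g → con (+ 4) :* (g :+ con (+ 2) :* (S :+ f)) :=
           con (+ 4) :* (f :+ con (+ 2) :* S) :+ con (+ 4) :* (f :+ g)) ≡.refl
           (S 3 i) (power 3 i) (power 3 (suc i)) ⟩
    + 4 ℤ.* (power 3 i ℤ.+ + 2 ℤ.* S 3 i) ℤ.+ + 4 ℤ.* (power 3 i ℤ.+ power 3 (suc i))
      ≡⟨ ≡.cong (ℤ._+ + 4 ℤ.* (power 3 i ℤ.+ power 3 (suc i))) (alternating₃ i) ⟩
    ((+ 6 ℤ.* power 2 i ℤ.+ ℤ.1ℤ) ℤ.- sign (suc i)) ℤ.+ + 4 ℤ.* (power 3 i ℤ.+ power 3 (suc i))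
      ≡⟨ solve 2 (λ s m →
           let s′ = con ℤ.-1ℤ :* s ; m′ = con ℤ.1ℤ :+ m in
           ((con (+ 6) :* (s :* m :^ 2) :+ con ℤ.1ℤ) :- s)
             :+ con (+ 4) :* (s :* m :^ 3 :+ s′ :* m′ :^ 3) :=
           (con (+ 6) :* (s′ :* m′ :^ 2) :+ con ℤ.1ℤ) :- s′) ≡.refl (sign (suc i)) (index i) ⟩
    (+ 6 ℤ.* power 2 (suc i) ℤ.+ ℤ.1ℤ) ℤ.- sign (suc (suc i)) ∎

  -- Summing once more accumulates the constant of `alternating₁` into a term linear in the index
  -- and free of signs, the source of the half of `W` that belongs to α.
  iterated₁ : ∀ i → + 4 ℤ.* second 1 i ≡ ℤ.- (index i ℤ.+ power 1 i)
  iterated₁ zero    = ≡.refl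
  iterated₁ (suc i) = begin
    + 4 ℤ.* (second 1 i ℤ.+ (S 1 i ℤ.+ power 1 i))
      ≡⟨ solve 3 (λ H S f → con (+ 4) :* (H :+ (S :+ f)) :=
           con (+ 4) :* H :+ (con (+ 2) :* (f :+ con (+ 2) :* S) :+ con (+ 2) :* f)) ≡.refl
           (second 1 i) (S 1 i) (power 1 i) ⟩
    + 4 ℤ.* second 1 i ℤ.+ (+ 2 ℤ.* (power 1 i ℤ.+ + 2 ℤ.* S 1 i) ℤ.+ + 2 ℤ.* power 1 i)
      ≡⟨ ≡.cong₂ (λ x y → x ℤ.+ (y ℤ.+ + 2 ℤ.* power 1 i)) (iterated₁ i) (alternating₁ i) ⟩
    ℤ.- (index i ℤ.+ power 1 i) ℤ.+ ((sign (suc i) ℤ.- ℤ.1ℤ) ℤ.+ + 2 ℤ.* power 1 i)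
      ≡⟨ solve 2 (λ s m →
           let s′ = con ℤ.-1ℤ :* s ; m′ = con ℤ.1ℤ :+ m in
           :- (m :+ s :* m :^ 1) :+ ((s :- con ℤ.1ℤ) :+ con (+ 2) :* (s :* m :^ 1)) :=
           :- (m′ :+ s′ :* m′ :^ 1)) ≡.refl (sign (suc i)) (index i) ⟩
    ℤ.- (index (suc i) ℤ.+ power 1 (suc i)) ∎

  iterated₃ : ∀ i → + 8 ℤ.* second 3 i ≡
                    (index i ℤ.+ + 3 ℤ.* power 1 i) ℤ.- + 2 ℤ.* power 3 i
  iterated₃ zero    = ≡.refl
  iterated₃ (suc i) = begin
    + 8 ℤ.* (second 3 i ℤ.+ (S 3 i ℤ.+ power 3 i))
      ≡⟨ solve 3 (λ H S f → con (+ 8) :* (H :+ (S :+ f)) :=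
           con (+ 8) :* H :+ (con (+ 4) :* (f :+ con (+ 2) :* S) :+ con (+ 4) :* f)) ≡.refl
           (second 3 i) (S 3 i) (power 3 i) ⟩
    + 8 ℤ.* second 3 i ℤ.+ (+ 4 ℤ.* (power 3 i ℤ.+ + 2 ℤ.* S 3 i) ℤ.+ + 4 ℤ.* power 3 i)
      ≡⟨ ≡.cong₂ (λ x y → x ℤ.+ (y ℤ.+ + 4 ℤ.* power 3 i)) (iterated₃ i) (alternating₃ i) ⟩
    ((index i ℤ.+ + 3 ℤ.* power 1 i) ℤ.- + 2 ℤ.* power 3 i)
      ℤ.+ (((+ 6 ℤ.* power 2 i ℤ.+ ℤ.1ℤ) ℤ.- sign (suc i)) ℤ.+ + 4 ℤ.* power 3 i)
      ≡⟨ solve 2 (λ s m →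
           let s′ = con ℤ.-1ℤ :* s ; m′ = con ℤ.1ℤ :+ m in
           ((m :+ con (+ 3) :* (s :* m :^ 1)) :- con (+ 2) :* (s :* m :^ 3))
             :+ (((con (+ 6) :* (s :* m :^ 2) :+ con ℤ.1ℤ) :- s) :+ con (+ 4) :* (s :* m :^ 3)) :=
           (m′ :+ con (+ 3) :* (s′ :* m′ :^ 1)) :- con (+ 2) :* (s′ :* m′ :^ 3))
           ≡.refl (sign (suc i)) (index i) ⟩
    (index (suc i) ℤ.+ + 3 ℤ.* power 1 (suc i)) ℤ.- + 2 ℤ.* power 3 (suc i) ∎

-- Quadratic relations between the series u_p and g_p

module LambertIdentities {c ℓ} (R : CommutativeRing c ℓ) (algebra : ℤ-algebra R)
                         (L : LambertData R algebra) where
  open CommutativeRing R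
  open SetoidReasoning setoid
  open MixedConvolution R algebra L public
  open Weights
  open ℤSolver.+-*-Solver using () renaming
    (solve to ℤ-solve; _:+_ to _⊞_; _:-_ to _⊟_; _:*_ to _⊠_; _:^_ to _⊡_; :-_ to ⊟_; con to ⟪_⟫; _:=_ to _≐_)

  u g : ℕ → Carrier
  u p = moment Sign.- (power p)
  g p = moment Sign.+ (power p)

  moment-cong : ∀ s {x y} → (∀ i → x i ≡ y i) → moment s x ≈ moment s y
  moment-cong s x≡y = ∑-cong M λ i → *-congʳ (ι-cong (x≡y i))

  moment-+ : ∀ s x y → moment s (λ i → x i ℤ.+ y i) ≈ moment s x + moment s y
  moment-+ s x y = trans
    (∑-cong M λ i → trans (*-congʳ (ι-+ (x i) (y i))) (distribʳ _ _ _))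
    (∑-+ M (λ i → ι (x i) * γ s i) (λ i → ι (y i) * γ s i))

  moment-scale : ∀ s k x → moment s (λ i → k ℤ.* x i) ≈ ι k * moment s x
  moment-scale s k x = trans
    (∑-cong M λ i → trans (*-congʳ (ι-* k (x i))) (*-assoc _ _ _))
    (∑-*ˡ M (ι k) (λ i → ι (x i) * γ s i))

  moment-neg : ∀ s x → moment s (λ i → ℤ.- x i) ≈ - moment s x
  moment-neg s x = trans
    (∑-cong M λ i → trans (*-congʳ (ι-neg (x i)))
       (solve 2 (λ a b → (:- a) :* b := :- (a :* b)) refl (ι (x i)) (γ s i)))
    (∑-neg M (λ i → ι (x i) * γ s i))

  moment-- : ∀ s x y → moment s (λ i → x i ℤ.- y i) ≈ moment s x - moment s y
  moment-- s x y = trans (moment-+ s x (λ i → ℤ.- y i)) (+-congˡ (moment-neg s y))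

  moment-+2 : ∀ s x y → moment s (λ i → x i ℤ.+ + 2 ℤ.* y i) ≈ moment s x + ι (+ 2) * moment s y
  moment-+2 s x y = trans (moment-+ s x (λ i → + 2 ℤ.* y i)) (+-congˡ (moment-scale s (+ 2) y))

  bilinear-+ : ∀ s t {w v x} → (∀ i j → w i j ≡ v i j ℤ.+ x i j) →
               bilinear s t w ≈ bilinear s t v + bilinear s t x
  bilinear-+ s t {w} {v} {x} w≡ = trans
    (∑-cong M λ i → trans
      (∑-cong M λ j → trans (*-congʳ (trans (ι-cong (w≡ i j)) (ι-+ (v i j) (x i j)))) (distribʳ _ _ _))
      (∑-+ M (λ j → ι (v i j) * (γ s i * γ t j)) (λ j → ι (x i j) * (γ s i * γ t j))))
    (∑-+ M (λ i → ∑[ j < M ] (ι (v i j) * (γ s i * γ t j)))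
           (λ i → ∑[ j < M ] (ι (x i j) * (γ s i * γ t j))))

  bilinear-⊗ : ∀ s t k x y →
    bilinear s t (λ i j → k ℤ.* (x i ℤ.* y j)) ≈ ι k * (moment s x * moment t y)
  bilinear-⊗ s t k x y = begin
    bilinear s t (λ i j → k ℤ.* (x i ℤ.* y j))
      ≈⟨ ∑-cong M (λ i → trans (∑-cong M λ j → trans
           (*-congʳ (trans (ι-* k (x i ℤ.* y j)) (*-congˡ (ι-* (x i) (y j)))))
           (solve 5 (λ k a b c d → (k :* (a :* b)) :* (c :* d) := (k :* (a :* c)) :* (b :* d)) refl
              (ι k) (ι (x i)) (ι (y j)) (γ s i) (γ t j)))
           (∑-*ˡ M (ι k * (ι (x i) * γ s i)) (λ j → ι (y j) * γ t j))) ⟩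
    ∑[ i < M ] ((ι k * (ι (x i) * γ s i)) * moment t y)
      ≈⟨ ∑-*ʳ M (λ i → ι k * (ι (x i) * γ s i)) (moment t y) ⟩
    ∑[ i < M ] (ι k * (ι (x i) * γ s i)) * moment t y
      ≈⟨ *-congʳ (∑-*ˡ M (ι k) (λ i → ι (x i) * γ s i)) ⟩
    (ι k * moment s x) * moment t y
      ≈⟨ *-assoc _ _ _ ⟩
    ι k * (moment s x * moment t y) ∎

  index-power : ∀ p i → index i ℤ.* power p i ≡ power (suc p) i
  index-power p i = ℤ-solve 3 (λ s m x → m ⊠ (s ⊠ x) ≐ s ⊠ (m ⊠ x)) ≡.refl
    (sign (suc i)) (index i) (index i ℤ.^ p)

  private
    -- Two minus signs multiply to plus, so the partial fractions produce β. Since 2 α β = β - α,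
    -- the product at equal indices stays linear, and its β joins the l β of the antidiagonals to m
    -- β with m = l + 1. Hence quadratic expressions in u lead to g with the exponent raised by one.
    self⁻ : ∀ p → (∀ x → (ℤ.- x) ℤ.^ suc p ≡ x ℤ.^ suc p) →
      ι ℤ.-1ℤ * (bilinear Sign.- Sign.- (w⁻ (suc p)) - bilinear Sign.- Sign.- (w⁺ (suc p))) ≈
      g (suc (suc p)) -
      moment Sign.- (λ i → power (suc p) i ℤ.+ + 2 ℤ.* partialSum (power (suc p)) i)
    self⁻ p even = begin
      _ ≈⟨ self-convolution Sign.- {w⁻ (suc p)} {w⁺ (suc p)} {f} {F} (w⁻-diagonal p) (w⁻≡power (suc p))
             (λ j l → ≡.trans (w⁻-swap (suc p) j l) (≡.cong (sign (suc l) ℤ.*_) (even (index l))))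
             (w⁺≡power (suc p)) (partialSum-antiderivative f) ⟩
      ∑[ l < M ] (ι (f l) * (ι (+ 2) * (β l * α l) - ι ℤ.-1ℤ * (ι (+ l) * β l)))
      - ι (+ 2) * moment Sign.- F
        ≈⟨ +-congʳ (∑-cong M λ l → trans
             (linear 5 (ι (f l) ∷ α l ∷ β l ∷ ι (+ l) ∷ ι (index l) ∷ [])
               (λ f a b n m →
                 (f :* (con (+ 2) :* (b :* a) :- con ℤ.-1ℤ :* (n :* b)) :=
                  (m :* f) :* b :+ :- (f :* a)) ,
                 (f , (con (+ 2) :* (a :* b) := b :- a)) ∷
                 (:- (f :* b) , (m := con ℤ.1ℤ :+ n)) ∷ [])
               (αβ-sameIndex l , ι-+ ℤ.1ℤ (+ l) , lift tt) refl)
             (+-congʳ (*-congʳ (trans (sym (ι-* (index l) (f l))) (ι-cong (index-power (suc p) l)))))) ⟩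
      ∑[ l < M ] (ι (power (suc (suc p)) l) * β l + - (ι (f l) * α l)) - ι (+ 2) * moment Sign.- F
        ≈⟨ +-congʳ (trans (∑-+ M (λ l → ι (power (suc (suc p)) l) * β l) (λ l → - (ι (f l) * α l)))
                          (+-congˡ (∑-neg M (λ l → ι (f l) * α l)))) ⟩
      (g (suc (suc p)) - moment Sign.- f) - ι (+ 2) * moment Sign.- F
        ≈⟨ solve 3 (λ a b c → (a :- b) :- con (+ 2) :* c := a :- (b :+ con (+ 2) :* c)) refl
             (g (suc (suc p))) (moment Sign.- f) (moment Sign.- F) ⟩
      g (suc (suc p)) - (moment Sign.- f + ι (+ 2) * moment Sign.- F)
        ≈⟨ +-congˡ (-‿cong (moment-+2 Sign.- f F)) ⟨
      _ ∎
      where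
      f F : ℕ → ℤ
      f = power (suc p)
      F = partialSum f

  -- The identity (m - n)² - (m + n)² = -4 m n turns the difference of the two bilinear sums into a
  -- product, and `alternating₂` reduces the remaining moment to u₁.
  g₃-identity : ι (+ 4) * (u 1 * u 1) ≈ g 3 - u 1
  g₃-identity = linear 5 (bilinear Sign.- Sign.- (w⁻ 2) ∷ bilinear Sign.- Sign.- (w⁺ 2) ∷
                          u 1 ∷ g 3 ∷ moment Sign.- (λ i → power 2 i ℤ.+ + 2 ℤ.* partialSum (power 2) i) ∷ [])
    (λ b⁻ b⁺ u₁ g₃ m →
      (con (+ 4) :* (u₁ :* u₁) := g₃ :- u₁) ,
      (con ℤ.1ℤ , (con ℤ.-1ℤ :* (b⁻ :- b⁺) := g₃ :- m)) ∷
      (con ℤ.1ℤ , (b⁻ := b⁺ :+ con (ℤ.- + 4) :* (u₁ :* u₁))) ∷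
      (con ℤ.-1ℤ , (m := u₁)) ∷ [])
    (self⁻ 1 even₂ , expand , moment-cong Sign.- alternating₂ , lift tt) refl
    where
    expand : bilinear Sign.- Sign.- (w⁻ 2) ≈
             bilinear Sign.- Sign.- (w⁺ 2) + ι (ℤ.- + 4) * (u 1 * u 1)
    expand = trans
      (bilinear-+ Sign.- Sign.- {v = w⁺ 2} {λ i j → ℤ.- + 4 ℤ.* (power 1 i ℤ.* power 1 j)}
        λ i j → ℤ-solve 4 (λ s t m n →
          (s ⊠ t) ⊠ (m ⊟ n) ⊡ 2 ≐
          (s ⊠ t) ⊠ (m ⊞ n) ⊡ 2 ⊞ ⟪ ℤ.- + 4 ⟫ ⊠ ((s ⊠ m ⊡ 1) ⊠ (t ⊠ n ⊡ 1))) ≡.refl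
          (sign (suc i)) (sign (suc j)) (index i) (index j))
      (+-congˡ (bilinear-⊗ Sign.- Sign.- (ℤ.- + 4) (power 1) (power 1)))

  private
    -- In (m - n)⁴ - (m + n)⁴ the terms -8 m n³ and -8 m³ n contribute the same product of moments,
    -- whence -16.
    expand₄ : ∀ s → bilinear s s (w⁻ 4) ≈
              bilinear s s (w⁺ 4) + ι (ℤ.- + 16) * (moment s (power 1) * moment s (power 3))
    expand₄ s = begin
      bilinear s s (w⁻ 4)
        ≈⟨ bilinear-+ s s {v = λ i j → w⁺ 4 i j ℤ.+ ℤ.- + 8 ℤ.* (power 1 i ℤ.* power 3 j)}
                          {λ i j → ℤ.- + 8 ℤ.* (power 3 i ℤ.* power 1 j)}
             (λ i j → ℤ-solve 4 (λ s t m n →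
               (s ⊠ t) ⊠ (m ⊟ n) ⊡ 4 ≐
               ((s ⊠ t) ⊠ (m ⊞ n) ⊡ 4 ⊞ ⟪ ℤ.- + 8 ⟫ ⊠ ((s ⊠ m ⊡ 1) ⊠ (t ⊠ n ⊡ 3)))
                 ⊞ ⟪ ℤ.- + 8 ⟫ ⊠ ((s ⊠ m ⊡ 3) ⊠ (t ⊠ n ⊡ 1))) ≡.refl
               (sign (suc i)) (sign (suc j)) (index i) (index j)) ⟩
      _ ≈⟨ +-cong (trans (bilinear-+ s s {v = w⁺ 4} {λ i j → ℤ.- + 8 ℤ.* (power 1 i ℤ.* power 3 j)}
                            (λ i j → ≡.refl))
                         (+-congˡ (bilinear-⊗ s s (ℤ.- + 8) (power 1) (power 3))))
                  (bilinear-⊗ s s (ℤ.- + 8) (power 3) (power 1)) ⟩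
      _ ≈⟨ solve 3 (λ b x y → (b :+ con (ℤ.- + 8) :* (x :* y)) :+ con (ℤ.- + 8) :* (y :* x) :=
                              b :+ con (ℤ.- + 16) :* (x :* y)) refl
             (bilinear s s (w⁺ 4)) (moment s (power 1)) (moment s (power 3)) ⟩
      _ ∎

    alternating-moment₄ : ∀ s → moment s (λ i → power 4 i ℤ.+ + 2 ℤ.* partialSum (power 4) i) ≈
                          ι (+ 2) * moment s (power 3) - moment s (power 1)
    alternating-moment₄ s = trans (moment-cong s alternating₄)
      (trans (moment-- s (λ i → + 2 ℤ.* power 3 i) (power 1)) (+-congʳ (moment-scale s (+ 2) (power 3))))

  g₅-identity : ι (+ 16) * (u 1 * u 3) ≈ g 5 - (ι (+ 2) * u 3 - u 1)
  g₅-identity = linear 6 (bilinear Sign.- Sign.- (w⁻ 4) ∷ bilinear Sign.- Sign.- (w⁺ 4) ∷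
                          u 1 ∷ u 3 ∷ g 5 ∷ moment Sign.- (λ i → power 4 i ℤ.+ + 2 ℤ.* partialSum (power 4) i) ∷ [])
    (λ b⁻ b⁺ u₁ u₃ g₅ m →
      (con (+ 16) :* (u₁ :* u₃) := g₅ :- (con (+ 2) :* u₃ :- u₁)) ,
      (con ℤ.1ℤ , (con ℤ.-1ℤ :* (b⁻ :- b⁺) := g₅ :- m)) ∷
      (con ℤ.1ℤ , (b⁻ := b⁺ :+ con (ℤ.- + 16) :* (u₁ :* u₃))) ∷
      (con ℤ.-1ℤ , (m := con (+ 2) :* u₃ :- u₁)) ∷ [])
    (self⁻ 3 even₄ , expand₄ Sign.- , alternating-moment₄ Sign.- , lift tt) refl

  -- The constants are twice the binomial coefficients 6 and 20: (m - n)⁶ - (m + n)⁶ = -12 m n⁵ - 40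
  -- m³ n³ - 12 m⁵ n, where the outer terms give equal products.
  g₇-identity : ι (+ 24) * (u 1 * u 5) + ι (+ 40) * (u 3 * u 3) ≈
                g 7 - ((ι (+ 3) * u 5 - ι (+ 5) * u 3) + ι (+ 3) * u 1)
  g₇-identity = linear 7 (bilinear Sign.- Sign.- (w⁻ 6) ∷ bilinear Sign.- Sign.- (w⁺ 6) ∷
                          u 1 ∷ u 3 ∷ u 5 ∷ g 7 ∷
                          moment Sign.- (λ i → power 6 i ℤ.+ + 2 ℤ.* partialSum (power 6) i) ∷ [])
    (λ b⁻ b⁺ u₁ u₃ u₅ g₇ m →
      (con (+ 24) :* (u₁ :* u₅) :+ con (+ 40) :* (u₃ :* u₃) :=
       g₇ :- ((con (+ 3) :* u₅ :- con (+ 5) :* u₃) :+ con (+ 3) :* u₁)) ,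
      (con ℤ.1ℤ , (con ℤ.-1ℤ :* (b⁻ :- b⁺) := g₇ :- m)) ∷
      (con ℤ.1ℤ , (b⁻ := b⁺ :+ ((con (ℤ.- + 12) :* (u₁ :* u₅) :+ con (ℤ.- + 12) :* (u₅ :* u₁))
                                :+ con (ℤ.- + 40) :* (u₃ :* u₃)))) ∷
      (con ℤ.-1ℤ , (m := (con (+ 3) :* u₅ :- con (+ 5) :* u₃) :+ con (+ 3) :* u₁)) ∷ [])
    (self⁻ 5 even₆ , expand , alternating , lift tt) refl
    where
    v₁ v₂ v₃ : ℕ → ℕ → ℤ
    v₁ i j = ℤ.- + 12 ℤ.* (power 1 i ℤ.* power 5 j)
    v₂ i j = ℤ.- + 12 ℤ.* (power 5 i ℤ.* power 1 j)
    v₃ i j = ℤ.- + 40 ℤ.* (power 3 i ℤ.* power 3 j)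
    expand : bilinear Sign.- Sign.- (w⁻ 6) ≈
             bilinear Sign.- Sign.- (w⁺ 6) +
             ((ι (ℤ.- + 12) * (u 1 * u 5) + ι (ℤ.- + 12) * (u 5 * u 1)) + ι (ℤ.- + 40) * (u 3 * u 3))
    expand = trans
      (bilinear-+ Sign.- Sign.- {v = w⁺ 6} {λ i j → (v₁ i j ℤ.+ v₂ i j) ℤ.+ v₃ i j}
        λ i j → ℤ-solve 4 (λ s t m n →
          (s ⊠ t) ⊠ (m ⊟ n) ⊡ 6 ≐
          (s ⊠ t) ⊠ (m ⊞ n) ⊡ 6 ⊞
          ((⟪ ℤ.- + 12 ⟫ ⊠ ((s ⊠ m ⊡ 1) ⊠ (t ⊠ n ⊡ 5)) ⊞ ⟪ ℤ.- + 12 ⟫ ⊠ ((s ⊠ m ⊡ 5) ⊠ (t ⊠ n ⊡ 1)))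
            ⊞ ⟪ ℤ.- + 40 ⟫ ⊠ ((s ⊠ m ⊡ 3) ⊠ (t ⊠ n ⊡ 3)))) ≡.refl
          (sign (suc i)) (sign (suc j)) (index i) (index j))
      (+-congˡ (trans
        (bilinear-+ Sign.- Sign.- {v = λ i j → v₁ i j ℤ.+ v₂ i j} {v₃} λ i j → ≡.refl)
        (+-cong (trans (bilinear-+ Sign.- Sign.- {v = v₁} {v₂} λ i j → ≡.refl)
                       (+-cong (bilinear-⊗ Sign.- Sign.- (ℤ.- + 12) (power 1) (power 5))
                               (bilinear-⊗ Sign.- Sign.- (ℤ.- + 12) (power 5) (power 1))))
                (bilinear-⊗ Sign.- Sign.- (ℤ.- + 40) (power 3) (power 3)))))
    alternating : moment Sign.- (λ i → power 6 i ℤ.+ + 2 ℤ.* partialSum (power 6) i) ≈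
                  (ι (+ 3) * u 5 - ι (+ 5) * u 3) + ι (+ 3) * u 1
    alternating = trans (moment-cong Sign.- alternating₆)
      (trans (moment-+ Sign.- (λ i → + 3 ℤ.* power 5 i ℤ.- + 5 ℤ.* power 3 i) (λ i → + 3 ℤ.* power 1 i))
        (+-cong (trans (moment-- Sign.- (λ i → + 3 ℤ.* power 5 i) (λ i → + 5 ℤ.* power 3 i))
                       (+-cong (moment-scale Sign.- (+ 3) (power 5))
                               (-‿cong (moment-scale Sign.- (+ 5) (power 3)))))
                (moment-scale Sign.- (+ 3) (power 1))))

  -- The image of `g 3` under q d/dq, because m (β + β²) is that of β; it is written out since no
  -- derivation is assumed here.
  g₃-derivative : Carrier
  g₃-derivative = ∑[ i < M ] (ι (power 4 i) * (β i + β i * β i))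

  -- For the sign + the product at equal indices is β², which has no linear expression. Together
  -- with β it forms a derivative, and this is how a quadratic relation becomes a differential
  -- equation.
  g₁g₃-identity : ι (ℤ.- + 16) * (g 1 * g 3) ≈
                  (ι (+ 2) * g₃-derivative - g 5) - (ι (+ 2) * g 3 - g 1)
  g₁g₃-identity = linear 7 (bilinear Sign.+ Sign.+ (w⁻ 4) ∷ bilinear Sign.+ Sign.+ (w⁺ 4) ∷
                            g 1 ∷ g 3 ∷ g 5 ∷ g₃-derivative ∷
                            moment Sign.+ (λ i → power 4 i ℤ.+ + 2 ℤ.* partialSum (power 4) i) ∷ [])
    (λ b⁻ b⁺ g₁ g₃ g₅ d m →
      (con (ℤ.- + 16) :* (g₁ :* g₃) := (con (+ 2) :* d :- g₅) :- (con (+ 2) :* g₃ :- g₁)) ,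
      (con ℤ.1ℤ , (con ℤ.1ℤ :* (b⁻ :- b⁺) := (con (+ 2) :* d :- g₅) :- m)) ∷
      (con ℤ.-1ℤ , (b⁻ := b⁺ :+ con (ℤ.- + 16) :* (g₁ :* g₃))) ∷
      (con ℤ.-1ℤ , (m := con (+ 2) :* g₃ :- g₁)) ∷ [])
    (self⁺ , expand₄ Sign.+ , alternating-moment₄ Sign.+ , lift tt) refl
    where
    f F : ℕ → ℤ
    f = power 4
    F = partialSum f
    self⁺ : ι ℤ.1ℤ * (bilinear Sign.+ Sign.+ (w⁻ 4) - bilinear Sign.+ Sign.+ (w⁺ 4)) ≈
            (ι (+ 2) * g₃-derivative - g 5) - moment Sign.+ (λ i → f i ℤ.+ + 2 ℤ.* F i)
    self⁺ = begin
      _ ≈⟨ self-convolution Sign.+ {w⁻ 4} {w⁺ 4} {f} {F} (w⁻-diagonal 3) (w⁻≡power 4)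
             (λ j l → ≡.trans (w⁻-swap 4 j l) (≡.cong (sign (suc l) ℤ.*_) (even₄ (index l))))
             (w⁺≡power 4) (partialSum-antiderivative f) ⟩
      ∑[ l < M ] (ι (f l) * (ι (+ 2) * (β l * β l) - ι ℤ.1ℤ * (ι (+ l) * β l)))
      - ι (+ 2) * moment Sign.+ F
        ≈⟨ +-congʳ (∑-cong M λ l → trans
             (linear 4 (ι (f l) ∷ β l ∷ ι (+ l) ∷ ι (index l) ∷ [])
               (λ f b n m →
                 (f :* (con (+ 2) :* (b :* b) :- con ℤ.1ℤ :* (n :* b)) :=
                  con (+ 2) :* (f :* (b :+ b :* b)) :+ (:- ((m :* f) :* b) :+ :- (f :* b))) ,
                 (f :* b , (m := con ℤ.1ℤ :+ n)) ∷ [])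
               (ι-+ ℤ.1ℤ (+ l) , lift tt) refl)
             (+-congˡ (+-congʳ (-‿cong (*-congʳ (trans (sym (ι-* (index l) (f l)))
                (ι-cong (index-power 4 l)))))))) ⟩
      ∑[ l < M ] (ι (+ 2) * (ι (f l) * (β l + β l * β l))
                  + (- (ι (power 5 l) * β l) + - (ι (f l) * β l))) - ι (+ 2) * moment Sign.+ F
        ≈⟨ +-congʳ (trans (∑-+ M _ _) (+-cong (∑-*ˡ M (ι (+ 2)) _) (trans (∑-+ M _ _)
             (+-cong (∑-neg M (λ l → ι (power 5 l) * β l)) (∑-neg M (λ l → ι (f l) * β l)))))) ⟩
      (ι (+ 2) * g₃-derivative + (- g 5 + - moment Sign.+ f)) - ι (+ 2) * moment Sign.+ F
        ≈⟨ solve 4 (λ a b c d → (a :+ (:- b :+ :- c)) :- con (+ 2) :* d :=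
                                (a :- b) :- (c :+ con (+ 2) :* d)) refl
             (ι (+ 2) * g₃-derivative) (g 5) (moment Sign.+ f) (moment Sign.+ F) ⟩
      (ι (+ 2) * g₃-derivative - g 5) - (moment Sign.+ f + ι (+ 2) * moment Sign.+ F)
        ≈⟨ +-congˡ (-‿cong (moment-+2 Sign.+ f F)) ⟨
      _ ∎

  private
    -- For an odd exponent, (m + n)^p + (m - n)^p has odd powers of m and even powers of n. The
    -- extra factor n makes both odd, so the left side expands into products of u and g with odd
    -- exponents.
    mixed : ∀ p → (∀ x → (ℤ.- x) ℤ.^ suc p ≡ ℤ.- x ℤ.^ suc p) →
      ι (+ 2) * (bilinear Sign.- Sign.+ (λ i j → index j ℤ.* w⁺ (suc p) i j)
                 + bilinear Sign.- Sign.+ (λ i j → index j ℤ.* w⁻ (suc p) i j)) ≈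
      ((ι (+ 4) * W) * u (suc p) + u (suc (suc (suc p))))
      - (moment Sign.+ (λ i → index i ℤ.* (power (suc p) i ℤ.+ + 2 ℤ.* partialSum (power (suc p)) i))
         + ι (+ 2) * moment Sign.- (partialSum (λ i → partialSum (power (suc p)) (suc i))))
    mixed p odd = begin
      _ ≈⟨ mixed-convolution
             {λ i j → index j ℤ.* w⁺ (suc p) i j} {λ i j → index j ℤ.* w⁻ (suc p) i j} {f} {F} {G}
             (λ i j → ≡.cong (index j ℤ.*_) (w⁺≡power (suc p) i j))
             (λ i → ≡.trans (≡.cong (index i ℤ.*_) (w⁻-diagonal p i)) (ℤ.*-zeroʳ (index i)))
             (λ j l → ≡.cong (index j ℤ.*_) (w⁻≡power (suc p) j l))
             (λ j l → ≡.trans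
               (≡.cong (index (suc (j ℕ.+ l)) ℤ.*_)
                  (≡.trans (w⁻-swap (suc p) j l) (≡.cong (sign (suc l) ℤ.*_) (odd (index l)))))
               (ℤ-solve 3 (λ m s x → m ⊠ (s ⊠ (⊟ x)) ≐ ⊟ (m ⊠ (s ⊠ x))) ≡.refl
                  (index (suc (j ℕ.+ l))) (sign (suc l)) (index l ℤ.^ suc p)))
             (partialSum-antiderivative f) (partialSum-antiderivative (λ i → F (suc i))) ⟩
      _ ≈⟨ +-congʳ (+-congʳ (+-congˡ (moment-cong Sign.- λ i →
             ≡.trans (ℤ.*-assoc (index i) (index i) (f i))
               (≡.trans (≡.cong (index i ℤ.*_) (index-power (suc p) i))
                        (index-power (suc (suc p)) i))))) ⟩
      (((ι (+ 4) * W) * u (suc p) + u (suc (suc (suc p)))) - moment Sign.+ (λ i → index i ℤ.* f i))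
      - ι (+ 2) * (moment Sign.- G + moment Sign.+ (λ i → index i ℤ.* F i))
        ≈⟨ solve 4 (λ a b c d → (a :- b) :- con (+ 2) :* (c :+ d) :=
                                a :- ((b :+ con (+ 2) :* d) :+ con (+ 2) :* c)) refl
             ((ι (+ 4) * W) * u (suc p) + u (suc (suc (suc p))))
             (moment Sign.+ (λ i → index i ℤ.* f i)) (moment Sign.- G)
             (moment Sign.+ (λ i → index i ℤ.* F i)) ⟩
      _ ≈⟨ +-congˡ (-‿cong (+-congʳ (trans
             (moment-cong Sign.+ (λ i → ℤ-solve 3 (λ m f F →
                m ⊠ (f ⊞ ⟪ + 2 ⟫ ⊠ F) ≐ m ⊠ f ⊞ ⟪ + 2 ⟫ ⊠ (m ⊠ F)) ≡.refl (index i) (f i) (F i)))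
             (moment-+2 Sign.+ (λ i → index i ℤ.* f i) (λ i → index i ℤ.* F i))))) ⟨
      _ ∎
      where
      f F G : ℕ → ℤ
      f = power (suc p)
      F = partialSum f
      G = partialSum (λ i → F (suc i))

  -- Two moments without signs arise: that of β from the alternating sums and that of α from their
  -- iterates. They enter with equal coefficients and recombine to `W`.
  u₃-identity : ι (+ 8) * (u 1 * g 1) ≈
                (((ι (+ 8) * (W * u 1) + ι (+ 2) * u 3) - g 1) + W) + u 1
  u₃-identity = linear 9
    (b⁺ ∷ b⁻ ∷ u 1 ∷ u 3 ∷ g 1 ∷ moment Sign.- index ∷ moment Sign.+ index ∷ A ∷ H ∷ [])
    (λ b⁺ b⁻ u₁ u₃ g₁ m⁻ m⁺ a h →
      (con (+ 8) :* (u₁ :* g₁) :=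
       (((con (+ 8) :* ((m⁻ :+ m⁺) :* u₁) :+ con (+ 2) :* u₃) :- g₁) :+ (m⁻ :+ m⁺)) :+ u₁) ,
      (con (+ 2) , (con (+ 2) :* (b⁺ :+ b⁻) :=
                    ((con (+ 4) :* (m⁻ :+ m⁺)) :* u₁ :+ u₃) :- (a :+ con (+ 2) :* h))) ∷
      (con (+ 4) , (con (+ 2) :* (u₁ :* g₁) := b⁺ :+ b⁻)) ∷
      (con ℤ.-1ℤ , (con (+ 2) :* a := g₁ :- m⁺)) ∷
      (con ℤ.-1ℤ , (con (+ 4) :* h := :- (m⁻ :+ u₁))) ∷ [])
    (mixed 0 odd₁ , expand , alternating , iterated , lift tt) refl
    where
    b⁺ = bilinear Sign.- Sign.+ (λ i j → index j ℤ.* w⁺ 1 i j)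
    b⁻ = bilinear Sign.- Sign.+ (λ i j → index j ℤ.* w⁻ 1 i j)
    A = moment Sign.+ (λ i → index i ℤ.* (power 1 i ℤ.+ + 2 ℤ.* partialSum (power 1) i))
    H = moment Sign.- (partialSum (λ i → partialSum (power 1) (suc i)))
    odd₁ : ∀ x → (ℤ.- x) ℤ.^ 1 ≡ ℤ.- x ℤ.^ 1
    odd₁ = ℤ-solve 1 (λ x → (⊟ x) ⊡ 1 ≐ ⊟ (x ⊡ 1)) ≡.refl
    expand : ι (+ 2) * (u 1 * g 1) ≈ b⁺ + b⁻
    expand = trans (sym (bilinear-⊗ Sign.- Sign.+ (+ 2) (power 1) (power 1)))
      (bilinear-+ Sign.- Sign.+ {v = λ i j → index j ℤ.* w⁺ 1 i j} {λ i j → index j ℤ.* w⁻ 1 i j}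
        λ i j → ℤ-solve 4 (λ s t m n →
          ⟪ + 2 ⟫ ⊠ ((s ⊠ m ⊡ 1) ⊠ (t ⊠ n ⊡ 1)) ≐
          n ⊠ ((s ⊠ t) ⊠ (m ⊞ n) ⊡ 1) ⊞ n ⊠ ((s ⊠ t) ⊠ (m ⊟ n) ⊡ 1)) ≡.refl
          (sign (suc i)) (sign (suc j)) (index i) (index j))
    alternating : ι (+ 2) * A ≈ g 1 - moment Sign.+ index
    alternating = trans (sym (moment-scale Sign.+ (+ 2) _)) (trans
      (moment-cong Sign.+ λ i → ≡.trans
        (ℤ-solve 2 (λ m x → ⟪ + 2 ⟫ ⊠ (m ⊠ x) ≐ m ⊠ (⟪ + 2 ⟫ ⊠ x)) ≡.refl
           (index i) (power 1 i ℤ.+ + 2 ℤ.* partialSum (power 1) i))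
        (≡.trans (≡.cong (index i ℤ.*_) (alternating₁ i))
          (ℤ-solve 2 (λ s m → m ⊠ (s ⊟ ⟪ ℤ.1ℤ ⟫) ≐ s ⊠ m ⊡ 1 ⊟ m) ≡.refl (sign (suc i)) (index i))))
      (moment-- Sign.+ (power 1) index))
    iterated : ι (+ 4) * H ≈ - (moment Sign.- index + u 1)
    iterated = trans (sym (moment-scale Sign.- (+ 4) _)) (trans (moment-cong Sign.- iterated₁)
      (trans (moment-neg Sign.- (λ i → index i ℤ.+ power 1 i)) (-‿cong (moment-+ Sign.- index (power 1)))))

  u₅-identity : ι (+ 16) * (u 3 * g 1) + ι (+ 48) * (u 1 * g 3) ≈
                (((((ι (+ 16) * (W * u 3) + ι (+ 4) * u 5) - ι (+ 6) * g 3) + g 1) - W)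
                  + ι (+ 2) * u 3) - ι (+ 3) * u 1
  u₅-identity = linear 11
    (b⁺ ∷ b⁻ ∷ u 1 ∷ u 3 ∷ u 5 ∷ g 1 ∷ g 3 ∷ moment Sign.- index ∷ moment Sign.+ index ∷ A ∷ H ∷ [])
    (λ b⁺ b⁻ u₁ u₃ u₅ g₁ g₃ m⁻ m⁺ a h →
      (con (+ 16) :* (u₃ :* g₁) :+ con (+ 48) :* (u₁ :* g₃) :=
       (((((con (+ 16) :* ((m⁻ :+ m⁺) :* u₃) :+ con (+ 4) :* u₅) :- con (+ 6) :* g₃) :+ g₁) :- (m⁻ :+ m⁺))
         :+ con (+ 2) :* u₃) :- con (+ 3) :* u₁) ,
      (con (+ 4) , (con (+ 2) :* (b⁺ :+ b⁻) :=
                    ((con (+ 4) :* (m⁻ :+ m⁺)) :* u₃ :+ u₅) :- (a :+ con (+ 2) :* h))) ∷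
      (con (+ 8) , (con (+ 2) :* (u₃ :* g₁) :+ con (+ 6) :* (u₁ :* g₃) := b⁺ :+ b⁻)) ∷
      (con ℤ.-1ℤ , (con (+ 4) :* a := (con (+ 6) :* g₃ :+ m⁺) :- g₁)) ∷
      (con ℤ.-1ℤ , (con (+ 8) :* h := (m⁻ :+ con (+ 3) :* u₁) :- con (+ 2) :* u₃)) ∷ [])
    (mixed 2 odd₃ , expand , alternating , iterated , lift tt) refl
    where
    b⁺ = bilinear Sign.- Sign.+ (λ i j → index j ℤ.* w⁺ 3 i j)
    b⁻ = bilinear Sign.- Sign.+ (λ i j → index j ℤ.* w⁻ 3 i j)
    A = moment Sign.+ (λ i → index i ℤ.* (power 3 i ℤ.+ + 2 ℤ.* partialSum (power 3) i))
    H = moment Sign.- (partialSum (λ i → partialSum (power 3) (suc i)))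
    odd₃ : ∀ x → (ℤ.- x) ℤ.^ 3 ≡ ℤ.- x ℤ.^ 3
    odd₃ = ℤ-solve 1 (λ x → (⊟ x) ⊡ 3 ≐ ⊟ (x ⊡ 3)) ≡.refl
    v₁ v₂ : ℕ → ℕ → ℤ
    v₁ i j = + 2 ℤ.* (power 3 i ℤ.* power 1 j)
    v₂ i j = + 6 ℤ.* (power 1 i ℤ.* power 3 j)
    expand : ι (+ 2) * (u 3 * g 1) + ι (+ 6) * (u 1 * g 3) ≈ b⁺ + b⁻
    expand = trans
      (+-cong (sym (bilinear-⊗ Sign.- Sign.+ (+ 2) (power 3) (power 1)))
              (sym (bilinear-⊗ Sign.- Sign.+ (+ 6) (power 1) (power 3))))
      (trans (sym (bilinear-+ Sign.- Sign.+ {λ i j → v₁ i j ℤ.+ v₂ i j} {v₁} {v₂} λ i j → ≡.refl))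
        (bilinear-+ Sign.- Sign.+ {v = λ i j → index j ℤ.* w⁺ 3 i j} {λ i j → index j ℤ.* w⁻ 3 i j}
          λ i j → ℤ-solve 4 (λ s t m n →
            ⟪ + 2 ⟫ ⊠ ((s ⊠ m ⊡ 3) ⊠ (t ⊠ n ⊡ 1)) ⊞ ⟪ + 6 ⟫ ⊠ ((s ⊠ m ⊡ 1) ⊠ (t ⊠ n ⊡ 3)) ≐
            n ⊠ ((s ⊠ t) ⊠ (m ⊞ n) ⊡ 3) ⊞ n ⊠ ((s ⊠ t) ⊠ (m ⊟ n) ⊡ 3)) ≡.refl
            (sign (suc i)) (sign (suc j)) (index i) (index j)))
    alternating : ι (+ 4) * A ≈ (ι (+ 6) * g 3 + moment Sign.+ index) - g 1
    alternating = trans (sym (moment-scale Sign.+ (+ 4) _)) (trans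
      (moment-cong Sign.+ λ i → ≡.trans
        (ℤ-solve 2 (λ m x → ⟪ + 4 ⟫ ⊠ (m ⊠ x) ≐ m ⊠ (⟪ + 4 ⟫ ⊠ x)) ≡.refl
           (index i) (power 3 i ℤ.+ + 2 ℤ.* partialSum (power 3) i))
        (≡.trans (≡.cong (index i ℤ.*_) (alternating₃ i))
          (ℤ-solve 2 (λ s m → m ⊠ ((⟪ + 6 ⟫ ⊠ (s ⊠ m ⊡ 2) ⊞ ⟪ ℤ.1ℤ ⟫) ⊟ s) ≐
                              (⟪ + 6 ⟫ ⊠ (s ⊠ m ⊡ 3) ⊞ m) ⊟ s ⊠ m ⊡ 1) ≡.refl
             (sign (suc i)) (index i))))
      (trans (moment-- Sign.+ (λ i → + 6 ℤ.* power 3 i ℤ.+ index i) (power 1))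
        (+-congʳ (trans (moment-+ Sign.+ (λ i → + 6 ℤ.* power 3 i) index)
                        (+-congʳ (moment-scale Sign.+ (+ 6) (power 3)))))))
    iterated : ι (+ 8) * H ≈ (moment Sign.- index + ι (+ 3) * u 1) - ι (+ 2) * u 3
    iterated = trans (sym (moment-scale Sign.- (+ 8) _)) (trans (moment-cong Sign.- iterated₃)
      (trans (moment-- Sign.- (λ i → index i ℤ.+ + 3 ℤ.* power 1 i) (λ i → + 2 ℤ.* power 3 i))
        (+-cong (trans (moment-+ Sign.- index (λ i → + 3 ℤ.* power 1 i))
                       (+-congˡ (moment-scale Sign.- (+ 3) (power 1))))
                (-‿cong (moment-scale Sign.- (+ 2) (power 3))))))

-- The derivation q d/dq and Gauss' product for the theta series

record LambertDerivation {c ℓ} (R : CommutativeRing c ℓ) (algebra : ℤ-algebra R)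
                         (L : LambertData R algebra) : Set (c Level.⊔ ℓ) where
  open CommutativeRing R
  open _-Raw-AlmostCommutative⟶_ algebra using () renaming (⟦_⟧ to ι)
  open LambertData L
  field
    D      : Carrier → Carrier
    D-cong : ∀ {x y} → x ≈ y → D x ≈ D y
    D-+    : ∀ x y → D (x + y) ≈ D x + D y
    D-*    : ∀ x y → D (x * y) ≈ D x * y + x * D y
    D-ι    : ∀ k → D (ι k) ≈ 0#
    D-Q    : ∀ m → D (Q m) ≈ ι (+ m) * Q m

module Squares {c ℓ} (R : CommutativeRing c ℓ) (algebra : ℤ-algebra R)
               (L : LambertData R algebra) (Δ : LambertDerivation R algebra L) where
  open CommutativeRing R
  open SetoidReasoning setoid
  open LambertIdentities R algebra L public
  open LambertDerivation Δ
  open RingProperties ring using (-0#≈0#)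
  private
    𝟙 : Carrier
    𝟙 = ι ℤ.1ℤ

  D-scale : ∀ k x → D (ι k * x) ≈ ι k * D x
  D-scale k x = trans (D-* (ι k) x) (trans
    (+-congʳ (trans (*-congʳ (D-ι k)) (zeroˡ x))) (+-identityˡ _))

  -- Implicit differentiation of `γ-unfold`. The factor 1 - σ q^m in front of D γ is invertible with
  -- inverse 1 + σ γ, which is the cofactor `v`.
  D-γ : ∀ s i → D (γ s i) ≈ ι (index i) * (γ s i * (𝟙 + ι (σ s) * γ s i))
  D-γ s i = linear 5 (D (γ s i) ∷ γ s i ∷ ι (index i) ∷ ι (σ s) ∷ Q (suc i) ∷ [])
    (λ d x m S a →
      let v = con ℤ.1ℤ :+ S :* x in
      (d := m :* (x :* v)) ,
      (v , (d := (m :* a) :* v :+ a :* (S :* d))) ∷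
      (:- (S :* d :+ m :* v) , (x := a :* v)) ∷ [])
    ((begin
      D (γ s i)
        ≈⟨ D-cong (γ-unfold s i) ⟩
      D (Q (suc i) * (𝟙 + ι (σ s) * γ s i))
        ≈⟨ D-* _ _ ⟩
      D (Q (suc i)) * (𝟙 + ι (σ s) * γ s i) + Q (suc i) * D (𝟙 + ι (σ s) * γ s i)
        ≈⟨ +-cong (*-congʳ (D-Q (suc i))) (*-congˡ (trans (D-+ _ _) (trans
             (+-cong (D-ι ℤ.1ℤ) (D-scale (σ s) (γ s i))) (+-identityˡ _)))) ⟩
      (ι (index i) * Q (suc i)) * (𝟙 + ι (σ s) * γ s i) + Q (suc i) * (ι (σ s) * D (γ s i)) ∎)
     , γ-unfold s i , lift tt) refl

  D-∑ : ∀ n f → D (∑ n f) ≈ ∑[ i < n ] D (f i)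
  D-∑ zero    f = trans (D-cong (sym ι-0)) (D-ι ℤ.0ℤ)
  D-∑ (suc n) f = trans (D-+ _ _) (+-congˡ (D-∑ n (λ i → f (suc i))))

  D-g₃ : D (g 3) ≈ g₃-derivative
  D-g₃ = trans (D-∑ M (λ i → ι (power 3 i) * β i)) (∑-cong M λ i → begin
    D (ι (power 3 i) * β i)
      ≈⟨ trans (D-scale (power 3 i) (β i)) (*-congˡ (D-γ Sign.+ i)) ⟩
    ι (power 3 i) * (ι (index i) * (β i * (𝟙 + 𝟙 * β i)))
      ≈⟨ solve 3 (λ p m b → p :* (m :* (b :* (con ℤ.1ℤ :+ con ℤ.1ℤ :* b))) :=
                            (m :* p) :* (b :+ b :* b)) refl (ι (power 3 i)) (ι (index i)) (β i) ⟩
    (ι (index i) * ι (power 3 i)) * (β i + β i * β i)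
      ≈⟨ *-congʳ (trans (sym (ι-* (index i) (power 3 i))) (ι-cong (index-power 3 i))) ⟩
    ι (power 4 i) * (β i + β i * β i) ∎)

  -- r k = (1 - q^(k+1)) / (1 + q^(k+1)), κ s = 2 / (1 + q^s), and ρ s d is the
  -- product of the r k with s ≤ k < s + d.
  r κ : ℕ → Carrier
  r k = 𝟙 - ι (+ 2) * α k
  κ zero    = 𝟙
  κ (suc s) = ι (+ 2) * (𝟙 - α s)

  ρ : ℕ → ℕ → Carrier
  ρ s zero    = 𝟙
  ρ s (suc d) = ρ s d * r (s ℕ.+ d)

  ρ-head : ∀ s d → ρ s (suc d) ≈ r s * ρ (suc s) d
  ρ-head s zero    = trans (*-comm _ _) (*-congʳ (reflexive (≡.cong r (ℕ.+-identityʳ s))))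
  ρ-head s (suc d) = begin
    ρ s (suc d) * r (s ℕ.+ suc d)          ≈⟨ *-cong (ρ-head s d) (reflexive (≡.cong r (ℕ.+-suc s d))) ⟩
    (r s * ρ (suc s) d) * r (suc s ℕ.+ d)  ≈⟨ *-assoc _ _ _ ⟩
    r s * ρ (suc s) (suc d)                ∎

  κ-sum : ∀ s → κ s * (𝟙 + Q s) ≈ ι (+ 2)
  κ-sum zero    = trans (*-congˡ (+-congˡ Q-0))
    (solve 0 (con ℤ.1ℤ :* (con ℤ.1ℤ :+ con ℤ.1ℤ) := con (+ 2)) refl)
  κ-sum (suc s) = linear 2 (α s ∷ Q (suc s) ∷ [])
    (λ a q → ((con (+ 2) :* (con ℤ.1ℤ :- a)) :* (con ℤ.1ℤ :+ q) := con (+ 2)) ,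
      (con (ℤ.- + 2) , (a := q :* (con ℤ.1ℤ :+ con ℤ.-1ℤ :* a))) ∷ [])
    (γ-unfold Sign.- s , lift tt) refl

  κ-difference : ∀ s → κ (suc s) * (𝟙 - Q (suc s)) ≈ ι (+ 2) * r s
  κ-difference s = linear 2 (α s ∷ Q (suc s) ∷ [])
    (λ a q → ((con (+ 2) :* (con ℤ.1ℤ :- a)) :* (con ℤ.1ℤ :- q) :=
              con (+ 2) :* (con ℤ.1ℤ :- con (+ 2) :* a)) ,
      (con (+ 2) , (a := q :* (con ℤ.1ℤ :+ con ℤ.-1ℤ :* a))) ∷ [])
    (γ-unfold Sign.- s , lift tt) refl

  private
    -- Let P_n be the product of the `r k` with k < n. On s + d = n the summands are (-1)^s κ_s (P_n
    -- / P_s) q^(s (n + 1)), the terms of Shanks' finite sum. `telescope` is the certificate whose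
    -- differences give the increments of the summands in d.
    summand telescope : ℕ → ℕ → Carrier
    summand   s d = ι (sign s) * (κ s * (ρ s d * Q (s ℕ.* suc (s ℕ.+ d))))
    telescope s d = ι (sign s) * (ρ s d * Q (suc s ℕ.* suc (s ℕ.+ d)))

    -- This is 1 / (1 + q^(n+1)).
    e : ℕ → Carrier
    e n = 𝟙 - α n

    ι-sign-suc : ∀ s → ι (sign (suc s)) ≈ - ι (sign s)
    ι-sign-suc s = trans (ι-* ℤ.-1ℤ (sign s))
      (solve 1 (λ x → con ℤ.-1ℤ :* x := :- x) refl (ι (sign s)))

    Q-raise : ∀ s d → Q (s ℕ.* suc (s ℕ.+ suc d)) ≈ Q (s ℕ.* suc (s ℕ.+ d)) * Q s
    Q-raise s d = trans (reflexive (≡.cong Q (exponent s d))) (Q-+ (s ℕ.* suc (s ℕ.+ d)) s)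
      where
      open ℕSolver.+-*-Solver using () renaming
        (solve to ℕ-solve; _:+_ to _⊞_; _:*_ to _⊠_; con to ⟪_⟫; _:=_ to _≐_)
      exponent : ∀ s d → s ℕ.* suc (s ℕ.+ suc d) ≡ s ℕ.* suc (s ℕ.+ d) ℕ.+ s
      exponent = ℕ-solve 2 (λ s d →
        s ⊠ (⟪ 1 ⟫ ⊞ (s ⊞ (⟪ 1 ⟫ ⊞ d))) ≐ s ⊠ (⟪ 1 ⟫ ⊞ (s ⊞ d)) ⊞ s) ≡.refl

    Q-next : ∀ s d → Q (suc s ℕ.* suc (s ℕ.+ d)) ≈ Q (suc (s ℕ.+ d)) * Q (s ℕ.* suc (s ℕ.+ d))
    Q-next s d = Q-+ (suc (s ℕ.+ d)) (s ℕ.* suc (s ℕ.+ d))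

    step-first : ∀ d → summand 0 (suc d) + - summand 0 d ≈ (- ι (+ 2)) * (e d * telescope 0 d)
    step-first d = linear 6 (ρ 0 d ∷ α d ∷ Q (suc d) ∷ Q 0 ∷ ι (sign 0) ∷ Q (1 ℕ.* suc d) ∷ [])
      (λ p a b z s b′ →
        let 𝟏 = con ℤ.1ℤ in
        (s :* (𝟏 :* ((p :* (𝟏 :- con (+ 2) :* a)) :* z)) :+ :- (s :* (𝟏 :* (p :* z))) :=
         (:- con (+ 2)) :* ((𝟏 :- a) :* (s :* (p :* b′)))) ,
        (con (ℤ.- + 2) :* s :* p , (a := b :* (𝟏 :+ con ℤ.-1ℤ :* a))) ∷
        (con (ℤ.- + 2) :* s :* p :* a , (z := 𝟏)) ∷
        (con (+ 2) :* s :* p :* (𝟏 :- a) , (b′ := b)) ∷ [])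
      (γ-unfold Sign.- d , Q-0 , reflexive (≡.cong Q (ℕ.*-identityˡ (suc d))) , lift tt) refl

    -- With x = q^(s+1) and b = q^(s+d+2), the increment is a multiple of κ ((1 - x) + b (1 + x)),
    -- where κ (1 - x) = 2 r and κ (1 + x) = 2. These two parts are the two certificates. The common
    -- factor depends only on s + d and so leaves the sum over an antidiagonal.
    step-next : ∀ s d →
      summand (suc s) (suc d) + - summand (suc s) d ≈
      (ι (+ 2) * e (suc s ℕ.+ d)) * (telescope s (suc d) + - telescope (suc s) d)
    step-next s d = linear 13
      (α (suc s ℕ.+ d) ∷ Q (suc (suc s ℕ.+ d)) ∷ Q (suc s) ∷ κ (suc s) ∷ ρ (suc s) d ∷ r s ∷
       ρ s (suc d) ∷ ι (sign s) ∷ ι (sign (suc s)) ∷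
       Q (suc s ℕ.* suc (suc s ℕ.+ d)) ∷ Q (suc s ℕ.* suc (suc s ℕ.+ suc d)) ∷
       Q (suc (suc s) ℕ.* suc (suc s ℕ.+ d)) ∷ Q (suc s ℕ.* suc (s ℕ.+ suc d)) ∷ [])
      (λ a b x k p r p′ σ σ′ X X↑ Y X′ →
        let 𝟏 = con ℤ.1ℤ ; ē = 𝟏 :- a in
        (σ′ :* (k :* ((p :* (𝟏 :- con (+ 2) :* a)) :* X↑)) :+ :- (σ′ :* (k :* (p :* X))) :=
         (con (+ 2) :* ē) :* (σ :* (p′ :* X′) :+ :- (σ′ :* (p :* Y)))) ,
        (σ′ :* k :* p :* (𝟏 :- con (+ 2) :* a) , (X↑ := X :* x)) ∷
        (con (+ 2) :* ē :* σ′ :* p , (Y := b :* X)) ∷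
        (:- (con (+ 2) :* ē :* σ :* p′) , (X′ := X)) ∷
        (:- (con (+ 2) :* ē :* σ :* X) , (p′ := r :* p)) ∷
        (:- (con (+ 2) :* ē :* r :* p :* X) , (σ′ := :- σ)) ∷
        (:- (σ′ :* p :* X :* ē) , (k :* (𝟏 :- x) := con (+ 2) :* r)) ∷
        (:- (σ′ :* p :* X :* ē :* b) , (k :* (𝟏 :+ x) := con (+ 2))) ∷
        (:- (σ′ :* p :* X :* k :* (𝟏 :+ x)) , (a := b :* (𝟏 :+ con ℤ.-1ℤ :* a))) ∷ [])
      (Q-raise (suc s) d , Q-next (suc s) d ,
       reflexive (≡.cong (λ k → Q (suc s ℕ.* suc k)) (ℕ.+-suc s d)) ,
       ρ-head s d , ι-sign-suc s , κ-difference s , κ-sum (suc s) ,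
       γ-unfold Sign.- (suc s ℕ.+ d) , lift tt) refl

    conv-telescope : ∀ n (X : ℕ → ℕ → Carrier) →
      conv n (λ s d → X s (suc d) + - X (suc s) d) ≈ X 0 n - X n 0
    conv-telescope n X = begin
      conv n (λ s d → X s (suc d) + - X (suc s) d)
        ≈⟨ conv-+ n (λ s d → X s (suc d)) (λ s d → - X (suc s) d) ⟩
      a + conv n (λ s d → - X (suc s) d)
        ≈⟨ +-congˡ (trans (conv-cong n λ s d _ →
             solve 1 (λ x → :- x := con ℤ.-1ℤ :* x) refl (X (suc s) d))
             (conv-*ˡ n (ι ℤ.-1ℤ) (λ s d → X (suc s) d))) ⟩
      a + ι ℤ.-1ℤ * b
        ≈⟨ linear 4 (a ∷ b ∷ X 0 n ∷ X n 0 ∷ [])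
             (λ a b x y → (a :+ con ℤ.-1ℤ :* b := x :- y) , (con ℤ.-1ℤ , (x :+ b := a :+ y)) ∷ [])
             (conv-snoc n X , lift tt) refl ⟩
      X 0 n - X n 0 ∎
      where
      a = conv n (λ s d → X s (suc d))
      b = conv n (λ s d → X (suc s) d)

    shanksSum : ℕ → Carrier
    shanksSum n = conv (suc n) summand

    square-exponent : ∀ n → Q (suc n ℕ.* suc (suc n ℕ.+ 0)) ≈ Q (suc n ℕ.* suc n) * Q (suc n)
    square-exponent n = trans (reflexive (≡.cong Q (exponent n))) (Q-+ (suc n ℕ.* suc n) (suc n))
      where
      open ℕSolver.+-*-Solver using () renaming
        (solve to ℕ-solve; _:+_ to _⊞_; _:*_ to _⊠_; con to ⟪_⟫; _:=_ to _≐_)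
      exponent : ∀ n → suc n ℕ.* suc (suc n ℕ.+ 0) ≡ suc n ℕ.* suc n ℕ.+ suc n
      exponent = ℕ-solve 1 (λ n →
        (⟪ 1 ⟫ ⊞ n) ⊠ (⟪ 1 ⟫ ⊞ ((⟪ 1 ⟫ ⊞ n) ⊞ ⟪ 0 ⟫)) ≐
        (⟪ 1 ⟫ ⊞ n) ⊠ (⟪ 1 ⟫ ⊞ n) ⊞ (⟪ 1 ⟫ ⊞ n)) ≡.refl

  thetaSum : ℕ → Carrier
  thetaSum n = 𝟙 + ∑[ i < n ] (ι (+ 2) * (ι (sign (suc i)) * Q (suc i ℕ.* suc i)))

  private
    -- Going from n to n + 1 raises d in every summand and adds one with d = 0. The increments
    -- telescope; the boundary term at s = 0 cancels against `step-first`, and the one at s = n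
    -- merges with the new summand into a single square power.
    shanksSum-step : ∀ n →
      shanksSum (suc n) ≈
      shanksSum n + ι (+ 2) * (ι (sign (suc n)) * Q (suc n ℕ.* suc n))
    shanksSum-step n = begin
      shanksSum (suc n)
        ≈⟨ conv-snoc (suc n) summand ⟩
      conv (suc n) (λ s d → summand s (suc d)) + summand (suc n) 0
        ≈⟨ +-congʳ (trans (conv-cong (suc n) λ s d _ →
             solve 2 (λ x y → x := y :+ (x :+ :- y)) refl (summand s (suc d)) (summand s d))
             (conv-+ (suc n) summand (λ s d → summand s (suc d) + - summand s d))) ⟩
      (shanksSum n + conv (suc n) (λ s d → summand s (suc d) + - summand s d)) + summand (suc n) 0
        ≈⟨ +-congʳ (+-congˡ (+-cong (step-first n) (trans
             (conv-cong n λ s d eq → trans (step-next s d)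
                (*-congʳ (*-congˡ (reflexive (≡.cong e eq)))))
             (trans (conv-*ˡ n (ι (+ 2) * e n) (λ s d → telescope s (suc d) + - telescope (suc s) d))
                    (*-congˡ (conv-telescope n telescope)))))) ⟩
      (shanksSum n + ((- ι (+ 2)) * (e n * telescope 0 n)
                      + (ι (+ 2) * e n) * (telescope 0 n - telescope n 0))) + summand (suc n) 0
        ≈⟨ linear 9 (shanksSum n ∷ α n ∷ telescope 0 n ∷ ι (sign n) ∷ ι (sign (suc n)) ∷
                     Q (suc n ℕ.* suc (n ℕ.+ 0)) ∷ Q (suc n ℕ.* suc (suc n ℕ.+ 0)) ∷
                     Q (suc n ℕ.* suc n) ∷ Q (suc n) ∷ [])
             (λ S a t σ σ′ X Y q b →
               let 𝟏 = con ℤ.1ℤ ; ē = 𝟏 :- a in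
               ((S :+ ((:- con (+ 2)) :* (ē :* t) :+ (con (+ 2) :* ē) :* (t :- σ :* (𝟏 :* X))))
                 :+ σ′ :* ((con (+ 2) :* ē) :* (𝟏 :* Y)) :=
                S :+ con (+ 2) :* (σ′ :* q)) ,
               (:- (con (+ 2) :* ē :* σ) , (X := q)) ∷
               (con (+ 2) :* ē :* σ′ , (Y := q :* b)) ∷
               (:- (con (+ 2) :* ē :* q) , (σ′ := :- σ)) ∷
               (:- (con (+ 2) :* σ′ :* q) , (a := b :* (𝟏 :+ con ℤ.-1ℤ :* a))) ∷ [])
             (reflexive (≡.cong (λ k → Q (suc n ℕ.* suc k)) (ℕ.+-identityʳ n)) ,
              square-exponent n , ι-sign-suc n , γ-unfold Sign.- n , lift tt) refl ⟩
      shanksSum n + ι (+ 2) * (ι (sign (suc n)) * Q (suc n ℕ.* suc n)) ∎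

    shanksSum≈thetaSum : ∀ n → shanksSum n ≈ thetaSum n
    shanksSum≈thetaSum zero = +-congʳ (linear 1 (Q 0 ∷ [])
      (λ z → (con ℤ.1ℤ :* (con ℤ.1ℤ :* (con ℤ.1ℤ :* z)) := con ℤ.1ℤ) ,
             (con ℤ.1ℤ , (z := con ℤ.1ℤ)) ∷ []) (Q-0 , lift tt) refl)
    shanksSum≈thetaSum (suc n) = trans (shanksSum-step n) (trans
      (+-congʳ (shanksSum≈thetaSum n)) (trans (+-assoc _ _ _)
        (+-congˡ (sym (∑-snoc n (λ i → ι (+ 2) * (ι (sign (suc i)) * Q (suc i ℕ.* suc i))))))))

  -- At n = M every summand with s > 0 contains the vanishing power q^(s (M + 1)); only the product
  -- at s = 0 is left of Shanks' sum.
  gauss : thetaSum M ≈ ρ 0 M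
  gauss = begin
    thetaSum M
      ≈⟨ shanksSum≈thetaSum M ⟨
    summand 0 M + conv M (λ s d → summand (suc s) d)
      ≈⟨ +-cong
           (linear 2 (ρ 0 M ∷ Q 0 ∷ [])
             (λ p z → (con ℤ.1ℤ :* (con ℤ.1ℤ :* (p :* z)) := p) , (p , (z := con ℤ.1ℤ)) ∷ [])
             (Q-0 , lift tt) refl)
           (trans (conv-cong M λ s d eq → vanish s d eq)
                  (trans (conv-fst M (λ _ → 0#)) (∑-zero M λ _ _ → refl))) ⟩
    ρ 0 M + 0#
      ≈⟨ +-identityʳ _ ⟩
    ρ 0 M ∎
    where
    vanish : ∀ s d → suc (s ℕ.+ d) ≡ M → summand (suc s) d ≈ 0#
    vanish s d eq = trans (*-congˡ (trans (*-congˡ (trans (*-congˡ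
      (Q-nil _ (ℕ.≤-trans (ℕ.≤-reflexive (≡.sym eq))
         (ℕ.≤-trans (ℕ.n≤1+n _) (ℕ.m≤m+n (suc (suc s ℕ.+ d)) _)))))
      (zeroʳ _))) (zeroʳ _))) (zeroʳ _)

  private
    -- Every factor contributes D r = -m (α + β) r. Since r = 1 - 2 α and D α = m α (1 - α), this is
    -- again the relation 2 α β = β - α.
    D-ρ : ∀ d → D (ρ 0 d) ≈ (- ∑[ i < d ] (ι (index i) * (α i + β i))) * ρ 0 d
    D-ρ zero    = trans (D-ι ℤ.1ℤ) (sym (trans (*-congʳ -0#≈0#) (zeroˡ _)))
    D-ρ (suc d) = begin
      D (ρ 0 d * r d)
        ≈⟨ D-* (ρ 0 d) (r d) ⟩
      D (ρ 0 d) * r d + ρ 0 d * D (r d)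
        ≈⟨ linear 9 (D (ρ 0 d) ∷ D (r d) ∷ D (α d) ∷ ρ 0 d ∷ ι (index d) ∷ α d ∷ β d ∷
                     ∑[ i < d ] (ι (index i) * (α i + β i)) ∷
                     ∑[ i < suc d ] (ι (index i) * (α i + β i)) ∷ [])
             (λ dp dr da p m a b w w′ →
               let 𝟏 = con ℤ.1ℤ ; r = 𝟏 :- con (+ 2) :* a in
               (dp :* r :+ p :* dr := (:- w′) :* (p :* r)) ,
               (r , (dp := (:- w) :* p)) ∷
               (p , (dr := (:- con (+ 2)) :* da)) ∷
               (:- (con (+ 2) :* p) , (da := m :* (a :* (𝟏 :+ con ℤ.-1ℤ :* a)))) ∷
               (p :* r , (w′ := w :+ m :* (a :+ b))) ∷
               (:- (p :* m) , (con (+ 2) :* (a :* b) := b :- a)) ∷ [])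
             (D-ρ d , D-r , D-γ Sign.- d , ∑-snoc d (λ i → ι (index i) * (α i + β i)) ,
              αβ-sameIndex d , lift tt) refl ⟩
      (- ∑[ i < suc d ] (ι (index i) * (α i + β i))) * (ρ 0 d * r d) ∎
      where
      D-r : D (r d) ≈ (- ι (+ 2)) * D (α d)
      D-r = begin
        D (𝟙 - ι (+ 2) * α d)
          ≈⟨ D-cong (solve 1 (λ a → con ℤ.1ℤ :- con (+ 2) :* a := con ℤ.1ℤ :+ con (ℤ.- + 2) :* a)
               refl (α d)) ⟩
        D (𝟙 + ι (ℤ.- + 2) * α d)
          ≈⟨ trans (D-+ _ _) (trans (+-cong (D-ι ℤ.1ℤ) (D-scale (ℤ.- + 2) (α d))) (+-identityˡ _)) ⟩
        ι (ℤ.- + 2) * D (α d)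
          ≈⟨ *-congʳ (ι-neg (+ 2)) ⟩
        (- ι (+ 2)) * D (α d) ∎

  D-thetaSum : D (thetaSum M) ≈ (- W) * thetaSum M
  D-thetaSum = trans (D-cong gauss) (trans (D-ρ M) (*-cong (-‿cong W-sum) (sym gauss)))
    where
    W-sum : ∑[ i < M ] (ι (index i) * (α i + β i)) ≈ W
    W-sum = trans (∑-cong M λ i → distribˡ _ _ _)
      (∑-+ M (λ i → ι (index i) * α i) (λ i → ι (index i) * β i))

  -- Jacobi's eight-square series at -q: differential equation, square and cube

  D₃ : Carrier
  D₃ = 𝟙 + ι (+ 16) * g 3

  -- A and E are the forms of weight two with D₃ = A², 1 - 16 u₃ = A E and
  -- 1 - 8 g₅ = A² E.
  D-D₃ : D D₃ ≈ (ι (ℤ.- + 8) * W) * D₃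
  D-D₃ = linear 8 (D D₃ ∷ g₃-derivative ∷ W ∷ u 1 ∷ u 3 ∷ g 1 ∷ g 3 ∷ g 5 ∷ [])
    (λ dd v w u₁ u₃ g₁ g₃ g₅ →
      let 𝟏 = con ℤ.1ℤ
          A = 𝟏 :+ con (+ 8) :* u₁
          E = 𝟏 :+ con (+ 8) :* (w :- g₁) in
      (dd := (con (ℤ.- + 8) :* w) :* (𝟏 :+ con (+ 16) :* g₃)) ,
      (𝟏 , (dd := con (+ 16) :* v)) ∷
      (con (ℤ.- + 8) , (con (ℤ.- + 16) :* (g₁ :* g₃) :=
                        (con (+ 2) :* v :- g₅) :- (con (+ 2) :* g₃ :- g₁))) ∷
      (con (ℤ.- + 8) , (con (+ 16) :* (u₁ :* u₃) := g₅ :- (con (+ 2) :* u₃ :- u₁))) ∷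
      (con (ℤ.- + 8) :* A , (con (+ 8) :* (u₁ :* g₁) :=
            (((con (+ 8) :* (w :* u₁) :+ con (+ 2) :* u₃) :- g₁) :+ w) :+ u₁)) ∷
      (con (ℤ.- + 16) :* E , (con (+ 4) :* (u₁ :* u₁) := g₃ :- u₁)) ∷ [])
    (D-linear , g₁g₃-identity , g₅-identity , u₃-identity , g₃-identity , lift tt) refl
    where
    D-linear : D D₃ ≈ ι (+ 16) * g₃-derivative
    D-linear = trans (D-+ _ _) (trans
      (+-cong (D-ι ℤ.1ℤ) (trans (D-scale (+ 16) (g 3)) (*-congˡ D-g₃))) (+-identityˡ _))

  private
    -- 4 A B₅ = B₃² + 3 D₃²
    hankel : ι (+ 3) * (D₃ * D₃) ≈
             ι (+ 4) * ((𝟙 + ι (+ 8) * u 1) * (𝟙 + ι (+ 8) * u 5))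
             - (𝟙 - ι (+ 16) * u 3) * (𝟙 - ι (+ 16) * u 3)
    hankel = linear 6 (W ∷ u 1 ∷ u 3 ∷ u 5 ∷ g 1 ∷ g 3 ∷ [])
      (λ w u₁ u₃ u₅ g₁ g₃ →
        let 𝟏 = con ℤ.1ℤ
            A = 𝟏 :+ con (+ 8) :* u₁ ; B₃ = 𝟏 :- con (+ 16) :* u₃ ; B₅ = 𝟏 :+ con (+ 8) :* u₅
            D₃ = 𝟏 :+ con (+ 16) :* g₃ in
        (con (+ 3) :* (D₃ :* D₃) := con (+ 4) :* (A :* B₅) :- B₃ :* B₃) ,
        (con (+ 8) :* A , (con (+ 16) :* (u₃ :* g₁) :+ con (+ 48) :* (u₁ :* g₃) :=
          (((((con (+ 16) :* (w :* u₃) :+ con (+ 4) :* u₅) :- con (+ 6) :* g₃) :+ g₁) :- w)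
            :+ con (+ 2) :* u₃) :- con (+ 3) :* u₁)) ∷
        (con (ℤ.- + 48) :* D₃ , (con (+ 4) :* (u₁ :* u₁) := g₃ :- u₁)) ∷
        (con (+ 8) :* B₃ , (con (+ 8) :* (u₁ :* g₁) :=
            (((con (+ 8) :* (w :* u₁) :+ con (+ 2) :* u₃) :- g₁) :+ w) :+ u₁)) ∷ [])
      (u₅-identity , g₃-identity , u₃-identity , lift tt) refl

  D₃-squared : ι (+ 3) * (D₃ * D₃) ≈
               (ι (+ 3) + ι (+ 32) * ((u 1 + u 3) + u 5)) + ι (+ 256) * (u 1 * u 5 - u 3 * u 3)
  D₃-squared = trans hankel (solve 3 (λ u₁ u₃ u₅ →
      let 𝟏 = con ℤ.1ℤ
          A = 𝟏 :+ con (+ 8) :* u₁ ; B₃ = 𝟏 :- con (+ 16) :* u₃ ; B₅ = 𝟏 :+ con (+ 8) :* u₅ in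
      con (+ 4) :* (A :* B₅) :- B₃ :* B₃ :=
      (con (+ 3) :+ con (+ 32) :* ((u₁ :+ u₃) :+ u₅)) :+ con (+ 256) :* (u₁ :* u₅ :- u₃ :* u₃))
    refl (u 1) (u 3) (u 5))

  -- Twelve A B₅ plus five B₃² equals 17 + 32 g₇, and 4 A B₅ = B₃² + 3 D₃² turns this into 9 D₃² + 8
  -- B₃² = 17 + 32 g₇. Multiplying by D₃ = A² and using A B₃ = D₅ gives 9 D₃³ = D₃ (17 + 32 g₇) - 8
  -- D₅².
  D₃-cubed : ι (+ 9) * (D₃ * (D₃ * D₃)) ≈
             (ι (+ 9) + ι (+ 16) * ((ι (+ 17) * g 3 + ι (+ 8) * g 5) + ι (+ 2) * g 7))
             + ι (+ 512) * (g 3 * g 7 - g 5 * g 5)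
  D₃-cubed = linear 6 (u 1 ∷ u 3 ∷ u 5 ∷ g 3 ∷ g 5 ∷ g 7 ∷ [])
    (λ u₁ u₃ u₅ g₃ g₅ g₇ →
      let 𝟏 = con ℤ.1ℤ
          A = 𝟏 :+ con (+ 8) :* u₁ ; B₃ = 𝟏 :- con (+ 16) :* u₃ ; B₅ = 𝟏 :+ con (+ 8) :* u₅
          D₃ = 𝟏 :+ con (+ 16) :* g₃ ; D₅ = 𝟏 :- con (+ 8) :* g₅ in
      (con (+ 9) :* (D₃ :* (D₃ :* D₃)) :=
       (con (+ 9) :+ con (+ 16) :* ((con (+ 17) :* g₃ :+ con (+ 8) :* g₅) :+ con (+ 2) :* g₇))
         :+ con (+ 512) :* (g₃ :* g₇ :- g₅ :* g₅)) ,
      (con (+ 32) :* D₃ , (con (+ 24) :* (u₁ :* u₅) :+ con (+ 40) :* (u₃ :* u₃) :=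
         g₇ :- ((con (+ 3) :* u₅ :- con (+ 5) :* u₃) :+ con (+ 3) :* u₁))) ∷
      (con (+ 64) :* (D₅ :+ A :* B₃) , (con (+ 16) :* (u₁ :* u₃) := g₅ :- (con (+ 2) :* u₃ :- u₁))) ∷
      (con (+ 3) :* D₃ , (con (+ 3) :* (D₃ :* D₃) := con (+ 4) :* (A :* B₅) :- B₃ :* B₃)) ∷
      (con (+ 128) :* (B₃ :* B₃) , (con (+ 4) :* (u₁ :* u₁) := g₃ :- u₁)) ∷ [])
    (g₇-identity , g₅-identity , hankel , g₃-identity , lift tt) refl

  private
    D-square : ∀ c x → D x ≈ (ι c * W) * x → D (x * x) ≈ (ι (+ 2 ℤ.* c) * W) * (x * x)
    D-square c x Dx = trans (D-* x x)
      (linear 5 (D x ∷ x ∷ W ∷ ι c ∷ ι (+ 2 ℤ.* c) ∷ [])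
        (λ d x w c c′ → (d :* x :+ x :* d := (c′ :* w) :* (x :* x)) ,
           (con (+ 2) :* x , (d := (c :* w) :* x)) ∷ (:- (w :* (x :* x)) , (c′ := con (+ 2) :* c)) ∷ [])
        (Dx , ι-* (+ 2) c , lift tt) refl)

  thetaSum⁸ : Carrier
  thetaSum⁸ = Θ⁴ * Θ⁴
    where
    Θ² = thetaSum M * thetaSum M
    Θ⁴ = Θ² * Θ²

  D-thetaSum⁸ : D thetaSum⁸ ≈ (ι (ℤ.- + 8) * W) * thetaSum⁸
  D-thetaSum⁸ = D-square (ℤ.- + 4) _ (D-square (ℤ.- + 2) _ (D-square ℤ.-1ℤ (thetaSum M)
    (linear 3 (D (thetaSum M) ∷ W ∷ thetaSum M ∷ [])
      (λ d w x → (d := (con ℤ.-1ℤ :* w) :* x) , (con ℤ.1ℤ , (d := (:- w) :* x)) ∷ [])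
      (D-thetaSum , lift tt) refl)))

  -- By linearity of the equation, comparing two solutions is reduced to showing that one solution
  -- with zero constant term vanishes.
  D-difference : ∀ w {x y} → D x ≈ w * x → D y ≈ w * y → D (x - y) ≈ w * (x - y)
  D-difference w {x} {y} Dx Dy = linear 6 (D (x - y) ∷ D x ∷ D (- y) ∷ w ∷ x ∷ y ∷ [])
    (λ d dx dy′ w x y → (d := w :* (x :- y)) ,
      (con ℤ.1ℤ , (d := dx :+ dy′)) ∷ (con ℤ.1ℤ , (dx := w :* x)) ∷
      (con ℤ.1ℤ , (dy′ := :- (w :* y))) ∷ [])
    (D-+ x (- y) , Dx , D-neg , lift tt) refl
    where
    D-neg : D (- y) ≈ - (w * y)
    D-neg = begin
      D (- y)           ≈⟨ D-cong (solve 1 (λ y → :- y := con ℤ.-1ℤ :* y) refl y) ⟩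
      D (ι ℤ.-1ℤ * y)   ≈⟨ trans (D-scale ℤ.-1ℤ y) (*-congˡ Dy) ⟩
      ι ℤ.-1ℤ * (w * y) ≈⟨ solve 1 (λ y → con ℤ.-1ℤ :* y := :- y) refl (w * y) ⟩
      - (w * y)         ∎

-- Formal power series with integer coefficients

Series : Set
Series = ℕ → ℤ

module Σℤ = RangeSums ℤ.+-*-commutativeRing

module SeriesOperations where
  open ≡.≡-Reasoning
  open ℤSolver.+-*-Solver
  open Σℤ

  infixl 6 _⊕_
  infixl 7 _⊛_
  infix  8 ⊖_

  _⊕_ _⊛_ : Series → Series → Series
  (a ⊕ b) k = a k ℤ.+ b k
  (a ⊛ b) k = conv (suc k) (λ i j → a i ℤ.* b j)

  ⊖_ : Series → Series
  (⊖ a) k = ℤ.- a k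

  constant : ℤ → Series
  constant c zero    = c
  constant c (suc k) = ℤ.0ℤ

  monomial : ℕ → Series
  monomial zero    k       = constant ℤ.1ℤ k
  monomial (suc m) zero    = ℤ.0ℤ
  monomial (suc m) (suc k) = monomial m k

  ⊛-comm : ∀ a b k → (a ⊛ b) k ≡ (b ⊛ a) k
  ⊛-comm a b k = ≡.trans (conv-swap (suc k) (λ i j → a i ℤ.* b j))
    (conv-cong (suc k) λ i j _ → ℤ.*-comm (a j) (b i))

  ⊛-distribʳ : ∀ a b c k → ((b ⊕ c) ⊛ a) k ≡ (b ⊛ a) k ℤ.+ (c ⊛ a) k
  ⊛-distribʳ a b c k = ≡.trans
    (conv-cong (suc k) λ i j _ → ℤ.*-distribʳ-+ (a j) (b i) (c i))
    (conv-+ (suc k) (λ i j → b i ℤ.* a j) (λ i j → c i ℤ.* a j))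

  scale-⊛ : ∀ x a b k → ((λ i → x ℤ.* a i) ⊛ b) k ≡ x ℤ.* (a ⊛ b) k
  scale-⊛ x a b k = ≡.trans
    (conv-cong (suc k) λ i j _ → ℤ.*-assoc x (a i) (b j))
    (conv-*ˡ (suc k) x (λ i j → a i ℤ.* b j))

  ⊛-assoc : ∀ a b c k → ((a ⊛ b) ⊛ c) k ≡ (a ⊛ (b ⊛ c)) k
  ⊛-assoc a b c zero = solve 3 (λ a b c →
    (a :* b :+ con ℤ.0ℤ) :* c :+ con ℤ.0ℤ := a :* (b :* c :+ con ℤ.0ℤ) :+ con ℤ.0ℤ) ≡.refl (a 0) (b 0) (c 0)
  ⊛-assoc a b c (suc k) = begin
    (a 0 ℤ.* b 0 ℤ.+ ℤ.0ℤ) ℤ.* c (suc k) ℤ.+ (((λ i → a 0 ℤ.* b (suc i)) ⊕ (a′ ⊛ b)) ⊛ c) k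
      ≡⟨ ≡.cong (λ z → (a 0 ℤ.* b 0 ℤ.+ ℤ.0ℤ) ℤ.* c (suc k) ℤ.+ z) (≡.trans
           (⊛-distribʳ c (λ i → a 0 ℤ.* b (suc i)) (a′ ⊛ b) k)
           (≡.cong₂ ℤ._+_ (scale-⊛ (a 0) b′ c k) (⊛-assoc a′ b c k))) ⟩
    (a 0 ℤ.* b 0 ℤ.+ ℤ.0ℤ) ℤ.* c (suc k) ℤ.+ (a 0 ℤ.* (b′ ⊛ c) k ℤ.+ (a′ ⊛ (b ⊛ c)) k)
      ≡⟨ solve 5 (λ a b c x y → (a :* b :+ con ℤ.0ℤ) :* c :+ (a :* x :+ y) :=
                                a :* (b :* c :+ x) :+ y) ≡.refl
           (a 0) (b 0) (c (suc k)) ((b′ ⊛ c) k) ((a′ ⊛ (b ⊛ c)) k) ⟩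
    a 0 ℤ.* (b 0 ℤ.* c (suc k) ℤ.+ (b′ ⊛ c) k) ℤ.+ (a′ ⊛ (b ⊛ c)) k ∎
    where
    a′ b′ : Series
    a′ i = a (suc i)
    b′ i = b (suc i)

  zero-⊛ : ∀ a b k → (∀ i → a i ≡ ℤ.0ℤ) → (a ⊛ b) k ≡ ℤ.0ℤ
  zero-⊛ a b k a≡0 = ≡.trans
    (conv-cong (suc k) λ i j _ → ≡.trans (≡.cong (ℤ._* b j) (a≡0 i)) (ℤ.*-zeroˡ (b j)))
    (≡.trans (conv-fst (suc k) (λ _ → ℤ.0ℤ)) (∑-zero (suc k) λ _ _ → ≡.refl))

  constant-⊛ : ∀ c a k → (constant c ⊛ a) k ≡ c ℤ.* a k
  constant-⊛ c a zero    = ℤ.+-identityʳ _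
  constant-⊛ c a (suc k) = ≡.trans
    (≡.cong (λ z → c ℤ.* a (suc k) ℤ.+ z) (zero-⊛ (λ i → ℤ.0ℤ) a k λ _ → ≡.refl))
    (ℤ.+-identityʳ _)

  monomial-+ : ∀ m n k → monomial (m ℕ.+ n) k ≡ (monomial m ⊛ monomial n) k
  monomial-+ zero    n k       = ≡.sym (≡.trans (constant-⊛ ℤ.1ℤ (monomial n) k) (ℤ.*-identityˡ _))
  monomial-+ (suc m) n zero    = ≡.refl
  monomial-+ (suc m) n (suc k) = ≡.trans (monomial-+ m n k) (≡.sym (≡.trans
    (≡.cong (ℤ._+ (monomial m ⊛ monomial n) k) (ℤ.*-zeroˡ (monomial n (suc k)))) (ℤ.+-identityˡ _)))

  monomial-low : ∀ {m k} → k ℕ.< m → monomial m k ≡ ℤ.0ℤ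
  monomial-low {suc m} {zero}  k<m       = ≡.refl
  monomial-low {suc m} {suc k} (s≤s k<m) = monomial-low k<m

  monomial-support : ∀ m k → monomial m k ≡ ℤ.0ℤ ⊎ k ≡ m
  monomial-support zero    zero    = inj₂ ≡.refl
  monomial-support zero    (suc k) = inj₁ ≡.refl
  monomial-support (suc m) zero    = inj₁ ≡.refl
  monomial-support (suc m) (suc k) with monomial-support m k
  ... | inj₁ eq = inj₁ eq
  ... | inj₂ eq = inj₂ (≡.cong suc eq)

  derivative : Series → Series
  derivative a k = + k ℤ.* a k

  derivative-⊛ : ∀ a b k →
    derivative (a ⊛ b) k ≡ (derivative a ⊛ b) k ℤ.+ (a ⊛ derivative b) k
  derivative-⊛ a b k = begin
    + k ℤ.* (a ⊛ b) k
      ≡⟨ conv-*ˡ (suc k) (+ k) (λ i j → a i ℤ.* b j) ⟨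
    conv (suc k) (λ i j → + k ℤ.* (a i ℤ.* b j))
      ≡⟨ conv-cong (suc k) (λ i j eq → ≡.trans
           (≡.cong (λ n → + n ℤ.* (a i ℤ.* b j)) (≡.sym (ℕ.suc-injective eq)))
           (solve 4 (λ i j a b → (i :+ j) :* (a :* b) := (i :* a) :* b :+ a :* (j :* b)) ≡.refl
              (+ i) (+ j) (a i) (b j))) ⟩
    conv (suc k) (λ i j → (+ i ℤ.* a i) ℤ.* b j ℤ.+ a i ℤ.* (+ j ℤ.* b j))
      ≡⟨ conv-+ (suc k) (λ i j → (+ i ℤ.* a i) ℤ.* b j) (λ i j → a i ℤ.* (+ j ℤ.* b j)) ⟩
    (derivative a ⊛ b) k ℤ.+ (a ⊛ derivative b) k ∎

open SeriesOperations

-- The coefficients of Σ_{i < N} Σ_{y < Y} w i y q^((i + 1)(y + 1)).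
lattice : (ℕ → ℕ → ℤ) → ℕ → ℕ → Series
lattice w N Y k = Σℤ.∑ N λ i → Σℤ.∑ Y λ y → w i y ℤ.* monomial (suc i ℕ.* suc y) k

-- Only pairs with (i + 1) (y + 1) = k reach the coefficient k, and these have i, y < k. So the
-- bounds `k` already describe the infinite double sum.
lambertSeries : (ℕ → ℕ → ℤ) → Series
lambertSeries w k = lattice w k k k

thetaLattice : ℕ → Series
thetaLattice N k =
  constant ℤ.1ℤ k ℤ.+ Σℤ.∑ N λ i → + 2 ℤ.* (sign (suc i) ℤ.* monomial (suc i ℕ.* suc i) k)

thetaSeries : Series
thetaSeries k = thetaLattice k k

scaled-low : ∀ c {m k} → k ℕ.< m → c ℤ.* monomial m k ≡ ℤ.0ℤ
scaled-low c k<m = ≡.trans (≡.cong (c ℤ.*_) (monomial-low k<m)) (ℤ.*-zeroʳ c)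

lattice-stable : ∀ w {N Y k} → k ℕ.≤ N → k ℕ.≤ Y → lattice w N Y k ≡ lambertSeries w k
lattice-stable w {N} {Y} {k} k≤N k≤Y = ≡.trans
  (Σℤ.∑-cong N λ i → Σℤ.∑-extend (term i) k≤Y λ y k≤y →
     scaled-low (w i y) (ℕ.≤-trans (s≤s k≤y) (ℕ.m≤m+n (suc y) _)))
  (Σℤ.∑-extend (λ i → Σℤ.∑ k (term i)) k≤N λ i k≤i → Σℤ.∑-zero k λ y _ →
     scaled-low (w i y) (ℕ.≤-trans (s≤s k≤i) (ℕ.m≤m*n (suc i) (suc y))))
  where
  term : ℕ → ℕ → ℤ
  term i y = w i y ℤ.* monomial (suc i ℕ.* suc y) k

thetaLattice-stable : ∀ {N k} → k ℕ.≤ N → thetaLattice N k ≡ thetaSeries k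
thetaLattice-stable {N} {k} k≤N = ≡.cong (λ z → constant ℤ.1ℤ k ℤ.+ z)
  (Σℤ.∑-extend (λ i → + 2 ℤ.* (sign (suc i) ℤ.* monomial (suc i ℕ.* suc i) k)) k≤N
    λ i k≤i → ≡.cong (+ 2 ℤ.*_)
      (scaled-low (sign (suc i)) (ℕ.≤-trans (s≤s k≤i) (ℕ.m≤m+n (suc i) _))))

-- ℤ[[q]] modulo q^M.
module Truncated (M : ℕ) where
  infix 4 _≈_
  _≈_ : Series → Series → Set
  a ≈ b = ∀ k → k ℕ.< M → a k ≡ b k

  private
    ⊛-cong : ∀ {a b c d} → a ≈ b → c ≈ d → (a ⊛ c) ≈ (b ⊛ d)
    ⊛-cong a≈b c≈d k k<M = Σℤ.conv-cong (suc k) λ i j eq → ≡.cong₂ ℤ._*_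
      (a≈b i (ℕ.≤-<-trans (ℕ.≤-trans (ℕ.m≤m+n i j) (ℕ.≤-reflexive (ℕ.suc-injective eq))) k<M))
      (c≈d j (ℕ.≤-<-trans (ℕ.≤-trans (ℕ.m≤n+m j i) (ℕ.≤-reflexive (ℕ.suc-injective eq))) k<M))

    1⊛ : ∀ a k → (constant ℤ.1ℤ ⊛ a) k ≡ a k
    1⊛ a k = ≡.trans (constant-⊛ ℤ.1ℤ a k) (ℤ.*-identityˡ (a k))

  commutativeRing : CommutativeRing 0ℓ 0ℓ
  commutativeRing = record
    { Carrier = Series ; _≈_ = _≈_ ; _+_ = _⊕_ ; _*_ = _⊛_ ; -_ = ⊖_
    ; 0# = λ _ → ℤ.0ℤ ; 1# = constant ℤ.1ℤ
    ; isCommutativeRing = record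
      { isRing = record
        { +-isAbelianGroup = record
          { isGroup = record
            { isMonoid = record
              { isSemigroup = record
                { isMagma = record
                  { isEquivalence = record
                    { refl  = λ _ _ → ≡.refl
                    ; sym   = λ a≈b k k<M → ≡.sym (a≈b k k<M)
                    ; trans = λ a≈b b≈c k k<M → ≡.trans (a≈b k k<M) (b≈c k k<M) }
                  ; ∙-cong = λ a≈b c≈d k k<M → ≡.cong₂ ℤ._+_ (a≈b k k<M) (c≈d k k<M) }
                ; assoc = λ a b c k _ → ℤ.+-assoc (a k) (b k) (c k) }
              ; identity = (λ a k _ → ℤ.+-identityˡ (a k)) , (λ a k _ → ℤ.+-identityʳ (a k)) }
            ; inverse = (λ a k _ → ℤ.+-inverseˡ (a k)) , (λ a k _ → ℤ.+-inverseʳ (a k))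
            ; ⁻¹-cong = λ a≈b k k<M → ≡.cong ℤ.-_ (a≈b k k<M) }
          ; comm = λ a b k _ → ℤ.+-comm (a k) (b k) }
        ; *-cong = ⊛-cong
        ; *-assoc = λ a b c k _ → ⊛-assoc a b c k
        ; *-identity = (λ a k _ → 1⊛ a k) ,
                       (λ a k _ → ≡.trans (⊛-comm a (constant ℤ.1ℤ) k) (1⊛ a k))
        ; distrib = (λ a b c k _ → ≡.trans (⊛-comm a (b ⊕ c) k) (≡.trans (⊛-distribʳ a b c k)
                      (≡.cong₂ ℤ._+_ (⊛-comm b a k) (⊛-comm c a k)))) ,
                    (λ a b c k _ → ⊛-distribʳ a b c k) }
      ; *-comm = λ a b k _ → ⊛-comm a b k } }

  algebra : ℤ-algebra commutativeRing
  algebra = record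
    { ⟦_⟧    = constant
    ; +-homo = λ { a b zero _ → ≡.refl ; a b (suc k) _ → ≡.refl }
    ; *-homo = λ a b k _ → ≡.sym (≡.trans (constant-⊛ a (constant b) k) (times a b k))
    ; -‿homo = λ { a zero _ → ≡.refl ; a (suc k) _ → ≡.refl }
    ; 0-homo = λ { zero _ → ≡.refl ; (suc k) _ → ≡.refl }
    ; 1-homo = λ _ _ → ≡.refl }
    where
    times : ∀ a b k → a ℤ.* constant b k ≡ constant (a ℤ.* b) k
    times a b zero    = ≡.refl
    times a b (suc k) = ℤ.*-zeroʳ a

  open CommutativeRing commutativeRing using (_+_; _*_; setoid; *-cong; +-congˡ; *-congˡ; zeroʳ; +-identityʳ; distribˡ; trans; sym)
  module Sums = RangeSums commutativeRing

  ∑-coefficient : ∀ n f k → Sums.∑ n f k ≡ Σℤ.∑ n (λ i → f i k)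
  ∑-coefficient zero    f k = ≡.refl
  ∑-coefficient (suc n) f k = ≡.cong (λ z → f 0 k ℤ.+ z) (∑-coefficient n (λ i → f (suc i)) k)

  geometric : Sign → ℕ → Series
  geometric s i = Sums.∑ M (λ y → constant (σ s ℤ.^ y) ⊛ monomial (suc i ℕ.* suc y))

  private
    open ScalarSolver commutativeRing algebra using (linear; _:=_; _:*_; ι-*)
    Q-nil : ∀ m → M ℕ.≤ m → monomial m ≈ (λ _ → ℤ.0ℤ)
    Q-nil m M≤m k k<M = monomial-low (ℕ.<-≤-trans k<M M≤m)

    geometric-unfold : ∀ s i →
      geometric s i ≈ monomial (suc i) ⊛ (constant ℤ.1ℤ ⊕ constant (σ s) ⊛ geometric s i)
    geometric-unfold s i = begin
      Sums.∑ M f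
        ≈⟨ CommutativeRing.+-identityʳ commutativeRing _ ⟨
      Sums.∑ M f ⊕ (λ _ → ℤ.0ℤ)
        -- The term `f M` is zero modulo q^M. Appending it allows the first term to be detached
        -- while `M` shifted terms remain.
        ≈⟨ +-congˡ {Sums.∑ M f} (trans {f M} (*-congˡ {constant (σ s ℤ.^ M)}
             (Q-nil (suc i ℕ.* suc M) (ℕ.≤-trans (ℕ.n≤1+n M) (ℕ.m≤m+n (suc M) _)))) (zeroʳ (constant (σ s ℤ.^ M)))) ⟨
      Sums.∑ M f ⊕ f M
        ≈⟨ Sums.∑-snoc M f ⟨
      f 0 ⊕ Sums.∑ M (λ y → f (suc y))
        ≈⟨ CommutativeRing.+-cong commutativeRing {f 0} {a ⊛ constant ℤ.1ℤ} first
             (Sums.∑-cong M next) ⟩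
      (a ⊛ constant ℤ.1ℤ) ⊕ Sums.∑ M (λ y → (a ⊛ constant (σ s)) ⊛ f y)
        ≈⟨ +-congˡ {a ⊛ constant ℤ.1ℤ} (Sums.∑-*ˡ M (a ⊛ constant (σ s)) f) ⟩
      (a ⊛ constant ℤ.1ℤ) ⊕ (a ⊛ constant (σ s)) ⊛ Sums.∑ M f
        ≈⟨ +-congˡ {a ⊛ constant ℤ.1ℤ} (CommutativeRing.*-assoc commutativeRing a (constant (σ s)) (Sums.∑ M f)) ⟩
      (a ⊛ constant ℤ.1ℤ) ⊕ a ⊛ (constant (σ s) ⊛ Sums.∑ M f)
        ≈⟨ distribˡ a (constant ℤ.1ℤ) (constant (σ s) ⊛ Sums.∑ M f) ⟨
      a ⊛ (constant ℤ.1ℤ ⊕ constant (σ s) ⊛ geometric s i) ∎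
      where
      open SetoidReasoning setoid
      a : Series
      a = monomial (suc i)
      f : ℕ → Series
      f y = constant (σ s ℤ.^ y) ⊛ monomial (suc i ℕ.* suc y)
      first : f 0 ≈ a ⊛ constant ℤ.1ℤ
      first k _ = ≡.trans (⊛-comm (constant ℤ.1ℤ) (monomial (suc i ℕ.* 1)) k)
        (≡.cong (λ n → (monomial n ⊛ constant ℤ.1ℤ) k) (ℕ.*-identityʳ (suc i)))
      next : ∀ y → f (suc y) ≈ (a ⊛ constant (σ s)) ⊛ f y
      next y = linear 6
        (constant (σ s ℤ.^ suc y) ∷ constant (σ s) ∷ constant (σ s ℤ.^ y) ∷
         monomial (suc i ℕ.* suc (suc y)) ∷ a ∷ monomial (suc i ℕ.* suc y) ∷ [])
        (λ c′ c d q′ a q → (c′ :* q′ := (a :* c) :* (d :* q)) ,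
           (q′ , (c′ := c :* d)) ∷ (c :* d , (q′ := a :* q)) ∷ [])
        ((λ k k<M → ι-* (σ s) (σ s ℤ.^ y) k k<M) ,
         (λ k _ → ≡.trans (≡.cong (λ n → monomial n k) (ℕ.*-suc (suc i) (suc y)))
                          (monomial-+ (suc i) (suc i ℕ.* suc y) k)) , lift tt)
        (λ _ _ → ≡.refl)

  lambertData : LambertData commutativeRing algebra
  lambertData = record
    { M = M ; Q = monomial ; Q-0 = λ _ _ → ≡.refl ; Q-+ = λ m n k _ → monomial-+ m n k
    ; Q-nil = Q-nil ; γ = geometric ; γ-unfold = geometric-unfold }

  lambertDerivation : LambertDerivation commutativeRing algebra lambertData
  lambertDerivation = record
    { D = derivative
    ; D-cong = λ a≈b k k<M → ≡.cong (+ k ℤ.*_) (a≈b k k<M)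
    ; D-+ = λ a b k _ → ℤ.*-distribˡ-+ (+ k) (a k) (b k)
    ; D-* = λ a b k _ → derivative-⊛ a b k
    ; D-ι = λ { c zero _ → ℤ.*-zeroˡ c ; c (suc k) _ → ℤ.*-zeroʳ (+ suc k) }
    ; D-Q = λ m k _ → ≡.trans (D-monomial m k) (≡.sym (constant-⊛ (+ m) (monomial m) k)) }
    where
    D-monomial : ∀ m k → + k ℤ.* monomial m k ≡ + m ℤ.* monomial m k
    D-monomial m k with monomial-support m k
    ... | inj₁ eq     = ≡.trans (≡.trans (≡.cong (+ k ℤ.*_) eq) (ℤ.*-zeroʳ (+ k)))
                          (≡.sym (≡.trans (≡.cong (+ m ℤ.*_) eq) (ℤ.*-zeroʳ (+ m))))
    ... | inj₂ ≡.refl = ≡.refl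

-- Coefficient identities obtained from the truncated rings

uSeries gSeries : ℕ → Series
uSeries p = lambertSeries λ i y → power p i ℤ.* σ Sign.- ℤ.^ y
gSeries p = lambertSeries λ i y → power p i ℤ.* σ Sign.+ ℤ.^ y

θ²Series θ⁴Series θ⁸Series : Series
θ²Series = thetaSeries ⊛ thetaSeries
θ⁴Series = θ²Series ⊛ θ²Series
θ⁸Series = θ⁴Series ⊛ θ⁴Series

d₃Series : Series
d₃Series k = constant ℤ.1ℤ k ℤ.+ + 16 ℤ.* gSeries 3 k

geometricSeries : Sign → ℕ → Series
geometricSeries s i k = Σℤ.∑ k λ y → σ s ℤ.^ y ℤ.* monomial (suc i ℕ.* suc y) k

denominator : Sign → ℕ → Series
denominator s i = constant ℤ.1ℤ ⊕ λ k → ℤ.- σ s ℤ.* monomial (suc i) k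

private
  module Modulo (M : ℕ) where
    open Truncated M public
    open Squares commutativeRing algebra lambertData lambertDerivation public hiding (M)

    module R = CommutativeRing commutativeRing

    moment≈ : ∀ s x → moment s x ≈ lambertSeries (λ i y → x i ℤ.* σ s ℤ.^ y)
    moment≈ s x k k<M = ≡.trans (∑-coefficient M (λ i → constant (x i) ⊛ geometric s i) k) (≡.trans
      (Σℤ.∑-cong M λ i → ≡.trans (constant-⊛ (x i) (geometric s i) k) (≡.trans
        (≡.cong (x i ℤ.*_) (≡.trans
          (∑-coefficient M (λ y → constant (σ s ℤ.^ y) ⊛ monomial (suc i ℕ.* suc y)) k)
          (Σℤ.∑-cong M λ y → constant-⊛ (σ s ℤ.^ y) (monomial (suc i ℕ.* suc y)) k)))
        (≡.trans (≡.sym (Σℤ.∑-*ˡ M (x i) (λ y → σ s ℤ.^ y ℤ.* monomial (suc i ℕ.* suc y) k)))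
                 (Σℤ.∑-cong M λ y → ≡.sym (ℤ.*-assoc (x i) (σ s ℤ.^ y) (monomial (suc i ℕ.* suc y) k))))))
      (lattice-stable (λ i y → x i ℤ.* σ s ℤ.^ y) (ℕ.<⇒≤ k<M) (ℕ.<⇒≤ k<M)))

    theta≈ : thetaSum M ≈ thetaSeries
    theta≈ k k<M = ≡.trans (≡.cong (λ z → constant ℤ.1ℤ k ℤ.+ z) (≡.trans
      (∑-coefficient M (λ i → constant (+ 2) ⊛ (constant (sign (suc i)) ⊛ monomial (suc i ℕ.* suc i))) k)
      (Σℤ.∑-cong M λ i → ≡.trans (constant-⊛ (+ 2) (constant (sign (suc i)) ⊛ monomial (suc i ℕ.* suc i)) k)
        (≡.cong (+ 2 ℤ.*_) (constant-⊛ (sign (suc i)) (monomial (suc i ℕ.* suc i)) k)))))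
      (thetaLattice-stable (ℕ.<⇒≤ k<M))

    geometric≈ : ∀ s i → geometric s i ≈ geometricSeries s i
    geometric≈ s i k k<M = ≡.trans
      (∑-coefficient M (λ y → constant (σ s ℤ.^ y) ⊛ monomial (suc i ℕ.* suc y)) k)
      (≡.trans (Σℤ.∑-cong M λ y → constant-⊛ (σ s ℤ.^ y) (monomial (suc i ℕ.* suc y)) k)
        (Σℤ.∑-extend (λ y → σ s ℤ.^ y ℤ.* monomial (suc i ℕ.* suc y) k) (ℕ.<⇒≤ k<M)
          λ y k≤y → scaled-low (σ s ℤ.^ y) (ℕ.≤-trans (s≤s k≤y) (ℕ.m≤m+n (suc y) _))))

    geometric-quotient≈ : ∀ s i → geometricSeries s i ⊛ denominator s i ≈ monomial (suc i)
    geometric-quotient≈ s i = R.trans {geometricSeries s i ⊛ denominator s i}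
      (R.*-cong {geometricSeries s i} {geometric s i} {denominator s i}
        {constant ℤ.1ℤ ⊕ ⊖ (constant (σ s) ⊛ monomial (suc i))}
        (R.sym {geometric s i} (geometric≈ s i))
        (λ k _ → ≡.cong (λ z → constant ℤ.1ℤ k ℤ.+ z) (≡.trans
          (≡.sym (ℤ.neg-distribˡ-* (σ s) (monomial (suc i) k)))
          (≡.cong ℤ.-_ (≡.sym (constant-⊛ (σ s) (monomial (suc i)) k))))))
      (γ-quotient s i)

    -- For the difference d the coefficients satisfy k d_k = Σ w_i d_(k-i). Since w_0 = 0, the right
    -- side involves only earlier coefficients, so strong induction applies and the factor k > 0 is
    -- cancelled in ℤ.
    unique : ∀ (w x y : Series) → w 0 ≡ ℤ.0ℤ → x 0 ≡ y 0 →
             derivative x ≈ w ⊛ x → derivative y ≈ w ⊛ y → x ≈ y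
    unique w x y w₀ x₀ Dx Dy k k<M = ℤ.i-j≡0⇒i≡j (x k) (y k) (<-rec _ vanish k k<M)
      where
      d : Series
      d = x ⊕ (⊖ y)
      D-d : derivative d ≈ w ⊛ d
      D-d = D-difference w {x} {y} Dx Dy
      vanish : ∀ k → (∀ {j} → j ℕ.< k → j ℕ.< M → d j ≡ ℤ.0ℤ) → k ℕ.< M → d k ≡ ℤ.0ℤ
      vanish zero    rec k<M = ≡.trans (≡.cong (ℤ._- y 0) x₀) (ℤ.+-inverseʳ (y 0))
      vanish (suc k) rec k<M = ℤ.*-cancelˡ-≡ (+ suc k) (d (suc k)) ℤ.0ℤ
        (≡.trans (D-d (suc k) k<M) (≡.trans wd≡0 (≡.sym (ℤ.*-zeroʳ (+ suc k)))))
        where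
        term : ∀ i j → suc (i ℕ.+ j) ≡ suc (suc k) → w i ℤ.* d j ≡ ℤ.0ℤ
        term zero    j eq = ≡.trans (≡.cong (ℤ._* d j) w₀) (ℤ.*-zeroˡ (d j))
        term (suc i) j eq = ≡.trans (≡.cong (w (suc i) ℤ.*_) (rec j<k (ℕ.<-trans j<k k<M)))
                                    (ℤ.*-zeroʳ (w (suc i)))
          where
          j<k : j ℕ.< suc k
          j<k = s≤s (ℕ.≤-trans (ℕ.m≤n+m j i) (ℕ.≤-reflexive (ℕ.suc-injective (ℕ.suc-injective eq))))
        wd≡0 : (w ⊛ d) (suc k) ≡ ℤ.0ℤ
        wd≡0 = ≡.trans (Σℤ.conv-cong (suc (suc k)) term)
          (≡.trans (Σℤ.conv-fst (suc (suc k)) (λ _ → ℤ.0ℤ)) (Σℤ.∑-zero (suc (suc k)) λ _ _ → ≡.refl))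

    W₀ : W 0 ≡ ℤ.0ℤ
    W₀ = ≡.cong₂ ℤ._+_ (moment₀ Sign.-) (moment₀ Sign.+)
      where
      moment₀ : ∀ s → moment s index 0 ≡ ℤ.0ℤ
      moment₀ s = ≡.trans (∑-coefficient M (λ i → constant (index i) ⊛ geometric s i) 0)
        (Σℤ.∑-zero M λ i _ → ≡.trans (constant-⊛ (index i) (geometric s i) 0)
          (≡.trans (≡.cong (index i ℤ.*_) (≡.trans
            (∑-coefficient M (λ y → constant (σ s ℤ.^ y) ⊛ monomial (suc i ℕ.* suc y)) 0)
            (Σℤ.∑-zero M λ y _ → ≡.trans (constant-⊛ (σ s ℤ.^ y) (monomial (suc i ℕ.* suc y)) 0)
              (ℤ.*-zeroʳ (σ s ℤ.^ y)))))
            (ℤ.*-zeroʳ (index i))))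

    u≈ : ∀ p → u p ≈ uSeries p
    u≈ p = moment≈ Sign.- (power p)

    g≈ : ∀ p → g p ≈ gSeries p
    g≈ p = moment≈ Sign.+ (power p)

    scale≈ : ∀ c {x y} → x ≈ y → constant c ⊛ x ≈ λ k → c ℤ.* y k
    scale≈ c {x} x≈y k k<M = ≡.trans (constant-⊛ c x k) (≡.cong (c ℤ.*_) (x≈y k k<M))

    D₃≈ : D₃ ≈ d₃Series
    D₃≈ k k<M = ≡.cong (λ z → constant ℤ.1ℤ k ℤ.+ z) (scale≈ (+ 16) (g≈ 3) k k<M)

    square₀ : ∀ x → x 0 ≡ ℤ.1ℤ → (x ⊛ x) 0 ≡ ℤ.1ℤ
    square₀ x eq = ≡.cong (λ z → z ℤ.* z ℤ.+ ℤ.0ℤ) eq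

    square-cong : ∀ {x y} → x ≈ y → x ⊛ x ≈ y ⊛ y
    square-cong {x} {y} x≈y = R.*-cong {x} {y} {x} {y} x≈y x≈y

    thetaSum⁸≈D₃ : 0 ℕ.< M → thetaSum⁸ ≈ D₃
    thetaSum⁸≈D₃ 0<M = unique (constant (ℤ.- + 8) ⊛ W) thetaSum⁸ D₃
      (≡.trans (constant-⊛ (ℤ.- + 8) W 0) (≡.cong (ℤ.- + 8 ℤ.*_) W₀))
      (≡.trans (square₀ (Θ² ⊛ Θ²) (square₀ Θ² (square₀ (thetaSum M) (theta≈ 0 0<M)))) (≡.sym (D₃≈ 0 0<M)))
      D-thetaSum⁸ D-D₃
      where
      Θ² : Series
      Θ² = thetaSum M ⊛ thetaSum M

    θ⁸≈ : 0 ℕ.< M → θ⁸Series ≈ d₃Series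
    θ⁸≈ 0<M = R.trans {θ⁸Series} {thetaSum⁸}
      (square-cong {θ⁴Series} (square-cong {θ²Series} (square-cong {thetaSeries}
        (R.sym {thetaSum M} theta≈))))
      (R.trans {thetaSum⁸} {D₃} (thetaSum⁸≈D₃ 0<M) D₃≈)

    d₃-squared≈ :
      (λ k → + 3 ℤ.* (d₃Series ⊛ d₃Series) k) ≈
      (λ k → (constant (+ 3) k ℤ.+ + 32 ℤ.* ((uSeries 1 k ℤ.+ uSeries 3 k) ℤ.+ uSeries 5 k))
             ℤ.+ + 256 ℤ.* ((uSeries 1 ⊛ uSeries 5) k ℤ.- (uSeries 3 ⊛ uSeries 3) k))
    d₃-squared≈ k k<M = ≡.trans (≡.sym (scale≈ (+ 3) (square-cong {D₃} D₃≈) k k<M))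
      (≡.trans (D₃-squared k k<M) (≡.cong₂ (λ x y → (constant (+ 3) k ℤ.+ x) ℤ.+ y)
        (scale≈ (+ 32) {u 1 ⊕ u 3 ⊕ u 5} {uSeries 1 ⊕ uSeries 3 ⊕ uSeries 5}
          (λ j j<M → ≡.cong₂ ℤ._+_ (≡.cong₂ ℤ._+_ (u≈ 1 j j<M) (u≈ 3 j j<M)) (u≈ 5 j j<M)) k k<M)
        (scale≈ (+ 256) {u 1 ⊛ u 5 ⊕ ⊖ (u 3 ⊛ u 3)} {uSeries 1 ⊛ uSeries 5 ⊕ ⊖ (uSeries 3 ⊛ uSeries 3)}
          (λ j j<M → ≡.cong₂ ℤ._-_
            (R.*-cong {u 1} {uSeries 1} {u 5} {uSeries 5} (u≈ 1) (u≈ 5) j j<M)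
            (square-cong {u 3} (u≈ 3) j j<M)) k k<M)))

    d₃-cubed≈ :
      (λ k → + 9 ℤ.* (d₃Series ⊛ (d₃Series ⊛ d₃Series)) k) ≈
      (λ k → (constant (+ 9) k ℤ.+ + 16 ℤ.* ((+ 17 ℤ.* gSeries 3 k ℤ.+ + 8 ℤ.* gSeries 5 k)
                                             ℤ.+ + 2 ℤ.* gSeries 7 k))
             ℤ.+ + 512 ℤ.* ((gSeries 3 ⊛ gSeries 7) k ℤ.- (gSeries 5 ⊛ gSeries 5) k))
    d₃-cubed≈ k k<M = ≡.trans (≡.sym (scale≈ (+ 9) (R.*-cong {D₃} {d₃Series} {D₃ ⊛ D₃} {d₃Series ⊛ d₃Series}
        D₃≈ (square-cong {D₃} D₃≈)) k k<M))
      (≡.trans (D₃-cubed k k<M) (≡.cong₂ (λ x y → (constant (+ 9) k ℤ.+ x) ℤ.+ y)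
        (scale≈ (+ 16) {constant (+ 17) ⊛ g 3 ⊕ constant (+ 8) ⊛ g 5 ⊕ constant (+ 2) ⊛ g 7}
          {λ j → (+ 17 ℤ.* gSeries 3 j ℤ.+ + 8 ℤ.* gSeries 5 j) ℤ.+ + 2 ℤ.* gSeries 7 j}
          (λ j j<M → ≡.cong₂ ℤ._+_ (≡.cong₂ ℤ._+_ (scale≈ (+ 17) (g≈ 3) j j<M) (scale≈ (+ 8) (g≈ 5) j j<M))
                                   (scale≈ (+ 2) (g≈ 7) j j<M)) k k<M)
        (scale≈ (+ 512) {g 3 ⊛ g 7 ⊕ ⊖ (g 5 ⊛ g 5)} {gSeries 3 ⊛ gSeries 7 ⊕ ⊖ (gSeries 5 ⊛ gSeries 5)}
          (λ j j<M → ≡.cong₂ ℤ._-_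
            (R.*-cong {g 3} {gSeries 3} {g 7} {gSeries 7} (g≈ 3) (g≈ 7) j j<M)
            (square-cong {g 5} (g≈ 5) j j<M)) k k<M)))

-- The congruence modulo q^(k+1) already determines the coefficient k, so the truncated identities
-- together give exact ones.
θ⁸-coefficient : ∀ k → θ⁸Series k ≡ d₃Series k
θ⁸-coefficient k = Modulo.θ⁸≈ (suc k) (s≤s z≤n) k ℕ.≤-refl

geometric-quotient : ∀ s i k → (geometricSeries s i ⊛ denominator s i) k ≡ monomial (suc i) k
geometric-quotient s i k = Modulo.geometric-quotient≈ (suc k) s i k ℕ.≤-refl

d₃-squared : ∀ k →
  + 3 ℤ.* (d₃Series ⊛ d₃Series) k ≡
  (constant (+ 3) k ℤ.+ + 32 ℤ.* ((uSeries 1 k ℤ.+ uSeries 3 k) ℤ.+ uSeries 5 k))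
  ℤ.+ + 256 ℤ.* ((uSeries 1 ⊛ uSeries 5) k ℤ.- (uSeries 3 ⊛ uSeries 3) k)
d₃-squared k = Modulo.d₃-squared≈ (suc k) k ℕ.≤-refl

d₃-cubed : ∀ k →
  + 9 ℤ.* (d₃Series ⊛ (d₃Series ⊛ d₃Series)) k ≡
  (constant (+ 9) k ℤ.+ + 16 ℤ.* ((+ 17 ℤ.* gSeries 3 k ℤ.+ + 8 ℤ.* gSeries 5 k)
                                  ℤ.+ + 2 ℤ.* gSeries 7 k))
  ℤ.+ + 512 ℤ.* ((gSeries 3 ⊛ gSeries 7) k ℤ.- (gSeries 5 ⊛ gSeries 5) k)
d₃-cubed k = Modulo.d₃-cubed≈ (suc k) k ℕ.≤-refl

-- Rational estimates for polynomially weighted geometric series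

module Σℚ = RangeSums ℚ.+-*-commutativeRing
open Exponentiation (CommutativeRing.semiring ℚ.+-*-commutativeRing) public using ()
  renaming (_^_ to infixr 8 _^ℚ_; ^-homo-* to ^ℚ-+)

module RationalLemmas where
  open ℚSolver.+-*-Solver

  opaque
    -- Opaque, so that the reduction to lowest terms inside `k / 1` is never unfolded; outside the
    -- block the map is handled through its laws.
    fromℤ : ℤ → ℚ
    fromℤ k = k ℚ./ 1

    /1≡fromℤ : ∀ k → k ℚ./ 1 ≡ fromℤ k
    /1≡fromℤ k = ≡.refl

    fromℤ-0 : fromℤ (+ 0) ≡ 0ℚ
    fromℤ-0 = ≡.refl

    fromℤ-1 : fromℤ (+ 1) ≡ 1ℚ
    fromℤ-1 = ≡.refl

  private
    toℚᵘ-fromℤ : ∀ k → ℚ.toℚᵘ (fromℤ k) ℚᵘ.≃ mkℚᵘ k 0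
    toℚᵘ-fromℤ k = ≡.subst (λ p → ℚ.toℚᵘ p ℚᵘ.≃ mkℚᵘ k 0) (/1≡fromℤ k) (ℚ.toℚᵘ-fromℚᵘ (mkℚᵘ k 0))

  fromℤ-+ : ∀ a b → fromℤ (a ℤ.+ b) ≡ fromℤ a ℚ.+ fromℤ b
  fromℤ-+ a b = ℚ.toℚᵘ-injective (ℚᵘ.≃-trans (toℚᵘ-fromℤ (a ℤ.+ b)) (ℚᵘ.≃-trans
    (ℚᵘ.*≡* (≡.cong (ℤ._* + 1) (≡.sym (≡.cong₂ ℤ._+_ (ℤ.*-identityʳ a) (ℤ.*-identityʳ b)))))
    (ℚᵘ.≃-trans (ℚᵘ.≃-sym (ℚᵘ.+-cong (toℚᵘ-fromℤ a) (toℚᵘ-fromℤ b)))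
      (ℚᵘ.≃-sym (ℚ.toℚᵘ-homo-+ (fromℤ a) (fromℤ b))))))

  fromℤ-* : ∀ a b → fromℤ (a ℤ.* b) ≡ fromℤ a ℚ.* fromℤ b
  fromℤ-* a b = ℚ.toℚᵘ-injective (ℚᵘ.≃-trans (toℚᵘ-fromℤ (a ℤ.* b))
    (ℚᵘ.≃-trans (ℚᵘ.≃-sym (ℚᵘ.*-cong (toℚᵘ-fromℤ a) (toℚᵘ-fromℤ b)))
      (ℚᵘ.≃-sym (ℚ.toℚᵘ-homo-* (fromℤ a) (fromℤ b)))))

  fromℤ-neg : ∀ a → fromℤ (ℤ.- a) ≡ ℚ.- fromℤ a
  fromℤ-neg a = ℚ.toℚᵘ-injective (ℚᵘ.≃-trans (toℚᵘ-fromℤ (ℤ.- a))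
    (ℚᵘ.≃-trans (ℚᵘ.≃-sym (ℚᵘ.-‿cong (toℚᵘ-fromℤ a)))
      (ℚᵘ.≃-sym (ℚ.toℚᵘ-homo‿- (fromℤ a)))))

  fromℤ-mono : ∀ {a b} → a ℤ.≤ b → fromℤ a ℚ.≤ fromℤ b
  fromℤ-mono {a} {b} a≤b = ℚ.toℚᵘ-cancel-≤ (ℚᵘ.≤-respˡ-≃ (ℚᵘ.≃-sym (toℚᵘ-fromℤ a))
    (ℚᵘ.≤-respʳ-≃ (ℚᵘ.≃-sym (toℚᵘ-fromℤ b)) (ℚᵘ.*≤* (ℤ.*-monoʳ-≤-nonNeg (+ 1) a≤b))))

  0≤fromℕ : ∀ n → 0ℚ ℚ.≤ fromℤ (+ n)
  0≤fromℕ n = ≡.subst (ℚ._≤ fromℤ (+ n)) fromℤ-0 (fromℤ-mono {+ 0} {+ n} (ℤ.+≤+ z≤n))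

  archimedean : ∀ r → ∃[ n ] r ℚ.< fromℤ (+ suc n)
  archimedean r@(mkℚ p d _) = ℤ.∣ p ∣ , ℚ.toℚᵘ-cancel-<
    (ℚᵘ.<-respʳ-≃ (ℚᵘ.≃-sym (toℚᵘ-fromℤ (+ suc ℤ.∣ p ∣))) (ℚᵘ.*<* (begin-strict
      p ℤ.* + 1                 ≡⟨ ℤ.*-identityʳ p ⟩
      p                         ≤⟨ p≤∣p∣ p ⟩
      + ℤ.∣ p ∣                 <⟨ ℤ.+<+ (ℕ.n<1+n ℤ.∣ p ∣) ⟩
      + suc ℤ.∣ p ∣             ≤⟨ ℤ.+≤+ (ℕ.m≤m*n (suc ℤ.∣ p ∣) (suc d)) ⟩
      + (suc ℤ.∣ p ∣ ℕ.* suc d) ≡⟨ ℤ.pos-* (suc ℤ.∣ p ∣) (suc d) ⟩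
      + suc ℤ.∣ p ∣ ℤ.* + suc d ∎)))
    where
    open ℤ.≤-Reasoning
    p≤∣p∣ : ∀ p → p ℤ.≤ + ℤ.∣ p ∣
    p≤∣p∣ (+ n)    = ℤ.≤-refl
    p≤∣p∣ -[1+ n ] = ℤ.-≤+

  ∣fromℤ∣ : ∀ k → ℚ.∣ fromℤ k ∣ ≡ fromℤ (+ ℤ.∣ k ∣)
  ∣fromℤ∣ (+ n)    = ℚ.0≤p⇒∣p∣≡p (0≤fromℕ n)
  ∣fromℤ∣ -[1+ n ] = ≡.trans (≡.cong ℚ.∣_∣ (fromℤ-neg (+ suc n)))
    (≡.trans (ℚ.∣-p∣≡∣p∣ (fromℤ (+ suc n))) (ℚ.0≤p⇒∣p∣≡p (0≤fromℕ (suc n))))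

  0≤q-p : ∀ {p q} → p ℚ.≤ q → 0ℚ ℚ.≤ q ℚ.- p
  0≤q-p {p} {q} p≤q = ≡.subst (ℚ._≤ q ℚ.- p) (ℚ.+-inverseʳ p) (ℚ.+-monoˡ-≤ (ℚ.- p) p≤q)

  p≤q-from : ∀ {p q r} → 0ℚ ℚ.≤ r → q ≡ p ℚ.+ r → p ℚ.≤ q
  p≤q-from {p} 0≤r ≡.refl = ≡.subst (ℚ._≤ p ℚ.+ _) (ℚ.+-identityʳ p) (ℚ.+-monoʳ-≤ p 0≤r)

  p<q-from : ∀ {p q r} → 0ℚ ℚ.< r → q ≡ p ℚ.+ r → p ℚ.< q
  p<q-from {p} 0<r ≡.refl = ≡.subst (ℚ._< p ℚ.+ _) (ℚ.+-identityʳ p) (ℚ.+-monoʳ-< p 0<r)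

  0<q-p : ∀ {p q} → p ℚ.< q → 0ℚ ℚ.< q ℚ.- p
  0<q-p {p} {q} p<q = ≡.subst (ℚ._< q ℚ.- p) (ℚ.+-inverseʳ p) (ℚ.+-monoˡ-< (ℚ.- p) p<q)

  0≤* : ∀ {p q} → 0ℚ ℚ.≤ p → 0ℚ ℚ.≤ q → 0ℚ ℚ.≤ p ℚ.* q
  0≤* {p} {q} 0≤p 0≤q = ≡.subst (ℚ._≤ p ℚ.* q) (ℚ.*-zeroʳ p)
    (ℚ.*-monoˡ-≤-nonNeg p {{ℚ.nonNegative 0≤p}} 0≤q)

  0<* : ∀ {p q} → 0ℚ ℚ.< p → 0ℚ ℚ.< q → 0ℚ ℚ.< p ℚ.* q
  0<* {p} {q} 0<p 0<q = ≡.subst (ℚ._< p ℚ.* q) (ℚ.*-zeroʳ p)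
    (ℚ.*-monoʳ-<-pos p {{ℚ.positive 0<p}} 0<q)

  0≤+ : ∀ {p q} → 0ℚ ℚ.≤ p → 0ℚ ℚ.≤ q → 0ℚ ℚ.≤ p ℚ.+ q
  0≤+ 0≤p 0≤q = ℚ.+-mono-≤ 0≤p 0≤q

  *-mono-≤ : ∀ {p q r s} → 0ℚ ℚ.≤ p → 0ℚ ℚ.≤ s → p ℚ.≤ q → r ℚ.≤ s → p ℚ.* r ℚ.≤ q ℚ.* s
  *-mono-≤ {p} {q} {r} {s} 0≤p 0≤s p≤q r≤s = ℚ.≤-trans
    (ℚ.*-monoˡ-≤-nonNeg p {{ℚ.nonNegative 0≤p}} r≤s)
    (ℚ.*-monoʳ-≤-nonNeg s {{ℚ.nonNegative 0≤s}} p≤q)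

  0<1 : 0ℚ ℚ.< 1ℚ
  0<1 = ℚ.positive⁻¹ 1ℚ

  0<½ : 0ℚ ℚ.< ½
  0<½ = ℚ.positive⁻¹ ½

  inverse : ∀ {p} → 0ℚ ℚ.< p → ∃[ r ] (0ℚ ℚ.< r) × (p ℚ.* r ≡ 1ℚ)
  inverse {p} 0<p = ℚ.1/ p , ℚ.positive⁻¹ (ℚ.1/ p) {{ℚ.1/pos⇒pos p}} , ℚ.*-inverseʳ p
    where instance
      p-positive : ℚ.Positive p
      p-positive = ℚ.positive 0<p
      p-nonZero : ℚ.NonZero p
      p-nonZero = ℚ.pos⇒nonZero p

  0≤^ : ∀ {x} → 0ℚ ℚ.≤ x → ∀ k → 0ℚ ℚ.≤ x ^ℚ k
  0≤^ 0≤x zero    = ℚ.<⇒≤ 0<1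
  0≤^ 0≤x (suc k) = 0≤* 0≤x (0≤^ 0≤x k)

  ^≤1 : ∀ {x} → 0ℚ ℚ.≤ x → x ℚ.≤ 1ℚ → ∀ k → x ^ℚ k ℚ.≤ 1ℚ
  ^≤1 0≤x x≤1 zero    = ℚ.≤-refl
  ^≤1 0≤x x≤1 (suc k) = *-mono-≤ 0≤x (ℚ.<⇒≤ 0<1) x≤1 (^≤1 0≤x x≤1 k)

  ^-mono : ∀ {x y} → 0ℚ ℚ.≤ x → x ℚ.≤ y → ∀ k → x ^ℚ k ℚ.≤ y ^ℚ k
  ^-mono 0≤x x≤y zero    = ℚ.≤-refl
  ^-mono 0≤x x≤y (suc k) = *-mono-≤ 0≤x (0≤^ (ℚ.≤-trans 0≤x x≤y) k) x≤y (^-mono 0≤x x≤y k)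

  *-^ : ∀ x y k → (x ℚ.* y) ^ℚ k ≡ x ^ℚ k ℚ.* y ^ℚ k
  *-^ x y zero    = ≡.refl
  *-^ x y (suc k) = ≡.trans (≡.cong (x ℚ.* y ℚ.*_) (*-^ x y k))
    (solve 4 (λ x y a b → x :* y :* (a :* b) := x :* a :* (y :* b)) ≡.refl x y (x ^ℚ k) (y ^ℚ k))

  ∑-mono : ∀ n {f g : ℕ → ℚ} → (∀ i → f i ℚ.≤ g i) → Σℚ.∑ n f ℚ.≤ Σℚ.∑ n g
  ∑-mono zero    f≤g = ℚ.≤-refl
  ∑-mono (suc n) f≤g = ℚ.+-mono-≤ (f≤g 0) (∑-mono n λ i → f≤g (suc i))

  -- (k + 1) x^k (1 - x) ≤ 1 - x^(k + 1).
  linear-geometric : ∀ {x} → 0ℚ ℚ.≤ x → x ℚ.≤ 1ℚ → ∀ k →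
    fromℤ (+ suc k) ℚ.* x ^ℚ k ℚ.* (1ℚ ℚ.- x) ℚ.≤ 1ℚ ℚ.- x ^ℚ suc k
  linear-geometric {x} 0≤x x≤1 zero = ℚ.≤-reflexive (≡.trans
    (≡.cong (λ c → c ℚ.* 1ℚ ℚ.* (1ℚ ℚ.- x)) fromℤ-1) (solve 1 (λ x → con 1ℚ :* con 1ℚ :* (con 1ℚ :- x) := con 1ℚ :- x :* con 1ℚ) ≡.refl x))
  linear-geometric {x} 0≤x x≤1 (suc k) = begin
    fromℤ (+ suc (suc k)) ℚ.* (x ℚ.* x ^ℚ k) ℚ.* (1ℚ ℚ.- x)
      ≡⟨ ≡.cong (λ c → c ℚ.* (x ℚ.* x ^ℚ k) ℚ.* (1ℚ ℚ.- x)) (≡.trans (fromℤ-+ (+ 1) (+ suc k))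
             (≡.cong (ℚ._+ fromℤ (+ suc k)) fromℤ-1)) ⟩
    (1ℚ ℚ.+ fromℤ (+ suc k)) ℚ.* (x ℚ.* x ^ℚ k) ℚ.* (1ℚ ℚ.- x)
      ≡⟨ solve 3 (λ c x p → (con 1ℚ :+ c) :* (x :* p) :* (con 1ℚ :- x) :=
                            x :* (c :* p :* (con 1ℚ :- x)) :+ (x :* p) :* (con 1ℚ :- x)) ≡.refl
           (fromℤ (+ suc k)) x (x ^ℚ k) ⟩
    x ℚ.* (fromℤ (+ suc k) ℚ.* x ^ℚ k ℚ.* (1ℚ ℚ.- x)) ℚ.+ x ^ℚ suc k ℚ.* (1ℚ ℚ.- x)
      ≤⟨ ℚ.+-monoˡ-≤ _ (ℚ.*-monoˡ-≤-nonNeg x {{ℚ.nonNegative 0≤x}} (linear-geometric 0≤x x≤1 k)) ⟩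
    x ℚ.* (1ℚ ℚ.- x ^ℚ suc k) ℚ.+ x ^ℚ suc k ℚ.* (1ℚ ℚ.- x)
      ≤⟨ p≤q-from (0≤* (0≤q-p x≤1) (0≤q-p (^≤1 0≤x x≤1 (suc k))))
           (solve 2 (λ x p → con 1ℚ :- x :* p :=
              x :* (con 1ℚ :- p) :+ p :* (con 1ℚ :- x) :+ (con 1ℚ :- x) :* (con 1ℚ :- p)) ≡.refl
              x (x ^ℚ suc k)) ⟩
    1ℚ ℚ.- x ^ℚ suc (suc k) ∎
    where open ℚ.≤-Reasoning

  -- The bound is K = 1 / (1 - x): each of the k + 1 terms of 1 + x + ... + x^k is at least x^k.
  linear-bound : ∀ {x} → 0ℚ ℚ.≤ x → x ℚ.< 1ℚ →
    ∃[ K ] (0ℚ ℚ.< K) × (∀ k → fromℤ (+ suc k) ℚ.* x ^ℚ k ℚ.≤ K)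
  linear-bound {x} 0≤x x<1 = from (inverse (0<q-p x<1))
    where
    open ℚ.≤-Reasoning
    from : ∃[ K ] (0ℚ ℚ.< K) × ((1ℚ ℚ.- x) ℚ.* K ≡ 1ℚ) →
           ∃[ K ] (0ℚ ℚ.< K) × (∀ k → fromℤ (+ suc k) ℚ.* x ^ℚ k ℚ.≤ K)
    from (K , 0<K , eq) = K , 0<K , λ k → begin
      fromℤ (+ suc k) ℚ.* x ^ℚ k
        ≡⟨ ℚ.*-identityʳ _ ⟨
      fromℤ (+ suc k) ℚ.* x ^ℚ k ℚ.* 1ℚ
        ≡⟨ ≡.cong (fromℤ (+ suc k) ℚ.* x ^ℚ k ℚ.*_) eq ⟨
      fromℤ (+ suc k) ℚ.* x ^ℚ k ℚ.* ((1ℚ ℚ.- x) ℚ.* K)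
        ≡⟨ ℚ.*-assoc (fromℤ (+ suc k) ℚ.* x ^ℚ k) (1ℚ ℚ.- x) K ⟨
      fromℤ (+ suc k) ℚ.* x ^ℚ k ℚ.* (1ℚ ℚ.- x) ℚ.* K
        ≤⟨ ℚ.*-monoʳ-≤-nonNeg K {{ℚ.nonNegative (ℚ.<⇒≤ 0<K)}} (ℚ.≤-trans
             (linear-geometric 0≤x (ℚ.<⇒≤ x<1) k)
             (p≤q-from (0≤^ 0≤x (suc k)) (solve 1 (λ p → con 1ℚ := con 1ℚ :- p :+ p) ≡.refl (x ^ℚ suc k)))) ⟩
      1ℚ ℚ.* K
        ≡⟨ ℚ.*-identityˡ K ⟩
      K ∎

  -- A rational substitute for the square root of x. The mean y = (1 + x) / 2 satisfies y² = x + ((1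
  -- - x) / 2)².
  midpoint : ∀ {x} → 0ℚ ℚ.≤ x → x ℚ.< 1ℚ →
    ∃[ y ] (0ℚ ℚ.≤ y) × (y ℚ.< 1ℚ) × (x ℚ.≤ y ℚ.* y)
  midpoint {x} 0≤x x<1 = y , 0≤* (ℚ.<⇒≤ 0<½) (0≤+ (ℚ.<⇒≤ 0<1) 0≤x) ,
    p<q-from (0<* 0<½ (0<q-p x<1))
      (solve 1 (λ x → con 1ℚ := con ½ :* (con 1ℚ :+ x) :+ con ½ :* (con 1ℚ :- x)) ≡.refl x) ,
    p≤q-from (0≤* (0≤* (ℚ.<⇒≤ 0<½) (0≤q-p (ℚ.<⇒≤ x<1))) (0≤* (ℚ.<⇒≤ 0<½) (0≤q-p (ℚ.<⇒≤ x<1))))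
      (solve 1 (λ x → con ½ :* (con 1ℚ :+ x) :* (con ½ :* (con 1ℚ :+ x)) :=
                      x :+ con ½ :* (con 1ℚ :- x) :* (con ½ :* (con 1ℚ :- x))) ≡.refl x)
    where
    y : ℚ
    y = ½ ℚ.* (1ℚ ℚ.+ x)

  -- Induction on the degree with x ≤ w²: of the two factors w^k, one absorbs a factor k + 1 by
  -- `linear-bound` and the other carries the remaining power of degree d.
  polynomial-geometric : ∀ d {x} → 0ℚ ℚ.≤ x → x ℚ.< 1ℚ →
    ∃[ K ] ∃[ y ] (0ℚ ℚ.< K) × (0ℚ ℚ.≤ y) × (y ℚ.< 1ℚ) ×
    (∀ k → fromℤ (+ (suc k ℕ.^ d)) ℚ.* x ^ℚ k ℚ.≤ K ℚ.* y ^ℚ k)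
  polynomial-geometric zero {x} 0≤x x<1 = 1ℚ , x , 0<1 , 0≤x , x<1 , λ k →
    ℚ.≤-reflexive (≡.cong (ℚ._* x ^ℚ k) fromℤ-1)
  polynomial-geometric (suc d) {x} 0≤x x<1 = from-midpoint (midpoint 0≤x x<1)
    where
    open ℚ.≤-Reasoning
    from : ∀ {w} → 0ℚ ℚ.≤ w → x ℚ.≤ w ℚ.* w →
      ∃[ K ] ∃[ y ] (0ℚ ℚ.< K) × (0ℚ ℚ.≤ y) × (y ℚ.< 1ℚ) ×
        (∀ k → fromℤ (+ (suc k ℕ.^ d)) ℚ.* w ^ℚ k ℚ.≤ K ℚ.* y ^ℚ k) →
      ∃[ K ] (0ℚ ℚ.< K) × (∀ k → fromℤ (+ suc k) ℚ.* w ^ℚ k ℚ.≤ K) →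
      ∃[ K ] ∃[ y ] (0ℚ ℚ.< K) × (0ℚ ℚ.≤ y) × (y ℚ.< 1ℚ) ×
        (∀ k → fromℤ (+ (suc k ℕ.^ suc d)) ℚ.* x ^ℚ k ℚ.≤ K ℚ.* y ^ℚ k)
    from-midpoint : ∃[ w ] (0ℚ ℚ.≤ w) × (w ℚ.< 1ℚ) × (x ℚ.≤ w ℚ.* w) → _
    from-midpoint (w , 0≤w , w<1 , x≤ww) =
      from 0≤w x≤ww (polynomial-geometric d 0≤w w<1) (linear-bound 0≤w w<1)
    from {w} 0≤w x≤ww (K , y , 0<K , 0≤y , y<1 , bound) (K′ , 0<K′ , bound′) = K′ ℚ.* K , y , 0<* 0<K′ 0<K , 0≤y , y<1 , λ k → begin
        fromℤ (+ (suc k ℕ.* suc k ℕ.^ d)) ℚ.* x ^ℚ k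
          ≡⟨ ≡.cong (ℚ._* x ^ℚ k) (≡.trans (≡.cong fromℤ (ℤ.pos-* (suc k) (suc k ℕ.^ d)))
               (fromℤ-* (+ suc k) (+ (suc k ℕ.^ d)))) ⟩
        fromℤ (+ suc k) ℚ.* fromℤ (+ (suc k ℕ.^ d)) ℚ.* x ^ℚ k
          ≤⟨ ℚ.*-monoˡ-≤-nonNeg (fromℤ (+ suc k) ℚ.* fromℤ (+ (suc k ℕ.^ d))) {{ℚ.nonNegative (0≤* (0≤fromℕ (suc k)) (0≤fromℕ (suc k ℕ.^ d)))}}
               (ℚ.≤-trans (^-mono 0≤x x≤ww k) (ℚ.≤-reflexive (*-^ w w k))) ⟩
        fromℤ (+ suc k) ℚ.* fromℤ (+ (suc k ℕ.^ d)) ℚ.* (w ^ℚ k ℚ.* w ^ℚ k)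
          ≡⟨ solve 3 (λ a b w → a :* b :* (w :* w) := a :* w :* (b :* w)) ≡.refl
               (fromℤ (+ suc k)) (fromℤ (+ (suc k ℕ.^ d))) (w ^ℚ k) ⟩
        fromℤ (+ suc k) ℚ.* w ^ℚ k ℚ.* (fromℤ (+ (suc k ℕ.^ d)) ℚ.* w ^ℚ k)
          ≤⟨ *-mono-≤ (0≤* (0≤fromℕ (suc k)) (0≤^ 0≤w k)) (0≤* (ℚ.<⇒≤ 0<K) (0≤^ 0≤y k)) (bound′ k) (bound k) ⟩
        K′ ℚ.* (K ℚ.* y ^ℚ k)
          ≡⟨ ℚ.*-assoc K′ K (y ^ℚ k) ⟨
        K′ ℚ.* K ℚ.* y ^ℚ k ∎

  geometric-sum : ∀ {y} → 0ℚ ℚ.≤ y → ∀ n p →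
    Σℚ.∑ p (λ j → y ^ℚ (n ℕ.+ j)) ℚ.* (1ℚ ℚ.- y) ℚ.≤ y ^ℚ n
  geometric-sum {y} 0≤y n p = p≤q-from (0≤^ 0≤y (n ℕ.+ p)) (exact p)
    where
    exact : ∀ p → y ^ℚ n ≡ Σℚ.∑ p (λ j → y ^ℚ (n ℕ.+ j)) ℚ.* (1ℚ ℚ.- y) ℚ.+ y ^ℚ (n ℕ.+ p)
    exact zero = ≡.trans (≡.cong (y ^ℚ_) (≡.sym (ℕ.+-identityʳ n)))
      (solve 2 (λ y p → p := con 0ℚ :* (con 1ℚ :- y) :+ p) ≡.refl y (y ^ℚ (n ℕ.+ 0)))
    exact (suc p) = ≡.trans (exact p) (≡.trans
      (solve 3 (λ s y p → s :* (con 1ℚ :- y) :+ p := (s :+ p) :* (con 1ℚ :- y) :+ y :* p) ≡.refl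
         (Σℚ.∑ p (λ j → y ^ℚ (n ℕ.+ j))) y (y ^ℚ (n ℕ.+ p)))
      (≡.cong₂ (λ s k → s ℚ.* (1ℚ ℚ.- y) ℚ.+ y ^ℚ k)
        (≡.sym (Σℚ.∑-snoc p (λ j → y ^ℚ (n ℕ.+ j)))) (≡.sym (ℕ.+-suc n p))))

  -- Since (n + 1) y^n is bounded, multiplying the desired inequality by n + 1 reduces it to the
  -- Archimedean property.
  geometric-null : ∀ {K y ε} → 0ℚ ℚ.≤ K → 0ℚ ℚ.≤ y → y ℚ.< 1ℚ → 0ℚ ℚ.< ε →
    ∃[ N ] (∀ n → N ℕ.≤ n → K ℚ.* y ^ℚ n ℚ.< ε)
  geometric-null {K} {y} {ε} 0≤K 0≤y y<1 0<ε =
    let K′ , _ , bound = linear-bound 0≤y y<1 ; ε⁻¹ , _ , εε⁻¹ = inverse 0<ε in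
    from K′ ε⁻¹ bound εε⁻¹ (archimedean (K ℚ.* K′ ℚ.* ε⁻¹))
    where
    open ℚ.≤-Reasoning
    from : ∀ K′ ε⁻¹ → (∀ k → fromℤ (+ suc k) ℚ.* y ^ℚ k ℚ.≤ K′) → ε ℚ.* ε⁻¹ ≡ 1ℚ →
      ∃[ N ] K ℚ.* K′ ℚ.* ε⁻¹ ℚ.< fromℤ (+ suc N) → ∃[ N ] (∀ n → N ℕ.≤ n → K ℚ.* y ^ℚ n ℚ.< ε)
    from K′ ε⁻¹ bound εε⁻¹ (N , large) = N , λ n N≤n → ℚ.*-cancelˡ-<-nonNeg (fromℤ (+ suc n)) {{ℚ.nonNegative (0≤fromℕ (suc n))}}
      (begin-strict
        fromℤ (+ suc n) ℚ.* (K ℚ.* y ^ℚ n)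
          ≡⟨ solve 3 (λ a K p → a :* (K :* p) := K :* (a :* p)) ≡.refl (fromℤ (+ suc n)) K (y ^ℚ n) ⟩
        K ℚ.* (fromℤ (+ suc n) ℚ.* y ^ℚ n)
          ≤⟨ ℚ.*-monoˡ-≤-nonNeg K {{ℚ.nonNegative 0≤K}} (bound n) ⟩
        K ℚ.* K′
          ≡⟨ ℚ.*-identityʳ _ ⟨
        K ℚ.* K′ ℚ.* 1ℚ
          ≡⟨ ≡.cong (K ℚ.* K′ ℚ.*_) εε⁻¹ ⟨
        K ℚ.* K′ ℚ.* (ε ℚ.* ε⁻¹)
          ≡⟨ solve 4 (λ K L e i → K :* L :* (e :* i) := e :* (K :* L :* i)) ≡.refl K K′ ε ε⁻¹ ⟩
        ε ℚ.* (K ℚ.* K′ ℚ.* ε⁻¹)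
          <⟨ ℚ.*-monoʳ-<-pos ε {{ℚ.positive 0<ε}} (ℚ.<-≤-trans large (fromℤ-mono (ℤ.+≤+ (s≤s N≤n)))) ⟩
        ε ℚ.* fromℤ (+ suc n)
          ≡⟨ ℚ.*-comm ε _ ⟩
        fromℤ (+ suc n) ℚ.* ε ∎)

  polyTerm : ℕ → ℕ → ℚ → ℕ → ℚ
  polyTerm C d x k = fromℤ (+ (C ℕ.* suc k ℕ.^ d)) ℚ.* x ^ℚ k

  -- The bound is uniform in the length p because the geometric majorant sums to at most y^n / (1 -
  -- y), for any number of terms.
  polynomial-tail : ∀ C d {x ε} → 0ℚ ℚ.≤ x → x ℚ.< 1ℚ → 0ℚ ℚ.< ε →
    ∃[ N ] (∀ n p → N ℕ.≤ n → Σℚ.∑ p (λ j → polyTerm C d x (n ℕ.+ j)) ℚ.< ε)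
  polynomial-tail C d {x} {ε} 0≤x x<1 0<ε = from (polynomial-geometric d 0≤x x<1)
    where
    open ℚ.≤-Reasoning
    S : ℚ → ℕ → ℕ → ℚ
    S y n p = Σℚ.∑ p (λ j → y ^ℚ (n ℕ.+ j))
    Goal : Set
    Goal = ∃[ N ] (∀ n p → N ℕ.≤ n → Σℚ.∑ p (λ j → polyTerm C d x (n ℕ.+ j)) ℚ.< ε)
    from-null : ∀ {K y I} → 0ℚ ℚ.< K → 0ℚ ℚ.≤ y → 0ℚ ℚ.< I → (1ℚ ℚ.- y) ℚ.* I ≡ 1ℚ →
      (∀ k → fromℤ (+ (suc k ℕ.^ d)) ℚ.* x ^ℚ k ℚ.≤ K ℚ.* y ^ℚ k) →
      ∃[ N ] (∀ n → N ℕ.≤ n → fromℤ (+ C) ℚ.* K ℚ.* I ℚ.* y ^ℚ n ℚ.< ε) → Goal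
    from-inverse : ∀ {K y} → 0ℚ ℚ.< K → 0ℚ ℚ.≤ y → y ℚ.< 1ℚ →
      (∀ k → fromℤ (+ (suc k ℕ.^ d)) ℚ.* x ^ℚ k ℚ.≤ K ℚ.* y ^ℚ k) →
      ∃[ I ] (0ℚ ℚ.< I) × ((1ℚ ℚ.- y) ℚ.* I ≡ 1ℚ) → Goal
    from-inverse {K} {y} 0<K 0≤y y<1 bound (I , 0<I , eq) = from-null 0<K 0≤y 0<I eq bound
      (geometric-null {fromℤ (+ C) ℚ.* K ℚ.* I}
        (0≤* (0≤* (0≤fromℕ C) (ℚ.<⇒≤ 0<K)) (ℚ.<⇒≤ 0<I)) 0≤y y<1 0<ε)
    from : ∃[ K ] ∃[ y ] (0ℚ ℚ.< K) × (0ℚ ℚ.≤ y) × (y ℚ.< 1ℚ) ×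
             (∀ k → fromℤ (+ (suc k ℕ.^ d)) ℚ.* x ^ℚ k ℚ.≤ K ℚ.* y ^ℚ k) → Goal
    from (K , y , 0<K , 0≤y , y<1 , bound) = from-inverse 0<K 0≤y y<1 bound (inverse (0<q-p y<1))
    from-null {K} {y} {I} 0<K 0≤y 0<I eq bound (N , null) = N , λ n p N≤n → begin-strict
      Σℚ.∑ p (λ j → polyTerm C d x (n ℕ.+ j))
        ≤⟨ ∑-mono p (λ j → term (n ℕ.+ j)) ⟩
      Σℚ.∑ p (λ j → fromℤ (+ C) ℚ.* K ℚ.* y ^ℚ (n ℕ.+ j))
        ≡⟨ Σℚ.∑-*ˡ p (fromℤ (+ C) ℚ.* K) (λ j → y ^ℚ (n ℕ.+ j)) ⟩
      fromℤ (+ C) ℚ.* K ℚ.* S y n p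
        ≡⟨ ℚ.*-identityʳ _ ⟨
      fromℤ (+ C) ℚ.* K ℚ.* S y n p ℚ.* 1ℚ
        ≡⟨ ≡.cong (fromℤ (+ C) ℚ.* K ℚ.* S y n p ℚ.*_) eq ⟨
      fromℤ (+ C) ℚ.* K ℚ.* S y n p ℚ.* ((1ℚ ℚ.- y) ℚ.* I)
        ≡⟨ solve 4 (λ c s o i → c :* s :* (o :* i) := c :* i :* (s :* o)) ≡.refl
             (fromℤ (+ C) ℚ.* K) (S y n p) (1ℚ ℚ.- y) I ⟩
      fromℤ (+ C) ℚ.* K ℚ.* I ℚ.* (S y n p ℚ.* (1ℚ ℚ.- y))
        ≤⟨ ℚ.*-monoˡ-≤-nonNeg (fromℤ (+ C) ℚ.* K ℚ.* I) {{ℚ.nonNegative (0≤* (0≤* (0≤fromℕ C) (ℚ.<⇒≤ 0<K)) (ℚ.<⇒≤ 0<I))}}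
             (geometric-sum 0≤y n p) ⟩
      fromℤ (+ C) ℚ.* K ℚ.* I ℚ.* y ^ℚ n
        <⟨ null n N≤n ⟩
      ε ∎
      where
      term : ∀ k → polyTerm C d x k ℚ.≤ fromℤ (+ C) ℚ.* K ℚ.* y ^ℚ k
      term k = begin
        fromℤ (+ (C ℕ.* suc k ℕ.^ d)) ℚ.* x ^ℚ k
          ≡⟨ ≡.cong (ℚ._* x ^ℚ k) (≡.trans (≡.cong fromℤ (ℤ.pos-* C (suc k ℕ.^ d)))
               (fromℤ-* (+ C) (+ (suc k ℕ.^ d)))) ⟩
        fromℤ (+ C) ℚ.* fromℤ (+ (suc k ℕ.^ d)) ℚ.* x ^ℚ k
          ≡⟨ ℚ.*-assoc (fromℤ (+ C)) _ _ ⟩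
        fromℤ (+ C) ℚ.* (fromℤ (+ (suc k ℕ.^ d)) ℚ.* x ^ℚ k)
          ≤⟨ ℚ.*-monoˡ-≤-nonNeg (fromℤ (+ C)) {{ℚ.nonNegative (0≤fromℕ C)}} (bound k) ⟩
        fromℤ (+ C) ℚ.* (K ℚ.* y ^ℚ k)
          ≡⟨ ℚ.*-assoc (fromℤ (+ C)) K (y ^ℚ k) ⟨
        fromℤ (+ C) ℚ.* K ℚ.* y ^ℚ k ∎

open RationalLemmas

-- Gaussian rationals and their ℓ¹ norm

record ℚ[i] : Set where
  constructor _∔_
  field
    Re Im : ℚ

open ℚ[i]

module Gaussian where
  open ℚSolver.+-*-Solver

  ι : ℤ → ℚ[i]
  ι k = fromℤ k ∔ 0ℚ

  commutativeRing : CommutativeRing 0ℓ 0ℓ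
  commutativeRing = record
    { Carrier = ℚ[i] ; _≈_ = _≡_
    ; _+_ = λ z w → (Re z ℚ.+ Re w) ∔ (Im z ℚ.+ Im w)
    ; _*_ = λ z w → (Re z ℚ.* Re w ℚ.- Im z ℚ.* Im w) ∔ (Re z ℚ.* Im w ℚ.+ Im z ℚ.* Re w)
    ; -_ = λ z → (ℚ.- Re z) ∔ (ℚ.- Im z)
    ; 0# = 0ℚ ∔ 0ℚ ; 1# = 1ℚ ∔ 0ℚ
    ; isCommutativeRing = record
      { isRing = record
        { +-isAbelianGroup = record
          { isGroup = record
            { isMonoid = record
              { isSemigroup = record
                { isMagma = record { isEquivalence = ≡.isEquivalence ; ∙-cong = ≡.cong₂ _ }
                ; assoc = λ x y z → ≡.cong₂ _∔_ (ℚ.+-assoc (Re x) (Re y) (Re z)) (ℚ.+-assoc (Im x) (Im y) (Im z)) }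
              ; identity = (λ x → ≡.cong₂ _∔_ (ℚ.+-identityˡ (Re x)) (ℚ.+-identityˡ (Im x))) ,
                           (λ x → ≡.cong₂ _∔_ (ℚ.+-identityʳ (Re x)) (ℚ.+-identityʳ (Im x))) }
            ; inverse = (λ x → ≡.cong₂ _∔_ (ℚ.+-inverseˡ (Re x)) (ℚ.+-inverseˡ (Im x))) ,
                        (λ x → ≡.cong₂ _∔_ (ℚ.+-inverseʳ (Re x)) (ℚ.+-inverseʳ (Im x)))
            ; ⁻¹-cong = ≡.cong λ z → (ℚ.- Re z) ∔ (ℚ.- Im z) }
          ; comm = λ x y → ≡.cong₂ _∔_ (ℚ.+-comm (Re x) (Re y)) (ℚ.+-comm (Im x) (Im y)) }
        ; *-cong = ≡.cong₂ _
        ; *-assoc = λ x y z → ≡.cong₂ _∔_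
            (solve 6 (λ a b c d e f → (a :* c :- b :* d) :* e :- (a :* d :+ b :* c) :* f :=
                                      a :* (c :* e :- d :* f) :- b :* (c :* f :+ d :* e)) ≡.refl
               (Re x) (Im x) (Re y) (Im y) (Re z) (Im z))
            (solve 6 (λ a b c d e f → (a :* c :- b :* d) :* f :+ (a :* d :+ b :* c) :* e :=
                                      a :* (c :* f :+ d :* e) :+ b :* (c :* e :- d :* f)) ≡.refl
               (Re x) (Im x) (Re y) (Im y) (Re z) (Im z))
        ; *-identity = (λ x → ≡.cong₂ _∔_
              (solve 2 (λ a b → con 1ℚ :* a :- con 0ℚ :* b := a) ≡.refl (Re x) (Im x))
              (solve 2 (λ a b → con 1ℚ :* b :+ con 0ℚ :* a := b) ≡.refl (Re x) (Im x))) ,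
            (λ x → ≡.cong₂ _∔_
              (solve 2 (λ a b → a :* con 1ℚ :- b :* con 0ℚ := a) ≡.refl (Re x) (Im x))
              (solve 2 (λ a b → a :* con 0ℚ :+ b :* con 1ℚ := b) ≡.refl (Re x) (Im x)))
        ; distrib = (λ x y z → ≡.cong₂ _∔_
              (solve 6 (λ a b c d e f → a :* (c :+ e) :- b :* (d :+ f) :=
                  (a :* c :- b :* d) :+ (a :* e :- b :* f)) ≡.refl
                 (Re x) (Im x) (Re y) (Im y) (Re z) (Im z))
              (solve 6 (λ a b c d e f → a :* (d :+ f) :+ b :* (c :+ e) :=
                  (a :* d :+ b :* c) :+ (a :* f :+ b :* e)) ≡.refl
                 (Re x) (Im x) (Re y) (Im y) (Re z) (Im z))) ,
            (λ x y z → ≡.cong₂ _∔_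
              (solve 6 (λ a b c d e f → (c :+ e) :* a :- (d :+ f) :* b :=
                  (c :* a :- d :* b) :+ (e :* a :- f :* b)) ≡.refl
                 (Re x) (Im x) (Re y) (Im y) (Re z) (Im z))
              (solve 6 (λ a b c d e f → (c :+ e) :* b :+ (d :+ f) :* a :=
                  (c :* b :+ d :* a) :+ (e :* b :+ f :* a)) ≡.refl
                 (Re x) (Im x) (Re y) (Im y) (Re z) (Im z))) }
      ; *-comm = λ x y → ≡.cong₂ _∔_
          (solve 4 (λ a b c d → a :* c :- b :* d := c :* a :- d :* b) ≡.refl (Re x) (Im x) (Re y) (Im y))
          (solve 4 (λ a b c d → a :* d :+ b :* c := c :* b :+ d :* a) ≡.refl (Re x) (Im x) (Re y) (Im y)) } }

  open CommutativeRing commutativeRing public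
    using (_+_; _*_; -_; _-_; 0#; 1#; +-assoc; +-comm; +-identityˡ; +-identityʳ;
           *-assoc; *-comm; *-identityˡ; *-identityʳ; distribˡ; distribʳ; zeroˡ; zeroʳ; -‿inverseʳ)
  open Exponentiation (CommutativeRing.semiring commutativeRing) public using (_^_; ^-homo-*)
  module Sums = RangeSums commutativeRing
  open Sums public using (∑)

  ι-+ : ∀ a b → ι (a ℤ.+ b) ≡ ι a + ι b
  ι-+ a b = ≡.cong₂ _∔_ (fromℤ-+ a b) ≡.refl

  ι-* : ∀ a b → ι (a ℤ.* b) ≡ ι a * ι b
  ι-* a b = ≡.cong₂ _∔_
    (≡.trans (fromℤ-* a b) (solve 2 (λ a b → a :* b := a :* b :- con 0ℚ :* con 0ℚ) ≡.refl (fromℤ a) (fromℤ b)))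
    (solve 2 (λ a b → con 0ℚ := a :* con 0ℚ :+ con 0ℚ :* b) ≡.refl (fromℤ a) (fromℤ b))

  ι-neg : ∀ a → ι (ℤ.- a) ≡ - ι a
  ι-neg a = ≡.cong₂ _∔_ (fromℤ-neg a) ≡.refl

  ι-0 : ι (+ 0) ≡ 0#
  ι-0 = ≡.cong (_∔ 0ℚ) fromℤ-0

  ι-1 : ι (+ 1) ≡ 1#
  ι-1 = ≡.cong (_∔ 0ℚ) fromℤ-1

  -- In contrast to the modulus, this norm is rational on Gaussian rationals. It is
  -- submultiplicative and differs from the modulus by a bounded factor.
  ‖_‖ : ℚ[i] → ℚ
  ‖ z ‖ = ℚ.∣ Re z ∣ ℚ.+ ℚ.∣ Im z ∣

  0≤‖‖ : ∀ z → 0ℚ ℚ.≤ ‖ z ‖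
  0≤‖‖ z = 0≤+ (ℚ.0≤∣p∣ (Re z)) (ℚ.0≤∣p∣ (Im z))

  ∣Re∣≤‖‖ : ∀ z → ℚ.∣ Re z ∣ ℚ.≤ ‖ z ‖
  ∣Re∣≤‖‖ z = p≤q-from (ℚ.0≤∣p∣ (Im z)) ≡.refl

  ∣Im∣≤‖‖ : ∀ z → ℚ.∣ Im z ∣ ℚ.≤ ‖ z ‖
  ∣Im∣≤‖‖ z = p≤q-from (ℚ.0≤∣p∣ (Re z)) (ℚ.+-comm ℚ.∣ Re z ∣ ℚ.∣ Im z ∣)

  ‖+‖ : ∀ z w → ‖ z + w ‖ ℚ.≤ ‖ z ‖ ℚ.+ ‖ w ‖
  ‖+‖ z w = ℚ.≤-trans
    (ℚ.+-mono-≤ (ℚ.∣p+q∣≤∣p∣+∣q∣ (Re z) (Re w)) (ℚ.∣p+q∣≤∣p∣+∣q∣ (Im z) (Im w)))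
    (ℚ.≤-reflexive (solve 4 (λ a b c d → (a :+ c) :+ (b :+ d) := (a :+ b) :+ (c :+ d)) ≡.refl
      ℚ.∣ Re z ∣ ℚ.∣ Im z ∣ ℚ.∣ Re w ∣ ℚ.∣ Im w ∣))

  ‖-‖ : ∀ z → ‖ - z ‖ ≡ ‖ z ‖
  ‖-‖ z = ≡.cong₂ ℚ._+_ (ℚ.∣-p∣≡∣p∣ (Re z)) (ℚ.∣-p∣≡∣p∣ (Im z))

  ‖*‖ : ∀ z w → ‖ z * w ‖ ℚ.≤ ‖ z ‖ ℚ.* ‖ w ‖
  ‖*‖ z w = begin
    ℚ.∣ a ℚ.* c ℚ.- b ℚ.* d ∣ ℚ.+ ℚ.∣ a ℚ.* d ℚ.+ b ℚ.* c ∣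
      ≤⟨ ℚ.+-mono-≤ (ℚ.∣p-q∣≤∣p∣+∣q∣ (a ℚ.* c) (b ℚ.* d)) (ℚ.∣p+q∣≤∣p∣+∣q∣ (a ℚ.* d) (b ℚ.* c)) ⟩
    (ℚ.∣ a ℚ.* c ∣ ℚ.+ ℚ.∣ b ℚ.* d ∣) ℚ.+ (ℚ.∣ a ℚ.* d ∣ ℚ.+ ℚ.∣ b ℚ.* c ∣)
      ≡⟨ ≡.cong₂ ℚ._+_ (≡.cong₂ ℚ._+_ (ℚ.∣p*q∣≡∣p∣*∣q∣ a c) (ℚ.∣p*q∣≡∣p∣*∣q∣ b d))
                       (≡.cong₂ ℚ._+_ (ℚ.∣p*q∣≡∣p∣*∣q∣ a d) (ℚ.∣p*q∣≡∣p∣*∣q∣ b c)) ⟩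
    (ℚ.∣ a ∣ ℚ.* ℚ.∣ c ∣ ℚ.+ ℚ.∣ b ∣ ℚ.* ℚ.∣ d ∣) ℚ.+ (ℚ.∣ a ∣ ℚ.* ℚ.∣ d ∣ ℚ.+ ℚ.∣ b ∣ ℚ.* ℚ.∣ c ∣)
      ≡⟨ solve 4 (λ a b c d → (a :* c :+ b :* d) :+ (a :* d :+ b :* c) := (a :+ b) :* (c :+ d)) ≡.refl
           ℚ.∣ a ∣ ℚ.∣ b ∣ ℚ.∣ c ∣ ℚ.∣ d ∣ ⟩
    ‖ z ‖ ℚ.* ‖ w ‖ ∎
    where
    open ℚ.≤-Reasoning
    a b c d : ℚ
    a = Re z
    b = Im z
    c = Re w
    d = Im w

  ‖ι‖ : ∀ k → ‖ ι k ‖ ≡ fromℤ (+ ℤ.∣ k ∣)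
  ‖ι‖ k = ≡.trans (ℚ.+-identityʳ _) (∣fromℤ∣ k)

  ‖∑‖ : ∀ n f → ‖ ∑ n f ‖ ℚ.≤ Σℚ.∑ n (λ i → ‖ f i ‖)
  ‖∑‖ zero    f = ℚ.≤-refl
  ‖∑‖ (suc n) f = ℚ.≤-trans (‖+‖ (f 0) _) (ℚ.+-monoʳ-≤ ‖ f 0 ‖ (‖∑‖ n (λ i → f (suc i))))

  ‖-‖-triangle : ∀ x y z → ‖ x - z ‖ ℚ.≤ ‖ x - y ‖ ℚ.+ ‖ y - z ‖
  ‖-‖-triangle x y z = ℚ.≤-trans (ℚ.≤-reflexive (≡.cong ‖_‖ (≡.cong₂ _∔_
      (telescope (Re x) (Re y) (Re z)) (telescope (Im x) (Im y) (Im z)))))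
    (‖+‖ (x - y) (y - z))
    where
    telescope : ∀ a b c → a ℚ.- c ≡ (a ℚ.- b) ℚ.+ (b ℚ.- c)
    telescope = solve 3 (λ a b c → a :- c := (a :- b) :+ (b :- c)) ≡.refl

  ‖-‖-sym : ∀ x y → ‖ x - y ‖ ≡ ‖ y - x ‖
  ‖-‖-sym x y = ≡.trans (≡.sym (‖-‖ (x - y))) (≡.cong ‖_‖ (≡.cong₂ _∔_ (flip (Re x) (Re y)) (flip (Im x) (Im y))))
    where
    flip : ∀ a b → ℚ.- (a ℚ.- b) ≡ b ℚ.- a
    flip = solve 2 (λ a b → :- (a :- b) := b :- a) ≡.refl

  ‖x-x‖ : ∀ x → ‖ x - x ‖ ≡ 0ℚ
  ‖x-x‖ x = ≡.cong ‖_‖ {x - x} {0#} (-‿inverseʳ x)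

-- Partial sums of power series at Gaussian rationals

module Evaluations where
  open Gaussian
  open Weights using (sign²; sign-+)
  open Defs using
    (ℂ; mkℝ; seq; cauchy; re; im; ℤ→ℂ; ℚ→ℂ; 0ℝ; 1ℝ; 1ℂ; _<ℝ_; ∣_∣²; Within; CauchySeq; sign; divisorSum;
     HasSum; HasSum₂; HasSumℤ; HasQuotientSum; IsQuotient; IsU; IsG; Isϑ₃)

  -- A point of modulus below 1 can have ℓ¹ norm above 1, so a bound on `‖ z ‖` would not give
  -- decaying powers. Bounding every power directly costs only a constant factor, 2.
  Dominated : ℚ → ℚ[i] → Set
  Dominated x z = ∀ k → ‖ z ^ k ‖ ℚ.≤ x ^ℚ k ℚ.+ x ^ℚ k

  PolyBound : ℕ → ℕ → Series → Set
  PolyBound C d a = ∀ k → ℤ.∣ a k ∣ ℕ.≤ C ℕ.* suc k ℕ.^ d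

  ev : Series → ℚ[i] → ℕ → ℚ[i]
  ev c z n = ∑ n λ k → ι (c k) * z ^ k

  term-bound : ∀ {C d x z c} → 0ℚ ℚ.≤ x → Dominated x z → PolyBound C d c → ∀ k →
               ‖ ι (c k) * z ^ k ‖ ℚ.≤ polyTerm (C ℕ.+ C) d x k
  term-bound {C} {d} {x} {z} {c} 0≤x dom bound k = begin
    ‖ ι (c k) * z ^ k ‖
      ≤⟨ ‖*‖ (ι (c k)) (z ^ k) ⟩
    ‖ ι (c k) ‖ ℚ.* ‖ z ^ k ‖
      ≤⟨ *-mono-≤ (0≤‖‖ (ι (c k))) (0≤+ (0≤^ 0≤x k) (0≤^ 0≤x k))
           (ℚ.≤-trans (ℚ.≤-reflexive (‖ι‖ (c k))) (fromℤ-mono (ℤ.+≤+ (bound k)))) (dom k) ⟩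
    B ℚ.* (x ^ℚ k ℚ.+ x ^ℚ k)
      ≡⟨ solve 2 (λ b p → b :* (p :+ p) := (b :+ b) :* p) ≡.refl B (x ^ℚ k) ⟩
    (B ℚ.+ B) ℚ.* x ^ℚ k
      ≡⟨ ≡.cong (ℚ._* x ^ℚ k) (≡.trans (≡.sym (fromℤ-+ (+ (C ℕ.* suc k ℕ.^ d)) (+ (C ℕ.* suc k ℕ.^ d))))
           (≡.cong (λ n → fromℤ (+ n)) (≡.sym (ℕ.*-distribʳ-+ (suc k ℕ.^ d) C C)))) ⟩
    polyTerm (C ℕ.+ C) d x k ∎
    where
    open ℚ.≤-Reasoning
    open ℚSolver.+-*-Solver
    B : ℚ
    B = fromℤ (+ (C ℕ.* suc k ℕ.^ d))

  ev-head : ∀ {C d x z c} → 0ℚ ℚ.≤ x → Dominated x z → PolyBound C d c → ∀ n p →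
            ‖ ev c z (n ℕ.+ p) - ev c z n ‖ ℚ.≤ Σℚ.∑ p (λ j → polyTerm (C ℕ.+ C) d x (n ℕ.+ j))
  ev-head {C} {d} {x} {z} {c} 0≤x dom bound n p = begin
    ‖ ev c z (n ℕ.+ p) - ev c z n ‖
      ≡⟨ ≡.cong (λ w → ‖ w - ev c z n ‖) (Sums.∑-++ n p (λ k → ι (c k) * z ^ k)) ⟩
    ‖ (ev c z n + T) - ev c z n ‖
      ≡⟨ ≡.cong ‖_‖ (≡.cong₂ _∔_ (cancel (Re (ev c z n)) (Re T)) (cancel (Im (ev c z n)) (Im T))) ⟩
    ‖ T ‖
      ≤⟨ ‖∑‖ p (λ j → ι (c (n ℕ.+ j)) * z ^ (n ℕ.+ j)) ⟩
    Σℚ.∑ p (λ j → ‖ ι (c (n ℕ.+ j)) * z ^ (n ℕ.+ j) ‖)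
      ≤⟨ ∑-mono p (λ j → term-bound {C} {d} {x} {z} {c} 0≤x dom bound (n ℕ.+ j)) ⟩
    Σℚ.∑ p (λ j → polyTerm (C ℕ.+ C) d x (n ℕ.+ j)) ∎
    where
    open ℚ.≤-Reasoning
    open ℚSolver.+-*-Solver
    T : ℚ[i]
    T = ∑ p λ j → ι (c (n ℕ.+ j)) * z ^ (n ℕ.+ j)
    cancel : ∀ a b → (a ℚ.+ b) ℚ.- a ≡ b
    cancel = solve 2 (λ a b → (a :+ b) :- a := b) ≡.refl

  -- The point and both coefficient sequences are quantified after `N`, since products of partial
  -- sums have coefficients that change with the stage. Both values are compared with the common
  -- partial sum of n terms.
  Close : ℕ → ℕ → ℚ → ℚ → ℕ → Set
  Close C d x ε N = ∀ n → N ℕ.≤ n → ∀ z → Dominated x z → ∀ c c′ → PolyBound C d c → PolyBound C d c′ →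
    (∀ k → k ℕ.< n → c k ≡ c′ k) → ∀ p p′ → n ℕ.≤ p → n ℕ.≤ p′ → ‖ ev c z p - ev c′ z p′ ‖ ℚ.< ε

  half : ∀ ε → ½ ℚ.* ε ℚ.+ ½ ℚ.* ε ≡ ε
  half = solve 1 (λ e → con ½ :* e :+ con ½ :* e := e) ≡.refl
    where open ℚSolver.+-*-Solver

  close : ∀ C d {x} → 0ℚ ℚ.≤ x → x ℚ.< 1ℚ → ∀ {ε} → 0ℚ ℚ.< ε → ∃[ N ] Close C d x ε N
  close C d {x} 0≤x x<1 {ε} 0<ε = from (polynomial-tail (C ℕ.+ C) d 0≤x x<1 (0<* 0<½ 0<ε))
    where
    open ℚ.≤-Reasoning
    from : ∃[ N ] (∀ n p → N ℕ.≤ n → Σℚ.∑ p (λ j → polyTerm (C ℕ.+ C) d x (n ℕ.+ j)) ℚ.< ½ ℚ.* ε) →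
           ∃[ N ] Close C d x ε N
    from (N , tail) = N , λ n N≤n z dom c c′ bc bc′ agree p p′ n≤p n≤p′ →
      let
        one : ∀ c → PolyBound C d c → ∀ p → n ℕ.≤ p → ‖ ev c z p - ev c z n ‖ ℚ.< ½ ℚ.* ε
        one c bc p n≤p = ≡.subst (λ k → ‖ ev c z k - ev c z n ‖ ℚ.< ½ ℚ.* ε) (ℕ.m+[n∸m]≡n n≤p)
          (ℚ.≤-<-trans (ev-head {C} {d} {x} {z} {c} 0≤x dom bc n (p ℕ.∸ n)) (tail n (p ℕ.∸ n) N≤n))
        same : ev c′ z n ≡ ev c z n
        same = Sums.∑-cong< n λ k k<n → ≡.cong (λ a → ι a * z ^ k) (≡.sym (agree k k<n))
      in begin-strict
        ‖ ev c z p - ev c′ z p′ ‖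
          ≤⟨ ‖-‖-triangle (ev c z p) (ev c z n) (ev c′ z p′) ⟩
        ‖ ev c z p - ev c z n ‖ ℚ.+ ‖ ev c z n - ev c′ z p′ ‖
          <⟨ ℚ.+-mono-< (one c bc p n≤p)
               (≡.subst (ℚ._< ½ ℚ.* ε)
                 (≡.trans (‖-‖-sym (ev c′ z p′) (ev c′ z n)) (≡.cong (λ w → ‖ w - ev c′ z p′ ‖) same))
                 (one c′ bc′ p′ n≤p′)) ⟩
        ½ ℚ.* ε ℚ.+ ½ ℚ.* ε
          ≡⟨ half ε ⟩
        ε ∎

  module PolynomialBounds where
    open ℕ.≤-Reasoning

    -- The bound involves the support `k` and not the number `N` of terms. Hence lattice sums of
    -- every size obey the same polynomial bound.
    ∣∑∣≤ : ∀ N k {B} (f : ℕ → ℤ) → (∀ i → i ℕ.< k → ℤ.∣ f i ∣ ℕ.≤ B) → (∀ i → k ℕ.≤ i → f i ≡ ℤ.0ℤ) →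
           ℤ.∣ Σℤ.∑ N f ∣ ℕ.≤ k ℕ.* B
    ∣∑∣≤ zero    k       f f≤ f≡0 = z≤n
    ∣∑∣≤ (suc N) zero    f f≤ f≡0 = ℕ.≤-reflexive
      (≡.cong ℤ.∣_∣ (Σℤ.∑-zero (suc N) {f} λ i _ → f≡0 i z≤n))
    ∣∑∣≤ (suc N) (suc k) f f≤ f≡0 = ℕ.≤-trans (ℤ.∣i+j∣≤∣i∣+∣j∣ (f 0) _)
      (ℕ.+-mono-≤ (f≤ 0 (s≤s z≤n))
        (∣∑∣≤ N k (λ i → f (suc i)) (λ i i<k → f≤ (suc i) (s≤s i<k)) (λ i k≤i → f≡0 (suc i) (s≤s k≤i))))

    ∣conv∣≤ : ∀ n {B} (X : ℕ → ℕ → ℤ) → (∀ i j → suc (i ℕ.+ j) ≡ n → ℤ.∣ X i j ∣ ℕ.≤ B) →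
              ℤ.∣ Σℤ.conv n X ∣ ℕ.≤ n ℕ.* B
    ∣conv∣≤ zero    X X≤ = z≤n
    ∣conv∣≤ (suc n) X X≤ = ℕ.≤-trans (ℤ.∣i+j∣≤∣i∣+∣j∣ (X 0 n) _)
      (ℕ.+-mono-≤ (X≤ 0 n ≡.refl) (∣conv∣≤ n (λ i → X (suc i)) λ i j eq → X≤ (suc i) j (≡.cong suc eq)))

    ∣monomial∣≤1 : ∀ m k → ℤ.∣ monomial m k ∣ ℕ.≤ 1
    ∣monomial∣≤1 zero    zero    = ℕ.≤-refl
    ∣monomial∣≤1 zero    (suc k) = z≤n
    ∣monomial∣≤1 (suc m) zero    = z≤n
    ∣monomial∣≤1 (suc m) (suc k) = ∣monomial∣≤1 m k

    ∣scaled∣≤ : ∀ c m k → ℤ.∣ c ℤ.* monomial m k ∣ ℕ.≤ ℤ.∣ c ∣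
    ∣scaled∣≤ c m k = begin
      ℤ.∣ c ℤ.* monomial m k ∣         ≡⟨ ℤ.∣i*j∣≡∣i∣*∣j∣ c (monomial m k) ⟩
      ℤ.∣ c ∣ ℕ.* ℤ.∣ monomial m k ∣   ≤⟨ ℕ.*-monoʳ-≤ ℤ.∣ c ∣ (∣monomial∣≤1 m k) ⟩
      ℤ.∣ c ∣ ℕ.* 1                   ≡⟨ ℕ.*-identityʳ _ ⟩
      ℤ.∣ c ∣                         ∎

    lattice-bound : ∀ {w s} → (∀ i y → ℤ.∣ w i y ∣ ℕ.≤ suc i ℕ.^ s) → ∀ N Y →
                    PolyBound 1 (2 ℕ.+ s) (lattice w N Y)
    lattice-bound {w} {s} w≤ N Y k = begin
      ℤ.∣ lattice w N Y k ∣
        ≤⟨ ∣∑∣≤ N k (λ i → Σℤ.∑ Y (term i)) (λ i i<k → ∣∑∣≤ Y k (term i) (λ y _ → begin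
             ℤ.∣ term i y ∣ ≤⟨ ∣scaled∣≤ (w i y) (suc i ℕ.* suc y) k ⟩
             ℤ.∣ w i y ∣    ≤⟨ w≤ i y ⟩
             suc i ℕ.^ s    ≤⟨ ℕ.^-monoˡ-≤ s (ℕ.m≤n⇒m≤1+n i<k) ⟩
             suc k ℕ.^ s    ∎)
             (λ y k≤y → scaled-low (w i y) (ℕ.≤-trans (s≤s k≤y) (ℕ.m≤m+n (suc y) _))))
           (λ i k≤i → Σℤ.∑-zero Y λ y _ →
             scaled-low (w i y) (ℕ.≤-trans (s≤s k≤i) (ℕ.m≤m*n (suc i) (suc y)))) ⟩
      k ℕ.* (k ℕ.* suc k ℕ.^ s)
        ≤⟨ ℕ.*-mono-≤ (ℕ.n≤1+n k) (ℕ.*-monoˡ-≤ (suc k ℕ.^ s) (ℕ.n≤1+n k)) ⟩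
      suc k ℕ.^ (2 ℕ.+ s)
        ≡⟨ ℕ.*-identityˡ _ ⟨
      1 ℕ.* suc k ℕ.^ (2 ℕ.+ s) ∎
      where
      term : ℕ → ℕ → ℤ
      term i y = w i y ℤ.* monomial (suc i ℕ.* suc y) k

    ∣sign∣ : ∀ n → ℤ.∣ sign n ∣ ≡ 1
    ∣sign∣ zero    = ≡.refl
    ∣sign∣ (suc n) = ≡.trans (ℤ.∣i*j∣≡∣i∣*∣j∣ ℤ.-1ℤ (sign n)) (≡.trans (ℕ.*-identityˡ _) (∣sign∣ n))

    theta-bound : ∀ N → PolyBound 2 1 (thetaLattice N)
    theta-bound N k = begin
      ℤ.∣ thetaLattice N k ∣
        ≤⟨ ℤ.∣i+j∣≤∣i∣+∣j∣ (constant ℤ.1ℤ k) _ ⟩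
      ℤ.∣ constant ℤ.1ℤ k ∣ ℕ.+ ℤ.∣ Σℤ.∑ N term ∣
        ≤⟨ ℕ.+-mono-≤ (∣monomial∣≤1 0 k) (∣∑∣≤ N k term
             (λ i _ → begin
               ℤ.∣ term i ∣
                 ≡⟨ ℤ.∣i*j∣≡∣i∣*∣j∣ (+ 2) (sign (suc i) ℤ.* monomial (suc i ℕ.* suc i) k) ⟩
               2 ℕ.* ℤ.∣ sign (suc i) ℤ.* monomial (suc i ℕ.* suc i) k ∣
                 ≤⟨ ℕ.*-monoʳ-≤ 2 (∣scaled∣≤ (sign (suc i)) (suc i ℕ.* suc i) k) ⟩
               2 ℕ.* ℤ.∣ sign (suc i) ∣
                 ≡⟨ ≡.cong (2 ℕ.*_) (∣sign∣ (suc i)) ⟩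
               2 ∎)
             (λ i k≤i → ≡.cong (+ 2 ℤ.*_)
               (scaled-low (sign (suc i)) (ℕ.≤-trans (s≤s k≤i) (ℕ.m≤m+n (suc i) _))))) ⟩
      1 ℕ.+ k ℕ.* 2
        ≤⟨ ℕ.+-monoˡ-≤ (k ℕ.* 2) (s≤s z≤n) ⟩
      suc k ℕ.* 2
        ≡⟨ ℕ.*-comm (suc k) 2 ⟩
      2 ℕ.* suc k
        ≡⟨ ≡.cong (2 ℕ.*_) (≡.sym (ℕ.^-identityʳ (suc k))) ⟩
      2 ℕ.* suc k ℕ.^ 1 ∎
      where
      term : ℕ → ℤ
      term i = + 2 ℤ.* (sign (suc i) ℤ.* monomial (suc i ℕ.* suc i) k)

    ⊛-bound : ∀ {C d C′ d′ a b} → PolyBound C d a → PolyBound C′ d′ b →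
              PolyBound (C ℕ.* C′) (suc (d ℕ.+ d′)) (a ⊛ b)
    ⊛-bound {C} {d} {C′} {d′} {a} {b} a≤ b≤ k = begin
      ℤ.∣ (a ⊛ b) k ∣
        ≤⟨ ∣conv∣≤ (suc k) (λ i j → a i ℤ.* b j) (λ i j eq → begin
             ℤ.∣ a i ℤ.* b j ∣
               ≡⟨ ℤ.∣i*j∣≡∣i∣*∣j∣ (a i) (b j) ⟩
             ℤ.∣ a i ∣ ℕ.* ℤ.∣ b j ∣
               ≤⟨ ℕ.*-mono-≤ (a≤ i) (b≤ j) ⟩
             C ℕ.* suc i ℕ.^ d ℕ.* (C′ ℕ.* suc j ℕ.^ d′)
               ≤⟨ ℕ.*-mono-≤
                    (ℕ.*-monoʳ-≤ C (ℕ.^-monoˡ-≤ d (ℕ.≤-trans (s≤s (ℕ.m≤m+n i j)) (ℕ.≤-reflexive eq))))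
                    (ℕ.*-monoʳ-≤ C′ (ℕ.^-monoˡ-≤ d′ (ℕ.≤-trans (s≤s (ℕ.m≤n+m j i)) (ℕ.≤-reflexive eq)))) ⟩
             C ℕ.* suc k ℕ.^ d ℕ.* (C′ ℕ.* suc k ℕ.^ d′) ∎) ⟩
      suc k ℕ.* (C ℕ.* suc k ℕ.^ d ℕ.* (C′ ℕ.* suc k ℕ.^ d′))
        ≡⟨ solve 5 (λ n C x C′ y → n :* (C :* x :* (C′ :* y)) := C :* C′ :* (n :* (x :* y))) ≡.refl
             (suc k) C (suc k ℕ.^ d) C′ (suc k ℕ.^ d′) ⟩
      C ℕ.* C′ ℕ.* (suc k ℕ.* (suc k ℕ.^ d ℕ.* suc k ℕ.^ d′))
        ≡⟨ ≡.cong (λ x → C ℕ.* C′ ℕ.* (suc k ℕ.* x)) (≡.sym (ℕ.^-distribˡ-+-* (suc k) d d′)) ⟩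
      C ℕ.* C′ ℕ.* suc k ℕ.^ suc (d ℕ.+ d′) ∎
      where open ℕSolver.+-*-Solver

    ⊕-bound : ∀ {C d C′ d′ a b} → PolyBound C d a → PolyBound C′ d′ b →
              PolyBound (C ℕ.+ C′) (d ℕ.+ d′) (a ⊕ b)
    ⊕-bound {C} {d} {C′} {d′} {a} {b} a≤ b≤ k = begin
      ℤ.∣ a k ℤ.+ b k ∣
        ≤⟨ ℤ.∣i+j∣≤∣i∣+∣j∣ (a k) (b k) ⟩
      ℤ.∣ a k ∣ ℕ.+ ℤ.∣ b k ∣
        ≤⟨ ℕ.+-mono-≤ (ℕ.≤-trans (a≤ k) (ℕ.*-monoʳ-≤ C (ℕ.^-monoʳ-≤ (suc k) (ℕ.m≤m+n d d′))))
                      (ℕ.≤-trans (b≤ k) (ℕ.*-monoʳ-≤ C′ (ℕ.^-monoʳ-≤ (suc k) (ℕ.m≤n+m d′ d)))) ⟩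
      C ℕ.* suc k ℕ.^ (d ℕ.+ d′) ℕ.+ C′ ℕ.* suc k ℕ.^ (d ℕ.+ d′)
        ≡⟨ ℕ.*-distribʳ-+ (suc k ℕ.^ (d ℕ.+ d′)) C C′ ⟨
      (C ℕ.+ C′) ℕ.* suc k ℕ.^ (d ℕ.+ d′) ∎

    scale-bound : ∀ {C d a} c → PolyBound C d a → PolyBound (ℤ.∣ c ∣ ℕ.* C) d (λ k → c ℤ.* a k)
    scale-bound {C} {d} {a} c a≤ k = begin
      ℤ.∣ c ℤ.* a k ∣                     ≡⟨ ℤ.∣i*j∣≡∣i∣*∣j∣ c (a k) ⟩
      ℤ.∣ c ∣ ℕ.* ℤ.∣ a k ∣               ≤⟨ ℕ.*-monoʳ-≤ ℤ.∣ c ∣ (a≤ k) ⟩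
      ℤ.∣ c ∣ ℕ.* (C ℕ.* suc k ℕ.^ d)     ≡⟨ ℕ.*-assoc ℤ.∣ c ∣ C _ ⟨
      ℤ.∣ c ∣ ℕ.* C ℕ.* suc k ℕ.^ d       ∎

    monomial-bound : ∀ m → PolyBound 1 0 (monomial m)
    monomial-bound m k = ∣monomial∣≤1 m k

    constant-bound : ∀ c → PolyBound ℤ.∣ c ∣ 0 (constant c)
    constant-bound c zero    = ℕ.≤-reflexive (≡.sym (ℕ.*-identityʳ ℤ.∣ c ∣))
    constant-bound c (suc k) = z≤n

  truncate : ℕ → Series → Series
  truncate n a k with k ℕ.<? n
  ... | yes _ = a k
  ... | no _  = ℤ.0ℤ

  truncate-low : ∀ n a {k} → k ℕ.< n → truncate n a k ≡ a k
  truncate-low n a {k} k<n with k ℕ.<? n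
  ... | yes _  = ≡.refl
  ... | no k≮n = contradiction k<n k≮n

  truncate-high : ∀ n a {k} → n ℕ.≤ k → truncate n a k ≡ ℤ.0ℤ
  truncate-high n a {k} n≤k with k ℕ.<? n
  ... | yes k<n = contradiction k<n (ℕ.≤⇒≯ n≤k)
  ... | no _    = ≡.refl

  truncate-bound : ∀ {C d a} n → PolyBound C d a → PolyBound C d (truncate n a)
  truncate-bound n a≤ k with k ℕ.<? n
  ... | yes _ = a≤ k
  ... | no _  = z≤n

  open PolynomialBounds

  private
    ι-conv : ∀ n (X : ℕ → ℕ → ℤ) → ι (Σℤ.conv n X) ≡ Sums.conv n (λ i j → ι (X i j))
    ι-conv zero    X = ι-0
    ι-conv (suc n) X = ≡.trans (ι-+ (X 0 n) _) (≡.cong (λ z → ι (X 0 n) + z) (ι-conv n (λ i → X (suc i))))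

    ev-truncate : ∀ a z n {K} → n ℕ.≤ K → ev a z n ≡ ev (truncate n a) z K
    ev-truncate a z n {K} n≤K = ≡.sym (≡.trans
      (Sums.∑-extend (λ k → ι (truncate n a k) * z ^ k) n≤K
        λ k n≤k → ≡.trans (≡.cong (λ c → ι c * z ^ k) (truncate-high n a n≤k))
                          (≡.trans (≡.cong (_* z ^ k) ι-0) (zeroˡ (z ^ k))))
      (Sums.∑-cong< n λ k k<n → ≡.cong (λ c → ι c * z ^ k) (truncate-low n a k<n)))

  -- Two partial sums of n terms are polynomials of degree below n, so 2 n coefficients capture
  -- their product without an error term. Below degree n these coefficients agree with those of
  -- `a ⊛ b`, and `close` estimates the rest.
  ev-product : ∀ a b z n → ev a z n * ev b z n ≡ ev (truncate n a ⊛ truncate n b) z (n ℕ.+ n)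
  ev-product a b z n = begin
    ev a z n * ev b z n
      ≡⟨ ≡.cong₂ _*_ (ev-truncate a z n {K} n≤K) (ev-truncate b z n {K} n≤K) ⟩
    ∑ K f * ∑ K g
      ≡⟨ Sums.∑-*ʳ K f (∑ K g) ⟨
    ∑ K (λ i → f i * ∑ K g)
      ≡⟨ Sums.∑-cong K (λ i → ≡.sym (Sums.∑-*ˡ K (f i) g)) ⟩
    ∑ K (λ i → ∑ K (λ j → f i * g j))
      ≡⟨ Sums.∑-antidiagonal K K (λ i j → f i * g j) ℕ.≤-refl vanish ⟩
    0# + ∑ (n ℕ.+ n) (λ l → Sums.conv (suc l) (λ i j → f i * g j))
      ≡⟨ +-identityˡ _ ⟩
    ∑ (n ℕ.+ n) (λ l → Sums.conv (suc l) (λ i j → f i * g j))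
      ≡⟨ Sums.∑-cong (n ℕ.+ n) coefficient ⟩
    ev (truncate n a ⊛ truncate n b) z (n ℕ.+ n) ∎
    where
    open ≡.≡-Reasoning
    a′ b′ : Series
    a′ = truncate n a
    b′ = truncate n b
    K : ℕ
    K = suc (n ℕ.+ n)
    n≤K : n ℕ.≤ K
    n≤K = ℕ.m≤n⇒m≤1+n (ℕ.m≤m+n n n)
    f g : ℕ → ℚ[i]
    f i = ι (a′ i) * z ^ i
    g j = ι (b′ j) * z ^ j
    high : ∀ c i → n ℕ.≤ i → ι (truncate n c i) * z ^ i ≡ 0#
    high c i n≤i = ≡.trans (≡.cong (_* z ^ i) (≡.trans (≡.cong ι (truncate-high n c n≤i)) ι-0)) (zeroˡ (z ^ i))
    vanish : ∀ i j → K ℕ.≤ suc (i ℕ.+ j) → f i * g j ≡ 0#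
    vanish i j (s≤s nn≤) with ℕ.≤-total n i
    ... | inj₁ n≤i = ≡.trans (≡.cong (_* g j) (high a i n≤i)) (zeroˡ (g j))
    ... | inj₂ i≤n = ≡.trans (≡.cong (f i *_) (high b j
      (ℕ.+-cancelˡ-≤ n n j (ℕ.≤-trans nn≤ (ℕ.+-monoˡ-≤ j i≤n))))) (zeroʳ (f i))
    coefficient : ∀ l → Sums.conv (suc l) (λ i j → f i * g j) ≡ ι ((a′ ⊛ b′) l) * z ^ l
    coefficient l = begin
      Sums.conv (suc l) (λ i j → f i * g j)
        ≡⟨ Sums.conv-cong (suc l) (λ i j eq → begin
             (ι (a′ i) * z ^ i) * (ι (b′ j) * z ^ j)
               ≡⟨ *-assoc (ι (a′ i)) (z ^ i) _ ⟩
             ι (a′ i) * (z ^ i * (ι (b′ j) * z ^ j))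
               ≡⟨ ≡.cong (ι (a′ i) *_) (≡.trans (≡.sym (*-assoc (z ^ i) (ι (b′ j)) (z ^ j)))
                    (≡.trans (≡.cong (_* z ^ j) (*-comm (z ^ i) (ι (b′ j))))
                             (*-assoc (ι (b′ j)) (z ^ i) (z ^ j)))) ⟩
             ι (a′ i) * (ι (b′ j) * (z ^ i * z ^ j))
               ≡⟨ *-assoc (ι (a′ i)) (ι (b′ j)) _ ⟨
             (ι (a′ i) * ι (b′ j)) * (z ^ i * z ^ j)
               ≡⟨ ≡.cong₂ _*_ (≡.sym (ι-* (a′ i) (b′ j)))
                    (≡.trans (≡.sym (^-homo-* z i j)) (≡.cong (z ^_) (ℕ.suc-injective eq))) ⟩
             ι (a′ i ℤ.* b′ j) * z ^ l
               ≡⟨ *-comm (ι (a′ i ℤ.* b′ j)) (z ^ l) ⟩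
             z ^ l * ι (a′ i ℤ.* b′ j) ∎) ⟩
      Sums.conv (suc l) (λ i j → z ^ l * ι (a′ i ℤ.* b′ j))
        ≡⟨ Sums.conv-*ˡ (suc l) (z ^ l) (λ i j → ι (a′ i ℤ.* b′ j)) ⟩
      z ^ l * Sums.conv (suc l) (λ i j → ι (a′ i ℤ.* b′ j))
        ≡⟨ ≡.cong (z ^ l *_) (ι-conv (suc l) (λ i j → a′ i ℤ.* b′ j)) ⟨
      z ^ l * ι ((a′ ⊛ b′) l)
        ≡⟨ *-comm (z ^ l) _ ⟩
      ι ((a′ ⊛ b′) l) * z ^ l ∎

  truncate-⊛ : ∀ n a b {k} → k ℕ.< n → (truncate n a ⊛ truncate n b) k ≡ (a ⊛ b) k
  truncate-⊛ n a b {k} k<n = Σℤ.conv-cong (suc k) λ i j eq → ≡.cong₂ ℤ._*_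
    (truncate-low n a (ℕ.≤-<-trans (ℕ.≤-trans (ℕ.m≤m+n i j) (ℕ.≤-reflexive (ℕ.suc-injective eq))) k<n))
    (truncate-low n b (ℕ.≤-<-trans (ℕ.≤-trans (ℕ.m≤n+m j i) (ℕ.≤-reflexive (ℕ.suc-injective eq))) k<n))

  ev-⊕ : ∀ a b z n → ev (a ⊕ b) z n ≡ ev a z n + ev b z n
  ev-⊕ a b z n = ≡.trans
    (Sums.∑-cong n λ k → ≡.trans (≡.cong (_* z ^ k) (ι-+ (a k) (b k))) (distribʳ (z ^ k) (ι (a k)) (ι (b k))))
    (Sums.∑-+ n (λ k → ι (a k) * z ^ k) (λ k → ι (b k) * z ^ k))

  ev-scale : ∀ c a z n → ev (λ k → c ℤ.* a k) z n ≡ ι c * ev a z n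
  ev-scale c a z n = ≡.trans
    (Sums.∑-cong n λ k → ≡.trans (≡.cong (_* z ^ k) (ι-* c (a k))) (*-assoc (ι c) (ι (a k)) (z ^ k)))
    (Sums.∑-*ˡ n (ι c) (λ k → ι (a k) * z ^ k))

  ev-monomial : ∀ m z {n} → m ℕ.< n → ev (monomial m) z n ≡ z ^ m
  ev-monomial zero    z {suc n} m<n = ≡.trans (≡.cong₂ _+_
      (≡.trans (*-identityʳ (ι ℤ.1ℤ)) ι-1)
      (Sums.∑-zero n λ k _ → ≡.trans (≡.cong (_* z ^ suc k) ι-0) (zeroˡ (z ^ suc k))))
    (+-identityʳ 1#)
  ev-monomial (suc m) z {suc n} (s≤s m<n) = begin
    ι ℤ.0ℤ * 1# + ∑ n (λ k → ι (monomial m k) * (z * z ^ k))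
      ≡⟨ ≡.cong₂ _+_ (≡.trans (≡.cong (_* 1#) ι-0) (zeroˡ 1#))
           (Sums.∑-cong n λ k → ≡.trans (≡.sym (*-assoc (ι (monomial m k)) z (z ^ k)))
              (≡.trans (≡.cong (_* z ^ k) (*-comm (ι (monomial m k)) z)) (*-assoc z (ι (monomial m k)) (z ^ k)))) ⟩
    0# + ∑ n (λ k → z * (ι (monomial m k) * z ^ k))
      ≡⟨ ≡.trans (+-identityˡ _) (Sums.∑-*ˡ n z (λ k → ι (monomial m k) * z ^ k)) ⟩
    z * ev (monomial m) z n
      ≡⟨ ≡.cong (z *_) (ev-monomial m z m<n) ⟩
    z * z ^ m ∎
    where open ≡.≡-Reasoning

  private
    ev-zero : ∀ z n → ev (λ _ → ℤ.0ℤ) z n ≡ 0#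
    ev-zero z n = Sums.∑-zero n λ k _ → ≡.trans (≡.cong (_* z ^ k) ι-0) (zeroˡ (z ^ k))

  ev-∑ : ∀ N (a : ℕ → Series) z n → ev (λ k → Σℤ.∑ N (λ i → a i k)) z n ≡ ∑ N (λ i → ev (a i) z n)
  ev-∑ zero    a z n = ev-zero z n
  ev-∑ (suc N) a z n = ≡.trans (ev-⊕ (a 0) (λ k → Σℤ.∑ N (λ i → a (suc i) k)) z n)
    (≡.cong (λ w → ev (a 0) z n + w) (ev-∑ N (λ i → a (suc i)) z n))

  ev-lattice : ∀ w N Y z {n} → N ℕ.* Y ℕ.< n →
    ev (lattice w N Y) z n ≡ ∑ N (λ i → ∑ Y (λ y → ι (w i y) * z ^ (suc i ℕ.* suc y)))
  ev-lattice w N Y z {n} NY<n = ≡.trans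
    (ev-∑ N (λ i k → Σℤ.∑ Y (λ y → w i y ℤ.* monomial (suc i ℕ.* suc y) k)) z n)
    (Sums.∑-cong< N λ i i<N → ≡.trans
      (ev-∑ Y (λ y k → w i y ℤ.* monomial (suc i ℕ.* suc y) k) z n)
      (Sums.∑-cong< Y λ y y<Y → ≡.trans (ev-scale (w i y) (monomial (suc i ℕ.* suc y)) z n)
        (≡.cong (ι (w i y) *_) (ev-monomial (suc i ℕ.* suc y) z
          (ℕ.≤-<-trans (ℕ.*-mono-≤ i<N y<Y) NY<n)))))

  -- Sequences with the same limit and values of series

  Sequence : Set
  Sequence = ℕ → ℚ[i]

  module Asymptotics where
    open ℚSolver.+-*-Solver

    infix 4 _~_
    -- Compares two sequences without asking either of them to converge, so identities of limits can
    -- be proved before or apart from convergence.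
    record _~_ (a b : Sequence) : Set where
      constructor asymptotic
      field
        eventually : ∀ {ε} → 0ℚ ℚ.< ε → ∃[ N ] (∀ n → N ℕ.≤ n → ‖ a n - b n ‖ ℚ.< ε)
    open _~_ public

    Bounded : Sequence → Set
    Bounded a = ∃[ B ] (0ℚ ℚ.≤ B) × ∃[ N ] (∀ n → N ℕ.≤ n → ‖ a n ‖ ℚ.≤ B)

    ~-eventually : ∀ {a b} N → (∀ n → N ℕ.≤ n → a n ≡ b n) → a ~ b
    ~-eventually {a} {b} N a≡b = asymptotic λ {ε} 0<ε → N , λ n N≤n →
      ≡.subst (ℚ._< ε) (≡.sym (≡.trans (≡.cong (λ w → ‖ w - b n ‖) (a≡b n N≤n)) (‖x-x‖ (b n)))) 0<ε

    private
      both : ∀ {P Q : ℕ → Set} → ∃[ N ] (∀ n → N ℕ.≤ n → P n) → ∃[ N ] (∀ n → N ℕ.≤ n → Q n) →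
             ∃[ N ] (∀ n → N ℕ.≤ n → P n × Q n)
      both (M , p) (N , q) = M ℕ.⊔ N , λ n h →
        p n (ℕ.m⊔n≤o⇒m≤o M N h) , q n (ℕ.m⊔n≤o⇒n≤o M N h)

      map-eventually : ∀ {P Q : ℕ → Set} → (∀ n → P n → Q n) →
                       ∃[ N ] (∀ n → N ℕ.≤ n → P n) → ∃[ N ] (∀ n → N ℕ.≤ n → Q n)
      map-eventually f (N , p) = N , λ n N≤n → f n (p n N≤n)

    ~-sym : ∀ {a b} → a ~ b → b ~ a
    ~-sym {a} {b} a~b = asymptotic λ {ε} 0<ε → map-eventually
      (λ n → ≡.subst (ℚ._< ε) (‖-‖-sym (a n) (b n))) (eventually a~b 0<ε)

    ~-trans : ∀ {a b c} → a ~ b → b ~ c → a ~ c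
    ~-trans {a} {b} {c} a~b b~c = asymptotic λ {ε} 0<ε → map-eventually
      (λ n (p , q) → ℚ.≤-<-trans (‖-‖-triangle (a n) (b n) (c n))
        (≡.subst (_ ℚ.<_) (half ε) (ℚ.+-mono-< p q)))
      (both (eventually a~b (0<* 0<½ 0<ε)) (eventually b~c (0<* 0<½ 0<ε)))

    ~-+ : ∀ {a b c d} → a ~ b → c ~ d → (λ n → a n + c n) ~ (λ n → b n + d n)
    ~-+ {a} {b} {c} {d} a~b c~d = asymptotic λ {ε} 0<ε → map-eventually
      (λ n (p , q) → ℚ.≤-<-trans
        (ℚ.≤-trans (ℚ.≤-reflexive (≡.cong ‖_‖ (≡.cong₂ _∔_
            (regroup (Re (a n)) (Re (b n)) (Re (c n)) (Re (d n)))
            (regroup (Im (a n)) (Im (b n)) (Im (c n)) (Im (d n))))))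
          (‖+‖ (a n - b n) (c n - d n)))
        (≡.subst (_ ℚ.<_) (half ε) (ℚ.+-mono-< p q)))
      (both (eventually a~b (0<* 0<½ 0<ε)) (eventually c~d (0<* 0<½ 0<ε)))
      where
      regroup : ∀ a b c d → (a ℚ.+ c) ℚ.- (b ℚ.+ d) ≡ (a ℚ.- b) ℚ.+ (c ℚ.- d)
      regroup = solve 4 (λ a b c d → (a :+ c) :- (b :+ d) := (a :- b) :+ (c :- d)) ≡.refl

    -- The error is (a - b) ((c - d) + d) + b (c - d). Once c - d has norm below 1, bounds for b and
    -- d suffice, and the constant is 1 + D + B.
    ~-* : ∀ {a b c d} → Bounded b → Bounded d → a ~ b → c ~ d → (λ n → a n * c n) ~ (λ n → b n * d n)
    ~-* {a} {b} {c} {d} (B , 0≤B , N , ∣b∣≤B) (D , 0≤D , M , ∣d∣≤D) a~b c~d =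
      asymptotic λ 0<ε → from 0<ε (inverse 0<K)
      where
      open ℚ.≤-Reasoning
      K : ℚ
      K = 1ℚ ℚ.+ (D ℚ.+ B)
      0<K : 0ℚ ℚ.< K
      0<K = ℚ.+-mono-<-≤ 0<1 (0≤+ 0≤D 0≤B)
      estimate : ∀ {ε} δ → 0ℚ ℚ.≤ δ → K ℚ.* δ ≡ ε → ∀ n →
        ((‖ b n ‖ ℚ.≤ B) × (‖ d n ‖ ℚ.≤ D)) × ((‖ a n - b n ‖ ℚ.< δ) × ((‖ c n - d n ‖ ℚ.< δ) × (‖ c n - d n ‖ ℚ.< 1ℚ))) →
        ‖ a n * c n - b n * d n ‖ ℚ.< ε
      estimate {ε} δ 0≤δ Kδ≡ε n ((b≤B , d≤D) , (p , q , r)) = begin-strict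
        ‖ a n * c n - b n * d n ‖
          ≡⟨ ≡.cong ‖_‖ (≡.cong₂ _∔_
               (solve 8 (λ a a′ b b′ c c′ d d′ →
                 (a :* c :- a′ :* c′) :- (b :* d :- b′ :* d′) :=
                 ((a :- b) :* ((c :- d) :+ d) :- (a′ :- b′) :* ((c′ :- d′) :+ d′))
                   :+ (b :* (c :- d) :- b′ :* (c′ :- d′))) ≡.refl
                  (Re (a n)) (Im (a n)) (Re (b n)) (Im (b n)) (Re (c n)) (Im (c n)) (Re (d n)) (Im (d n)))
               (solve 8 (λ a a′ b b′ c c′ d d′ →
                 (a :* c′ :+ a′ :* c) :- (b :* d′ :+ b′ :* d) :=
                 ((a :- b) :* ((c′ :- d′) :+ d′) :+ (a′ :- b′) :* ((c :- d) :+ d))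
                   :+ (b :* (c′ :- d′) :+ b′ :* (c :- d))) ≡.refl
                  (Re (a n)) (Im (a n)) (Re (b n)) (Im (b n)) (Re (c n)) (Im (c n)) (Re (d n)) (Im (d n)))) ⟩
        ‖ (a n - b n) * ((c n - d n) + d n) + b n * (c n - d n) ‖
          ≤⟨ ‖+‖ ((a n - b n) * ((c n - d n) + d n)) (b n * (c n - d n)) ⟩
        ‖ (a n - b n) * ((c n - d n) + d n) ‖ ℚ.+ ‖ b n * (c n - d n) ‖
          ≤⟨ ℚ.+-mono-≤
               (ℚ.≤-trans (‖*‖ (a n - b n) ((c n - d n) + d n))
                 (ℚ.*-monoˡ-≤-nonNeg ‖ a n - b n ‖ {{ℚ.nonNegative (0≤‖‖ (a n - b n))}}
                   (ℚ.≤-trans (‖+‖ (c n - d n) (d n)) (ℚ.+-mono-≤ (ℚ.<⇒≤ r) d≤D))))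
               (‖*‖ (b n) (c n - d n)) ⟩
        ‖ a n - b n ‖ ℚ.* (1ℚ ℚ.+ D) ℚ.+ ‖ b n ‖ ℚ.* ‖ c n - d n ‖
          <⟨ ℚ.+-mono-<-≤
               (ℚ.*-monoˡ-<-pos (1ℚ ℚ.+ D) {{ℚ.positive (ℚ.+-mono-<-≤ 0<1 0≤D)}} p)
               (*-mono-≤ (0≤‖‖ (b n)) 0≤δ b≤B (ℚ.<⇒≤ q)) ⟩
        δ ℚ.* (1ℚ ℚ.+ D) ℚ.+ B ℚ.* δ
          ≡⟨ solve 3 (λ e d b → e :* (con 1ℚ :+ d) :+ b :* e := (con 1ℚ :+ (d :+ b)) :* e) ≡.refl δ D B ⟩
        K ℚ.* δ
          ≡⟨ Kδ≡ε ⟩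
        ε ∎
      from : ∀ {ε} → 0ℚ ℚ.< ε → ∃[ I ] (0ℚ ℚ.< I) × (K ℚ.* I ≡ 1ℚ) → ∃[ N ] (∀ n → N ℕ.≤ n → ‖ a n * c n - b n * d n ‖ ℚ.< ε)
      from {ε} 0<ε (I , 0<I , KI≡1) = map-eventually (estimate δ (ℚ.<⇒≤ 0<δ) Kδ≡ε)
        (both (both (N , ∣b∣≤B) (M , ∣d∣≤D)) (both (eventually a~b 0<δ) (both (eventually c~d 0<δ) (eventually c~d 0<1))))
        where
        δ : ℚ
        δ = I ℚ.* ε
        0<δ : 0ℚ ℚ.< δ
        0<δ = 0<* 0<I 0<ε
        Kδ≡ε : K ℚ.* δ ≡ ε
        Kδ≡ε = ≡.trans (≡.sym (ℚ.*-assoc K I ε)) (≡.trans (≡.cong (ℚ._* ε) KI≡1) (ℚ.*-identityˡ ε))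

    ~-neg : ∀ {a b} → a ~ b → (λ n → - a n) ~ (λ n → - b n)
    ~-neg {a} {b} a~b = asymptotic λ {ε} 0<ε → map-eventually
      (λ n → ≡.subst (ℚ._< ε) (≡.trans (≡.sym (‖-‖ (a n - b n)))
        (≡.cong ‖_‖ (≡.cong₂ _∔_ (ℚ.neg-distrib-+ (Re (a n)) (ℚ.- Re (b n))) (ℚ.neg-distrib-+ (Im (a n)) (ℚ.- Im (b n)))))))
      (eventually a~b 0<ε)

    ~-scale : ∀ w {a b} → a ~ b → (λ n → w * a n) ~ (λ n → w * b n)
    ~-scale w {a} {b} a~b = asymptotic λ 0<ε → from 0<ε (inverse 0<K)
      where
      open ℚ.≤-Reasoning
      K : ℚ
      -- The summand 1 keeps `K` invertible when w = 0.
      K = 1ℚ ℚ.+ ‖ w ‖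
      0<K : 0ℚ ℚ.< K
      0<K = ℚ.+-mono-<-≤ 0<1 (0≤‖‖ w)
      from : ∀ {ε} → 0ℚ ℚ.< ε → ∃[ I ] (0ℚ ℚ.< I) × (K ℚ.* I ≡ 1ℚ) →
             ∃[ N ] (∀ n → N ℕ.≤ n → ‖ w * a n - w * b n ‖ ℚ.< ε)
      from {ε} 0<ε (I , 0<I , KI≡1) = map-eventually (λ n p → begin-strict
        ‖ w * a n - w * b n ‖
          ≡⟨ ≡.cong ‖_‖ (≡.cong₂ _∔_
               (solve 6 (λ w w′ a a′ b b′ → (w :* a :- w′ :* a′) :- (w :* b :- w′ :* b′) :=
                  w :* (a :- b) :- w′ :* (a′ :- b′)) ≡.refl
                  (Re w) (Im w) (Re (a n)) (Im (a n)) (Re (b n)) (Im (b n)))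
               (solve 6 (λ w w′ a a′ b b′ → (w :* a′ :+ w′ :* a) :- (w :* b′ :+ w′ :* b) :=
                  w :* (a′ :- b′) :+ w′ :* (a :- b)) ≡.refl
                  (Re w) (Im w) (Re (a n)) (Im (a n)) (Re (b n)) (Im (b n)))) ⟩
        ‖ w * (a n - b n) ‖
          ≤⟨ ‖*‖ w (a n - b n) ⟩
        ‖ w ‖ ℚ.* ‖ a n - b n ‖
          ≤⟨ p≤q-from (0≤‖‖ (a n - b n))
               (solve 2 (λ w x → (con 1ℚ :+ w) :* x := w :* x :+ x) ≡.refl ‖ w ‖ ‖ a n - b n ‖) ⟩
        K ℚ.* ‖ a n - b n ‖
          <⟨ ℚ.*-monoʳ-<-pos K {{ℚ.positive 0<K}} p ⟩
        K ℚ.* (I ℚ.* ε)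
          ≡⟨ ≡.trans (≡.sym (ℚ.*-assoc K I ε)) (≡.trans (≡.cong (ℚ._* ε) KI≡1) (ℚ.*-identityˡ ε)) ⟩
        ε ∎) (eventually a~b (0<* 0<I 0<ε))

    ~-refl : ∀ {a} → a ~ a
    ~-refl = ~-eventually 0 λ _ _ → ≡.refl

  open Asymptotics public

  module Evaluation (z : Sequence) {x : ℚ} (0≤x : 0ℚ ℚ.≤ x) (x<1 : x ℚ.< 1ℚ)
                    (N₀ : ℕ) (dominated : ∀ n → N₀ ℕ.≤ n → Dominated x (z n)) where

    -- A diagonal sequence: the same index counts the terms of the series and the stage of the
    -- approximation of q. The uniform estimates `Close` make the limit independent of this
    -- coupling.
    value : Series → Sequence
    value a n = ev a (z n) n

    private
      truncation-bound : ∀ {C d} a → PolyBound C d a → ∀ N n → N₀ ℕ.≤ n →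
        ‖ ev a (z n) N ‖ ℚ.≤ Σℚ.∑ N (polyTerm (C ℕ.+ C) d x)
      truncation-bound {C} {d} a a≤ N n N₀≤n = ℚ.≤-trans (‖∑‖ N (λ k → ι (a k) * z n ^ k))
        (∑-mono N λ k → term-bound {C} {d} {x} {z n} {a} 0≤x (dominated n N₀≤n) a≤ k)

    -- From stage `N` on, the value is within 1 of the partial sum with the fixed number `N` of
    -- terms, and that is bounded by a sum in which n does not occur.
    value-bounded : ∀ {C d a} → PolyBound C d a → Bounded (value a)
    value-bounded {C} {d} {a} a≤ = from (close C d 0≤x x<1 0<1)
      where
      from : ∃[ N ] Close C d x 1ℚ N → Bounded (value a)
      from (N , cl) = 1ℚ ℚ.+ S , 0≤+ (ℚ.<⇒≤ 0<1) (∑-nonneg N) , N ℕ.⊔ N₀ , λ n h →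
        let N≤n = ℕ.m⊔n≤o⇒m≤o N N₀ h ; N₀≤n = ℕ.m⊔n≤o⇒n≤o N N₀ h in
        ℚ.≤-trans (ℚ.≤-trans (ℚ.≤-reflexive (≡.cong ‖_‖ (≡.cong₂ _∔_
            (split (Re (value a n)) (Re (ev a (z n) N))) (split (Im (value a n)) (Im (ev a (z n) N))))))
          (‖+‖ (value a n - ev a (z n) N) (ev a (z n) N)))
        (ℚ.+-mono-≤ (ℚ.<⇒≤ (cl N ℕ.≤-refl (z n) (dominated n N₀≤n) a a a≤ a≤ (λ _ _ → ≡.refl) n N N≤n ℕ.≤-refl))
                    (truncation-bound {C} {d} a a≤ N n N₀≤n))
        where
        open ℚSolver.+-*-Solver
        S : ℚ
        S = Σℚ.∑ N (polyTerm (C ℕ.+ C) d x)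
        ∑-nonneg : ∀ N → 0ℚ ℚ.≤ Σℚ.∑ N (polyTerm (C ℕ.+ C) d x)
        ∑-nonneg N = ℚ.≤-trans (ℚ.≤-reflexive (≡.sym (Σℚ.∑-zero N λ _ _ → ≡.refl)))
          (∑-mono N λ k → 0≤* (0≤fromℕ ((C ℕ.+ C) ℕ.* suc k ℕ.^ d)) (0≤^ 0≤x k))
        split : ∀ a b → a ≡ (a ℚ.- b) ℚ.+ b
        split = solve 2 (λ a b → a := (a :- b) :+ b) ≡.refl

    value-product : ∀ {C d C′ d′ a b} → PolyBound C d a → PolyBound C′ d′ b →
                    (λ n → value a n * value b n) ~ value (a ⊛ b)
    value-product {C} {d} {C′} {d′} {a} {b} a≤ b≤ =
      asymptotic λ 0<ε → from (close (C ℕ.* C′) (suc (d ℕ.+ d′)) 0≤x x<1 0<ε)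
      where
      from : ∀ {ε} → ∃[ N ] Close (C ℕ.* C′) (suc (d ℕ.+ d′)) x ε N →
             ∃[ N ] (∀ n → N ℕ.≤ n → ‖ value a n * value b n - value (a ⊛ b) n ‖ ℚ.< ε)
      from {ε} (N , cl) = N ℕ.⊔ N₀ , λ n h →
        ≡.subst (λ w → ‖ w - value (a ⊛ b) n ‖ ℚ.< ε) (≡.sym (ev-product a b (z n) n))
          (cl n (ℕ.m⊔n≤o⇒m≤o N N₀ h) (z n) (dominated n (ℕ.m⊔n≤o⇒n≤o N N₀ h))
            (truncate n a ⊛ truncate n b) (a ⊛ b)
            (⊛-bound {C} {d} {C′} {d′} {truncate n a} {truncate n b}
               (truncate-bound {C} {d} {a} n a≤) (truncate-bound {C′} {d′} {b} n b≤))
            (⊛-bound {C} {d} {C′} {d′} {a} {b} a≤ b≤)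
            (λ k k<n → truncate-⊛ n a b k<n) (n ℕ.+ n) n (ℕ.m≤m+n n n) ℕ.≤-refl)

    product-~ : ∀ {C d C′ d′ a b} {s t : Sequence} → PolyBound C d a → PolyBound C′ d′ b →
                s ~ value a → t ~ value b → (λ n → s n * t n) ~ value (a ⊛ b)
    product-~ {C} {d} {C′} {d′} {a} {b} a≤ b≤ s~a t~b =
      ~-trans (~-* (value-bounded {C} {d} {a} a≤) (value-bounded {C′} {d′} {b} b≤) s~a t~b)
              (value-product {C} {d} {C′} {d′} {a} {b} a≤ b≤)

    value-cong : ∀ {a b} → (∀ k → a k ≡ b k) → ∀ n → value a n ≡ value b n
    value-cong a≡b n = Sums.∑-cong n λ k → ≡.cong (λ c → ι c * z n ^ k) (a≡b k)

    value-constant : ∀ c → value (constant c) ~ (λ _ → ι c)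
    value-constant c = ~-eventually 1 λ { (suc n) _ → ≡.trans (≡.cong₂ _+_ (*-identityʳ (ι c))
      (Sums.∑-zero n λ k _ → ≡.trans (≡.cong (_* z (suc n) ^ suc k) ι-0) (zeroˡ (z (suc n) ^ suc k))))
      (+-identityʳ (ι c)) }

    -- The double index matters: the polynomials c may be chosen after m.
    Approximates : ℕ → ℕ → Series → ℚ → ℕ → Set
    Approximates C d a ε N = ∀ n → N ℕ.≤ n → ∀ m → n ℕ.≤ m → N₀ ℕ.≤ m → ∀ c → PolyBound C d c →
      (∀ k → k ℕ.< n → c k ≡ a k) → ∀ p → n ℕ.≤ p → ‖ ev c (z m) p - value a m ‖ ℚ.< ε

    approximation : ∀ {C d a} → PolyBound C d a → ∀ {ε} → 0ℚ ℚ.< ε → ∃[ N ] Approximates C d a ε N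
    approximation {C} {d} {a} a≤ {ε} 0<ε = from (close C d 0≤x x<1 0<ε)
      where
      from : ∃[ N ] Close C d x ε N → ∃[ N ] Approximates C d a ε N
      from (N , cl) = N , λ n N≤n m n≤m N₀≤m c c≤ agree p n≤p →
        cl n N≤n (z m) (dominated m N₀≤m) c a c≤ a≤ agree p m n≤p n≤m

  -- Complex numbers through their Gaussian rational approximations

  at : ℕ → ℂ → ℚ[i]
  at m w = seq (re w) m ∔ seq (im w) m

  at-^ : ∀ m w k → at m (w Defs.^ k) ≡ at m w ^ k
  at-^ m w zero    = ≡.refl
  at-^ m w (suc k) = ≡.cong (at m w *_) (at-^ m w k)

  at-sum : ∀ m n (f : ℕ → ℂ) → at m (Defs.sum {n} (λ i → f (toℕ i))) ≡ ∑ n (λ i → at m (f i))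
  at-sum m zero    f = ≡.refl
  at-sum m (suc n) f = ≡.cong (λ v → at m (f 0) + v) (at-sum m n (λ i → f (suc i)))

  at-ℤ : ∀ m k → at m (ℤ→ℂ k) ≡ ι k
  at-ℤ m k = ≡.cong (_∔ 0ℚ) (/1≡fromℤ k)

  at-term : ∀ m c w k → at m (ℤ→ℂ c Defs.* w Defs.^ k) ≡ ι c * at m w ^ k
  at-term m c w k = ≡.cong₂ _*_ (at-ℤ m c) (at-^ m w k)

  ≈-from-~ : ∀ {v w} → (λ m → at m v) ~ (λ m → at m w) → v Defs.≈ w
  ≈-from-~ {v} {w} v~w =
    (λ ε 0<ε → let N , p = eventually v~w 0<ε in N , λ n N≤n →
      ℚ.≤-<-trans (∣Re∣≤‖‖ (at n v - at n w)) (p n N≤n)) ,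
    (λ ε 0<ε → let N , p = eventually v~w 0<ε in N , λ n N≤n →
      ℚ.≤-<-trans (∣Im∣≤‖‖ (at n v - at n w)) (p n N≤n))

  module SquaredModulus where
    open ℚSolver.+-*-Solver

    normSq : ℚ[i] → ℚ
    normSq w = Re w ℚ.* Re w ℚ.+ Im w ℚ.* Im w

    ∣p∣²≡p² : ∀ p → ℚ.∣ p ∣ ℚ.* ℚ.∣ p ∣ ≡ p ℚ.* p
    ∣p∣²≡p² p with ℚ.∣p∣≡p∨∣p∣≡-p p
    ... | inj₁ eq = ≡.cong₂ ℚ._*_ eq eq
    ... | inj₂ eq = ≡.trans (≡.cong₂ ℚ._*_ eq eq) (solve 1 (λ p → (:- p) :* (:- p) := p :* p) ≡.refl p)

    0≤p² : ∀ p → 0ℚ ℚ.≤ p ℚ.* p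
    0≤p² p = ≡.subst (0ℚ ℚ.≤_) (∣p∣²≡p² p) (0≤* (ℚ.0≤∣p∣ p) (ℚ.0≤∣p∣ p))

    p≤∣p∣ : ∀ p → p ℚ.≤ ℚ.∣ p ∣
    p≤∣p∣ p with ℚ.≤-total 0ℚ p
    ... | inj₁ 0≤p = ℚ.≤-reflexive (≡.sym (ℚ.0≤p⇒∣p∣≡p 0≤p))
    ... | inj₂ p≤0 = ℚ.≤-trans p≤0 (ℚ.0≤∣p∣ p)

    0≤normSq : ∀ w → 0ℚ ℚ.≤ normSq w
    0≤normSq w = 0≤+ (0≤p² (Re w)) (0≤p² (Im w))

    normSq≤‖‖² : ∀ w → normSq w ℚ.≤ ‖ w ‖ ℚ.* ‖ w ‖
    normSq≤‖‖² w = p≤q-from (0≤+ (0≤* (ℚ.0≤∣p∣ (Re w)) (ℚ.0≤∣p∣ (Im w))) (0≤* (ℚ.0≤∣p∣ (Re w)) (ℚ.0≤∣p∣ (Im w))))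
      (≡.trans (solve 2 (λ a b → (a :+ b) :* (a :+ b) := (a :* a :+ b :* b) :+ (a :* b :+ a :* b)) ≡.refl
         ℚ.∣ Re w ∣ ℚ.∣ Im w ∣)
        (≡.cong (ℚ._+ (ℚ.∣ Re w ∣ ℚ.* ℚ.∣ Im w ∣ ℚ.+ ℚ.∣ Re w ∣ ℚ.* ℚ.∣ Im w ∣))
          (≡.cong₂ ℚ._+_ (∣p∣²≡p² (Re w)) (∣p∣²≡p² (Im w)))))

    normSq-* : ∀ v w → normSq (v * w) ≡ normSq v ℚ.* normSq w
    normSq-* v w = solve 4 (λ a b c d →
      (a :* c :- b :* d) :* (a :* c :- b :* d) :+ (a :* d :+ b :* c) :* (a :* d :+ b :* c) :=
      (a :* a :+ b :* b) :* (c :* c :+ d :* d)) ≡.refl (Re v) (Im v) (Re w) (Im w)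

    -- The squared modulus is multiplicative, so powers pick up no constants. This is what yields
    -- `Dominated`, where the ℓ¹ norm alone would fail.
    normSq-^ : ∀ {x} w → normSq w ℚ.≤ x ℚ.* x → ∀ k → normSq (w ^ k) ℚ.≤ x ^ℚ k ℚ.* x ^ℚ k
    normSq-^ w w≤ zero = ℚ.≤-refl
    normSq-^ {x} w w≤ (suc k) = ℚ.≤-trans (ℚ.≤-reflexive (normSq-* w (w ^ k)))
      (ℚ.≤-trans (*-mono-≤ (0≤normSq w) (0≤p² (x ^ℚ k)) w≤ (normSq-^ w w≤ k))
        (ℚ.≤-reflexive (solve 2 (λ x p → x :* x :* (p :* p) := x :* p :* (x :* p)) ≡.refl x (x ^ℚ k))))

    root-≤ : ∀ {p y} → 0ℚ ℚ.≤ y → p ℚ.* p ℚ.≤ y ℚ.* y → ℚ.∣ p ∣ ℚ.≤ y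
    root-≤ {p} {y} 0≤y pp≤yy with ℚ.∣ p ∣ ℚ.≤? y
    ... | yes p≤y = p≤y
    ... | no p≰y = contradiction (ℚ.<-≤-trans yy<pp pp≤yy) (ℚ.<-irrefl ≡.refl)
      where
      y<p : y ℚ.< ℚ.∣ p ∣
      y<p = ℚ.≰⇒> p≰y
      yy<pp : y ℚ.* y ℚ.< p ℚ.* p
      yy<pp = ≡.subst (y ℚ.* y ℚ.<_) (∣p∣²≡p² p) (ℚ.≤-<-trans
        (ℚ.*-monoˡ-≤-nonNeg y {{ℚ.nonNegative 0≤y}} (ℚ.<⇒≤ y<p))
        (ℚ.*-monoˡ-<-pos ℚ.∣ p ∣ {{ℚ.positive (ℚ.≤-<-trans 0≤y y<p)}} y<p))

    ∣Re^∣≤ : ∀ {x} w → 0ℚ ℚ.≤ x → normSq w ℚ.≤ x ℚ.* x → ∀ k → ℚ.∣ Re (w ^ k) ∣ ℚ.≤ x ^ℚ k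
    ∣Re^∣≤ w 0≤x w≤ k = root-≤ (0≤^ 0≤x k)
      (ℚ.≤-trans (p≤q-from (0≤p² (Im (w ^ k))) ≡.refl) (normSq-^ w w≤ k))

    ∣Im^∣≤ : ∀ {x} w → 0ℚ ℚ.≤ x → normSq w ℚ.≤ x ℚ.* x → ∀ k → ℚ.∣ Im (w ^ k) ∣ ℚ.≤ x ^ℚ k
    ∣Im^∣≤ w 0≤x w≤ k = root-≤ (0≤^ 0≤x k)
      (ℚ.≤-trans (p≤q-from (0≤p² (Re (w ^ k))) (ℚ.+-comm (Re (w ^ k) ℚ.* Re (w ^ k)) (Im (w ^ k) ℚ.* Im (w ^ k))))
                 (normSq-^ w w≤ k))

    dominated-by : ∀ {x} w → 0ℚ ℚ.≤ x → normSq w ℚ.≤ x ℚ.* x → Dominated x w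
    dominated-by w 0≤x w≤ k = ℚ.+-mono-≤ (∣Re^∣≤ w 0≤x w≤ k) (∣Im^∣≤ w 0≤x w≤ k)

    -- The strict order on `ℝ` demands a uniform gap. With norm below η = ε / 2 the squared distance
    -- is at most η², and a further η² for the gap still fits into ε² = 4 η².
    within-from : ∀ {ε v w} → 0ℚ ℚ.< ε → ∃[ N ] (∀ n → N ℕ.≤ n → ‖ at n v - at n w ‖ ℚ.< ½ ℚ.* ε) →
                  Within ε v w
    within-from {ε} {v} {w} 0<ε (N , close) = η ℚ.* η , 0<* 0<η 0<η , N , λ n N≤n → begin
      normSq (at n v - at n w) ℚ.+ η ℚ.* η
        ≤⟨ ℚ.+-monoˡ-≤ (η ℚ.* η) (ℚ.≤-trans (normSq≤‖‖² (at n v - at n w))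
             (*-mono-≤ (0≤‖‖ (at n v - at n w)) (ℚ.<⇒≤ 0<η) (ℚ.<⇒≤ (close n N≤n)) (ℚ.<⇒≤ (close n N≤n)))) ⟩
      η ℚ.* η ℚ.+ η ℚ.* η
        ≤⟨ p≤q-from (0≤+ (0≤p² η) (0≤p² η))
             (solve 1 (λ e → e :* e := ((con ½ :* e) :* (con ½ :* e) :+ (con ½ :* e) :* (con ½ :* e))
                                       :+ ((con ½ :* e) :* (con ½ :* e) :+ (con ½ :* e) :* (con ½ :* e))) ≡.refl ε) ⟩
      ε ℚ.* ε ∎
      where
      open ℚ.≤-Reasoning
      η : ℚ
      η = ½ ℚ.* ε
      0<η : 0ℚ ℚ.< η
      0<η = 0<* 0<½ 0<ε

  open SquaredModulus

  record InDisc (q : ℂ) : Set where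
    field
      radius    : ℚ
      0≤radius  : 0ℚ ℚ.≤ radius
      radius<1  : radius ℚ.< 1ℚ
      threshold     : ℕ
      modulus≤  : ∀ n → threshold ℕ.≤ n → normSq (at n q) ℚ.≤ radius ℚ.* radius

  -- The uniform gap δ in |q|² < 1 bounds the squared moduli of all late approximations by 1 - δ,
  -- and `midpoint` supplies a rational radius below 1 whose square exceeds this.
  inDisc : ∀ q → ∣ q ∣² <ℝ 1ℝ → InDisc q
  inDisc q (δ , 0<δ , N , bound) = from (midpoint 0≤ρ ρ<1)
    where
    open ℚSolver.+-*-Solver
    ρ : ℚ
    ρ = 1ℚ ℚ.- δ
    modulus≤ρ : ∀ n → N ℕ.≤ n → normSq (at n q) ℚ.≤ ρ
    modulus≤ρ n N≤n = p≤q-from (0≤q-p (bound n N≤n))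
      (solve 2 (λ a d → con 1ℚ :- d := a :+ (con 1ℚ :- (a :+ d))) ≡.refl (normSq (at n q)) δ)
    0≤ρ : 0ℚ ℚ.≤ ρ
    0≤ρ = ℚ.≤-trans (0≤normSq (at N q)) (modulus≤ρ N ℕ.≤-refl)
    ρ<1 : ρ ℚ.< 1ℚ
    ρ<1 = p<q-from 0<δ (solve 1 (λ d → con 1ℚ := con 1ℚ :- d :+ d) ≡.refl δ)
    from : ∃[ x ] (0ℚ ℚ.≤ x) × (x ℚ.< 1ℚ) × (ρ ℚ.≤ x ℚ.* x) → InDisc q
    from (x , 0≤x , x<1 , ρ≤xx) = record
      { radius = x ; 0≤radius = 0≤x ; radius<1 = x<1 ; threshold = N
      ; modulus≤ = λ n N≤n → ℚ.≤-trans (modulus≤ρ n N≤n) ρ≤xx }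

  module PowerSeriesValue (q : ℂ) (disc : InDisc q) where
    open InDisc disc public

    z : Sequence
    z n = at n q

    open Evaluation z 0≤radius radius<1 threshold (λ n h → dominated-by (z n) 0≤radius (modulus≤ n h)) public

    private
      partial : Series → ℕ → ℂ
      partial a N = Defs.sum {N} (λ i → ℤ→ℂ (a (toℕ i)) Defs.* q Defs.^ toℕ i)

      at-partial : ∀ a N m → at m (partial a N) ≡ ev a (z m) N
      at-partial a N m = ≡.trans (at-sum m N (λ i → ℤ→ℂ (a i) Defs.* q Defs.^ i))
        (Sums.∑-cong N λ i → at-term m (a i) q i)

      quarter : ∀ ε → (½ ℚ.* (½ ℚ.* ε) ℚ.+ ½ ℚ.* (½ ℚ.* ε)) ℚ.+ ½ ℚ.* ε ≡ ε
      quarter = solve 1 (λ e → (con ½ :* (con ½ :* e) :+ con ½ :* (con ½ :* e)) :+ con ½ :* e := e) ≡.refl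
        where open ℚSolver.+-*-Solver

      ∣+∣₃ : ∀ a b c → ℚ.∣ (a ℚ.+ b) ℚ.+ c ∣ ℚ.≤ (ℚ.∣ a ∣ ℚ.+ ℚ.∣ b ∣) ℚ.+ ℚ.∣ c ∣
      ∣+∣₃ a b c = ℚ.≤-trans (ℚ.∣p+q∣≤∣p∣+∣q∣ (a ℚ.+ b) c) (ℚ.+-monoˡ-≤ ℚ.∣ c ∣ (ℚ.∣p+q∣≤∣p∣+∣q∣ a b))

      -- A partial sum of fixed length is a polynomial in q, and its Cauchy property comes with the
      -- arithmetic of complex numbers. The remainders at the two stages are uniformly small: ε is
      -- shared as ε/4 + ε/4 for them and ε/2 for the polynomial.
      component-cauchy : ∀ {C d a} → PolyBound C d a →
        (part : ℚ[i] → ℚ) → (∀ v w → part (v - w) ≡ part v ℚ.- part w) →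
        (∀ w → ℚ.∣ part w ∣ ℚ.≤ ‖ w ‖) →
        (∀ N → CauchySeq (λ n → part (ev a (z n) N))) →
        CauchySeq (λ n → part (value a n))
      component-cauchy {C} {d} {a} a≤ part part-- ∣part∣≤ partial-cauchy ε 0<ε =
        from (approximation {C} {d} {a} a≤ (0<* 0<½ (0<* 0<½ 0<ε)))
        where
        open ℚ.≤-Reasoning
        open ℚSolver.+-*-Solver
        from : ∃[ N ] Approximates C d a (½ ℚ.* (½ ℚ.* ε)) N →
               ∃[ N ] (∀ m n → N ℕ.≤ m → N ℕ.≤ n → ℚ.∣ part (value a m) ℚ.- part (value a n) ∣ ℚ.< ε)
        from (N , approx) = (N ℕ.⊔ threshold) ℕ.⊔ proj₁ K , λ m n hm hn → begin-strict
          ℚ.∣ part (value a m) ℚ.- part (value a n) ∣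
            ≡⟨ ≡.cong ℚ.∣_∣ (solve 4 (λ a b c d → a :- b := ((a :- c) :+ (d :- b)) :+ (c :- d)) ≡.refl
                 (part (value a m)) (part (value a n)) (part (ev a (z m) N)) (part (ev a (z n) N))) ⟩
          ℚ.∣ ((part (value a m) ℚ.- part (ev a (z m) N)) ℚ.+ (part (ev a (z n) N) ℚ.- part (value a n)))
              ℚ.+ (part (ev a (z m) N) ℚ.- part (ev a (z n) N)) ∣
            ≤⟨ ∣+∣₃ (part (value a m) ℚ.- part (ev a (z m) N)) (part (ev a (z n) N) ℚ.- part (value a n))
                    (part (ev a (z m) N) ℚ.- part (ev a (z n) N)) ⟩
          (ℚ.∣ part (value a m) ℚ.- part (ev a (z m) N) ∣ ℚ.+ ℚ.∣ part (ev a (z n) N) ℚ.- part (value a n) ∣)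
          ℚ.+ ℚ.∣ part (ev a (z m) N) ℚ.- part (ev a (z n) N) ∣
            <⟨ ℚ.+-mono-< (ℚ.+-mono-<
                 (≡.subst (ℚ._< ½ ℚ.* (½ ℚ.* ε)) (flip (part (ev a (z m) N)) (part (value a m))) (near m hm)) (near n hn))
                 (proj₂ K m n (ℕ.m⊔n≤o⇒n≤o (N ℕ.⊔ threshold) (proj₁ K) hm) (ℕ.m⊔n≤o⇒n≤o (N ℕ.⊔ threshold) (proj₁ K) hn)) ⟩
          (½ ℚ.* (½ ℚ.* ε) ℚ.+ ½ ℚ.* (½ ℚ.* ε)) ℚ.+ ½ ℚ.* ε
            ≡⟨ quarter ε ⟩
          ε ∎
          where
          K : ∃[ N′ ] (∀ m n → N′ ℕ.≤ m → N′ ℕ.≤ n →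
                ℚ.∣ part (ev a (z m) N) ℚ.- part (ev a (z n) N) ∣ ℚ.< ½ ℚ.* ε)
          K = partial-cauchy N (½ ℚ.* ε) (0<* 0<½ 0<ε)
          flip : ∀ a b → ℚ.∣ a ℚ.- b ∣ ≡ ℚ.∣ b ℚ.- a ∣
          flip a b = ≡.trans (≡.cong ℚ.∣_∣ (solve 2 (λ a b → a :- b := :- (b :- a)) ≡.refl a b)) (ℚ.∣-p∣≡∣p∣ (b ℚ.- a))
          near : ∀ n → (N ℕ.⊔ threshold) ℕ.⊔ proj₁ K ℕ.≤ n →
                 ℚ.∣ part (ev a (z n) N) ℚ.- part (value a n) ∣ ℚ.< ½ ℚ.* (½ ℚ.* ε)
          near n h = ℚ.≤-<-trans
            (ℚ.≤-trans (ℚ.≤-reflexive (≡.cong ℚ.∣_∣ (≡.sym (part-- (ev a (z n) N) (value a n)))))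
                       (∣part∣≤ (ev a (z n) N - value a n)))
            (approx N ℕ.≤-refl n (ℕ.m⊔n≤o⇒m≤o N threshold h′) (ℕ.m⊔n≤o⇒n≤o N threshold h′)
              a a≤ (λ _ _ → ≡.refl) N ℕ.≤-refl)
            where
            h′ : N ℕ.⊔ threshold ℕ.≤ n
            h′ = ℕ.m⊔n≤o⇒m≤o (N ℕ.⊔ threshold) (proj₁ K) h

      Re-partial-cauchy : ∀ a N → CauchySeq (λ n → Re (ev a (z n) N))
      Re-partial-cauchy a N ε 0<ε = let K , p = cauchy (re (partial a N)) ε 0<ε in K , λ m n hm hn →
        ≡.subst (ℚ._< ε) (≡.cong₂ (λ v w → ℚ.∣ Re v ℚ.- Re w ∣) (at-partial a N m) (at-partial a N n)) (p m n hm hn)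

      Im-partial-cauchy : ∀ a N → CauchySeq (λ n → Im (ev a (z n) N))
      Im-partial-cauchy a N ε 0<ε = let K , p = cauchy (im (partial a N)) ε 0<ε in K , λ m n hm hn →
        ≡.subst (ℚ._< ε) (≡.cong₂ (λ v w → ℚ.∣ Im v ℚ.- Im w ∣) (at-partial a N m) (at-partial a N n)) (p m n hm hn)

    valueℂ : ∀ {C d} a → PolyBound C d a → ℂ
    valueℂ {C} {d} a a≤ =
      mkℝ (λ n → Re (value a n))
          (component-cauchy {C} {d} {a} a≤ Re (λ _ _ → ≡.refl) ∣Re∣≤‖‖ (Re-partial-cauchy a))
      Defs.+i
      mkℝ (λ n → Im (value a n))
          (component-cauchy {C} {d} {a} a≤ Im (λ _ _ → ≡.refl) ∣Im∣≤‖‖ (Im-partial-cauchy a))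

    -- w is the value of a polynomial which agrees with a below degree n.
    record Represents (C d : ℕ) (a : Series) (n m : ℕ) (w : ℚ[i]) : Set where
      field
        polynomial : Series
        bound      : PolyBound C d polynomial
        agrees     : ∀ k → k ℕ.< n → polynomial k ≡ a k
        size       : ℕ
        n≤size     : n ℕ.≤ size
        evaluates  : w ≡ ev polynomial (z m) size

    -- The two-sided, rectangular, divisor and quotient partial sums are all approximated by values
    -- of coefficient sequences that agree with `a` below `N`. One estimate thus gives all the
    -- convergence statements.
    within-value : ∀ {C d a} (a≤ : PolyBound C d a) {ε} → 0ℚ ℚ.< ε →
      ∃[ N ] (∀ w → (∃[ m₀ ] (∀ m → m₀ ℕ.≤ m → Represents C d a N m (at m w))) → Within ε w (valueℂ {C} {d} a a≤))
    within-value {C} {d} {a} a≤ {ε} 0<ε = from (approximation {C} {d} {a} a≤ (0<* 0<½ 0<ε))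
      where
      from : ∃[ N ] Approximates C d a (½ ℚ.* ε) N →
        ∃[ N ] (∀ w → (∃[ m₀ ] (∀ m → m₀ ℕ.≤ m → Represents C d a N m (at m w))) → Within ε w (valueℂ {C} {d} a a≤))
      from (N , approx) = N , λ w (m₀ , rep) → within-from {ε} {w} {valueℂ {C} {d} a a≤} 0<ε
        ((m₀ ℕ.⊔ N) ℕ.⊔ threshold , λ m h →
          let h′ = ℕ.m⊔n≤o⇒m≤o (m₀ ℕ.⊔ N) threshold h
              r = rep m (ℕ.m⊔n≤o⇒m≤o m₀ N h′)
              open Represents r in
          ≡.subst (λ v → ‖ v - value a m ‖ ℚ.< ½ ℚ.* ε) (≡.sym evaluates)
            (approx N ℕ.≤-refl m (ℕ.m⊔n≤o⇒n≤o m₀ N h′) (ℕ.m⊔n≤o⇒n≤o (m₀ ℕ.⊔ N) threshold h)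
              polynomial bound agrees size n≤size))

  -- Divisor sums as coefficients of Lambert series

  module DivisorSums where
    foldr-filter : ∀ {P : ℕ → Set} (P? : ∀ k → Dec (P k)) (g : ℕ → ℤ) (h : ℕ → ℕ) n →
      foldr ℤ._+_ ℤ.0ℤ (map g (filter P? (applyUpTo h n))) ≡
      Σℤ.∑ n (λ i → if does (P? (h i)) then g (h i) else ℤ.0ℤ)
    foldr-filter P? g h zero = ≡.refl
    foldr-filter P? g h (suc n) with does (P? (h 0))
    ... | true  = ≡.cong (λ z → g (h 0) ℤ.+ z) (foldr-filter P? g (h ∘ suc) n)
    ... | false = ≡.trans (foldr-filter P? g (h ∘ suc) n) (≡.sym (ℤ.+-identityˡ _))

    ∑-single : ∀ n (f : ℕ → ℤ) {y} → y ℕ.< n → (∀ i → f i ≡ ℤ.0ℤ ⊎ i ≡ y) → Σℤ.∑ n f ≡ f y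
    ∑-single (suc n) f {zero} y<n only = ≡.trans
      (≡.cong (λ z → f 0 ℤ.+ z) (Σℤ.∑-zero n λ i _ → off i)) (ℤ.+-identityʳ (f 0))
      where
      off : ∀ i → f (suc i) ≡ ℤ.0ℤ
      off i with only (suc i)
      ... | inj₁ eq = eq
    ∑-single (suc n) f {suc y} (s≤s y<n) only = ≡.trans
      (≡.cong₂ ℤ._+_ off (∑-single n (f ∘ suc) y<n only′)) (ℤ.+-identityˡ (f (suc y)))
      where
      off : f 0 ≡ ℤ.0ℤ
      off with only 0
      ... | inj₁ eq = eq
      only′ : ∀ i → f (suc i) ≡ ℤ.0ℤ ⊎ i ≡ y
      only′ i with only (suc i)
      ... | inj₁ eq     = inj₁ eq
      ... | inj₂ ≡.refl = inj₂ ≡.refl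

    monomial-diagonal : ∀ m → monomial m m ≡ ℤ.1ℤ
    monomial-diagonal zero    = ≡.refl
    monomial-diagonal (suc m) = monomial-diagonal m

    -- In row i the equation (i + 1) (y + 1) = n + 1 has exactly one solution y when i + 1 divides n
    -- + 1 and none otherwise; the solution is the complementary divisor.
    divisorSum-lattice : ∀ {f : ℕ → ℕ → ℤ} {w : ℕ → ℕ → ℤ} → (∀ i y → f (suc i) (suc y) ≡ w i y) →
      ∀ n → divisorSum f (suc n) ≡ lambertSeries w (suc n)
    divisorSum-lattice {f} {w} f≡w n = ≡.trans
      (foldr-filter (λ k → suc k ∣? suc n) (λ k → f (suc k) (suc n ℕ./ suc k)) id (suc n))
      (Σℤ.∑-cong (suc n) λ i → row i (suc i ∣? suc n))
      where
      row : ∀ i (d : Dec (suc i ∣ suc n)) → (if does d then f (suc i) (suc n ℕ./ suc i) else ℤ.0ℤ) ≡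
                  Σℤ.∑ (suc n) (λ y → w i y ℤ.* monomial (suc i ℕ.* suc y) (suc n))
      row i (yes (divides (suc y) eq)) = ≡.sym (≡.trans
        (∑-single (suc n) (λ y → w i y ℤ.* monomial (suc i ℕ.* suc y) (suc n)) y<n only)
        (≡.trans (≡.cong (λ k → w i y ℤ.* monomial (suc i ℕ.* suc y) k) eq′)
          (≡.trans (≡.cong (w i y ℤ.*_) (monomial-diagonal (suc i ℕ.* suc y)))
            (≡.trans (ℤ.*-identityʳ (w i y)) (≡.sym (≡.trans
              (≡.cong (f (suc i)) (≡.trans (≡.cong (ℕ._/ suc i) eq) (ℕ.m*n/n≡m (suc y) (suc i))))
              (f≡w i y)))))))
        where
        eq′ : suc n ≡ suc i ℕ.* suc y
        eq′ = ≡.trans eq (ℕ.*-comm (suc y) (suc i))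
        y<n : y ℕ.< suc n
        y<n = ℕ.≤-trans (ℕ.m≤m*n (suc y) (suc i)) (ℕ.≤-reflexive (≡.sym eq))
        only : ∀ y′ → w i y′ ℤ.* monomial (suc i ℕ.* suc y′) (suc n) ≡ ℤ.0ℤ ⊎ y′ ≡ y
        only y′ with monomial-support (suc i ℕ.* suc y′) (suc n)
        ... | inj₁ zero≡ = inj₁ (≡.trans (≡.cong (w i y′ ℤ.*_) zero≡) (ℤ.*-zeroʳ (w i y′)))
        ... | inj₂ n≡    = inj₂ (ℕ.suc-injective (ℕ.*-cancelˡ-≡ (suc y′) (suc y) (suc i) (≡.trans (≡.sym n≡) eq′)))
      row i (no ∤) = ≡.sym (Σℤ.∑-zero (suc n) λ y _ → off y)
        where
        off : ∀ y → w i y ℤ.* monomial (suc i ℕ.* suc y) (suc n) ≡ ℤ.0ℤ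
        off y with monomial-support (suc i ℕ.* suc y) (suc n)
        ... | inj₁ zero≡ = ≡.trans (≡.cong (w i y ℤ.*_) zero≡) (ℤ.*-zeroʳ (w i y))
        ... | inj₂ n≡    = contradiction (divides (suc y) (≡.trans n≡ (ℕ.*-comm (suc i) (suc y)))) ∤

  open DivisorSums

  -- Convergence of the three series that define U_s and G_s

  ∣σ^∣ : ∀ s y → ℤ.∣ σ s ℤ.^ y ∣ ≡ 1
  ∣σ^∣ s zero    = ≡.refl
  ∣σ^∣ s (suc y) = ≡.trans (ℤ.∣i*j∣≡∣i∣*∣j∣ (σ s) (σ s ℤ.^ y)) (≡.cong₂ ℕ._*_ (∣σ∣ s) (∣σ^∣ s y))
    where
    ∣σ∣ : ∀ s → ℤ.∣ σ s ∣ ≡ 1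
    ∣σ∣ Sign.+ = ≡.refl
    ∣σ∣ Sign.- = ≡.refl

  module LambertSums (q : ℂ) (disc : InDisc q) (s : Sign) (ν : ℕ → ℤ) (p : ℕ)
                     (ν≤ : ∀ i → ℤ.∣ ν i ∣ ℕ.≤ suc i ℕ.^ p) where
    open PowerSeriesValue q disc

    weight : ℕ → ℕ → ℤ
    weight i y = ν i ℤ.* σ s ℤ.^ y

    private
      weight≤ : ∀ i y → ℤ.∣ weight i y ∣ ℕ.≤ suc i ℕ.^ p
      weight≤ i y = ℕ.≤-trans (ℕ.≤-reflexive (≡.trans (ℤ.∣i*j∣≡∣i∣*∣j∣ (ν i) (σ s ℤ.^ y))
        (≡.trans (≡.cong (ℤ.∣ ν i ∣ ℕ.*_) (∣σ^∣ s y)) (ℕ.*-identityʳ ℤ.∣ ν i ∣)))) (ν≤ i)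

      lattice≤ : ∀ N Y → PolyBound 1 (2 ℕ.+ p) (lattice weight N Y)
      lattice≤ = lattice-bound {weight} {p} weight≤

    series : Series
    series = lambertSeries weight

    series≤ : PolyBound 1 (2 ℕ.+ p) series
    series≤ k = lattice≤ k k k

    total : ℂ
    total = valueℂ {1} {2 ℕ.+ p} series series≤

    -- The summands are parameters so that unification never compares complex
    -- numbers, whose Cauchy proofs are too large to be compared.
    record Summand (a : ℕ → ℂ) (coefficient : ℕ → ℤ) : Set where
      field evaluates : ∀ m n → at m (a n) ≡ ι (coefficient n) * z m ^ n

    record Summand₂ (a : ℕ → ℕ → ℂ) (coefficient : ℕ → ℕ → ℤ) : Set where
      field evaluates : ∀ n y m → at n (a y m) ≡ ι (coefficient y m) * z n ^ (m ℕ.* y)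

    record SummandQuotient (num den : ℕ → ℂ) : Set where
      field
        numerator   : ∀ m i → at m (num (suc i)) ≡ ι (ν i) * z m ^ suc i
        denom       : ∀ m i → at m (den (suc i)) ≡ 1# + ι (ℤ.- σ s) * z m ^ suc i

    private
      hasSum : ∀ (a : ℕ → ℂ) →
        (∀ N n → N ℕ.≤ n → ∀ m → N ℕ.≤ m →
           Represents 1 (2 ℕ.+ p) series N m (∑ n (λ i → at m (a (suc i))))) → HasSum a total
      hasSum a represents ε 0<ε = from (within-value {1} {2 ℕ.+ p} {series} series≤ 0<ε)
        where
        from : ∃[ N ] (∀ w → (∃[ m₀ ] (∀ m → m₀ ℕ.≤ m → Represents 1 (2 ℕ.+ p) series N m (at m w))) → Within ε w total) →
               ∃[ N ] (∀ n → N ℕ.≤ n → Within ε (Defs.sum {n} (λ i → a (suc (toℕ i)))) total)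
        from (N , within) = N , λ n N≤n → within (Defs.sum {n} (λ i → a (suc (toℕ i)))) (N , λ m N≤m →
          ≡.subst (Represents 1 (2 ℕ.+ p) series N m) (≡.sym (at-sum m n (λ i → a (suc i))))
            (represents N n N≤n m N≤m))

      hasSum₂ : ∀ (a : ℕ → ℕ → ℂ) →
        (∀ N Y M → N ℕ.≤ Y → N ℕ.≤ M → ∀ m →
           Represents 1 (2 ℕ.+ p) series N m (∑ Y (λ y → ∑ M (λ i → at m (a (suc y) (suc i)))))) → HasSum₂ a total
      hasSum₂ a represents ε 0<ε = from (within-value {1} {2 ℕ.+ p} {series} series≤ 0<ε)
        where
        from : ∃[ N ] (∀ w → (∃[ m₀ ] (∀ m → m₀ ℕ.≤ m → Represents 1 (2 ℕ.+ p) series N m (at m w))) → Within ε w total) →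
               ∃[ N ] (∀ Y M → N ℕ.≤ Y → N ℕ.≤ M →
                 Within ε (Defs.sum {Y} (λ i → Defs.sum {M} (λ j → a (suc (toℕ i)) (suc (toℕ j))))) total)
        from (N , within) = N , λ Y M N≤Y N≤M →
          within (Defs.sum {Y} (λ i → Defs.sum {M} (λ j → a (suc (toℕ i)) (suc (toℕ j))))) (0 , λ m _ →
            ≡.subst (Represents 1 (2 ℕ.+ p) series N m)
              (≡.sym (≡.trans (at-sum m Y (λ y → Defs.sum {M} (λ j → a (suc y) (suc (toℕ j)))))
                              (Sums.∑-cong Y λ y → at-sum m M (λ i → a (suc y) (suc i)))))
              (represents N Y M N≤Y N≤M m))

    doubleSum : ∀ {a coefficient} → Summand₂ a coefficient →
      (∀ i y → coefficient (suc y) (suc i) ≡ weight i y) → HasSum₂ a total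
    doubleSum {a} {coefficient} summand coefficient≡ = hasSum₂ a λ N Y M N≤Y N≤M m → record
        { polynomial = lattice weight M Y
        ; bound = lattice≤ M Y
        ; agrees = λ k k<N → lattice-stable weight
            (ℕ.≤-trans (ℕ.<⇒≤ k<N) N≤M) (ℕ.≤-trans (ℕ.<⇒≤ k<N) N≤Y)
        -- The size exceeds the largest exponent M Y, so every monomial is evaluated, and it is at
        -- least N.
        ; size = suc (M ℕ.* Y) ℕ.+ N
        ; n≤size = ℕ.m≤n+m N (suc (M ℕ.* Y))
        ; evaluates = ≡.trans
            (Sums.∑-cong Y λ y → Sums.∑-cong M λ i → ≡.trans
              (Summand₂.evaluates summand m (suc y) (suc i))
              (≡.cong (λ c → ι c * z m ^ (suc i ℕ.* suc y)) (coefficient≡ i y)))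
            (≡.trans (Sums.∑-comm Y M (λ y i → ι (weight i y) * z m ^ (suc i ℕ.* suc y)))
              (≡.sym (ev-lattice weight M Y (z m) (s≤s (ℕ.m≤m+n (M ℕ.* Y) N))))) }

    divisorSeries : ∀ f {a} → Summand a (divisorSum f) →
      (∀ i y → f (suc i) (suc y) ≡ weight i y) → HasSum a total
    divisorSeries f {a} summand f≡ = hasSum a λ N n N≤n m _ → record
        { polynomial = series ; bound = series≤ ; agrees = λ _ _ → ≡.refl
        -- The series starts at exponent 1 and `ev` at exponent 0; the extra coefficient is an empty
        -- lattice sum, hence 0.
        ; size = suc n ; n≤size = ℕ.m≤n⇒m≤1+n N≤n
        ; evaluates = ≡.trans
            (Sums.∑-cong n λ i → ≡.trans (Summand.evaluates summand m (suc i))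
               (≡.cong (λ c → ι c * z m ^ suc i) (divisorSum-lattice {f} {weight} f≡ i)))
            (≡.trans (≡.sym (+-identityˡ (∑ n (λ i → ι (series (suc i)) * z m ^ suc i))))
              (≡.cong (_+ ∑ n (λ i → ι (series (suc i)) * z m ^ suc i))
                (≡.sym (≡.trans (≡.cong (_* 1#) ι-0) (zeroˡ 1#))))) }

    private
      row : ℕ → Series
      row i k = ν i ℤ.* geometricSeries s i k

      geometric≤ : ∀ i → PolyBound 1 1 (geometricSeries s i)
      geometric≤ i k = ℕ.≤-trans
        (∣∑∣≤ k k {1} (λ y → σ s ℤ.^ y ℤ.* monomial (suc i ℕ.* suc y) k)
          (λ y _ → ℕ.≤-trans (∣scaled∣≤ (σ s ℤ.^ y) (suc i ℕ.* suc y) k) (ℕ.≤-reflexive (∣σ^∣ s y)))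
          (λ y k≤y → scaled-low (σ s ℤ.^ y) (ℕ.≤-trans (s≤s k≤y) (ℕ.m≤m+n (suc y) _))))
        (ℕ.≤-trans (ℕ.≤-reflexive (ℕ.*-identityʳ k)) (ℕ.≤-trans (ℕ.n≤1+n k)
          (ℕ.≤-reflexive (≡.sym (≡.trans (ℕ.*-identityˡ _) (ℕ.^-identityʳ (suc k)))))))

      row≤ : ∀ i → PolyBound (ℤ.∣ ν i ∣ ℕ.* 1) 1 (row i)
      row≤ i = scale-bound {1} {1} {geometricSeries s i} (ν i) (geometric≤ i)

      rows≡lattice : ∀ n k → Σℤ.∑ n (λ i → row i k) ≡ lattice weight n k k
      rows≡lattice n k = Σℤ.∑-cong n λ i → ≡.trans
        (≡.sym (Σℤ.∑-*ˡ k (ν i) (λ y → σ s ℤ.^ y ℤ.* monomial (suc i ℕ.* suc y) k)))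
        (Σℤ.∑-cong k λ y → ≡.sym (ℤ.*-assoc (ν i) (σ s ℤ.^ y) (monomial (suc i ℕ.* suc y) k)))

      term : ℕ → ℂ
      -- A default value: the summation starts at r = 1.
      term zero    = 1ℂ
      term (suc i) = valueℂ {ℤ.∣ ν i ∣ ℕ.* 1} {1} (row i) (row≤ i)

      -- A row i with i ≥ k does not reach the coefficient k, so the first n rows agree with the
      -- whole series below degree N ≤ n. The size is the stage m because each row is itself an
      -- infinite series, evaluated with m terms at stage m.
      lambertSum : HasSum term total
      lambertSum = hasSum term λ N n N≤n m N≤m → record
        { polynomial = λ k → Σℤ.∑ n (λ i → row i k)
        ; bound = λ k → ≡.subst (λ c → ℤ.∣ c ∣ ℕ.≤ 1 ℕ.* suc k ℕ.^ (2 ℕ.+ p)) (≡.sym (rows≡lattice n k)) (lattice≤ n k k)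
        ; agrees = λ k k<N → ≡.trans (rows≡lattice n k)
            (lattice-stable weight (ℕ.≤-trans (ℕ.<⇒≤ k<N) N≤n) ℕ.≤-refl)
        ; size = m ; n≤size = N≤m
        ; evaluates = ≡.sym (ev-∑ n row (z m) m) }

      at-denominator : ∀ i → value (denominator s i) ~ (λ m → 1# + ι (ℤ.- σ s) * z m ^ suc i)
      at-denominator i = ~-trans
        (~-eventually 0 λ m _ → ev-⊕ (constant ℤ.1ℤ) (λ k → ℤ.- σ s ℤ.* monomial (suc i) k) (z m) m)
        (~-+ (~-trans (value-constant ℤ.1ℤ) (~-eventually 0 λ _ _ → ι-1))
             (~-eventually (suc (suc i)) λ m i<m → ≡.trans
               (ev-scale (ℤ.- σ s) (monomial (suc i)) (z m) m)
               (≡.cong (ι (ℤ.- σ s) *_) (ev-monomial (suc i) (z m) i<m))))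

      denominator≤ : ∀ i → PolyBound (1 ℕ.+ ℤ.∣ ℤ.- σ s ∣ ℕ.* 1) 0 (denominator s i)
      denominator≤ i = ⊕-bound {1} {0} {ℤ.∣ ℤ.- σ s ∣ ℕ.* 1} {0} {constant ℤ.1ℤ}
        {λ k → ℤ.- σ s ℤ.* monomial (suc i) k}
        (constant-bound ℤ.1ℤ) (scale-bound {1} {0} {monomial (suc i)} (ℤ.- σ s) (monomial-bound (suc i)))

      -- The real part of q^m is at most the radius in absolute value, for m ≥ 1, so the real part
      -- of 1 - σ q^m is at least 1 - radius. The square of this gap bounds the squared modulus from
      -- below.
      apart : ∀ i d → (∀ m → at m d ≡ 1# + ι (ℤ.- σ s) * z m ^ suc i) → 0ℝ <ℝ ∣ d ∣²
      apart i d d≡ = gap ℚ.* gap , 0<* 0<gap 0<gap , threshold , λ n h → begin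
        0ℚ ℚ.+ gap ℚ.* gap
          ≡⟨ ℚ.+-identityˡ _ ⟩
        gap ℚ.* gap
          ≤⟨ *-mono-≤ (ℚ.<⇒≤ 0<gap) (ℚ.≤-trans (ℚ.<⇒≤ 0<gap) (Re-large n h)) (Re-large n h) (Re-large n h) ⟩
        Re (at n d) ℚ.* Re (at n d)
          ≤⟨ p≤q-from (0≤p² (Im (at n d))) ≡.refl ⟩
        normSq (at n d) ∎
        where
        open ℚ.≤-Reasoning hiding (start)
        open ℚSolver.+-*-Solver
        gap : ℚ
        gap = 1ℚ ℚ.- radius
        0<gap : 0ℚ ℚ.< gap
        0<gap = 0<q-p radius<1
        unit : ∀ s w → ℚ.∣ Re (ι (ℤ.- σ s) * w) ∣ ≡ ℚ.∣ Re w ∣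
        unit Sign.- w = ≡.cong ℚ.∣_∣ (≡.cong Re (≡.trans (≡.cong (_* w) ι-1) (*-identityˡ w)))
        unit Sign.+ w = ≡.trans (≡.cong ℚ.∣_∣ (≡.trans
            (≡.cong (λ v → Re (v * w)) (≡.trans (ι-neg ℤ.1ℤ) (≡.cong -_ ι-1)))
            (solve 2 (λ a b → (:- con 1ℚ) :* a :- (:- con 0ℚ) :* b := :- a) ≡.refl (Re w) (Im w))))
          (ℚ.∣-p∣≡∣p∣ (Re w))
        small : ∀ n → threshold ℕ.≤ n → ℚ.∣ Re (ι (ℤ.- σ s) * z n ^ suc i) ∣ ℚ.≤ radius
        small n h = ℚ.≤-trans (ℚ.≤-reflexive (unit s (z n ^ suc i)))
          (ℚ.≤-trans (∣Re^∣≤ (z n) 0≤radius (modulus≤ n h) (suc i))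
            (ℚ.≤-trans (ℚ.*-monoˡ-≤-nonNeg radius {{ℚ.nonNegative 0≤radius}} (^≤1 0≤radius (ℚ.<⇒≤ radius<1) i))
                       (ℚ.≤-reflexive (ℚ.*-identityʳ radius))))
        Re-large : ∀ n → threshold ℕ.≤ n → gap ℚ.≤ Re (at n d)
        Re-large n h = ≡.subst (gap ℚ.≤_) (≡.cong Re (≡.sym (d≡ n)))
          (ℚ.+-monoʳ-≤ 1ℚ (ℚ.≤-trans (ℚ.neg-antimono-≤ (small n h)) -∣p∣≤p))
          where
          -∣p∣≤p : ∀ {p} → ℚ.- ℚ.∣ p ∣ ℚ.≤ p
          -∣p∣≤p {p} = ≡.subst (ℚ.- ℚ.∣ p ∣ ℚ.≤_) (solve 1 (λ p → :- (:- p) := p) ≡.refl p)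
            (ℚ.neg-antimono-≤ (ℚ.≤-trans (p≤∣p∣ (ℚ.- p)) (ℚ.≤-reflexive (ℚ.∣-p∣≡∣p∣ p))))

    -- No complex number is inverted: the quotient is the value of a geometric series, and the
    -- formal identity `geometric-quotient` becomes an identity of values through `product-~`.
    quotientSum : ∀ {num den} → SummandQuotient num den → HasQuotientSum num den total
    quotientSum {num} {den} summand = term , quotient′ , lambertSum
      where
      open SummandQuotient summand using () renaming (numerator to num≡; denom to den≡)
      product : ∀ i → (λ m → at m (term (suc i) Defs.* den (suc i))) ~ (λ m → at m (num (suc i)))
      product i = ~-trans
        (product-~ {ℤ.∣ ν i ∣ ℕ.* 1} {1} {1 ℕ.+ ℤ.∣ ℤ.- σ s ∣ ℕ.* 1} {0} {row i} {denominator s i} (row≤ i) (denominator≤ i)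
          ~-refl (~-trans (~-eventually 0 λ m _ → den≡ m i) (~-sym (at-denominator i))))
        (~-eventually (suc (suc i)) λ m i<m → ≡.trans
          (value-cong {row i ⊛ denominator s i} {λ k → ν i ℤ.* monomial (suc i) k}
            (λ k → ≡.trans (scale-⊛ (ν i) (geometricSeries s i) (denominator s i) k)
                           (≡.cong (ν i ℤ.*_) (geometric-quotient s i k))) m)
          (≡.trans (ev-scale (ν i) (monomial (suc i)) (z m) m)
            (≡.trans (≡.cong (ι (ν i) *_) (ev-monomial (suc i) (z m) i<m)) (≡.sym (num≡ m i)))))
      quotient′ : ∀ r → 1 ℕ.≤ r → IsQuotient (term r) (num r) (den r)
      quotient′ (suc i) _ = apart i (den (suc i)) (λ m → den≡ m i) , ≈-from-~ {term (suc i) Defs.* den (suc i)} {num (suc i)} (product i)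

  gaussianAlgebra : ℤ-algebra commutativeRing
  gaussianAlgebra = record
    { ⟦_⟧ = ι ; +-homo = ι-+ ; *-homo = ι-* ; -‿homo = ι-neg ; 0-homo = ι-0 ; 1-homo = ι-1 }

  -- The two-sided theta series and its powers

  module ThetaValue (q : ℂ) (disc : InDisc q) where
    open PowerSeriesValue q disc public

    θ : ℂ
    θ = valueℂ {2} {1} thetaSeries (λ k → theta-bound k k)

    private
      term : ℕ → ℕ → ℤ
      term k i = sign (suc i) ℤ.* monomial (suc i ℕ.* suc i) k

      term≤ : ∀ k i → ℤ.∣ term k i ∣ ℕ.≤ 1
      term≤ k i = ℕ.≤-trans (∣scaled∣≤ (sign (suc i)) (suc i ℕ.* suc i) k) (ℕ.≤-reflexive (∣sign∣ (suc i)))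

      term-low : ∀ k i → k ℕ.≤ i → term k i ≡ ℤ.0ℤ
      term-low k i k≤i = scaled-low (sign (suc i)) (ℕ.≤-trans (s≤s k≤i) (ℕ.m≤m+n (suc i) _))

      -- The positive half of the sum over j has length n and the negative half length m. The terms
      -- for j and -j coincide, so both halves use `term`; up to the shorter length they combine to
      -- the factor 2 in `thetaSeries`.
      polynomial : ℕ → ℕ → Series
      polynomial m n k = constant ℤ.1ℤ k ℤ.+ (Σℤ.∑ n (term k) ℤ.+ Σℤ.∑ m (term k))

      polynomial≤ : ∀ m n → PolyBound 2 1 (polynomial m n)
      polynomial≤ m n k = begin
        ℤ.∣ polynomial m n k ∣
          ≤⟨ ℕ.≤-trans (ℤ.∣i+j∣≤∣i∣+∣j∣ (constant ℤ.1ℤ k) _)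
               (ℕ.+-mono-≤ (∣monomial∣≤1 0 k) (ℕ.≤-trans (ℤ.∣i+j∣≤∣i∣+∣j∣ (Σℤ.∑ n (term k)) (Σℤ.∑ m (term k)))
                 (ℕ.+-mono-≤ (∣∑∣≤ n k (term k) (λ i _ → term≤ k i) (term-low k))
                             (∣∑∣≤ m k (term k) (λ i _ → term≤ k i) (term-low k))))) ⟩
        1 ℕ.+ (k ℕ.* 1 ℕ.+ k ℕ.* 1)
          ≤⟨ ℕ.n≤1+n _ ⟩
        2 ℕ.+ (k ℕ.* 1 ℕ.+ k ℕ.* 1)
          ≡⟨ solve 1 (λ k → con 2 :+ (k :* con 1 :+ k :* con 1) := con 2 :* ((con 1 :+ k) :* con 1)) ≡.refl k ⟩
        2 ℕ.* suc k ℕ.^ 1 ∎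
        where
        open ℕ.≤-Reasoning
        open ℕSolver.+-*-Solver

      polynomial-agrees : ∀ {m n k} → k ℕ.≤ m → k ℕ.≤ n → polynomial m n k ≡ thetaSeries k
      polynomial-agrees {m} {n} {k} k≤m k≤n = ≡.cong (λ z → constant ℤ.1ℤ k ℤ.+ z) (≡.trans
        (≡.cong₂ ℤ._+_ (Σℤ.∑-extend (term k) k≤n (term-low k)) (Σℤ.∑-extend (term k) k≤m (term-low k)))
        (≡.trans (solve 1 (λ s → s :+ s := con (+ 2) :* s) ≡.refl (Σℤ.∑ k (term k)))
                 (≡.sym (Σℤ.∑-*ˡ k (+ 2) (term k)))))
        where open ℤSolver.+-*-Solver

      ev-terms : ∀ n w {p} → n ℕ.* n ℕ.< p →
        ev (λ k → Σℤ.∑ n (term k)) w p ≡ ∑ n (λ i → ι (sign (suc i)) * w ^ (suc i ℕ.* suc i))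
      ev-terms n w {p} nn<p = ≡.trans
        (ev-∑ n (λ i k → sign (suc i) ℤ.* monomial (suc i ℕ.* suc i) k) w p)
        (Sums.∑-cong< n λ i i<n → ≡.trans (ev-scale (sign (suc i)) (monomial (suc i ℕ.* suc i)) w p)
          (≡.cong (ι (sign (suc i)) *_) (ev-monomial (suc i ℕ.* suc i) w (ℕ.≤-<-trans (ℕ.*-mono-≤ i<n i<n) nn<p))))

    thetaSum : ∀ (a : ℤ → ℂ) →
      (∀ n j → at n (a j) ≡ ι (sign ℤ.∣ j ∣) * z n ^ (ℤ.∣ j ∣ ℕ.* ℤ.∣ j ∣)) → HasSumℤ a θ
    thetaSum a a≡ ε 0<ε = from (within-value {2} {1} {thetaSeries} (λ k → theta-bound k k) 0<ε)
      where
      twoSided : ℕ → ℕ → ℂ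
      twoSided m n = Defs.sum {suc n} (λ i → a (+ toℕ i)) Defs.+ Defs.sum {m} (λ i → a -[1+ toℕ i ])
      size : ℕ → ℕ → ℕ → ℕ
      size N m n = (suc (n ℕ.* n) ℕ.+ m ℕ.* m) ℕ.+ N
      n<size : ∀ N m n → n ℕ.* n ℕ.< size N m n
      n<size N m n = ℕ.≤-trans (ℕ.m≤m+n (suc (n ℕ.* n)) (m ℕ.* m)) (ℕ.m≤m+n _ N)
      m<size : ∀ N m n → m ℕ.* m ℕ.< size N m n
      m<size N m n = ℕ.≤-trans (s≤s (ℕ.m≤n+m (m ℕ.* m) (n ℕ.* n))) (ℕ.m≤m+n _ N)
      at-twoSided : ∀ N m n l → at l (twoSided m n) ≡ ev (polynomial m n) (z l) (size N m n)
      at-twoSided N m n l = begin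
        at l (twoSided m n)
          ≡⟨ ≡.cong₂ _+_ (at-sum l (suc n) (λ i → a (+ i))) (at-sum l m (λ i → a -[1+ i ])) ⟩
        (at l (a (+ 0)) + ∑ n (λ i → at l (a (+ suc i)))) + ∑ m (λ i → at l (a -[1+ i ]))
          ≡⟨ ≡.cong₂ _+_ (≡.cong₂ _+_ (≡.trans (a≡ l (+ 0)) (≡.trans (*-identityʳ (ι ℤ.1ℤ)) ι-1))
               (Sums.∑-cong n λ i → a≡ l (+ suc i))) (Sums.∑-cong m λ i → a≡ l -[1+ i ]) ⟩
        (1# + ∑ n t) + ∑ m t
          ≡⟨ +-assoc 1# (∑ n t) (∑ m t) ⟩
        1# + (∑ n t + ∑ m t)
          ≡⟨ ≡.cong₂ _+_ (≡.sym (ev-monomial 0 (z l) {size N m n} (s≤s z≤n)))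
               (≡.cong₂ _+_ (≡.sym (ev-terms n (z l) (n<size N m n))) (≡.sym (ev-terms m (z l) (m<size N m n)))) ⟩
        ev (constant ℤ.1ℤ) (z l) (size N m n) +
          (ev (λ k → Σℤ.∑ n (term k)) (z l) (size N m n) + ev (λ k → Σℤ.∑ m (term k)) (z l) (size N m n))
          ≡⟨ ≡.cong (λ w → ev (constant ℤ.1ℤ) (z l) (size N m n) + w)
               (≡.sym (ev-⊕ (λ k → Σℤ.∑ n (term k)) (λ k → Σℤ.∑ m (term k)) (z l) (size N m n))) ⟩
        _ ≡⟨ ev-⊕ (constant ℤ.1ℤ) (λ k → Σℤ.∑ n (term k) ℤ.+ Σℤ.∑ m (term k)) (z l) (size N m n) ⟨
        ev (polynomial m n) (z l) (size N m n) ∎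
        where
        open ≡.≡-Reasoning
        t : ℕ → ℚ[i]
        t i = ι (sign (suc i)) * z l ^ (suc i ℕ.* suc i)
      from : ∃[ N ] (∀ w → (∃[ m₀ ] (∀ m → m₀ ℕ.≤ m → Represents 2 1 thetaSeries N m (at m w))) → Within ε w θ) →
             ∃[ N ] (∀ m n → N ℕ.≤ m → N ℕ.≤ n → Within ε (twoSided m n) θ)
      from (N , within) = N , λ m n N≤m N≤n → within (twoSided m n) (0 , λ l _ → record
        { polynomial = polynomial m n ; bound = polynomial≤ m n
        ; agrees = λ k k<N → polynomial-agrees (ℕ.≤-trans (ℕ.<⇒≤ k<N) N≤m) (ℕ.≤-trans (ℕ.<⇒≤ k<N) N≤n)
        ; size = size N m n ; n≤size = ℕ.m≤n+m N _
        ; evaluates = at-twoSided N m n l })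

    module Powers {C d : ℕ} (thetaSeries≤ : PolyBound C d thetaSeries) where
      Θ Θ² Θ⁴ Θ⁸ : Sequence
      Θ = value thetaSeries
      Θ² n = Θ n * Θ n
      Θ⁴ n = Θ² n * Θ² n
      Θ⁸ n = Θ⁴ n * Θ⁴ n

      C² C⁴ C⁸ d² d⁴ d⁸ : ℕ
      C² = C ℕ.* C
      C⁴ = C² ℕ.* C²
      C⁸ = C⁴ ℕ.* C⁴
      d² = suc (d ℕ.+ d)
      d⁴ = suc (d² ℕ.+ d²)
      d⁸ = suc (d⁴ ℕ.+ d⁴)

      θ²≤ : PolyBound C² d² θ²Series
      θ²≤ = ⊛-bound {C} {d} {C} {d} {thetaSeries} {thetaSeries} thetaSeries≤ thetaSeries≤

      θ⁴≤ : PolyBound C⁴ d⁴ θ⁴Series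
      θ⁴≤ = ⊛-bound {C²} {d²} {C²} {d²} {θ²Series} {θ²Series} θ²≤ θ²≤

      θ⁸≤ : PolyBound C⁸ d⁸ θ⁸Series
      θ⁸≤ = ⊛-bound {C⁴} {d⁴} {C⁴} {d⁴} {θ⁴Series} {θ⁴Series} θ⁴≤ θ⁴≤

      -- The bound is carried over from the eighth power of theta along the equality of
      -- coefficients, which gives both descriptions the same constants.
      d₃≤ : PolyBound C⁸ d⁸ d₃Series
      d₃≤ k = ≡.subst (λ c → ℤ.∣ c ∣ ℕ.≤ C⁸ ℕ.* suc k ℕ.^ d⁸) (θ⁸-coefficient k) (θ⁸≤ k)

      d₃²≤ : PolyBound (C⁸ ℕ.* C⁸) (suc (d⁸ ℕ.+ d⁸)) (d₃Series ⊛ d₃Series)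
      d₃²≤ = ⊛-bound {C⁸} {d⁸} {C⁸} {d⁸} {d₃Series} {d₃Series} d₃≤ d₃≤

      Θ⁸~d₃ : Θ⁸ ~ value d₃Series
      Θ⁸~d₃ = ~-trans
        (product-~ {C⁴} {d⁴} {C⁴} {d⁴} {θ⁴Series} {θ⁴Series} θ⁴≤ θ⁴≤ Θ⁴~ Θ⁴~)
        (~-eventually 0 λ n _ → value-cong {θ⁸Series} {d₃Series} θ⁸-coefficient n)
        where
        Θ²~ : Θ² ~ value θ²Series
        Θ²~ = product-~ {C} {d} {C} {d} {thetaSeries} {thetaSeries} thetaSeries≤ thetaSeries≤ ~-refl ~-refl
        Θ⁴~ : Θ⁴ ~ value θ⁴Series
        Θ⁴~ = product-~ {C²} {d²} {C²} {d²} {θ²Series} {θ²Series} θ²≤ θ²≤ Θ²~ Θ²~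

      Θ¹⁶~ : (λ n → Θ⁸ n * Θ⁸ n) ~ value (d₃Series ⊛ d₃Series)
      Θ¹⁶~ = product-~ {C⁸} {d⁸} {C⁸} {d⁸} {d₃Series} {d₃Series} d₃≤ d₃≤ Θ⁸~d₃ Θ⁸~d₃

      Θ²⁴~ : (λ n → Θ⁸ n * (Θ⁸ n * Θ⁸ n)) ~ value (d₃Series ⊛ (d₃Series ⊛ d₃Series))
      Θ²⁴~ = product-~ {C⁸} {d⁸} {C⁸ ℕ.* C⁸} {suc (d⁸ ℕ.+ d⁸)} {d₃Series} {d₃Series ⊛ d₃Series} d₃≤ d₃²≤ Θ⁸~d₃ Θ¹⁶~

  -- From coefficient identities to identities of values

  module Solver = ScalarSolver commutativeRing gaussianAlgebra

  fraction : ℚ → ℚ[i]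
  fraction p = p ∔ 0ℚ

  private
    real-* : ∀ a b → fraction (a ℚ.* b) ≡ fraction a * fraction b
    real-* a b = ≡.cong₂ _∔_
      (≡.sym (≡.trans (≡.cong (λ c → a ℚ.* b ℚ.+ ℚ.- c) (ℚ.*-zeroˡ 0ℚ)) (ℚ.+-identityʳ (a ℚ.* b))))
      (≡.sym (≡.cong₂ ℚ._+_ (ℚ.*-zeroʳ a) (ℚ.*-zeroˡ b)))

    ninth third : ℚ[i]
    third = fraction (+ 1 ℚ./ 3)
    ninth = fraction (+ 1 ℚ./ 9)

    -- The solver knows only integer constants. A fraction enters it as a variable, tied by this
    -- equation to an integer multiple of `third` or `ninth`.
    scaled : ∀ p k r → p ℚ.* (k ℚ./ 1) ≡ r → fraction p * ι k ≡ fraction r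
    scaled p k r eq = ≡.trans (≡.sym (real-* p (fromℤ k)))
      (≡.cong fraction (≡.trans (≡.cong (p ℚ.*_) (≡.sym (/1≡fromℤ k))) eq))

  module Identities (q : ℂ) (disc : InDisc q) where
    open ThetaValue q disc public

    combination-~ : ∀ k₀ k₁ k₂ (l : Series) {C d C′ d′ C″ d″ a b c} →
      PolyBound C d a → PolyBound C′ d′ b → PolyBound C″ d″ c →
      value (λ k → (constant k₀ k ℤ.+ k₁ ℤ.* l k) ℤ.+ k₂ ℤ.* ((a ⊛ b) k ℤ.- (c ⊛ c) k)) ~
      (λ n → (ι k₀ + ι k₁ * value l n) + ι k₂ * (value a n * value b n - value c n * value c n))
    combination-~ k₀ k₁ k₂ l {C} {d} {C′} {d′} {C″} {d″} {a} {b} {c} a≤ b≤ c≤ = ~-trans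
      (~-eventually 0 λ n _ → ≡.trans
        (ev-⊕ (λ k → constant k₀ k ℤ.+ k₁ ℤ.* l k) (λ k → k₂ ℤ.* ((a ⊛ b) k ℤ.- (c ⊛ c) k)) (z n) n)
        (≡.cong₂ _+_
          (≡.trans (ev-⊕ (constant k₀) (λ k → k₁ ℤ.* l k) (z n) n)
                   (≡.cong (λ w → value (constant k₀) n + w) (ev-scale k₁ l (z n) n)))
          (≡.trans (ev-scale k₂ (λ k → (a ⊛ b) k ℤ.- (c ⊛ c) k) (z n) n)
            (≡.cong (ι k₂ *_) (≡.trans (ev-⊕ (a ⊛ b) (λ k → ℤ.- (c ⊛ c) k) (z n) n)
              (≡.cong (λ w → value (a ⊛ b) n + w) (value-neg (c ⊛ c) n)))))))
      (~-+ (~-+ (value-constant k₀) ~-refl)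
           (~-scale (ι k₂) (~-+ (~-sym (value-product {C} {d} {C′} {d′} {a} {b} a≤ b≤))
                                (~-neg (~-sym (value-product {C″} {d″} {C″} {d″} {c} {c} c≤ c≤))))))
      where
      value-neg : ∀ a n → value (λ k → ℤ.- a k) n ≡ - value a n
      value-neg a n = ≡.trans
        (Sums.∑-cong n λ k → ≡.trans (≡.cong (_* z n ^ k) (ι-neg (a k))) (neg-* (ι (a k)) (z n ^ k)))
        (Sums.∑-neg n (λ k → ι (a k) * z n ^ k))
        where
        open Solver using (solve; _:=_; _:*_; :-_)
        neg-* : ∀ v w → (- v) * w ≡ - (v * w)
        neg-* = solve 2 (λ v w → (:- v) :* w := :- (v :* w)) ≡.refl

    -- With m = i + 1 the first sign is (-1)^(m-1), against (-1)^m in `power`. Hence U_p = -u_p,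
    -- whereas G_p = g_p.
    uCoefficient gCoefficient : ℕ → ℕ → ℤ
    uCoefficient p i = sign i ℤ.* index i ℤ.^ p
    gCoefficient p i = sign (suc i) ℤ.* index i ℤ.^ p

    private
      signed≤ : ∀ j i p → ℤ.∣ sign j ℤ.* index i ℤ.^ p ∣ ℕ.≤ suc i ℕ.^ p
      signed≤ j i p = ℕ.≤-reflexive (≡.trans (ℤ.∣i*j∣≡∣i∣*∣j∣ (sign j) (index i ℤ.^ p))
        (≡.trans (≡.cong (ℕ._* ℤ.∣ index i ℤ.^ p ∣) (∣sign∣ j)) (≡.trans (ℕ.*-identityˡ _) (∣^∣ p))))
        where
        ∣^∣ : ∀ p → ℤ.∣ index i ℤ.^ p ∣ ≡ suc i ℕ.^ p
        ∣^∣ zero    = ≡.refl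
        ∣^∣ (suc p) = ≡.trans (ℤ.∣i*j∣≡∣i∣*∣j∣ (index i) (index i ℤ.^ p)) (≡.cong (suc i ℕ.*_) (∣^∣ p))

    module USum (p : ℕ) = LambertSums q disc Sign.- (uCoefficient p) p (λ i → signed≤ i i p)
    module GSum (p : ℕ) = LambertSums q disc Sign.+ (gCoefficient p) p (λ i → signed≤ (suc i) i p)

    U G : ℕ → ℂ
    U = USum.total
    G = GSum.total

    private
      lattice-scale : ∀ c {w w′ : ℕ → ℕ → ℤ} → (∀ i y → w′ i y ≡ c ℤ.* w i y) → ∀ N Y k →
                      lattice w′ N Y k ≡ c ℤ.* lattice w N Y k
      lattice-scale c {w} {w′} w′≡ N Y k = ≡.trans
        (Σℤ.∑-cong N λ i → ≡.trans
          (Σℤ.∑-cong Y λ y → ≡.trans (≡.cong (ℤ._* monomial (suc i ℕ.* suc y) k) (w′≡ i y))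
            (ℤ.*-assoc c (w i y) (monomial (suc i ℕ.* suc y) k)))
          (Σℤ.∑-*ˡ Y c (λ y → w i y ℤ.* monomial (suc i ℕ.* suc y) k)))
        (Σℤ.∑-*ˡ N c (λ i → Σℤ.∑ Y λ y → w i y ℤ.* monomial (suc i ℕ.* suc y) k))

      uSeries-sign : ∀ p k → uSeries p k ≡ ℤ.-1ℤ ℤ.* USum.series p k
      uSeries-sign p k = lattice-scale ℤ.-1ℤ {USum.weight p}
        (λ i y → solve 3 (λ s m x → ((con ℤ.-1ℤ :* s) :* m) :* x := con ℤ.-1ℤ :* ((s :* m) :* x)) ≡.refl
           (sign i) (index i ℤ.^ p) (σ Sign.- ℤ.^ y)) k k k
        where open ℤSolver.+-*-Solver

    value-u : ∀ p n → value (uSeries p) n ≡ ι ℤ.-1ℤ * at n (U p)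
    value-u p n = ≡.trans (value-cong {uSeries p} {λ k → ℤ.-1ℤ ℤ.* USum.series p k} (uSeries-sign p) n)
                          (ev-scale ℤ.-1ℤ (USum.series p) (z n) n)

    private
      uSeries≤ : ∀ p → PolyBound 1 (2 ℕ.+ p) (uSeries p)
      uSeries≤ p k = lattice-bound {λ i y → power p i ℤ.* σ Sign.- ℤ.^ y} {p} weight≤ k k k
        where
        weight≤ : ∀ i y → ℤ.∣ power p i ℤ.* σ Sign.- ℤ.^ y ∣ ℕ.≤ suc i ℕ.^ p
        weight≤ i y = ℕ.≤-trans (ℕ.≤-reflexive (≡.trans (ℤ.∣i*j∣≡∣i∣*∣j∣ (power p i) (σ Sign.- ℤ.^ y))
          (≡.trans (≡.cong (ℤ.∣ power p i ∣ ℕ.*_) (∣σ^∣ Sign.- y)) (ℕ.*-identityʳ _)))) (signed≤ (suc i) i p)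

      Θ⁸ : Sequence
      Θ⁸ = Powers.Θ⁸ {2} {1} (λ k → theta-bound k k)

      quadratic : ∀ p₁ p₂ p₃ l {k₀ k₁ k₂ k₃} →
        (∀ k → k₃ ℤ.* (d₃Series ⊛ d₃Series) k ≡
               (constant k₀ k ℤ.+ k₁ ℤ.* l k) ℤ.+ k₂ ℤ.* ((uSeries p₁ ⊛ uSeries p₂) k ℤ.- (uSeries p₃ ⊛ uSeries p₃) k)) →
        (λ n → ι k₃ * (Θ⁸ n * Θ⁸ n)) ~
        (λ n → (ι k₀ + ι k₁ * value l n)
               + ι k₂ * (value (uSeries p₁) n * value (uSeries p₂) n - value (uSeries p₃) n * value (uSeries p₃) n))
      quadratic p₁ p₂ p₃ l {k₀} {k₁} {k₂} {k₃} identity = ~-trans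
        (~-scale (ι k₃) (Powers.Θ¹⁶~ {2} {1} (λ k → theta-bound k k)))
        (~-trans (~-eventually 0 λ n _ → ≡.trans (≡.sym (ev-scale k₃ (d₃Series ⊛ d₃Series) (z n) n))
                    (value-cong {λ k → k₃ ℤ.* (d₃Series ⊛ d₃Series) k} identity n))
          (combination-~ k₀ k₁ k₂ l {1} {2 ℕ.+ p₁} {1} {2 ℕ.+ p₂} {1} {2 ℕ.+ p₃}
            (uSeries≤ p₁) (uSeries≤ p₂) (uSeries≤ p₃)))

      cubic : ∀ p₁ p₂ p₃ l {k₀ k₁ k₂ k₃} →
        (∀ k → k₃ ℤ.* (d₃Series ⊛ (d₃Series ⊛ d₃Series)) k ≡
               (constant k₀ k ℤ.+ k₁ ℤ.* l k) ℤ.+ k₂ ℤ.* ((gSeries p₁ ⊛ gSeries p₂) k ℤ.- (gSeries p₃ ⊛ gSeries p₃) k)) →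
        (λ n → ι k₃ * (Θ⁸ n * (Θ⁸ n * Θ⁸ n))) ~
        (λ n → (ι k₀ + ι k₁ * value l n)
               + ι k₂ * (at n (G p₁) * at n (G p₂) - at n (G p₃) * at n (G p₃)))
      cubic p₁ p₂ p₃ l {k₀} {k₁} {k₂} {k₃} identity = ~-trans
        (~-scale (ι k₃) (Powers.Θ²⁴~ {2} {1} (λ k → theta-bound k k)))
        (~-trans (~-eventually 0 λ n _ → ≡.trans (≡.sym (ev-scale k₃ (d₃Series ⊛ (d₃Series ⊛ d₃Series)) (z n) n))
                    (value-cong {λ k → k₃ ℤ.* (d₃Series ⊛ (d₃Series ⊛ d₃Series)) k} identity n))
          (combination-~ k₀ k₁ k₂ l {1} {2 ℕ.+ p₁} {1} {2 ℕ.+ p₂} {1} {2 ℕ.+ p₃}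
            (GSum.series≤ p₁) (GSum.series≤ p₂) (GSum.series≤ p₃)))

      doubling : ∀ w n → w ^ (n ℕ.+ n) ≡ w ^ n * w ^ n
      doubling w n = ^-homo-* w n n

      Θ⁸≡ : ∀ n → at n θ ^ 8 ≡ Θ⁸ n
      Θ⁸≡ n = ≡.trans (doubling (at n θ) 4) (square (≡.trans (doubling (at n θ) 2)
        (square (≡.cong (at n θ *_) (*-identityʳ (at n θ))))))
        where
        square : ∀ {v w} → v ≡ w → v * v ≡ w * w
        square ≡.refl = ≡.refl

    at-θ¹⁶ : ∀ n → at n (θ Defs.^ 16) ≡ Θ⁸ n * Θ⁸ n
    at-θ¹⁶ n = ≡.trans (at-^ n θ 16) (≡.trans (doubling (at n θ) 8) (≡.cong₂ _*_ (Θ⁸≡ n) (Θ⁸≡ n)))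

    at-θ²⁴ : ∀ n → at n (θ Defs.^ 24) ≡ Θ⁸ n * (Θ⁸ n * Θ⁸ n)
    at-θ²⁴ n = ≡.trans (at-^ n θ 24) (≡.trans (^-homo-* (at n θ) 8 16) (≡.cong₂ _*_ (Θ⁸≡ n)
      (≡.trans (doubling (at n θ) 8) (≡.cong₂ _*_ (Θ⁸≡ n) (Θ⁸≡ n)))))

    -- Passing from u to -U reverses the linear part and preserves the quadratic one, which explains
    -- the opposite signs of 32/3 and 256/3.
    sixteen : (λ n → at n (θ Defs.^ 16)) ~
      (λ n → (1# - fraction (+ 32 ℚ./ 3) * ((at n (U 1) + at n (U 3)) + at n (U 5)))
             + fraction (+ 256 ℚ./ 3) * (at n (U 1) * at n (U 5) - at n (U 3) ^ 2))
    sixteen = ~-trans (~-eventually 0 λ n _ → ≡.trans (at-θ¹⁶ n) (unscale (Θ⁸ n * Θ⁸ n)))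
      (~-trans (~-scale third (quadratic 1 5 3 (λ k → (uSeries 1 k ℤ.+ uSeries 3 k) ℤ.+ uSeries 5 k) d₃-squared))
        (~-eventually 0 λ n _ → ≡.trans
          (≡.cong₂ (λ x y → third * ((ι (+ 3) + ι (+ 32) * x) + ι (+ 256) * y))
            (≡.trans (ev-⊕ (uSeries 1 ⊕ uSeries 3) (uSeries 5) (z n) n)
              (≡.cong₂ _+_ (≡.trans (ev-⊕ (uSeries 1) (uSeries 3) (z n) n) (≡.cong₂ _+_ (value-u 1 n) (value-u 3 n)))
                           (value-u 5 n)))
            (≡.cong₂ (λ x y → x - y) (≡.cong₂ _*_ (value-u 1 n) (value-u 5 n)) (≡.cong₂ _*_ (value-u 3 n) (value-u 3 n))))
          (algebra (at n (U 1)) (at n (U 3)) (at n (U 5)))))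
      where
      open Solver using (linear; _:=_; _:+_; _:-_; _:*_; :-_; con)
      unscale : ∀ x → x ≡ third * (ι (+ 3) * x)
      unscale x = linear 2 (x ∷ third ∷ []) (λ x t → (x := t :* (con (+ 3) :* x)) ,
          (:- x , (t :* con (+ 3) := con ℤ.1ℤ)) ∷ [])
        (≡.trans (scaled (+ 1 ℚ./ 3) (+ 3) 1ℚ ≡.refl) (≡.sym ι-1) , lift tt) ≡.refl
      algebra : ∀ u v w →
        third * ((ι (+ 3) + ι (+ 32) * ((ι ℤ.-1ℤ * u + ι ℤ.-1ℤ * v) + ι ℤ.-1ℤ * w))
                 + ι (+ 256) * ((ι ℤ.-1ℤ * u) * (ι ℤ.-1ℤ * w) - (ι ℤ.-1ℤ * v) * (ι ℤ.-1ℤ * v))) ≡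
        (1# - fraction (+ 32 ℚ./ 3) * ((u + v) + w)) + fraction (+ 256 ℚ./ 3) * (u * w - v ^ 2)
      algebra u v w = linear 8 (u ∷ v ∷ w ∷ third ∷ 1# ∷ fraction (+ 32 ℚ./ 3) ∷ fraction (+ 256 ℚ./ 3) ∷ v ^ 2 ∷ [])
        (λ u v w t o a b v² →
          let n = con ℤ.-1ℤ in
          (t :* ((con (+ 3) :+ con (+ 32) :* ((n :* u :+ n :* v) :+ n :* w))
                 :+ con (+ 256) :* ((n :* u) :* (n :* w) :- (n :* v) :* (n :* v))) :=
           (o :- a :* ((u :+ v) :+ w)) :+ b :* (u :* w :- v²)) ,
          (con ℤ.1ℤ , (t :* con (+ 3) := o)) ∷
          (:- ((u :+ v) :+ w) , (t :* con (+ 32) := a)) ∷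
          (u :* w :- v :* v , (t :* con (+ 256) := b)) ∷
          (b , (v² := v :* v)) ∷ [])
        (scaled (+ 1 ℚ./ 3) (+ 3) 1ℚ ≡.refl , scaled (+ 1 ℚ./ 3) (+ 32) (+ 32 ℚ./ 3) ≡.refl ,
         scaled (+ 1 ℚ./ 3) (+ 256) (+ 256 ℚ./ 3) ≡.refl ,
         ≡.cong (v *_) (*-identityʳ v) , lift tt) ≡.refl

    twentyFour : (λ n → at n (θ Defs.^ 24)) ~
      (λ n → (1# + fraction (+ 16 ℚ./ 9) * ((ι (+ 17) * at n (G 3) + ι (+ 8) * at n (G 5)) + ι (+ 2) * at n (G 7)))
             + fraction (+ 512 ℚ./ 9) * (at n (G 3) * at n (G 7) - at n (G 5) ^ 2))
    twentyFour = ~-trans (~-eventually 0 λ n _ → ≡.trans (at-θ²⁴ n) (unscale (Θ⁸ n * (Θ⁸ n * Θ⁸ n))))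
      (~-trans (~-scale ninth (cubic 3 7 5
          (λ k → (+ 17 ℤ.* gSeries 3 k ℤ.+ + 8 ℤ.* gSeries 5 k) ℤ.+ + 2 ℤ.* gSeries 7 k) d₃-cubed))
        (~-eventually 0 λ n _ → ≡.trans
          (≡.cong (λ x → ninth * ((ι (+ 9) + ι (+ 16) * x) + ι (+ 512) * (at n (G 3) * at n (G 7) - at n (G 5) * at n (G 5))))
            (≡.trans (ev-⊕ ((λ k → + 17 ℤ.* gSeries 3 k) ⊕ (λ k → + 8 ℤ.* gSeries 5 k)) (λ k → + 2 ℤ.* gSeries 7 k) (z n) n)
              (≡.cong₂ _+_ (≡.trans (ev-⊕ (λ k → + 17 ℤ.* gSeries 3 k) (λ k → + 8 ℤ.* gSeries 5 k) (z n) n)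
                  (≡.cong₂ _+_ (ev-scale (+ 17) (gSeries 3) (z n) n) (ev-scale (+ 8) (gSeries 5) (z n) n)))
                (ev-scale (+ 2) (gSeries 7) (z n) n))))
          (algebra (at n (G 3)) (at n (G 5)) (at n (G 7)))))
      where
      open Solver using (linear; _:=_; _:+_; _:-_; _:*_; :-_; con)
      unscale : ∀ x → x ≡ ninth * (ι (+ 9) * x)
      unscale x = linear 2 (x ∷ ninth ∷ []) (λ x t → (x := t :* (con (+ 9) :* x)) ,
          (:- x , (t :* con (+ 9) := con ℤ.1ℤ)) ∷ [])
        (≡.trans (scaled (+ 1 ℚ./ 9) (+ 9) 1ℚ ≡.refl) (≡.sym ι-1) , lift tt) ≡.refl
      algebra : ∀ u v w →
        ninth * ((ι (+ 9) + ι (+ 16) * ((ι (+ 17) * u + ι (+ 8) * v) + ι (+ 2) * w)) + ι (+ 512) * (u * w - v * v)) ≡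
        (1# + fraction (+ 16 ℚ./ 9) * ((ι (+ 17) * u + ι (+ 8) * v) + ι (+ 2) * w))
        + fraction (+ 512 ℚ./ 9) * (u * w - v ^ 2)
      algebra u v w = linear 8 (u ∷ v ∷ w ∷ ninth ∷ 1# ∷ fraction (+ 16 ℚ./ 9) ∷ fraction (+ 512 ℚ./ 9) ∷ v ^ 2 ∷ [])
        (λ u v w t o a b v² →
          let l = (con (+ 17) :* u :+ con (+ 8) :* v) :+ con (+ 2) :* w in
          (t :* ((con (+ 9) :+ con (+ 16) :* l) :+ con (+ 512) :* (u :* w :- v :* v)) :=
           (o :+ a :* l) :+ b :* (u :* w :- v²)) ,
          (con ℤ.1ℤ , (t :* con (+ 9) := o)) ∷
          (l , (t :* con (+ 16) := a)) ∷
          (u :* w :- v :* v , (t :* con (+ 512) := b)) ∷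
          (b , (v² := v :* v)) ∷ [])
        (scaled (+ 1 ℚ./ 9) (+ 9) 1ℚ ≡.refl , scaled (+ 1 ℚ./ 9) (+ 16) (+ 16 ℚ./ 9) ≡.refl ,
         scaled (+ 1 ℚ./ 9) (+ 512) (+ 512 ℚ./ 9) ≡.refl ,
         ≡.cong (v *_) (*-identityʳ v) , lift tt) ≡.refl

  -- The values satisfy the definitions of ϑ₃, U_s and G_s

  module Membership (q : Defs.ℂ) (disc : InDisc q) where
    open Identities q disc public

    private
      neg-^ : ∀ w k → (- w) ^ k ≡ ι (sign k) * w ^ k
      neg-^ w zero    = ≡.sym (≡.trans (≡.cong (_* 1#) ι-1) (*-identityˡ 1#))
      neg-^ w (suc k) = ≡.trans (≡.cong ((- w) *_) (neg-^ w k)) (linear 4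
        (w ∷ ι (sign k) ∷ w ^ k ∷ ι (sign (suc k)) ∷ [])
        (λ w s p s′ → ((:- w) :* (s :* p) := s′ :* (w :* p)) ,
          (:- (w :* p) , (s′ := con ℤ.-1ℤ :* s)) ∷ [])
        (ι-* ℤ.-1ℤ (sign k) , lift tt) ≡.refl)
        where open Solver using (linear; _:=_; _:*_; :-_; con)

      -- The parities of n² and n agree; this turns (-q)^(j²) into (-1)^j q^(j²).
      sign-square : ∀ n → sign (n ℕ.* n) ≡ sign n
      sign-square zero    = ≡.refl
      sign-square (suc n) = begin
        sign (suc (n ℕ.+ n ℕ.* suc n))
          ≡⟨ ≡.cong (λ k → sign (suc (n ℕ.+ k))) (ℕ.*-suc n n) ⟩
        sign (suc (n ℕ.+ (n ℕ.+ n ℕ.* n)))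
          ≡⟨ ≡.cong (ℤ.-1ℤ ℤ.*_) (≡.trans (sign-+ n (n ℕ.+ n ℕ.* n))
               (≡.cong (sign n ℤ.*_) (≡.trans (sign-+ n (n ℕ.* n)) (≡.cong (sign n ℤ.*_) (sign-square n))))) ⟩
        ℤ.-1ℤ ℤ.* (sign n ℤ.* (sign n ℤ.* sign n))
          ≡⟨ ≡.cong (λ s → ℤ.-1ℤ ℤ.* (sign n ℤ.* s)) (sign² n) ⟩
        ℤ.-1ℤ ℤ.* (sign n ℤ.* ℤ.1ℤ)
          ≡⟨ ≡.cong (ℤ.-1ℤ ℤ.*_) (ℤ.*-identityʳ (sign n)) ⟩
        sign (suc n) ∎
        where open ≡.≡-Reasoning

      sign-sum : ∀ i y m → sign (suc y ℕ.+ suc i) ℤ.* m ≡ (sign i ℤ.* m) ℤ.* sign y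
      sign-sum i y m = ≡.trans (≡.cong (ℤ._* m) (sign-+ (suc y) (suc i)))
        (solve 3 (λ s t m → ((con ℤ.-1ℤ :* t) :* (con ℤ.-1ℤ :* s)) :* m := (s :* m) :* t) ≡.refl
           (sign i) (sign y) m)
        where open ℤSolver.+-*-Solver

      1^ : ∀ y → σ Sign.+ ℤ.^ y ≡ ℤ.1ℤ
      1^ zero    = ≡.refl
      1^ (suc y) = ≡.trans (ℤ.*-identityˡ _) (1^ y)

      unsigned : ∀ c y → c ≡ c ℤ.* σ Sign.+ ℤ.^ y
      unsigned c y = ≡.sym (≡.trans (≡.cong (c ℤ.*_) (1^ y)) (ℤ.*-identityʳ c))

    thetaTerm : ℤ → Defs.ℂ
    thetaTerm j = (Defs.- q) Defs.^ ℤ.∣ j ℤ.* j ∣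

    at-thetaTerm : ∀ n j → at n (thetaTerm j) ≡ ι (sign ℤ.∣ j ∣) * z n ^ (ℤ.∣ j ∣ ℕ.* ℤ.∣ j ∣)
    at-thetaTerm n j = ≡.trans (at-^ n (Defs.- q) ℤ.∣ j ℤ.* j ∣)
      (≡.trans (≡.cong ((- z n) ^_) (ℤ.∣i*j∣≡∣i∣*∣j∣ j j))
        (≡.trans (neg-^ (z n) (ℤ.∣ j ∣ ℕ.* ℤ.∣ j ∣))
          (≡.cong (λ s → ι s * z n ^ (ℤ.∣ j ∣ ℕ.* ℤ.∣ j ∣)) (sign-square ℤ.∣ j ∣))))

    isϑ₃ : Isϑ₃ (Defs.- q) θ
    isϑ₃ = thetaSum thetaTerm at-thetaTerm

    uNumerator uDenominator uDivisorTerm gNumerator gDenominator gDivisorTerm : ℕ → ℕ → Defs.ℂ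
    uNumerator p r = ℤ→ℂ (sign (r ℕ.∸ 1) ℤ.* (+ r) ℤ.^ p) Defs.* q Defs.^ r
    uDenominator p r = 1ℂ Defs.+ q Defs.^ r
    uDivisorTerm p n = ℤ→ℂ (divisorSum (λ d e → sign (d ℕ.+ e) ℤ.* (+ d) ℤ.^ p) n) Defs.* q Defs.^ n
    gNumerator p r = ℤ→ℂ (sign r ℤ.* (+ r) ℤ.^ p) Defs.* q Defs.^ r
    gDenominator p r = 1ℂ Defs.- q Defs.^ r
    gDivisorTerm p n = ℤ→ℂ (divisorSum (λ d _ → sign d ℤ.* (+ d) ℤ.^ p) n) Defs.* q Defs.^ n

    uDoubleTerm gDoubleTerm : ℕ → ℕ → ℕ → Defs.ℂ
    uDoubleTerm p y m = ℤ→ℂ (sign (y ℕ.+ m) ℤ.* (+ m) ℤ.^ p) Defs.* q Defs.^ (m ℕ.* y)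
    gDoubleTerm p y m = ℤ→ℂ (sign m ℤ.* (+ m) ℤ.^ p) Defs.* q Defs.^ (m ℕ.* y)

    uDivisor gDivisor : ℕ → ℕ → ℕ → ℤ
    uDivisor p d e = sign (d ℕ.+ e) ℤ.* (+ d) ℤ.^ p
    gDivisor p d _ = sign d ℤ.* (+ d) ℤ.^ p

    uQuotient : ∀ p → USum.SummandQuotient p (uNumerator p) (uDenominator p)
    uQuotient p = record
      { numerator = λ m i → at-term m (uCoefficient p i) q (suc i)
      ; denom = λ m i → ≡.cong (λ v → 1# + v) (≡.trans (at-^ m q (suc i))
          (≡.sym (≡.trans (≡.cong (_* z m ^ suc i) ι-1) (*-identityˡ (z m ^ suc i))))) }

    uSummand : ∀ p → USum.Summand p (uDivisorTerm p) (divisorSum (uDivisor p))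
    uSummand p = record { evaluates = λ m n → at-term m _ q n }

    uSummand₂ : ∀ p → USum.Summand₂ p (uDoubleTerm p) (λ y m → sign (y ℕ.+ m) ℤ.* (+ m) ℤ.^ p)
    uSummand₂ p = record { evaluates = λ n y m → at-term n _ q (m ℕ.* y) }

    gQuotient : ∀ p → GSum.SummandQuotient p (gNumerator p) (gDenominator p)
    gQuotient p = record
      { numerator = λ m i → at-term m (gCoefficient p i) q (suc i)
      ; denom = λ m i → ≡.cong (λ v → 1# + v)
          (≡.trans (≡.cong -_ (at-^ m q (suc i))) (negate (z m ^ suc i))) }
      where
      open Solver using (solve; _:=_; _:*_; :-_; con)
      negate : ∀ w → - w ≡ ι ℤ.-1ℤ * w
      negate = solve 1 (λ w → :- w := con ℤ.-1ℤ :* w) ≡.refl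

    gSummand : ∀ p → GSum.Summand p (gDivisorTerm p) (divisorSum (gDivisor p))
    gSummand p = record { evaluates = λ m n → at-term m _ q n }

    gSummand₂ : ∀ p → GSum.Summand₂ p (gDoubleTerm p) (λ y m → sign m ℤ.* (+ m) ℤ.^ p)
    gSummand₂ p = record { evaluates = λ n y m → at-term n _ q (m ℕ.* y) }

    isU : ∀ p → IsU p q (U p)
    isU p = quotients , divisors , double
      where
      quotients : Defs.HasQuotientSum (uNumerator p) (uDenominator p) (U p)
      quotients = USum.quotientSum p (uQuotient p)
      divisors : Defs.HasSum (uDivisorTerm p) (U p)
      divisors = USum.divisorSeries p (uDivisor p) (uSummand p)
        (λ i y → ≡.trans (≡.cong (λ k → sign k ℤ.* (+ suc i) ℤ.^ p) (ℕ.+-comm (suc i) (suc y)))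
                         (sign-sum i y ((+ suc i) ℤ.^ p)))
      double : Defs.HasSum₂ (uDoubleTerm p) (U p)
      double = USum.doubleSum p (uSummand₂ p) (λ i y → sign-sum i y ((+ suc i) ℤ.^ p))

    isG : ∀ p → IsG p q (G p)
    isG p = quotients , divisors , double
      where
      quotients : Defs.HasQuotientSum (gNumerator p) (gDenominator p) (G p)
      quotients = GSum.quotientSum p (gQuotient p)
      divisors : Defs.HasSum (gDivisorTerm p) (G p)
      divisors = GSum.divisorSeries p (gDivisor p) (gSummand p) (λ i y → unsigned (gCoefficient p i) y)
      double : Defs.HasSum₂ (gDoubleTerm p) (G p)
      double = GSum.doubleSum p (gSummand₂ p) (λ i y → unsigned (gCoefficient p i) y)

-- The two identities for complex q in the unit disc

open import Defs
open import Data.Product.Base using (Σ-syntax)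
open import Data.Rational.Base using (_/_)
open Evaluations

module RightHandSides (n : ℕ) where
  open Gaussian using (ι) renaming (_+_ to _⊞_; _-_ to _⊟_; _*_ to _⊠_; _^_ to _↑_; 1# to 𝟙)

  -- The complex numbers are variables here, so that `refl` unfolds only the arithmetic operations
  -- and not the series values put in later.
  at-quadratic : ∀ a b u v w x →
    at n (1ℂ - ℚ→ℂ a * x + ℚ→ℂ b * (u * w - v ^ 2)) ≡
    (𝟙 ⊟ fraction a ⊠ at n x) ⊞ fraction b ⊠ (at n u ⊠ at n w ⊟ at n v ↑ 2)
  at-quadratic a b u v w x = ≡.refl

  at-quadratic⁺ : ∀ a b u v w x →
    at n (1ℂ + ℚ→ℂ a * x + ℚ→ℂ b * (u * w - v ^ 2)) ≡
    (𝟙 ⊞ fraction a ⊠ at n x) ⊞ fraction b ⊠ (at n u ⊠ at n w ⊟ at n v ↑ 2)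
  at-quadratic⁺ a b u v w x = ≡.refl

  at-linear : ∀ i j k u v w → at n (ℤ→ℂ i * u + ℤ→ℂ j * v + ℤ→ℂ k * w) ≡
    (ι i ⊠ at n u ⊞ ι j ⊠ at n v) ⊞ ι k ⊠ at n w
  at-linear i j k u v w = ≡.cong₂ _⊞_
    (≡.cong₂ _⊞_ (≡.cong (_⊠ at n u) (at-ℤ n i)) (≡.cong (_⊠ at n v) (at-ℤ n j)))
    (≡.cong (_⊠ at n w) (at-ℤ n k))

module _ (q : ℂ) (disc : InDisc q) where
  open Membership q disc

  θ¹⁶≈ : θ ^ 16 ≈ 1ℂ - ℚ→ℂ (+ 32 / 3) * (U 1 + U 3 + U 5)
                   + ℚ→ℂ (+ 256 / 3) * (U 1 * U 5 - U 3 ^ 2)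
  θ¹⁶≈ = ≈-from-~
    {θ ^ 16} {1ℂ - ℚ→ℂ (+ 32 / 3) * (U 1 + U 3 + U 5) + ℚ→ℂ (+ 256 / 3) * (U 1 * U 5 - U 3 ^ 2)}
    (~-trans sixteen (~-eventually 0 λ n _ → ≡.sym
      (RightHandSides.at-quadratic n (+ 32 / 3) (+ 256 / 3) (U 1) (U 3) (U 5) (U 1 + U 3 + U 5))))

  θ²⁴≈ : θ ^ 24 ≈ 1ℂ + ℚ→ℂ (+ 16 / 9) * (ℤ→ℂ (+ 17) * G 3 + ℤ→ℂ (+ 8) * G 5 + ℤ→ℂ (+ 2) * G 7)
                   + ℚ→ℂ (+ 512 / 9) * (G 3 * G 7 - G 5 ^ 2)
  θ²⁴≈ = ≈-from-~
    {θ ^ 24} {1ℂ + ℚ→ℂ (+ 16 / 9) * (ℤ→ℂ (+ 17) * G 3 + ℤ→ℂ (+ 8) * G 5 + ℤ→ℂ (+ 2) * G 7)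
                 + ℚ→ℂ (+ 512 / 9) * (G 3 * G 7 - G 5 ^ 2)}
    (~-trans twentyFour (~-eventually 0 λ n _ → let open RightHandSides n in ≡.sym (≡.trans
      (at-quadratic⁺ (+ 16 / 9) (+ 512 / 9) (G 3) (G 5) (G 7)
        (ℤ→ℂ (+ 17) * G 3 + ℤ→ℂ (+ 8) * G 5 + ℤ→ℂ (+ 2) * G 7))
      (≡.cong (λ w → (Gaussian.1# Gaussian.+ fraction (+ 16 / 9) Gaussian.* w) Gaussian.+
                     fraction (+ 512 / 9) Gaussian.* (at n (G 3) Gaussian.* at n (G 7) Gaussian.- at n (G 5) Gaussian.^ 2))
        (at-linear (+ 17) (+ 8) (+ 2) (G 3) (G 5) (G 7))))))

theorem1p5 : (q : ℂ) → 0ℝ <ℝ ∣ q ∣² → ∣ q ∣² <ℝ 1ℝ →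
    Σ[ θ ∈ ℂ ] Σ[ U ∈ (ℕ → ℂ) ] Σ[ G ∈ (ℕ → ℂ) ]
      Isϑ₃ (- q) θ ×
      (∀ (s : ℕ) → IsU s q (U s)) ×
      (∀ (s : ℕ) → IsG s q (G s)) ×
      (θ ^ 16 ≈ 1ℂ - ℚ→ℂ (+ 32 / 3) * (U 1 + U 3 + U 5)
                   + ℚ→ℂ (+ 256 / 3) * (U 1 * U 5 - U 3 ^ 2)) ×
      (θ ^ 24 ≈ 1ℂ + ℚ→ℂ (+ 16 / 9) * (ℤ→ℂ (+ 17) * G 3 + ℤ→ℂ (+ 8) * G 5 + ℤ→ℂ (+ 2) * G 7)
                   + ℚ→ℂ (+ 512 / 9) * (G 3 * G 7 - G 5 ^ 2))
theorem1p5 q _ q<1 = θ , U , G , isϑ₃ , isU , isG , θ¹⁶≈ q disc , θ²⁴≈ q disc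
  where
  disc : InDisc q
  disc = inDisc q q<1
  open Membership q disc
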